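{- Let $\varepsilon>0$ and consider an instance of 2GGK(R)-C. Let $OPT$ be an optimal packing and let $APX$ be a most profitable solution that is packed by a guillotine separable container packing. Then $p(APX)\ge(\frac45-O(\varepsilon))\,p(OPT)$.
   Context: 2GGK(R)-C: items are axis-aligned rectangles with integral width $w(i)$ and height $h(i)$, all of profit $1$; a feasible solution places a subset of items, each possibly rotated by 90 degrees, as pairwise disjoint open rectangles in $[0,N]^2$ such that the packing is guillotine separable (a packing in a rectangle $R$ is guillotine separable if it has at most one item or some horizontal/vertical segment spanning $R$ meets no item interior and splits $R$ into two rectangles whose packings are guillotine separable); $p(S)=|S|$. A container packing places all items into a number of containers bounded by a function of $\varepsilon$ only; containers are pairwise non-overlapping axis-aligned rectangles labeled large (one item), horizontal (items stacked on top of each other), vertical (items side by side) or area (a container of size $a\times b$ containing only items with $w(i)\le\varepsilon a$, $h(i)\le\varepsilon b$). $O(\varepsilon)\le c\varepsilon$ for an absolute constant $c$.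
   Formalization: The parameter ε and the coordinates of all items and containers in the packings OPT and APX are taken to be rational numbers instead of real numbers. -}

module Defs where

open import Data.Nat as ℕ using (ℕ; suc)
open import Data.Integer using (+_)
open import Data.Rational using (ℚ; _+_; _*_; _-_; _≤_; _<_; _/_; 0ℚ)
open import Data.Bool using (Bool; true; false)
open import Data.Fin using (Fin)
open import Data.Product using (Σ; _×_; _,_; proj₁; proj₂)
open import Data.Sum using (_⊎_)
open import Data.List using (List; []; _∷_; map; length; concat; _++_)
open import Data.List.Relation.Unary.All using (All)
open import Data.List.Relation.Unary.AllPairs using (AllPairs)
open import Data.List.Relation.Unary.Unique.Propositional using (Unique)
open import Data.List.Relation.Binary.Permutation.Propositional using (_↭_)
open import Relation.Binary.PropositionalEquality using (_≡_)

ℕ→ℚ : ℕ → ℚ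
ℕ→ℚ n = + n / 1

-- Axis-aligned rectangles with rational coordinates:
-- lower-left corner (x , y), width w, height h.
-- The open rectangle is (x , x + w) × (y , y + h).

record Rect : Set where
  constructor rect
  field
    x y w h : ℚ
open Rect public

_⊆R_ : Rect → Rect → Set
r ⊆R R = (x R ≤ x r) × (x r + w r ≤ x R + w R)
       × (y R ≤ y r) × (y r + h r ≤ y R + h R)

XDisj : Rect → Rect → Set
XDisj r s = (x r + w r ≤ x s) ⊎ (x s + w s ≤ x r)

YDisj : Rect → Rect → Set
YDisj r s = (y r + h r ≤ y s) ⊎ (y s + h s ≤ y r)

-- the open rectangles are disjoint (for rectangles of positive size)
Disj : Rect → Rect → Set
Disj r s = XDisj r s ⊎ YDisj r s

leftPart rightPart bottomPart topPart : Rect → ℚ → Rect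
leftPart   R c = rect (x R) (y R) (c - x R) (h R)
rightPart  R c = rect c (y R) (x R + w R - c) (h R)
bottomPart R c = rect (x R) (y R) (w R) (c - y R)
topPart    R c = rect (x R) c (w R) (y R + h R - c)

-- Guillotine separability of a packing L (all of whose rectangles lie
-- in R) inside the rectangle R: either at most one rectangle, or there
-- is a vertical / horizontal segment spanning R, strictly inside R,
-- meeting no interior, splitting into two guillotine separable packings.
data Guillotine (R : Rect) : List Rect → Set where
  trivial : ∀ {L} → length L ℕ.≤ 1 → Guillotine R L
  vcut : ∀ {L} (c : ℚ) (L₁ L₂ : List Rect) →
         x R < c → c < x R + w R →
         L ↭ (L₁ ++ L₂) →
         All (λ r → x r + w r ≤ c) L₁ → All (λ r → c ≤ x r) L₂ →
         Guillotine (leftPart R c) L₁ → Guillotine (rightPart R c) L₂ →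
         Guillotine R L
  hcut : ∀ {L} (c : ℚ) (L₁ L₂ : List Rect) →
         y R < c → c < y R + h R →
         L ↭ (L₁ ++ L₂) →
         All (λ r → y r + h r ≤ c) L₁ → All (λ r → c ≤ y r) L₂ →
         Guillotine (bottomPart R c) L₁ → Guillotine (topPart R c) L₂ →
         Guillotine R L

Square : ℕ → Rect
Square N = rect 0ℚ 0ℚ (ℕ→ℚ N) (ℕ→ℚ N)

GuillotinePacking : ℕ → List Rect → Set
GuillotinePacking N L =
  All (λ r → r ⊆R Square N) L × AllPairs Disj L × Guillotine (Square N) L

-- Instances of 2GGK(R)-C: n items with positive integral widths and
-- heights, all of profit 1, and a square knapsack [0,N]².

record Instance : Set where
  field
    n : ℕ
    N : ℕ
    wd : Fin n → ℕ
    ht : Fin n → ℕ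
    wd-pos : ∀ i → 1 ℕ.≤ wd i
    ht-pos : ∀ i → 1 ℕ.≤ ht i
open Instance public

record Placement (I : Instance) : Set where
  constructor place
  field
    item : Fin (n I)
    px py : ℚ
    rotated : Bool
open Placement public

placedRect : ∀ {I} → Placement I → Rect
placedRect {I} (place i a b false) = rect a b (ℕ→ℚ (wd I i)) (ℕ→ℚ (ht I i))
placedRect {I} (place i a b true)  = rect a b (ℕ→ℚ (ht I i)) (ℕ→ℚ (wd I i))

Feasible : (I : Instance) → List (Placement I) → Set
Feasible I P = Unique (map item P) × GuillotinePacking (N I) (map placedRect P)

-- profit p(S) = |S| (all profits are 1)
profit : ∀ {I} → List (Placement I) → ℕ
profit P = length P

data Label : Set where
  large horizontal vertical area : Label

record Container : Set where
  constructor container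
  field
    box : Rect
    label : Label
open Container public

LabelOK : ℚ → Label → Rect → List Rect → Set
LabelOK ε large      C L = length L ≡ 1
LabelOK ε horizontal C L = AllPairs YDisj L
LabelOK ε vertical   C L = AllPairs XDisj L
LabelOK ε area       C L = All (λ r → (w r ≤ ε * w C) × (h r ≤ ε * h C)) L

ValidContainer : ℚ → Container → List Rect → Set
ValidContainer ε C L =
  (0ℚ ≤ w (box C)) × (0ℚ ≤ h (box C)) ×
  All (λ r → r ⊆R box C) L × LabelOK ε (label C) (box C) L

PackedByGuillotineContainers : (I : Instance) → ℚ → ℕ → List (Placement I) → Set
PackedByGuillotineContainers I ε K P =
  Σ (List (Container × List (Placement I))) λ CP →
    (length CP ℕ.≤ K) ×
    (P ↭ concat (map proj₂ CP)) ×
    All (λ cp → ValidContainer ε (proj₁ cp) (map placedRect (proj₂ cp))) CP ×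
    GuillotinePacking (N I) (map (λ cp → box (proj₁ cp)) CP)

ContainerSolution : (I : Instance) → ℚ → ℕ → List (Placement I) → Set
ContainerSolution I ε K P = Feasible I P × PackedByGuillotineContainers I ε K P

{-# OPTIONS --safe #-}
-- A bounded number of items may always be discarded, so every constant depending on ε only is
-- free, and with at most a constant number of items each item is a container of its own.  Let
-- 1/q ≤ ε.  Discard the heaviest (by area) of q equal chunks of OPT, then the items with a side
-- in a suitable one of q disjoint ranges, then the boundedly many items with two long sides.
-- What is left are slim items (one side at least δ, the other at most μ, with μ much smaller
-- than δ), for which the cutting tree is kept, and small items, for which only their area
-- matters: they are put on shelves in the space that the slim items leave free.
--
-- Slim items that leave a full-length strip of the rectangle free can be repacked in boundedly
-- many containers: the strip pays for rounding to a grid of columns and for linear grouping.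
-- To gain such a strip, follow the cuts into the larger part.  The narrow strips that are cut
-- off form an L-shaped frame, until a wide strip (which has a cheap window to be emptied) or a
-- balanced cut is met; beyond the latter the procedure is repeated in both parts.
--
-- Either the smaller arm of each frame is discarded, and each arm gives way to the core and to
-- the other arm; or all arms are moved, rotated if necessary, to one common strip, which is
-- freed by discarding the items of one kind next to the first balanced cut, at most a third of
-- the items outside the arms.  With t items in the arms and r outside, the loss is at most
-- min (t / 2) (r / 3) ≤ (t + r) / 5.
module Submission where

-- The order in which the constants are fixed shapes the proof. Arms must be much thinner than the
-- strip freed for them; the width of that strip determines the grid and with it the number of
-- containers; and small items must be tiny even in comparison with that number. A group of peeled
-- strips that is too wide for an arm but too narrow to serve as a free strip helps neither purpose
-- and is discarded. Therefore `q` pairs of widths with disjoint gaps are prepared, and by averaging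
-- one pair discards at most a `1 / q` fraction of the slim items. Since that pair is known only
-- after the small items have been separated, `m` is computed from all `q` levels at once, and the
-- next range of sides begins where this one ends. Packings are handled as slicing trees over the
-- natural numbers, without coordinates; multiplying the instance by a suitable factor makes all
-- auxiliary widths integers. The small items ask for area only, so every repacking carries a bound
-- on the area that it closes to them. The fraction `1 / q` of the area freed by discarding the
-- heaviest chunk pays for rounding and for shelves.

-- Linear arithmetic over the natural numbers by reflection

module LinearArithmetic where

  open import Data.Nat
  open import Data.Nat.Properties
  open import Data.Nat.Tactic.RingSolver using (solve-∀)
  open import Data.Integer as ℤ using (ℤ; -[1+_])
  open import Data.Bool using (Bool; true; false; if_then_else_; _∧_; not; T)
  open import Data.List using (List; []; _∷_; _++_; map; foldr; concatMap; filterᵇ; length; zipWith; upTo)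
  open import Data.Product using (_×_; _,_; proj₁; proj₂)
  open import Data.Vec using (Vec; []; _∷_)
  open import Data.Unit using (tt)
  open import Data.Empty using (⊥)
  open import Relation.Binary.PropositionalEquality

  infixl 6 _:+_
  infixl 7 _:*_
  infix 4 _:≤_ _:<_ _:≡_
  infixr 3 _⇒_

  data Ex : Set where
    var : ℕ → Ex
    con : ℕ → Ex
    _:+_ _:*_ : Ex → Ex → Ex

  data Rel : Set where
    _:≤_ _:<_ _:≡_ : Ex → Ex → Rel

  data Prob : Set where
    ⟨_⟩ : Rel → Prob
    _⇒_ : Rel → Prob → Prob

  Env = ℕ → ℕ

  ⟦_⟧ : Ex → Env → ℕ
  ⟦ var i ⟧ ρ = ρ i
  ⟦ con k ⟧ ρ = k
  ⟦ e :+ e' ⟧ ρ = ⟦ e ⟧ ρ + ⟦ e' ⟧ ρ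
  ⟦ e :* e' ⟧ ρ = ⟦ e ⟧ ρ * ⟦ e' ⟧ ρ

  ⟦_⟧ʳ : Rel → Env → Set
  ⟦ a :≤ b ⟧ʳ ρ = ⟦ a ⟧ ρ ≤ ⟦ b ⟧ ρ
  ⟦ a :< b ⟧ʳ ρ = ⟦ a ⟧ ρ < ⟦ b ⟧ ρ
  ⟦ a :≡ b ⟧ʳ ρ = ⟦ a ⟧ ρ ≡ ⟦ b ⟧ ρ

  ⟦_⟧ᵖ : Prob → Env → Set
  ⟦ ⟨ r ⟩ ⟧ᵖ ρ = ⟦ r ⟧ʳ ρ
  ⟦ r ⇒ p ⟧ᵖ ρ = ⟦ r ⟧ʳ ρ → ⟦ p ⟧ᵖ ρ

  Mono = List ℕ
  Poly = List (ℕ × Mono)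

  evM : Env → Mono → ℕ
  evM ρ [] = 1
  evM ρ (i ∷ m) = ρ i * evM ρ m

  ev : Env → Poly → ℕ
  ev ρ [] = 0
  ev ρ ((c , m) ∷ p) = c * evM ρ m + ev ρ p

  insM : ℕ → Mono → Mono
  insM i [] = i ∷ []
  insM i (j ∷ m) = if i ≤ᵇ j then i ∷ j ∷ m else j ∷ insM i m

  insM-ev : ∀ ρ i m → evM ρ (insM i m) ≡ ρ i * evM ρ m
  insM-ev ρ i [] = refl
  insM-ev ρ i (j ∷ m) with i ≤ᵇ j
  ... | true = refl
  ... | false rewrite insM-ev ρ i m = lem (ρ j) (ρ i) (evM ρ m)
    where lem : ∀ a b c → a * (b * c) ≡ b * (a * c)
          lem = solve-∀

  mulM : Mono → Mono → Mono
  mulM [] m = m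
  mulM (i ∷ n) m = insM i (mulM n m)

  mulM-ev : ∀ ρ n m → evM ρ (mulM n m) ≡ evM ρ n * evM ρ m
  mulM-ev ρ [] m = sym (+-identityʳ _)
  mulM-ev ρ (i ∷ n) m = trans (insM-ev ρ i (mulM n m)) (trans (cong (ρ i *_) (mulM-ev ρ n m)) (sym (*-assoc (ρ i) _ _)))

  eqM : Mono → Mono → Bool
  eqM [] [] = true
  eqM [] (_ ∷ _) = false
  eqM (_ ∷ _) [] = false
  eqM (i ∷ m) (j ∷ n) = (i ≡ᵇ j) ∧ eqM m n

  eqM-sound : ∀ m n → eqM m n ≡ true → m ≡ n
  eqM-sound [] [] e = refl
  eqM-sound (i ∷ m) (j ∷ n) e with i ≡ᵇ j in eq | eqM m n in eq'
  ... | true | true = cong₂ _∷_ (≡ᵇ⇒≡ i j (subst T (sym eq) tt)) (eqM-sound m n eq')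

  addT : ℕ → Mono → Poly → Poly
  addT c m [] = (c , m) ∷ []
  addT c m ((d , n) ∷ p) with eqM m n
  ... | true = (c + d , n) ∷ p
  ... | false = (d , n) ∷ addT c m p

  addT-ev : ∀ ρ c m p → ev ρ (addT c m p) ≡ c * evM ρ m + ev ρ p
  addT-ev ρ c m [] = refl
  addT-ev ρ c m ((d , n) ∷ p) with eqM m n in eq
  ... | true rewrite eqM-sound m n eq = lem c d (evM ρ n) (ev ρ p)
    where lem : ∀ a b c p → (a + b) * c + p ≡ a * c + (b * c + p)
          lem = solve-∀
  ... | false rewrite addT-ev ρ c m p = lem (d * evM ρ n) (c * evM ρ m) (ev ρ p)
    where lem : ∀ a b c → a + (b + c) ≡ b + (a + c)
          lem = solve-∀

  addP : Poly → Poly → Poly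
  addP [] q = q
  addP ((c , m) ∷ p) q = addT c m (addP p q)

  addP-ev : ∀ ρ p q → ev ρ (addP p q) ≡ ev ρ p + ev ρ q
  addP-ev ρ [] q = refl
  addP-ev ρ ((c , m) ∷ p) q = trans (addT-ev ρ c m (addP p q)) (trans (cong ((c * evM ρ m) +_) (addP-ev ρ p q)) (sym (+-assoc (c * evM ρ m) _ _)))

  mulT : ℕ → Mono → Poly → Poly
  mulT c m [] = []
  mulT c m ((d , n) ∷ p) = addT (c * d) (mulM m n) (mulT c m p)

  mulT-ev : ∀ ρ c m p → ev ρ (mulT c m p) ≡ (c * evM ρ m) * ev ρ p
  mulT-ev ρ c m [] = sym (*-zeroʳ (c * evM ρ m))
  mulT-ev ρ c m ((d , n) ∷ p) = trans (addT-ev ρ (c * d) (mulM m n) (mulT c m p))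
    (trans (cong₂ _+_ (cong ((c * d) *_) (mulM-ev ρ m n)) (mulT-ev ρ c m p)) (lem c d (evM ρ m) (evM ρ n) (ev ρ p)))
    where lem : ∀ c d m n p → c * d * (m * n) + c * m * p ≡ c * m * (d * n + p)
          lem = solve-∀

  mulP : Poly → Poly → Poly
  mulP [] q = []
  mulP ((c , m) ∷ p) q = addP (mulT c m q) (mulP p q)

  mulP-ev : ∀ ρ p q → ev ρ (mulP p q) ≡ ev ρ p * ev ρ q
  mulP-ev ρ [] q = refl
  mulP-ev ρ ((c , m) ∷ p) q = trans (addP-ev ρ (mulT c m q) (mulP p q))
    (trans (cong₂ _+_ (mulT-ev ρ c m q) (mulP-ev ρ p q)) (sym (*-distribʳ-+ (ev ρ q) (c * evM ρ m) (ev ρ p))))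

  norm : Ex → Poly
  norm (var i) = (1 , i ∷ []) ∷ []
  norm (con k) = (k , []) ∷ []
  norm (e :+ e') = addP (norm e) (norm e')
  norm (e :* e') = mulP (norm e) (norm e')

  norm-ev : ∀ ρ e → ev ρ (norm e) ≡ ⟦ e ⟧ ρ
  norm-ev ρ (var i) = lem (ρ i)
    where lem : ∀ x → 1 * (x * 1) + 0 ≡ x
          lem = solve-∀
  norm-ev ρ (con k) = lem k
    where lem : ∀ x → x * 1 + 0 ≡ x
          lem = solve-∀
  norm-ev ρ (e :+ e') = trans (addP-ev ρ (norm e) (norm e')) (cong₂ _+_ (norm-ev ρ e) (norm-ev ρ e'))
  norm-ev ρ (e :* e') = trans (mulP-ev ρ (norm e) (norm e')) (cong₂ _*_ (norm-ev ρ e) (norm-ev ρ e'))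

  takeT : Mono → Poly → ℕ × Poly
  takeT m [] = 0 , []
  takeT m ((d , n) ∷ p) with eqM m n
  ... | true = d , p
  ... | false = proj₁ (takeT m p) , (d , n) ∷ proj₂ (takeT m p)

  takeT-ev : ∀ ρ m p → ev ρ p ≡ proj₁ (takeT m p) * evM ρ m + ev ρ (proj₂ (takeT m p))
  takeT-ev ρ m [] = refl
  takeT-ev ρ m ((d , n) ∷ p) with eqM m n in eq
  ... | true rewrite eqM-sound m n eq = refl
  ... | false rewrite takeT-ev ρ m p = lem (d * evM ρ n) (proj₁ (takeT m p) * evM ρ m) (ev ρ (proj₂ (takeT m p)))
    where lem : ∀ a b c → a + (b + c) ≡ b + (a + c)
          lem = solve-∀

  leqP : Poly → Poly → Bool
  leqP [] q = true
  leqP ((c , m) ∷ p) q = (c ≤ᵇ proj₁ (takeT m q)) ∧ leqP p (proj₂ (takeT m q))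

  -- Monomials have nonnegative values, so it suffices to compare coefficients.
  leqP-sound : ∀ ρ p q → leqP p q ≡ true → ev ρ p ≤ ev ρ q
  leqP-sound ρ [] q e = z≤n
  leqP-sound ρ ((c , m) ∷ p) q e with c ≤ᵇ proj₁ (takeT m q) in eq | leqP p (proj₂ (takeT m q)) in eq'
  ... | true | true rewrite takeT-ev ρ m q =
    +-mono-≤ (*-monoˡ-≤ (evM ρ m) (≤ᵇ⇒≤ c _ (subst T (sym eq) tt))) (leqP-sound ρ p _ eq')

  Ineq = Poly × Poly

  Holds : Env → Ineq → Set
  Holds ρ (a , b) = ev ρ a ≤ ev ρ b

  AllHold : Env → List Ineq → Set
  AllHold ρ [] = ℕ
  AllHold ρ (i ∷ is) = Holds ρ i × AllHold ρ is

  comb : List ℕ → List Ineq → Ineq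
  comb [] is = [] , []
  comb (_ ∷ _) [] = [] , []
  comb (c ∷ cs) ((a , b) ∷ is) = addP (mulT c [] a) (proj₁ (comb cs is)) , addP (mulT c [] b) (proj₂ (comb cs is))

  comb-sound : ∀ ρ cs is → AllHold ρ is → Holds ρ (comb cs is)
  comb-sound ρ [] is h = z≤n
  comb-sound ρ (_ ∷ _) [] h = z≤n
  comb-sound ρ (c ∷ cs) ((a , b) ∷ is) (h , hs)
    rewrite addP-ev ρ (mulT c [] a) (proj₁ (comb cs is)) | addP-ev ρ (mulT c [] b) (proj₂ (comb cs is))
          | mulT-ev ρ c [] a | mulT-ev ρ c [] b
    = +-mono-≤ (*-monoʳ-≤ (c * 1) h) (comb-sound ρ cs is hs)

  one : Poly
  one = (1 , []) ∷ []

  refutes : List ℕ → List Ineq → Bool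
  refutes cs is = leqP (addP one (proj₂ (comb cs is))) (proj₁ (comb cs is))

  -- Farkas: a nonnegative combination of valid inequalities cannot have a left side that exceeds
  -- the right side by 1 coefficientwise.
  refutes-sound : ∀ ρ cs is → refutes cs is ≡ true → AllHold ρ is → ⊥
  refutes-sound ρ cs is e h = 1+n≰n (≤-trans (≤-trans (≤-reflexive (sym lhs)) (leqP-sound ρ (addP one (proj₂ (comb cs is))) (proj₁ (comb cs is)) e)) (comb-sound ρ cs is h))
    where lhs : ev ρ (addP one (proj₂ (comb cs is))) ≡ suc (ev ρ (proj₂ (comb cs is)))
          lhs = addP-ev ρ one (proj₂ (comb cs is))

  ineqs : Rel → List Ineq
  ineqs (a :≤ b) = (norm a , norm b) ∷ []
  ineqs (a :< b) = (norm (con 1 :+ a) , norm b) ∷ []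
  ineqs (a :≡ b) = (norm a , norm b) ∷ (norm b , norm a) ∷ []

  conv : ∀ ρ a b → ⟦ a ⟧ ρ ≤ ⟦ b ⟧ ρ → Holds ρ (norm a , norm b)
  conv ρ a b h = subst₂ _≤_ (sym (norm-ev ρ a)) (sym (norm-ev ρ b)) h

  pushR : ∀ ρ r is → ⟦ r ⟧ʳ ρ → AllHold ρ is → AllHold ρ (ineqs r ++ is)
  pushR ρ (a :≤ b) is h hs = conv ρ a b h , hs
  pushR ρ (a :< b) is h hs = conv ρ (con 1 :+ a) b h , hs
  pushR ρ (a :≡ b) is h hs = conv ρ a b (≤-reflexive h) , conv ρ b a (≤-reflexive (sym h)) , hs

  -- Fourier–Motzkin elimination; the multipliers it returns are only a hint.

  record Row : Set where
    constructor row
    field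
      cst : ℤ
      cof : List ℤ
      crt : List ℕ

  coef : Mono → Poly → ℕ
  coef m p = proj₁ (takeT m p)

  addMono : Mono → List Mono → List Mono
  addMono [] ms = ms
  addMono m [] = m ∷ []
  addMono m (n ∷ ms) = if eqM m n then n ∷ ms else n ∷ addMono m ms

  monos : List Ineq → List Mono
  monos [] = []
  monos ((a , b) ∷ is) = foldr addMono (foldr addMono (monos is) (map proj₂ b)) (map proj₂ a)

  oneHot : ℕ → ℕ → List ℕ
  oneHot i n = map (λ j → if i ≡ᵇ j then 1 else 0) (upTo n)

  mkRows : ℕ → ℕ → List Mono → List Ineq → List Row
  mkRows i n ms [] = []
  mkRows i n ms ((a , b) ∷ is) = row (d []) (map d ms) (oneHot i n) ∷ mkRows (suc i) n ms is
    where d : Mono → ℤ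
          d m = (ℤ.+_ (coef m b)) ℤ.- (ℤ.+_ (coef m a))

  -- Nonnegativity of the monomials. These rows carry zero certificates because `leqP` accounts for
  -- nonnegativity by itself.
  posRows : ℕ → ℕ → List Row
  posRows k n = map (λ i → row (ℤ.+_ 0) (map (λ j → if i ≡ᵇ j then ℤ.+_ 1 else ℤ.+_ 0) (upTo k)) (map (λ _ → 0) (upTo n))) (upTo k)

  isNeg isPos : ℤ → Bool
  isNeg -[1+ _ ] = true
  isNeg (ℤ.+_ _) = false
  isPos (ℤ.+_ (suc _)) = true
  isPos _ = false

  nth : ℕ → List ℤ → ℤ
  nth _ [] = ℤ.+_ 0
  nth zero (x ∷ _) = x
  nth (suc i) (_ ∷ xs) = nth i xs

  combine : ℕ → Row → Row → Row
  combine i (row c v w) (row c' v' w') =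
    row ((ℤ.+_ q) ℤ.* c ℤ.+ (ℤ.+_ p) ℤ.* c') (zipWith (λ x y → (ℤ.+_ q) ℤ.* x ℤ.+ (ℤ.+_ p) ℤ.* y) v v') (zipWith (λ x y → q * x + p * y) w w')
    where
    p q : ℕ
    p = ℤ.∣ nth i v ∣
    q = ℤ.∣ nth i v' ∣

  elim : ℕ → List Row → List Row
  elim i rs = filterᵇ (λ r → not (isPos (k r)) ∧ not (isNeg (k r))) rs
           ++ concatMap (λ r → map (combine i r) (filterᵇ (λ s → isNeg (k s)) rs)) (filterᵇ (λ r → isPos (k r)) rs)
    where k : Row → ℤ
          k r = nth i (Row.cof r)

  count : (Row → Bool) → List Row → ℕ
  count f rs = length (filterᵇ f rs)

  cost : List Row → ℕ → ℕ
  cost rs i = count (λ r → isPos (nth i (Row.cof r))) rs * count (λ r → isNeg (nth i (Row.cof r))) rs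

  best : List Row → ℕ → List ℕ → ℕ
  best rs i [] = i
  best rs i (j ∷ js) = if cost rs j <ᵇ cost rs i then best rs j js else best rs i js

  remove : ℕ → List ℕ → List ℕ
  remove i = filterᵇ (λ j → not (i ≡ᵇ j))

  findNeg : List Row → List ℕ
  findNeg [] = []
  findNeg (r ∷ rs) = if isNeg (Row.cst r) ∧ foldr (λ c t → not (isNeg c) ∧ not (isPos c) ∧ t) true (Row.cof r) then Row.crt r else findNeg rs

  fm : ℕ → List ℕ → List Row → List ℕ
  fm zero vs rs = findNeg rs
  fm (suc f) [] rs = findNeg rs
  fm (suc f) (v ∷ vs) rs = go (best rs v vs)
    where go : ℕ → List ℕ
          go b = fm f (remove b (v ∷ vs)) (elim b rs)

  certificate : List Ineq → List ℕ
  certificate is = fm k (upTo k) (mkRows 0 n ms is ++ posRows k n)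
    where
    ms = monos is
    k = length ms
    n = length is

  contra : List Ineq → Bool
  contra is = refutes (certificate is) is

  -- The negated goal joins the hypotheses; an equation needs two refutations, one for each strict
  -- inequality.
  checkGoal : Rel → List Ineq → Bool
  checkGoal (a :≤ b) is = contra (ineqs (b :< a) ++ is)
  checkGoal (a :< b) is = contra (ineqs (b :≤ a) ++ is)
  checkGoal (a :≡ b) is = contra (ineqs (b :< a) ++ is) ∧ contra (ineqs (a :< b) ++ is)

  check : Prob → List Ineq → Bool
  check ⟨ r ⟩ is = checkGoal r is
  check (r ⇒ p) is = check p (ineqs r ++ is)

  contra-sound : ∀ ρ r is → contra (ineqs r ++ is) ≡ true → AllHold ρ is → ⟦ r ⟧ʳ ρ → ⊥
  contra-sound ρ r is e hs h = refutes-sound ρ (certificate (ineqs r ++ is)) (ineqs r ++ is) e (pushR ρ r is h hs)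

  check-sound : ∀ ρ p is → check p is ≡ true → AllHold ρ is → ⟦ p ⟧ᵖ ρ
  check-sound ρ (r ⇒ p) is e hs h = check-sound ρ p (ineqs r ++ is) e (pushR ρ r is h hs)
  check-sound ρ ⟨ a :≤ b ⟩ is e hs = ≮⇒≥ (contra-sound ρ (b :< a) is e hs)
  check-sound ρ ⟨ a :< b ⟩ is e hs = ≰⇒> (contra-sound ρ (b :≤ a) is e hs)
  check-sound ρ ⟨ a :≡ b ⟩ is e hs with contra (ineqs (b :< a) ++ is) in e₁ | contra (ineqs (a :< b) ++ is) in e₂
  ... | true | true = ≤-antisym (≮⇒≥ (contra-sound ρ (b :< a) is e₁ hs)) (≮⇒≥ (contra-sound ρ (a :< b) is e₂ hs))

  lookupV : ∀ {n} → Vec ℕ n → Env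
  lookupV [] _ = 0
  lookupV (x ∷ ρ) zero = x
  lookupV (x ∷ ρ) (suc i) = lookupV ρ i

  vars : (n k : ℕ) → Vec Ex n
  vars zero k = []
  vars (suc n) k = var k ∷ vars n (suc k)

  Curried : ℕ → Set
  Curried zero = Prob
  Curried (suc n) = Ex → Curried n

  close : ∀ {n} → Curried n → Vec Ex n → Prob
  close p [] = p
  close f (x ∷ xs) = close (f x) xs

  Universally : ∀ n → (Vec ℕ n → Set) → Set
  Universally zero P = P []
  Universally (suc n) P = ∀ x → Universally n (λ ρ → P (x ∷ ρ))

  universally : ∀ n {P : Vec ℕ n → Set} → (∀ ρ → P ρ) → Universally n P
  universally zero h = h []
  universally (suc n) h x = universally n (λ ρ → h (x ∷ ρ))

  -- Products of variables are atoms: a hypothesis that has to be multiplied by a variable is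
  -- supplied in both forms.
  lia : ∀ n (f : Curried n) → check (close f (vars n 0)) [] ≡ true → Universally n (λ ρ → ⟦ close f (vars n 0) ⟧ᵖ (lookupV ρ))
  lia n f e = universally n (λ ρ → check-sound (lookupV ρ) (close f (vars n 0)) [] e 0)

-- Permutations between concatenations of lists by reflection

module BagSolver where

  open import Data.Nat
  open import Data.Nat.Properties
  open import Data.Bool using (Bool; true; false; T)
  open import Data.List using (List; []; _∷_; _++_)
  open import Data.List.Properties using (++-assoc; ++-identityʳ)
  open import Data.List.Relation.Binary.Permutation.Propositional using (_↭_; ↭-refl; ↭-sym; ↭-trans; ↭-reflexive)
  import Data.List.Relation.Binary.Permutation.Propositional.Properties as ↭P
  open import Data.Maybe using (Maybe; just; nothing)
  open import Data.Vec using (Vec; []; _∷_)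
  open import Data.Unit using (tt)
  open import Relation.Binary.PropositionalEquality

  infixr 5 _:++_
  infix 4 _:↭_

  data Bag : Set where
    bvar : ℕ → Bag
    ∅ : Bag
    _:++_ : Bag → Bag → Bag

  data BagEq : Set where
    _:↭_ : Bag → Bag → BagEq

  atoms : Bag → List ℕ
  atoms (bvar i) = i ∷ []
  atoms ∅ = []
  atoms (b :++ c) = atoms b ++ atoms c

  pull : ℕ → List ℕ → Maybe (List ℕ)
  pull i [] = nothing
  pull i (j ∷ js) with i ≡ᵇ j | pull i js
  ... | true | _ = just js
  ... | false | just ks = just (j ∷ ks)
  ... | false | nothing = nothing

  sameBag : List ℕ → List ℕ → Bool
  sameBag [] [] = true
  sameBag [] (_ ∷ _) = false
  sameBag (i ∷ is) js with pull i js
  ... | just ks = sameBag is ks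
  ... | nothing = false

  checkB : BagEq → Bool
  checkB (b :↭ c) = sameBag (atoms b) (atoms c)

  bvars : (n k : ℕ) → Vec Bag n
  bvars zero k = []
  bvars (suc n) k = bvar k ∷ bvars n (suc k)

  Curried : ℕ → Set
  Curried zero = BagEq
  Curried (suc n) = Bag → Curried n

  close : ∀ {n} → Curried n → Vec Bag n → BagEq
  close p [] = p
  close f (x ∷ xs) = close (f x) xs

  module _ {A : Set} where

    ⟦_⟧ᵇ : Bag → (ℕ → List A) → List A
    ⟦ bvar i ⟧ᵇ ρ = ρ i
    ⟦ ∅ ⟧ᵇ ρ = []
    ⟦ b :++ c ⟧ᵇ ρ = ⟦ b ⟧ᵇ ρ ++ ⟦ c ⟧ᵇ ρ

    unflat : (ℕ → List A) → List ℕ → List A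
    unflat ρ [] = []
    unflat ρ (i ∷ is) = ρ i ++ unflat ρ is

    unflat-++ : ∀ ρ is js → unflat ρ (is ++ js) ≡ unflat ρ is ++ unflat ρ js
    unflat-++ ρ [] js = refl
    unflat-++ ρ (i ∷ is) js = trans (cong (ρ i ++_) (unflat-++ ρ is js)) (sym (++-assoc (ρ i) _ _))

    atoms-ok : ∀ ρ b → ⟦ b ⟧ᵇ ρ ≡ unflat ρ (atoms b)
    atoms-ok ρ (bvar i) = sym (++-identityʳ (ρ i))
    atoms-ok ρ ∅ = refl
    atoms-ok ρ (b :++ c) = trans (cong₂ _++_ (atoms-ok ρ b) (atoms-ok ρ c)) (sym (unflat-++ ρ (atoms b) (atoms c)))

    pull-ok : ∀ ρ i js {ks} → pull i js ≡ just ks → unflat ρ js ↭ ρ i ++ unflat ρ ks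
    pull-ok ρ i (j ∷ js) e with i ≡ᵇ j in eq | pull i js in eq'
    pull-ok ρ i (j ∷ js) refl | true | _ rewrite ≡ᵇ⇒≡ i j (subst T (sym eq) tt) = ↭-refl
    pull-ok ρ i (j ∷ js) refl | false | just ks =
      ↭-trans (↭P.++⁺ˡ (ρ j) (pull-ok ρ i js eq')) (↭P.shifts (ρ j) (ρ i))

    sameBag-ok : ∀ ρ is js → sameBag is js ≡ true → unflat ρ is ↭ unflat ρ js
    sameBag-ok ρ [] [] e = ↭-refl
    sameBag-ok ρ (i ∷ is) js e with pull i js in eq
    ... | just ks = ↭-trans (↭P.++⁺ˡ (ρ i) (sameBag-ok ρ is ks e)) (↭-sym (pull-ok ρ i js eq))

    lookupB : ∀ {n} → Vec (List A) n → ℕ → List A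
    lookupB [] _ = []
    lookupB (x ∷ ρ) zero = x
    lookupB (x ∷ ρ) (suc i) = lookupB ρ i

    ⟦_⟧ᵉ : BagEq → (ℕ → List A) → Set
    ⟦ b :↭ c ⟧ᵉ ρ = ⟦ b ⟧ᵇ ρ ↭ ⟦ c ⟧ᵇ ρ

    Universally : ∀ n → (Vec (List A) n → Set) → Set
    Universally zero P = P []
    Universally (suc n) P = ∀ x → Universally n (λ ρ → P (x ∷ ρ))

    universally : ∀ n {P : Vec (List A) n → Set} → (∀ ρ → P ρ) → Universally n P
    universally zero h = h []
    universally (suc n) h x = universally n (λ ρ → h (x ∷ ρ))

    bag : ∀ n (f : Curried n) → checkB (close f (bvars n 0)) ≡ true → Universally n (λ ρ → ⟦ close f (bvars n 0) ⟧ᵉ (lookupB ρ))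
    bag n f e = universally n (λ ρ → sound (close f (bvars n 0)) e (lookupB ρ))
      where
      sound : ∀ q → checkB q ≡ true → ∀ ρ → ⟦ q ⟧ᵉ ρ
      sound (b :↭ c) e ρ = ↭-trans (↭-reflexive (atoms-ok ρ b)) (↭-trans (sameBag-ok ρ (atoms b) (atoms c) e) (↭-reflexive (sym (atoms-ok ρ c))))

-- Slicing trees and their repacking into boundedly many cells

module SlicingPackings where

  open import Data.Nat
  open import Data.Nat.Properties
  open import Data.Nat.DivMod using (_/_; m%n<n; m≡m%n+[m/n]*n; m/n*n≤m; m*n/n≡m; 0/n≡0; n/n≡1; m/n≤m; /-monoˡ-≤; m<n*o⇒m/o<n)
  open import Data.Bool using (Bool; true; false; if_then_else_; _∧_; not; T)
  open import Data.Bool.Properties using (∧-zeroʳ)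
  open import Data.List using (List; []; _∷_; _++_; map; filterᵇ; length; concat; concatMap; replicate; zipWith; upTo)
  open import Data.List.Properties using (++-assoc; ++-identityʳ; length-++; map-++; length-replicate; length-map; ≡-dec; concat-++; length-upTo)
  open import Data.List.Relation.Unary.All as All using (All; []; _∷_)
  open import Data.List.Relation.Unary.All.Properties using (++⁺; ++⁻ˡ; ++⁻ʳ)
  open import Data.List.Relation.Unary.Any using (here; there)
  open import Data.List.Relation.Unary.AllPairs using (AllPairs; []; _∷_)
  open import Data.List.Membership.Propositional using (_∈_)
  open import Data.List.Membership.Propositional.Properties using (∈-map⁺; ∈-++⁺ˡ; ∈-++⁺ʳ; ∈-upTo⁺)
  open import Data.List.Relation.Binary.Permutation.Propositional using (_↭_; ↭-refl; ↭-sym; ↭-trans; ↭-reflexive; prep; swap)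
  import Data.List.Relation.Binary.Permutation.Propositional as ↭
  import Data.List.Relation.Binary.Permutation.Propositional.Properties as ↭P
  open import Data.Product using (Σ; _×_; _,_; proj₁; proj₂)
  open import Data.Sum using (_⊎_; inj₁; inj₂)
  open import Data.Unit using (tt)
  open import Function using (_∘_; _|>_)
  open import Relation.Nullary using (Dec; yes; no; contradiction)
  open import Relation.Nullary.Decidable using (⌊_⌋)
  open import Relation.Binary.PropositionalEquality
  open LinearArithmetic using (con; _:+_; _:*_; _:≤_; _:<_; _:≡_; ⟨_⟩; _⇒_; lia)
  open BagSolver using (_:++_; _:↭_; bag)

  -- Weighted lists

  𝟙 : Bool → ℕ
  𝟙 true = 1
  𝟙 false = 0

  ≤ᵇ-true : ∀ {m n} → m ≤ n → (m ≤ᵇ n) ≡ true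
  ≤ᵇ-true {m} {n} h with m ≤ᵇ n | ≤⇒≤ᵇ h
  ... | true | _ = refl

  true-≤ : ∀ {m n} → (m ≤ᵇ n) ≡ true → m ≤ n
  true-≤ {m} {n} e = ≤ᵇ⇒≤ m n (subst T (sym e) tt)

  false-> : ∀ {m n} → (m ≤ᵇ n) ≡ false → n < m
  false-> {m} {n} e = ≰⇒> (λ h → subst T e (≤⇒≤ᵇ h))

  ≤ᵇ-false : ∀ {m n} → n < m → (m ≤ᵇ n) ≡ false
  ≤ᵇ-false {m} {n} h with m ≤ᵇ n in eq
  ... | true = contradiction (true-≤ eq) (<⇒≱ h)
  ... | false = refl

  module _ {A : Set} where

    Σ′ : (A → ℕ) → List A → ℕ
    Σ′ φ [] = 0
    Σ′ φ (x ∷ xs) = φ x + Σ′ φ xs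

    Σ-++ : ∀ φ xs ys → Σ′ φ (xs ++ ys) ≡ Σ′ φ xs + Σ′ φ ys
    Σ-++ φ [] ys = refl
    Σ-++ φ (x ∷ xs) ys = trans (cong (φ x +_) (Σ-++ φ xs ys)) (sym (+-assoc (φ x) _ _))

    Σ-↭ : ∀ φ {xs ys} → xs ↭ ys → Σ′ φ xs ≡ Σ′ φ ys
    Σ-↭ φ ↭.refl = refl
    Σ-↭ φ (prep x p) = cong (φ x +_) (Σ-↭ φ p)
    Σ-↭ φ (swap {xs} {ys} x y p) = trans (cong (λ z → φ x + (φ y + z)) (Σ-↭ φ p)) (lem (φ x) (φ y) (Σ′ φ ys))
      where lem : ∀ a b c → a + (b + c) ≡ b + (a + c)
            lem = lia 3 (λ a b c → ⟨ a :+ (b :+ c) :≡ b :+ (a :+ c) ⟩) refl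
    Σ-↭ φ (↭.trans p q) = trans (Σ-↭ φ p) (Σ-↭ φ q)

    Σ-mono : ∀ {φ ψ : A → ℕ} {xs} → All (λ x → φ x ≤ ψ x) xs → Σ′ φ xs ≤ Σ′ ψ xs
    Σ-mono [] = z≤n
    Σ-mono (h ∷ hs) = +-mono-≤ h (Σ-mono hs)

    Σ-cong : ∀ {φ ψ : A → ℕ} {xs} → All (λ x → φ x ≡ ψ x) xs → Σ′ φ xs ≡ Σ′ ψ xs
    Σ-cong [] = refl
    Σ-cong (h ∷ hs) = cong₂ _+_ h (Σ-cong hs)

    Σ-* : ∀ k φ (xs : List A) → Σ′ (λ x → k * φ x) xs ≡ k * Σ′ φ xs
    Σ-* k φ [] = sym (*-zeroʳ k)
    Σ-* k φ (x ∷ xs) = trans (cong (k * φ x +_) (Σ-* k φ xs)) (sym (*-distribˡ-+ k (φ x) _))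

    Σ-+ : ∀ φ ψ (xs : List A) → Σ′ (λ x → φ x + ψ x) xs ≡ Σ′ φ xs + Σ′ ψ xs
    Σ-+ φ ψ [] = refl
    Σ-+ φ ψ (x ∷ xs) rewrite Σ-+ φ ψ xs = lem (φ x) (ψ x) (Σ′ φ xs) (Σ′ ψ xs)
      where lem : ∀ a b c d → a + b + (c + d) ≡ a + c + (b + d)
            lem = lia 4 (λ a b c d → ⟨ a :+ b :+ (c :+ d) :≡ a :+ c :+ (b :+ d) ⟩) refl

    Σ-const : ∀ k (xs : List A) → Σ′ (λ _ → k) xs ≡ k * length xs
    Σ-const k [] = sym (*-zeroʳ k)
    Σ-const k (x ∷ xs) = trans (cong (k +_) (Σ-const k xs)) (sym (*-suc k (length xs)))

    Σ-lower : ∀ k φ {xs : List A} → All (λ x → k ≤ φ x) xs → k * length xs ≤ Σ′ φ xs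
    Σ-lower k φ {xs} h = ≤-trans (≤-reflexive (sym (Σ-const k xs))) (Σ-mono h)

    filter-++ : ∀ (p : A → Bool) xs ys → filterᵇ p (xs ++ ys) ≡ filterᵇ p xs ++ filterᵇ p ys
    filter-++ p [] ys = refl
    filter-++ p (x ∷ xs) ys with p x
    ... | true = cong (x ∷_) (filter-++ p xs ys)
    ... | false = filter-++ p xs ys

    partition↭ : ∀ (p : A → Bool) xs → xs ↭ filterᵇ p xs ++ filterᵇ (not ∘ p) xs
    partition↭ p [] = ↭-refl
    partition↭ p (x ∷ xs) with p x
    ... | true = prep x (partition↭ p xs)
    ... | false = ↭-trans (prep x (partition↭ p xs)) (↭-sym (↭P.shift x (filterᵇ p xs) _))

    filter-All : ∀ {P : A → Set} (p : A → Bool) {xs} → All P xs → All P (filterᵇ p xs)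
    filter-All p [] = []
    filter-All p (_∷_ {x = x} h hs) with p x
    ... | true = h ∷ filter-All p hs
    ... | false = filter-All p hs

    filter-true : ∀ (p : A → Bool) xs → All (λ x → p x ≡ true) (filterᵇ p xs)
    filter-true p [] = []
    filter-true p (x ∷ xs) with p x in eq
    ... | true = eq ∷ filter-true p xs
    ... | false = filter-true p xs

    Σ-filter : ∀ (p : A → Bool) φ xs → Σ′ φ (filterᵇ p xs) ≡ Σ′ (λ x → 𝟙 (p x) * φ x) xs
    Σ-filter p φ [] = refl
    Σ-filter p φ (x ∷ xs) with p x
    ... | true = cong₂ _+_ (sym (+-identityʳ (φ x))) (Σ-filter p φ xs)
    ... | false = Σ-filter p φ xs

    length-filter : ∀ (p : A → Bool) xs → length (filterᵇ p xs) ≡ Σ′ (λ x → 𝟙 (p x)) xs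
    length-filter p [] = refl
    length-filter p (x ∷ xs) with p x
    ... | true = cong suc (length-filter p xs)
    ... | false = length-filter p xs

    Σ-length : ∀ (xs : List A) → Σ′ (λ _ → 1) xs ≡ length xs
    Σ-length [] = refl
    Σ-length (x ∷ xs) = cong suc (Σ-length xs)

    filter-cong : ∀ {p r : A → Bool} {xs} → All (λ x → p x ≡ r x) xs → filterᵇ p xs ≡ filterᵇ r xs
    filter-cong [] = refl
    filter-cong {p} {r} (_∷_ {x = x} h hs) with p x | r x
    ... | true | true = cong (x ∷_) (filter-cong hs)
    ... | false | false = filter-cong hs

    All-↭ : ∀ {P : A → Set} {xs ys} → xs ↭ ys → All P xs → All P ys
    All-↭ = ↭P.All-resp-↭

    length-↭ : ∀ {xs ys : List A} → xs ↭ ys → length xs ≡ length ys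
    length-↭ = ↭P.↭-length

  Σ-map : ∀ {A B : Set} (h : A → B) (φ : B → ℕ) xs → Σ′ φ (map h xs) ≡ Σ′ (λ x → φ (h x)) xs
  Σ-map h φ [] = refl
  Σ-map h φ (x ∷ xs) = cong (φ (h x) +_) (Σ-map h φ xs)

  Σ-concat : ∀ {A : Set} (φ : A → ℕ) xss → Σ′ φ (concat xss) ≡ Σ′ (Σ′ φ) xss
  Σ-concat φ [] = refl
  Σ-concat φ (xs ∷ xss) = trans (Σ-++ φ xs (concat xss)) (cong (Σ′ φ xs +_) (Σ-concat φ xss))

  filter-map : ∀ {A B : Set} (h : A → B) (p : B → Bool) xs → filterᵇ p (map h xs) ≡ map h (filterᵇ (λ x → p (h x)) xs)
  filter-map h p [] = refl
  filter-map h p (x ∷ xs) with p (h x)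
  ... | true = cong (h x ∷_) (filter-map h p xs)
  ... | false = filter-map h p xs

  upΣ : ℕ → (ℕ → ℕ) → ℕ
  upΣ zero c = 0
  upΣ (suc q) c = upΣ q c + c q

  -- The least of the `q` values is at most their average.
  pigeon : ∀ q (c : ℕ → ℕ) B → 1 ≤ q → upΣ q c ≤ B → Σ ℕ λ k → k < q × q * c k ≤ B
  pigeon (suc q) c B _ h = let (k , k< , le) = minimal q in k , k< , ≤-trans le h
    where
    minimal : ∀ q → Σ ℕ λ k → k < suc q × suc q * c k ≤ upΣ (suc q) c
    minimal zero = 0 , s≤s z≤n , ≤-reflexive (+-identityʳ (c 0))
    minimal (suc q) with minimal q
    ... | k , k< , le with c k ≤? c (suc q)
    ... | yes ck = k , m<n⇒m<1+n k< , lia 4 (λ a b q s → ((con 1 :+ q) :* a :≤ s) ⇒ (a :≤ b) ⇒ ⟨ (con 2 :+ q) :* a :≤ s :+ b ⟩) refl (c k) (c (suc q)) q (upΣ (suc q) c) le ck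
    ... | no ck = suc q , ≤-refl , ≤-trans (+-monoʳ-≤ (c (suc q)) (≤-trans (*-monoʳ-≤ (suc q) (<⇒≤ (≰⇒> ck))) le)) (≤-reflexive (+-comm (c (suc q)) _))

  -- Slicing trees

  -- Guillotine packings of items of width f and height g in an a × b rectangle, without coordinates.
  data Slice {A : Set} (f g : A → ℕ) (a b : ℕ) : List A → Set where
    none : Slice f g a b []
    one  : ∀ x → f x ≤ a → g x ≤ b → Slice f g a b (x ∷ [])
    ver  : ∀ {L₁ L₂} a₁ a₂ → a₁ + a₂ ≡ a → Slice f g a₁ b L₁ → Slice f g a₂ b L₂ → Slice f g a b (L₁ ++ L₂)
    hor  : ∀ {L₁ L₂} b₁ b₂ → b₁ + b₂ ≡ b → Slice f g a b₁ L₁ → Slice f g a b₂ L₂ → Slice f g a b (L₁ ++ L₂)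

  module _ {A : Set} where

    swapS : ∀ {f g : A → ℕ} {a b L} → Slice f g a b L → Slice g f b a L
    swapS none = none
    swapS (one x p q) = one x q p
    swapS (ver a₁ a₂ e s t) = hor a₁ a₂ e (swapS s) (swapS t)
    swapS (hor b₁ b₂ e s t) = ver b₁ b₂ e (swapS s) (swapS t)

    padS : ∀ {f g : A → ℕ} {a b a′ b′ L} → a ≤ a′ → b ≤ b′ → Slice f g a b L → Slice f g a′ b′ L
    padS p q none = none
    padS p q (one x h k) = one x (≤-trans h p) (≤-trans k q)
    padS {a′ = a′} p q (ver a₁ a₂ refl s t) = ver a₁ (a′ ∸ a₁) (m+[n∸m]≡n a₁≤) (padS ≤-refl q s) (padS a₂≤ q t)
      where a₁≤ : a₁ ≤ a′
            a₁≤ = ≤-trans (m≤m+n a₁ a₂) p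
            a₂≤ : a₂ ≤ a′ ∸ a₁
            a₂≤ = ≤-trans (≤-reflexive (sym (m+n∸m≡n a₁ a₂))) (∸-monoˡ-≤ a₁ p)
    padS {b′ = b′} p q (hor b₁ b₂ refl s t) = hor b₁ (b′ ∸ b₁) (m+[n∸m]≡n b₁≤) (padS p ≤-refl s) (padS p b₂≤ t)
      where b₁≤ : b₁ ≤ b′
            b₁≤ = ≤-trans (m≤m+n b₁ b₂) q
            b₂≤ : b₂ ≤ b′ ∸ b₁
            b₂≤ = ≤-trans (≤-reflexive (sym (m+n∸m≡n b₁ b₂))) (∸-monoˡ-≤ b₁ q)

    filterS : ∀ {f g : A → ℕ} {a b L} (p : A → Bool) → Slice f g a b L → Slice f g a b (filterᵇ p L)
    filterS p none = none
    filterS p (one x h k) with p x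
    ... | true = one x h k
    ... | false = none
    filterS p (ver {L₁} {L₂} a₁ a₂ e s t) = subst (Slice _ _ _ _) (sym (filter-++ p L₁ L₂)) (ver a₁ a₂ e (filterS p s) (filterS p t))
    filterS p (hor {L₁} {L₂} b₁ b₂ e s t) = subst (Slice _ _ _ _) (sym (filter-++ p L₁ L₂)) (hor b₁ b₂ e (filterS p s) (filterS p t))

    scaleS : ∀ {f g : A → ℕ} {a b L} k → Slice f g a b L → Slice (λ x → k * f x) (λ x → k * g x) (k * a) (k * b) L
    scaleS k none = none
    scaleS k (one x h h′) = one x (*-monoʳ-≤ k h) (*-monoʳ-≤ k h′)
    scaleS k (ver a₁ a₂ refl s t) = ver (k * a₁) (k * a₂) (sym (*-distribˡ-+ k a₁ a₂)) (scaleS k s) (scaleS k t)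
    scaleS k (hor b₁ b₂ refl s t) = hor (k * b₁) (k * b₂) (sym (*-distribˡ-+ k b₁ b₂)) (scaleS k s) (scaleS k t)

    reweigh : ∀ {f g f′ g′ : A → ℕ} {a b L} → All (λ x → f′ x ≤ f x × g′ x ≤ g x) L → Slice f g a b L → Slice f′ g′ a b L
    reweigh h none = none
    reweigh ((p , q) ∷ []) (one x h k) = one x (≤-trans p h) (≤-trans q k)
    reweigh h (ver {L₁} a₁ a₂ e s t) = ver a₁ a₂ e (reweigh (++⁻ˡ L₁ h) s) (reweigh (++⁻ʳ L₁ h) t)
    reweigh h (hor {L₁} b₁ b₂ e s t) = hor b₁ b₂ e (reweigh (++⁻ˡ L₁ h) s) (reweigh (++⁻ʳ L₁ h) t)

    area : (f g : A → ℕ) → List A → ℕ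
    area f g = Σ′ (λ x → f x * g x)

    area-swap : ∀ (f g : A → ℕ) L → area f g L ≡ area g f L
    area-swap f g L = Σ-cong {xs = L} (All.universal (λ x → *-comm (f x) (g x)) L)

    area-≤ : ∀ {f g : A → ℕ} {a b L} → Slice f g a b L → area f g L ≤ a * b
    area-≤ none = z≤n
    area-≤ (one x h k) = ≤-trans (≤-reflexive (+-identityʳ _)) (*-mono-≤ h k)
    area-≤ {f} {g} {b = b} (ver {L₁} {L₂} a₁ a₂ refl s t) = ≤-trans (≤-reflexive (Σ-++ _ L₁ L₂))
      (≤-trans (+-mono-≤ (area-≤ s) (area-≤ t)) (≤-reflexive (sym (*-distribʳ-+ b a₁ a₂))))
    area-≤ {f} {g} {a} (hor {L₁} {L₂} b₁ b₂ refl s t) = ≤-trans (≤-reflexive (Σ-++ _ L₁ L₂))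
      (≤-trans (+-mono-≤ (area-≤ s) (area-≤ t)) (≤-reflexive (sym (*-distribˡ-+ a b₁ b₂))))

    fits : ∀ {f g : A → ℕ} {a b L} → Slice f g a b L → All (λ x → f x ≤ a × g x ≤ b) L
    fits none = []
    fits (one x h k) = (h , k) ∷ []
    fits (ver a₁ a₂ refl s t) = ++⁺ (All.map (λ { (p , q) → ≤-trans p (m≤m+n a₁ a₂) , q }) (fits s))
                                    (All.map (λ { (p , q) → ≤-trans p (m≤n+m a₂ a₁) , q }) (fits t))
    fits (hor b₁ b₂ refl s t) = ++⁺ (All.map (λ { (p , q) → p , ≤-trans q (m≤m+n b₁ b₂) }) (fits s))
                                    (All.map (λ { (p , q) → p , ≤-trans q (m≤n+m b₂ b₁) }) (fits t))

    -- The items met by each of the a unit-width vertical lines.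
    levels : ∀ {f g : A → ℕ} {a b L} → Slice f g a b L → List (List A)
    levels {a = a} none = replicate a []
    levels {f} {a = a} (one x h k) = replicate (f x) (x ∷ []) ++ replicate (a ∸ f x) []
    levels (ver a₁ a₂ e s t) = levels s ++ levels t
    levels (hor b₁ b₂ e s t) = zipWith _++_ (levels s) (levels t)

    private
      zip-length : ∀ (xs ys : List (List A)) {n} → length xs ≡ n → length ys ≡ n → length (zipWith _++_ xs ys) ≡ n
      zip-length [] [] h k = h
      zip-length [] (y ∷ ys) refl ()
      zip-length (x ∷ xs) [] refl ()
      zip-length (x ∷ xs) (y ∷ ys) {suc n} h k = cong suc (zip-length xs ys (suc-injective h) (suc-injective k))

      zip-Σ : ∀ φ (xs ys : List (List A)) {n} → length xs ≡ n → length ys ≡ n →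
              Σ′ (Σ′ φ) (zipWith _++_ xs ys) ≡ Σ′ (Σ′ φ) xs + Σ′ (Σ′ φ) ys
      zip-Σ φ [] [] h k = refl
      zip-Σ φ [] (y ∷ ys) refl ()
      zip-Σ φ (x ∷ xs) [] refl ()
      zip-Σ φ (x ∷ xs) (y ∷ ys) {suc n} h k rewrite Σ-++ φ x y | zip-Σ φ xs ys (suc-injective h) (suc-injective k) =
        lia 4 (λ a b c d → ⟨ a :+ b :+ (c :+ d) :≡ a :+ c :+ (b :+ d) ⟩) refl (Σ′ φ x) (Σ′ φ y) (Σ′ (Σ′ φ) xs) (Σ′ (Σ′ φ) ys)

      zip-≤ : ∀ φ {c d} {xs ys : List (List A)} → All (λ l → Σ′ φ l ≤ c) xs → All (λ l → Σ′ φ l ≤ d) ys →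
              All (λ l → Σ′ φ l ≤ c + d) (zipWith _++_ xs ys)
      zip-≤ φ [] _ = []
      zip-≤ φ (_ ∷ _) [] = []
      zip-≤ φ (_∷_ {x = x} h hs) (_∷_ {x = y} k ks) = ≤-trans (≤-reflexive (Σ-++ φ x y)) (+-mono-≤ h k) ∷ zip-≤ φ hs ks

      zip-All : ∀ {P : A → Set} {xs ys : List (List A)} → All (All P) xs → All (All P) ys → All (All P) (zipWith _++_ xs ys)
      zip-All [] _ = []
      zip-All (_ ∷ _) [] = []
      zip-All (h ∷ hs) (k ∷ ks) = ++⁺ h k ∷ zip-All hs ks

      Σ-replicate : ∀ {B : Set} (φ : B → ℕ) n x → Σ′ φ (replicate n x) ≡ n * φ x
      Σ-replicate φ zero x = refl
      Σ-replicate φ (suc n) x = cong (φ x +_) (Σ-replicate φ n x)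

      All-replicate : ∀ {B : Set} {P : B → Set} n {x} → P x → All P (replicate n x)
      All-replicate zero p = []
      All-replicate (suc n) p = p ∷ All-replicate n p

    levels-length : ∀ {f g : A → ℕ} {a b L} (s : Slice f g a b L) → length (levels s) ≡ a
    levels-length {a = a} none = length-replicate a
    levels-length {f} {a = a} (one x h k) = trans (length-++ (replicate (f x) (x ∷ [])))
      (trans (cong₂ _+_ (length-replicate (f x)) (length-replicate (a ∸ f x))) (m+[n∸m]≡n h))
    levels-length (ver a₁ a₂ refl s t) = trans (length-++ (levels s)) (cong₂ _+_ (levels-length s) (levels-length t))
    levels-length (hor b₁ b₂ e s t) = zip-length (levels s) (levels t) (levels-length s) (levels-length t)

    levels-≤ : ∀ {f g : A → ℕ} {a b L} (s : Slice f g a b L) → All (λ l → Σ′ g l ≤ b) (levels s)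
    levels-≤ {a = a} none = All-replicate a z≤n
    levels-≤ {f} {a = a} (one x h k) = ++⁺ (All-replicate (f x) (≤-trans (≤-reflexive (+-identityʳ _)) k)) (All-replicate (a ∸ f x) z≤n)
    levels-≤ (ver a₁ a₂ e s t) = ++⁺ (levels-≤ s) (levels-≤ t)
    levels-≤ {g = g} (hor b₁ b₂ refl s t) = zip-≤ g (levels-≤ s) (levels-≤ t)

    levels-All : ∀ {P : A → Set} {f g : A → ℕ} {a b L} (s : Slice f g a b L) → All P L → All (All P) (levels s)
    levels-All {a = a} none h = All-replicate a []
    levels-All {f = f} {a = a} (one x h k) p = ++⁺ (All-replicate (f x) p) (All-replicate (a ∸ f x) [])
    levels-All (ver {L₁} a₁ a₂ e s t) h = ++⁺ (levels-All s (++⁻ˡ L₁ h)) (levels-All t (++⁻ʳ L₁ h))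
    levels-All (hor {L₁} b₁ b₂ e s t) h = zip-All (levels-All s (++⁻ˡ L₁ h)) (levels-All t (++⁻ʳ L₁ h))

    -- Double counting: x is met by exactly f x lines.
    fubini : ∀ {f g : A → ℕ} {a b L} (s : Slice f g a b L) φ → Σ′ (Σ′ φ) (levels s) ≡ Σ′ (λ x → f x * φ x) L
    fubini {a = a} none φ = trans (Σ-replicate (Σ′ φ) a []) (*-zeroʳ a)
    fubini {f} {a = a} (one x h k) φ = trans (Σ-++ (Σ′ φ) (replicate (f x) (x ∷ [])) _)
      (cong₂ _+_ (trans (Σ-replicate (Σ′ φ) (f x) (x ∷ [])) (cong (f x *_) (+-identityʳ (φ x))))
                 (trans (Σ-replicate (Σ′ φ) (a ∸ f x) []) (*-zeroʳ (a ∸ f x))))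
    fubini (ver {L₁} {L₂} a₁ a₂ e s t) φ = trans (Σ-++ (Σ′ φ) (levels s) (levels t))
      (trans (cong₂ _+_ (fubini s φ) (fubini t φ)) (sym (Σ-++ _ L₁ L₂)))
    fubini (hor {L₁} {L₂} b₁ b₂ e s t) φ = trans (zip-Σ φ (levels s) (levels t) (levels-length s) (levels-length t))
      (trans (cong₂ _+_ (fubini s φ) (fubini t φ)) (sym (Σ-++ _ L₁ L₂)))

  mapS : ∀ {A B : Set} {f g : B → ℕ} (h : A → B) {a b L} → Slice (f ∘ h) (g ∘ h) a b L → Slice f g a b (map h L)
  mapS h none = none
  mapS h (one x p q) = one (h x) p q
  mapS h (ver {L₁} {L₂} a₁ a₂ e s t) = subst (Slice _ _ _ _) (sym (map-++ h L₁ L₂)) (ver a₁ a₂ e (mapS h s) (mapS h t))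
  mapS h (hor {L₁} {L₂} b₁ b₂ e s t) = subst (Slice _ _ _ _) (sym (map-++ h L₁ L₂)) (hor b₁ b₂ e (mapS h s) (mapS h t))

  -- Each item carries the abscissa of its left side; o is the abscissa of the whole rectangle.
  data PSlice {A : Set} (f g : A → ℕ) (o a b : ℕ) : List (A × ℕ) → Set where
    none : PSlice f g o a b []
    one  : ∀ x p → o ≤ p → p + f x ≤ o + a → g x ≤ b → PSlice f g o a b ((x , p) ∷ [])
    ver  : ∀ {L₁ L₂} a₁ a₂ → a₁ + a₂ ≡ a → PSlice f g o a₁ b L₁ → PSlice f g (o + a₁) a₂ b L₂ → PSlice f g o a b (L₁ ++ L₂)
    hor  : ∀ {L₁ L₂} b₁ b₂ → b₁ + b₂ ≡ b → PSlice f g o a b₁ L₁ → PSlice f g o a b₂ L₂ → PSlice f g o a b (L₁ ++ L₂)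

  module _ {A : Set} {f g : A → ℕ} where

    position : ∀ {a b L} o → Slice f g a b L → Σ (List (A × ℕ)) λ L′ → map proj₁ L′ ≡ L × PSlice f g o a b L′
    position o none = [] , refl , none
    position o (one x h k) = (x , o) ∷ [] , refl , one x o ≤-refl (+-monoʳ-≤ o h) k
    position o (ver a₁ a₂ e s t) with position o s | position (o + a₁) t
    ... | L₁ , refl , s′ | L₂ , refl , t′ = L₁ ++ L₂ , map-++ proj₁ L₁ L₂ , ver a₁ a₂ e s′ t′
    position o (hor b₁ b₂ e s t) with position o s | position o t
    ... | L₁ , refl , s′ | L₂ , refl , t′ = L₁ ++ L₂ , map-++ proj₁ L₁ L₂ , hor b₁ b₂ e s′ t′

    filterP : ∀ {o a b L} (p : A × ℕ → Bool) → PSlice f g o a b L → PSlice f g o a b (filterᵇ p L)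
    filterP p none = none
    filterP p (one x o h k l) with p (x , o)
    ... | true = one x o h k l
    ... | false = none
    filterP p (ver {L₁} {L₂} a₁ a₂ e s t) = subst (PSlice _ _ _ _ _) (sym (filter-++ p L₁ L₂)) (ver a₁ a₂ e (filterP p s) (filterP p t))
    filterP p (hor {L₁} {L₂} b₁ b₂ e s t) = subst (PSlice _ _ _ _ _) (sym (filter-++ p L₁ L₂)) (hor b₁ b₂ e (filterP p s) (filterP p t))

    located : ∀ {o a b L} → PSlice f g o a b L → All (λ { (x , p) → o ≤ p × p + f x ≤ o + a × g x ≤ b }) L
    located none = []
    located (one x p h k l) = (h , k , l) ∷ []
    located {o} (ver a₁ a₂ refl s t) =
      ++⁺ (All.map (λ { (h , k , l) → h , ≤-trans k (+-monoʳ-≤ o (m≤m+n a₁ a₂)) , l }) (located s))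
          (All.map (λ { (h , k , l) → ≤-trans (m≤m+n o a₁) h , ≤-trans k (≤-reflexive (+-assoc o a₁ a₂)) , l }) (located t))
    located (hor b₁ b₂ refl s t) =
      ++⁺ (All.map (λ { (h , k , l) → h , k , ≤-trans l (m≤m+n b₁ b₂) }) (located s))
          (All.map (λ { (h , k , l) → h , k , ≤-trans l (m≤n+m b₂ b₁) }) (located t))

    Inside : ℕ → ℕ → A × ℕ → Set
    Inside u v (x , p) = u ≤ p × p + f x ≤ v

    private
      -- With truncated subtraction an interval that misses the window has length 0, so the two
      -- halves of a cut interval never exceed the whole, wherever the window lies.
      gap : ∀ {s t₁ s₂ t} → t₁ ≤ s₂ → t₁ ≤ t → s ≤ s₂ → (t₁ ∸ s) + (t ∸ s₂) ≤ t ∸ s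
      gap {s} {t₁} {s₂} {t} p q r with s ≤? t₁ | s₂ ≤? t
      ... | no ¬h | _ rewrite m≤n⇒m∸n≡0 (<⇒≤ (≰⇒> ¬h)) = ∸-monoʳ-≤ t r
      ... | _ | no ¬h rewrite m≤n⇒m∸n≡0 (<⇒≤ (≰⇒> ¬h)) | +-identityʳ (t₁ ∸ s) = ∸-monoˡ-≤ s q
      ... | yes h | yes k = lia 7 (λ s t₁ s₂ t x y z → (s :+ x :≡ t₁) ⇒ (s₂ :+ y :≡ t) ⇒ (s :+ z :≡ t) ⇒ (t₁ :≤ s₂) ⇒ ⟨ x :+ y :≤ z ⟩) refl
          s t₁ s₂ t (t₁ ∸ s) (t ∸ s₂) (t ∸ s) (m+[n∸m]≡n h) (m+[n∸m]≡n k) (m+[n∸m]≡n (≤-trans h q)) p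

      clip : ∀ {o a b L} u v → PSlice f g o a b L → All (Inside u v) L →
             Slice (f ∘ proj₁) (g ∘ proj₁) (v ⊓ (o + a) ∸ (u ⊔ o)) b L
      clip u v none h = none
      clip {o} {a} u v (one x p h k l) ((i , j) ∷ []) = one (x , p)
        (m+n≤o⇒n≤o∸m (u ⊔ o) (⊓-glb (≤-trans (+-monoˡ-≤ (f x) (⊔-lub i h)) j) (≤-trans (+-monoˡ-≤ (f x) (⊔-lub i h)) k))) l
        where
        m+n≤o⇒n≤o∸m : ∀ m {n o} → m + n ≤ o → n ≤ o ∸ m
        m+n≤o⇒n≤o∸m m {n} le = ≤-trans (≤-reflexive (sym (m+n∸m≡n m n))) (∸-monoˡ-≤ m le)
      clip {o} {b = b} u v (ver {L₁} {L₂} a₁ a₂ refl s t) h =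
        padS (gap (≤-trans (m⊓n≤n v (o + a₁)) (m≤n⊔m u (o + a₁)))
                  (⊓-monoʳ-≤ v (≤-trans (m≤m+n (o + a₁) a₂) (≤-reflexive (+-assoc o a₁ a₂))))
                  (⊔-monoʳ-≤ u (m≤m+n o a₁))) ≤-refl
          (ver (v ⊓ (o + a₁) ∸ (u ⊔ o)) (v ⊓ (o + (a₁ + a₂)) ∸ (u ⊔ (o + a₁))) refl
            (clip u v s (++⁻ˡ L₁ h))
            (subst (λ z → Slice (f ∘ proj₁) (g ∘ proj₁) (v ⊓ z ∸ (u ⊔ (o + a₁))) b L₂) (+-assoc o a₁ a₂) (clip u v t (++⁻ʳ L₁ h))))
      clip u v (hor {L₁} {L₂} b₁ b₂ e s t) h = hor b₁ b₂ e (clip u v s (++⁻ˡ L₁ h)) (clip u v t (++⁻ʳ L₁ h))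

    -- Every rectangle of the tree can be cut down to the window, since no item inside the window is
    -- affected.
    restrict : ∀ {o a b L} u v → PSlice f g o a b L → All (Inside u v) L → Slice (f ∘ proj₁) (g ∘ proj₁) (v ∸ u) b L
    restrict {o} {a} u v s h = padS (∸-mono (m⊓n≤m v (o + a)) (m≤m⊔n u o)) ≤-refl (clip u v s h)

    -- With A k the number of items ending at or before k s, the items meeting the window
    -- [k s, (k + 1) s) number at most A (k + 2) - A k, which telescopes.
    window : ∀ {a b L} q s → 1 ≤ q → q * s ≤ a → All (λ x → f x ≤ s) L → Slice f g a b L →
             Σ (List A) λ kept → Σ (List A) λ lost →
               L ↭ kept ++ lost × q * length lost ≤ 2 * length L × Slice f g (a ∸ s) b kept
    window {a} {b} {L} q s 1≤q qs≤a thin t = result (pigeon q drop# (2 * length L) 1≤q total)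
      where
      P : List (A × ℕ)
      P = proj₁ (position 0 t)
      P≡ : map proj₁ P ≡ L
      P≡ = proj₁ (proj₂ (position 0 t))
      t′ : PSlice f g 0 a b P
      t′ = proj₂ (proj₂ (position 0 t))
      left right : ℕ → A × ℕ → Bool
      left k (x , p) = p + f x ≤ᵇ k * s
      right k (x , p) = suc k * s ≤ᵇ p
      Lf Rt Dr : ℕ → List (A × ℕ)
      Lf k = filterᵇ (left k) P
      Rt k = filterᵇ (right k) (filterᵇ (not ∘ left k) P)
      Dr k = filterᵇ (not ∘ right k) (filterᵇ (not ∘ left k) P)
      drop# A# : ℕ → ℕ
      drop# k = length (Dr k)
      A# k = length (Lf k)
      thinP : All (λ z → f (proj₁ z) ≤ s) P
      thinP = go P (subst (All _) (sym P≡) thin)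
        where go : ∀ M → All (λ x → f x ≤ s) (map proj₁ M) → All (λ z → f (proj₁ z) ≤ s) M
              go [] [] = []
              go (z ∷ M) (h ∷ hs) = h ∷ go M hs
      bound : ∀ p w s k → w ≤ s → p < s + k → p + w ≤ s + (s + k)
      bound = lia 4 (λ p w s k → (w :≤ s) ⇒ (p :< s :+ k) ⇒ ⟨ p :+ w :≤ s :+ (s :+ k) ⟩) refl
      split : ∀ k M → All (λ z → f (proj₁ z) ≤ s) M →
              length (filterᵇ (not ∘ right k) (filterᵇ (not ∘ left k) M)) + length (filterᵇ (left k) M) ≤ length (filterᵇ (left (2 + k)) M)
      split k [] [] = z≤n
      split k ((x , p) ∷ M) (h ∷ hs) with split k M hs
      ... | ih with p + f x ≤ᵇ k * s in eq
      ... | true rewrite ≤ᵇ-true (≤-trans (true-≤ {p + f x} eq) (*-monoˡ-≤ s (m≤n+m k 2))) =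
        ≤-trans (≤-reflexive (+-suc _ _)) (s≤s ih)
      ... | false with suc k * s ≤ᵇ p in eq′
      ... | true with p + f x ≤ᵇ (2 + k) * s
      ... | true = m≤n⇒m≤1+n ih
      ... | false = ih
      split k ((x , p) ∷ M) (h ∷ hs) | ih | false | false rewrite ≤ᵇ-true (bound p (f x) s (k * s) h (false-> {suc k * s} eq′)) = s≤s ih
      tele : ∀ q → upΣ q drop# + (A# 0 + A# 1) ≤ A# q + A# (suc q)
      tele zero = ≤-refl
      tele (suc q) = lia 6 (λ u d x a₀ a₁ a₂ → (u :+ x :≤ a₀ :+ a₁) ⇒ (d :+ a₀ :≤ a₂) ⇒ ⟨ u :+ d :+ x :≤ a₁ :+ a₂ ⟩) refl
        (upΣ q drop#) (drop# q) (A# 0 + A# 1) (A# q) (A# (suc q)) (A# (2 + q)) (tele q) (split q P thinP)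
      lenP : length P ≡ length L
      lenP = trans (sym (length-map proj₁ P)) (cong length P≡)
      A≤ : ∀ k → A# k ≤ length L
      A≤ k = ≤-trans (m≤m+n _ _) (≤-reflexive (trans (sym (length-++ (Lf k))) (trans (sym (length-↭ (partition↭ (left k) P))) lenP)))
      total : upΣ q drop# ≤ 2 * length L
      total = lia 5 (λ u z x y l → (u :+ z :≤ x :+ y) ⇒ (x :≤ l) ⇒ (y :≤ l) ⇒ ⟨ u :≤ con 2 :* l ⟩) refl
        (upΣ q drop#) (A# 0 + A# 1) (A# q) (A# (suc q)) (length L) (tele q) (A≤ q) (A≤ (suc q))
      result : (Σ ℕ λ k → k < q × q * drop# k ≤ 2 * length L) → _
      result (k , k<q , le) = map proj₁ (Lf k) ++ map proj₁ (Rt k) , map proj₁ (Dr k) , perm ,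
          ≤-trans (≤-reflexive (cong (q *_) (length-map proj₁ (Dr k)))) le ,
          ver (k * s) (a ∸ suc k * s) widths leftS rightS
        where
        ks≤a : suc k * s ≤ a
        ks≤a = ≤-trans (*-monoˡ-≤ s k<q) qs≤a
        widths : k * s + (a ∸ suc k * s) ≡ a ∸ s
        widths = lia 5 (λ ks s a x y → (s :+ ks :+ x :≡ a) ⇒ (s :+ y :≡ a) ⇒ ⟨ ks :+ x :≡ y ⟩) refl (k * s) s a (a ∸ suc k * s) (a ∸ s)
          (m+[n∸m]≡n ks≤a) (m+[n∸m]≡n (≤-trans (m≤m+n s (k * s)) ks≤a))
        leftS : Slice f g (k * s) b (map proj₁ (Lf k))
        leftS = mapS proj₁ (restrict 0 (k * s) (filterP (left k) t′)
          (All.map (λ {z} e → z≤n , ≤ᵇ⇒≤ (proj₂ z + f (proj₁ z)) (k * s) (subst T (sym e) tt)) (filter-true (left k) P)))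
        rightS : Slice f g (a ∸ suc k * s) b (map proj₁ (Rt k))
        rightS = mapS proj₁ (restrict (suc k * s) a (filterP (right k) (filterP (not ∘ left k) t′))
          (All.zipWith (λ {z} → λ { (e , (_ , h , _)) → ≤ᵇ⇒≤ (suc k * s) (proj₂ z) (subst T (sym e) tt) , h })
            (filter-true (right k) (filterᵇ (not ∘ left k) P) , filter-All (right k) (filter-All (not ∘ left k) (located t′)))))
        perm : L ↭ (map proj₁ (Lf k) ++ map proj₁ (Rt k)) ++ map proj₁ (Dr k)
        perm = ↭-trans (↭-reflexive (sym P≡)) (↭-trans (↭P.map⁺ proj₁ (partition↭ (left k) P))
          (↭-trans (↭P.map⁺ proj₁ (↭P.++⁺ˡ (Lf k) (partition↭ (right k) _)))
            (↭-reflexive (trans (map-++ proj₁ (Lf k) (Rt k ++ Dr k)) (trans (cong (map proj₁ (Lf k) ++_) (map-++ proj₁ (Rt k) (Dr k)))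
              (sym (++-assoc (map proj₁ (Lf k)) _ _)))))))

  -- Packings into cells

  -- The cells tile the rectangle exactly, so that the area left to the small items can be read off
  -- from `lay-area`. A rectangle with a side 0 may have no cell at all.
  data Lay (a b : ℕ) : List (ℕ × ℕ) → Set where
    void : b ≡ 0 → Lay a b []
    cell : Lay a b ((a , b) ∷ [])
    ver  : ∀ {R₁ R₂} a₁ a₂ → a₁ + a₂ ≡ a → Lay a₁ b R₁ → Lay a₂ b R₂ → Lay a b (R₁ ++ R₂)
    hor  : ∀ {R₁ R₂} b₁ b₂ → b₁ + b₂ ≡ b → Lay a b₁ R₁ → Lay a b₂ R₂ → Lay a b (R₁ ++ R₂)
    wvoid : a ≡ 0 → Lay a b []

  swapD : ℕ × ℕ → ℕ × ℕ
  swapD (a , b) = b , a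

  swapLay : ∀ {a b R} → Lay a b R → Lay b a (map swapD R)
  swapLay (void e) = wvoid e
  swapLay (wvoid e) = void e
  swapLay cell = cell
  swapLay (ver {R₁} {R₂} a₁ a₂ e s t) = subst (Lay _ _) (sym (map-++ swapD R₁ R₂)) (hor a₁ a₂ e (swapLay s) (swapLay t))
  swapLay (hor {R₁} {R₂} a₁ a₂ e s t) = subst (Lay _ _) (sym (map-++ swapD R₁ R₂)) (ver a₁ a₂ e (swapLay s) (swapLay t))

  area₂ : ℕ × ℕ → ℕ
  area₂ (a , b) = a * b

  lay-area : ∀ {a b R} → Lay a b R → Σ′ area₂ R ≡ a * b
  lay-area {a} (void refl) = sym (*-zeroʳ a)
  lay-area (wvoid refl) = refl
  lay-area cell = +-identityʳ _
  lay-area {b = b} (ver {R₁} {R₂} a₁ a₂ refl s t) = trans (Σ-++ area₂ R₁ R₂) (trans (cong₂ _+_ (lay-area s) (lay-area t)) (sym (*-distribʳ-+ b a₁ a₂)))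
  lay-area {a} (hor {R₁} {R₂} b₁ b₂ refl s t) = trans (Σ-++ area₂ R₁ R₂) (trans (cong₂ _+_ (lay-area s) (lay-area t)) (sym (*-distribˡ-+ a b₁ b₂)))

  -- The Boolean tells whether the items of the container are rotated.
  data Kind : Set where
    free : Kind
    vert hori : Bool → Kind

  record Cell (A : Set) : Set where
    constructor mkCell
    field
      kind : Kind
      cw ch : ℕ
      its : List A
  open Cell public

  module _ {A : Set} where

    dim : Cell A → ℕ × ℕ
    dim c = cw c , ch c

    used : Cell A → ℕ
    used (mkCell free w h _) = 0
    used (mkCell _ w h _) = w * h

    OK : (f g : A → ℕ) → Cell A → Set
    OK f g (mkCell free w h xs) = xs ≡ []
    OK f g (mkCell (vert false) w h xs) = Σ′ f xs ≤ w × All (λ x → g x ≤ h) xs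
    OK f g (mkCell (vert true) w h xs) = Σ′ g xs ≤ w × All (λ x → f x ≤ h) xs
    OK f g (mkCell (hori false) w h xs) = Σ′ g xs ≤ h × All (λ x → f x ≤ w) xs
    OK f g (mkCell (hori true) w h xs) = Σ′ f xs ≤ h × All (λ x → g x ≤ w) xs

    swapK : Kind → Kind
    swapK free = free
    swapK (vert r) = hori r
    swapK (hori r) = vert r

    swapC : Cell A → Cell A
    swapC (mkCell k w h xs) = mkCell (swapK k) h w xs

    swapC-OK : ∀ {f g} c → OK f g c → OK g f (swapC c)
    swapC-OK (mkCell free w h xs) o = o
    swapC-OK (mkCell (vert false) w h xs) o = o
    swapC-OK (mkCell (vert true) w h xs) o = o
    swapC-OK (mkCell (hori false) w h xs) o = o
    swapC-OK (mkCell (hori true) w h xs) o = o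

    swapC-used : ∀ c → used (swapC c) ≡ used c
    swapC-used (mkCell free w h xs) = refl
    swapC-used (mkCell (vert r) w h xs) = *-comm h w
    swapC-used (mkCell (hori r) w h xs) = *-comm h w

    items : List (Cell A) → List A
    items = concatMap its

    items-++ : ∀ cs ds → items (cs ++ ds) ≡ items cs ++ items ds
    items-++ cs ds = trans (cong concat (map-++ its cs ds)) (sym (concat-++ (map its cs) (map its ds)))

    items-swap : ∀ cs → items (map swapC cs) ≡ items cs
    items-swap [] = refl
    items-swap (c ∷ cs) = cong (its c ++_) (items-swap cs)

  -- `U` bounds the area closed to the small items; `k` counts cells and lost items together, since
  -- both only have to be bounded. Cells match the layout up to order, because slots are filled in
  -- order of length and not of position.
  record Pack {A : Set} (f g : A → ℕ) (a b : ℕ) (L : List A) (U k : ℕ) : Set where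
    constructor mkPack
    field
      {dims} : List (ℕ × ℕ)
      lay : Lay a b dims
      cells : List (Cell A)
      dims↭ : dims ↭ map dim cells
      ok : All (OK f g) cells
      lost : List A
      perm : L ↭ items cells ++ lost
      used≤ : Σ′ used cells ≤ U
      size≤ : length cells + length lost ≤ k
  open Pack public

  module _ {A : Set} {f g : A → ℕ} where

    packVer : ∀ {a₁ a₂ b L₁ L₂ U₁ U₂ k₁ k₂} → Pack f g a₁ b L₁ U₁ k₁ → Pack f g a₂ b L₂ U₂ k₂ →
              Pack f g (a₁ + a₂) b (L₁ ++ L₂) (U₁ + U₂) (k₁ + k₂)
    packVer {a₁} {a₂} p q = mkPack (ver a₁ a₂ refl (lay p) (lay q)) (cells p ++ cells q)
      (↭-trans (↭P.++⁺ (dims↭ p) (dims↭ q)) (↭-reflexive (sym (map-++ dim (cells p) (cells q)))))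
      (++⁺ (ok p) (ok q)) (lost p ++ lost q)
      (↭-trans (↭P.++⁺ (perm p) (perm q)) (↭-trans (bag 4 (λ a b c d → (a :++ b) :++ (c :++ d) :↭ (a :++ c) :++ (b :++ d)) refl
        (items (cells p)) (lost p) (items (cells q)) (lost q)) (↭-reflexive (cong (_++ (lost p ++ lost q)) (sym (items-++ (cells p) (cells q)))))))
      (≤-trans (≤-reflexive (Σ-++ used (cells p) (cells q))) (+-mono-≤ (used≤ p) (used≤ q)))
      (≤-trans (≤-reflexive (trans (cong₂ _+_ (length-++ (cells p)) (length-++ (lost p)))
        (lia 4 (λ a b c d → ⟨ a :+ b :+ (c :+ d) :≡ a :+ c :+ (b :+ d) ⟩) refl (length (cells p)) (length (cells q)) (length (lost p)) (length (lost q)))))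
        (+-mono-≤ (size≤ p) (size≤ q)))

    packSwap : ∀ {a b L U k} → Pack f g a b L U k → Pack g f b a L U k
    packSwap p = mkPack (swapLay (lay p)) (map swapC (cells p))
      (↭-trans (↭P.map⁺ swapD (dims↭ p)) (↭-reflexive (eq (cells p))))
      (oks (ok p)) (lost p) (↭-trans (perm p) (↭-reflexive (cong (_++ lost p) (sym (items-swap (cells p))))))
      (≤-trans (≤-reflexive (trans (Σ-map swapC used (cells p)) (Σ-cong {xs = cells p} (All.universal swapC-used (cells p))))) (used≤ p))
      (≤-trans (≤-reflexive (cong (_+ length (lost p)) (length-map swapC (cells p)))) (size≤ p))
      where
      eq : ∀ cs → map swapD (map dim cs) ≡ map dim (map swapC cs)
      eq [] = refl
      eq (c ∷ cs) = cong (_ ∷_) (eq cs)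
      oks : ∀ {cs} → All (OK f g) cs → All (OK g f) (map swapC cs)
      oks [] = []
      oks (_∷_ {x = c} h hs) = swapC-OK {f = f} {g} c h ∷ oks hs

    packWeaken : ∀ {a b L U U′ k k′} → U ≤ U′ → k ≤ k′ → Pack f g a b L U k → Pack f g a b L U′ k′
    packWeaken p q (mkPack l cs d o ls pm u s) = mkPack l cs d o ls pm (≤-trans u p) (≤-trans s q)

    packPerm : ∀ {a b L L′ U k} → L′ ↭ L → Pack f g a b L U k → Pack f g a b L′ U k
    packPerm p (mkPack l cs d o ls pm u s) = mkPack l cs d o ls (↭-trans p pm) u s

    packLose : ∀ {a b L U k} D → Pack f g a b L U k → Pack f g a b (L ++ D) U (k + length D)
    packLose {k = k} D (mkPack l cs d o ls pm u s) = mkPack l cs d o (ls ++ D)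
      (↭-trans (↭P.++⁺ʳ D pm) (↭-reflexive (++-assoc (items cs) ls D))) u
      (≤-trans (≤-reflexive (trans (cong (length cs +_) (length-++ ls)) (sym (+-assoc (length cs) _ _)))) (+-monoˡ-≤ (length D) s))

    packFree : ∀ a b → Pack f g a b [] 0 1
    packFree a b = mkPack cell (mkCell free a b [] ∷ []) ↭-refl (refl ∷ []) [] ↭-refl z≤n ≤-refl

    packVoid : ∀ a → Pack f g a 0 [] 0 0
    packVoid a = mkPack (void refl) [] ↭-refl [] [] ↭-refl z≤n z≤n

    packCell : ∀ k a b xs → OK f g (mkCell k a b xs) → Pack f g a b xs (used (mkCell k a b xs)) 1
    packCell k a b xs o = mkPack cell (mkCell k a b xs ∷ []) ↭-refl (o ∷ []) []
      (↭-reflexive (sym (trans (++-identityʳ _) (++-identityʳ xs)))) (≤-reflexive (+-identityʳ _)) ≤-refl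

    packPadW : ∀ {a a′ b L U k} → a ≤ a′ → Pack f g a b L U k → Pack f g a′ b L U (k + 1)
    packPadW {a} {a′} {b} {L} {U} {k} h p = packPerm (↭-reflexive (sym (++-identityʳ L)))
      (packWeaken (≤-reflexive (+-identityʳ U)) ≤-refl
        (subst (λ z → Pack f g z b (L ++ []) (U + 0) (k + 1)) (m+[n∸m]≡n h) (packVer p (packFree (a′ ∸ a) b))))

  packHor : ∀ {A : Set} {f g : A → ℕ} {a b₁ b₂ L₁ L₂ U₁ U₂ k₁ k₂} → Pack f g a b₁ L₁ U₁ k₁ → Pack f g a b₂ L₂ U₂ k₂ →
            Pack f g a (b₁ + b₂) (L₁ ++ L₂) (U₁ + U₂) (k₁ + k₂)
  packHor p q = packSwap (packVer (packSwap p) (packSwap q))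

  packPadH : ∀ {A : Set} {f g : A → ℕ} {a b b′ L U k} → b ≤ b′ → Pack f g a b L U k → Pack f g a b′ L U (k + 1)
  packPadH h p = packSwap (packPadW h (packSwap p))

  module _ {A : Set} (key : A → ℕ) where

    insertBy : A → List A → List A
    insertBy x [] = x ∷ []
    insertBy x (y ∷ ys) with key y ≤? key x
    ... | yes _ = x ∷ y ∷ ys
    ... | no _ = y ∷ insertBy x ys

    sortBy : List A → List A
    sortBy [] = []
    sortBy (x ∷ xs) = insertBy x (sortBy xs)

    Decreasing : List A → Set
    Decreasing = AllPairs (λ x y → key y ≤ key x)

    insertBy↭ : ∀ x ys → insertBy x ys ↭ x ∷ ys
    insertBy↭ x [] = ↭-refl
    insertBy↭ x (y ∷ ys) with key y ≤? key x
    ... | yes _ = ↭-refl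
    ... | no _ = ↭-trans (prep y (insertBy↭ x ys)) (swap y x ↭-refl)

    sortBy↭ : ∀ xs → sortBy xs ↭ xs
    sortBy↭ [] = ↭-refl
    sortBy↭ (x ∷ xs) = ↭-trans (insertBy↭ x (sortBy xs)) (prep x (sortBy↭ xs))

    insertBy-decr : ∀ x ys → Decreasing ys → Decreasing (insertBy x ys)
    insertBy-decr x [] [] = [] ∷ []
    insertBy-decr x (y ∷ ys) (h ∷ hs) with key y ≤? key x
    ... | yes le = (le ∷ All.map (λ z → ≤-trans z le) h) ∷ h ∷ hs
    ... | no ¬le = All-↭ (↭-sym (insertBy↭ x ys)) (<⇒≤ (≰⇒> ¬le) ∷ h) ∷ insertBy-decr x ys hs

    sortBy-decr : ∀ xs → Decreasing (sortBy xs)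
    sortBy-decr [] = []
    sortBy-decr (x ∷ xs) = insertBy-decr x (sortBy xs) (sortBy-decr xs)

    decr-split : ∀ ys x zs → Decreasing (ys ++ x ∷ zs) → All (λ y → key x ≤ key y) ys × All (λ z → key z ≤ key x) zs
    decr-split [] x zs (h ∷ _) = [] , h
    decr-split (y ∷ ys) x zs (h ∷ hs) with decr-split ys x zs hs
    ... | p , q = All.head (++⁻ʳ ys h) ∷ p , q

  -- The demand of the items, or the supply of the slots, at length at least `ℓ`: the two sides of
  -- Hall's condition.
  above : {A : Set} (wt key : A → ℕ) → ℕ → List A → ℕ
  above wt key ℓ = Σ′ (λ x → 𝟙 (ℓ ≤ᵇ key x) * wt x)

  above-all : ∀ {A : Set} (wt key : A → ℕ) ℓ {xs} → All (λ x → ℓ ≤ key x) xs → above wt key ℓ xs ≡ Σ′ wt xs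
  above-all wt key ℓ h = Σ-cong (All.map (λ {x} le → trans (cong (λ c → 𝟙 c * wt x) (≤ᵇ-true le)) (+-identityʳ (wt x))) h)

  above-none : ∀ {A : Set} (wt key : A → ℕ) ℓ {xs} → All (λ x → key x < ℓ) xs → above wt key ℓ xs ≡ 0
  above-none wt key ℓ {xs} h = trans (Σ-cong {ψ = λ _ → 0} (All.map (λ {x} lt → cong (λ c → 𝟙 c * wt x) (≤ᵇ-false lt)) h)) (Σ-const 0 xs)

  above-≤ : ∀ {A : Set} (wt key : A → ℕ) ℓ xs → above wt key ℓ xs ≤ Σ′ wt xs
  above-≤ wt key ℓ xs = Σ-mono (All.universal (λ x → le (ℓ ≤ᵇ key x) (wt x)) xs)
    where le : ∀ c w → 𝟙 c * w ≤ w
          le true w = ≤-reflexive (+-identityʳ w)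
          le false w = z≤n

  -- Filling slots (capacity , length) with items of thickness f and length g; the item
  -- that overflows a slot is lost.

  module Fill {A : Set} (f g h : A → ℕ) (κ : ℕ) where

    Slot = ℕ × ℕ

    cap len : Slot → ℕ
    cap = proj₁
    len = proj₂

    slotDim : Slot → ℕ × ℕ
    slotDim (m , l) = m , κ * l

    -- The item that overflows a slot is lost, so when the slot `s` is reached the items passed are
    -- at least as thick as all earlier slots `P` together. Only the fits that can arise in this way
    -- are demanded.
    Dom : List Slot → List A → Set
    Dom ss xs = ∀ P s Q ys x zs → ss ≡ P ++ s ∷ Q → xs ≡ ys ++ x ∷ zs → Σ′ cap P ≤ Σ′ f ys → g x ≤ len s

    record Filled (ss : List Slot) (xs : List A) : Set where
      field
        fcells : List (Cell A)
        fdims : map dim fcells ≡ map slotDim ss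
        fok : All (OK f h) fcells
        flost : List A
        fperm : xs ↭ items fcells ++ flost
        fcount : length flost ≤ length ss
        fused : Σ′ used fcells ≡ Σ′ (λ s → cap s * (κ * len s)) ss

    takeFit : ∀ m (xs : List A) → Σ (List A) λ ys → Σ (List A) λ zs → xs ≡ ys ++ zs × Σ′ f ys ≤ m ×
              (zs ≡ [] ⊎ Σ A λ o → Σ (List A) λ ws → zs ≡ o ∷ ws × m < Σ′ f ys + f o)
    takeFit m [] = [] , [] , refl , z≤n , inj₁ refl
    takeFit m (x ∷ xs) with f x ≤? m
    ... | no ¬le = [] , x ∷ xs , refl , z≤n , inj₂ (x , xs , refl , ≰⇒> ¬le)
    ... | yes le with takeFit (m ∸ f x) xs
    ... | ys , zs , refl , h , r = x ∷ ys , zs , refl , ≤-trans (+-monoʳ-≤ (f x) h) (≤-reflexive (m+[n∸m]≡n le)) , over r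
      where
      over : (zs ≡ [] ⊎ Σ A λ o → Σ (List A) λ ws → zs ≡ o ∷ ws × m ∸ f x < Σ′ f ys + f o) →
             (zs ≡ [] ⊎ Σ A λ o → Σ (List A) λ ws → zs ≡ o ∷ ws × m < f x + Σ′ f ys + f o)
      over (inj₁ e) = inj₁ e
      over (inj₂ (o , ws , e , lt)) = inj₂ (o , ws , e , lia 5 (λ m d x y o → (x :+ d :≡ m) ⇒ (d :< y :+ o) ⇒ ⟨ m :< x :+ y :+ o ⟩) refl
        m (m ∸ f x) (f x) (Σ′ f ys) (f o) (m+[n∸m]≡n le) lt)

    fill : ∀ ss xs → Dom ss xs → Σ′ f xs ≤ Σ′ cap ss → All (λ x → 1 ≤ f x) xs → All (λ x → h x ≤ κ * g x) xs → Filled ss xs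
    fill [] [] dom le pos len≤ = record { fcells = [] ; fdims = refl ; fok = [] ; flost = [] ; fperm = ↭-refl ; fcount = z≤n ; fused = refl }
    fill [] (x ∷ xs) dom le (p ∷ _) len≤ = contradiction (≤-trans p (≤-trans (m≤m+n (f x) _) le)) λ ()
    fill ((m , l) ∷ ss) xs dom le pos len≤ with takeFit m xs
    ... | ys , zs , refl , fit , over = finish over
      where
      fitsLen : ∀ ps qs → ys ≡ ps ++ qs → All (λ x → g x ≤ l) qs
      fitsLen ps [] e = []
      fitsLen ps (q ∷ qs) e = dom [] (m , l) ss ps q (qs ++ zs) refl (trans (cong (_++ zs) e) (++-assoc ps (q ∷ qs) zs)) z≤n
        ∷ fitsLen (ps ++ q ∷ []) qs (trans e (sym (++-assoc ps (q ∷ []) qs)))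
      okC : OK f h (mkCell (vert false) m (κ * l) ys)
      okC = fit , All.zipWith (λ { (p , q) → ≤-trans q (*-monoʳ-≤ κ p) }) (fitsLen [] ys refl , ++⁻ˡ ys len≤)
      assemble : ∀ ws vs → zs ≡ vs ++ ws → length vs ≤ 1 → Filled ss ws → Filled ((m , l) ∷ ss) (ys ++ zs)
      assemble ws vs refl le₁ r = record
        { fcells = mkCell (vert false) m (κ * l) ys ∷ fcells
        ; fdims = cong ((m , κ * l) ∷_) fdims
        ; fok = okC ∷ fok
        ; flost = vs ++ flost
        ; fperm = ↭-trans (↭P.++⁺ˡ ys (↭P.++⁺ˡ vs fperm)) (bag 4 (λ a b c d → a :++ (b :++ (c :++ d)) :↭ (a :++ c) :++ (b :++ d)) refl ys vs (items fcells) flost)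
        ; fcount = ≤-trans (≤-reflexive (length-++ vs)) (+-mono-≤ le₁ fcount)
        ; fused = cong (m * (κ * l) +_) fused }
        where open Filled r
      finish : (zs ≡ [] ⊎ Σ A λ o → Σ (List A) λ ws → zs ≡ o ∷ ws × m < Σ′ f ys + f o) → Filled ((m , l) ∷ ss) (ys ++ zs)
      finish (inj₁ refl) = assemble [] [] refl z≤n (fill ss [] (λ P s Q → λ { [] x zs e () ; (_ ∷ _) x zs e () }) z≤n [] [])
      finish (inj₂ (o , ws , refl , lt)) = assemble ws (o ∷ []) refl ≤-refl
        (fill ss ws dom′ le′ (All.tail (++⁻ʳ ys pos)) (All.tail (++⁻ʳ ys len≤)))
        where
        -- The items placed and the lost one are thicker than the slot, so the remaining slots still
        -- suffice.
        le′ : Σ′ f ws ≤ Σ′ cap ss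
        le′ = lia 5 (λ y o w m c → (y :+ (o :+ w) :≤ m :+ c) ⇒ (m :< y :+ o) ⇒ ⟨ w :≤ c ⟩) refl (Σ′ f ys) (f o) (Σ′ f ws) m (Σ′ cap ss)
          (≤-trans (≤-reflexive (sym (Σ-++ f ys (o ∷ ws)))) le) lt
        dom′ : Dom ss ws
        dom′ P s Q vs x us refl refl c = dom ((m , l) ∷ P) s Q (ys ++ o ∷ vs) x us refl (sym (++-assoc ys (o ∷ vs) (x ∷ us)))
          (≤-trans (lia 5 (λ m p y o v → (m :< y :+ o) ⇒ (p :≤ v) ⇒ ⟨ m :+ p :≤ y :+ (o :+ v) ⟩) refl m (Σ′ cap P) (Σ′ f ys) (f o) (Σ′ f vs) lt c)
                   (≤-reflexive (sym (Σ-++ f ys (o ∷ vs)))))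

    -- Hall's condition suffices because a slot accepts all items shorter than itself.
    hall⇒Dom : ∀ ss xs → Decreasing len ss → Decreasing g xs → All (λ x → 1 ≤ f x) xs →
               (∀ ℓ → above f g ℓ xs ≤ above cap len ℓ ss) → Dom ss xs
    hall⇒Dom ss xs ds dx pos hall P s Q ys x zs refl refl c with g x ≤? len s
    ... | yes le = le
    ... | no ¬le = contradiction tooMuch (<⇒≱ (All.head (++⁻ʳ ys pos)))
      where
      ℓ = g x
      lower : Σ′ f ys + f x ≤ above f g ℓ (ys ++ x ∷ zs)
      lower = ≤-trans (+-mono-≤ (≤-reflexive (sym (above-all f g ℓ (proj₁ (decr-split g ys x zs dx)))))
          (≤-trans (≤-reflexive (sym (trans (cong (λ b → 𝟙 b * f x) (≤ᵇ-true (≤-refl {g x}))) (+-identityʳ (f x))))) (m≤m+n _ (above f g ℓ zs))))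
        (≤-reflexive (sym (Σ-++ _ ys (x ∷ zs))))
      upper : above cap len ℓ (P ++ s ∷ Q) ≤ Σ′ cap P
      upper = ≤-trans (≤-reflexive (Σ-++ _ P (s ∷ Q))) (≤-trans (+-monoʳ-≤ _ (≤-reflexive
          (above-none cap len ℓ {s ∷ Q} (≰⇒> ¬le ∷ All.map (λ z → ≤-<-trans z (≰⇒> ¬le)) (proj₂ (decr-split len P s Q ds))))))
        (≤-trans (≤-reflexive (+-identityʳ _)) (above-≤ cap len ℓ P)))
      tooMuch : f x ≤ 0
      tooMuch = lia 4 (λ y x a p → (y :+ x :≤ a) ⇒ (a :≤ p) ⇒ (p :≤ y) ⇒ ⟨ x :≤ con 0 ⟩) refl (Σ′ f ys) (f x) (above f g ℓ (ys ++ x ∷ zs)) (Σ′ cap P)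
        lower (≤-trans (hall ℓ) upper) c

  -- The candidates for a configuration, which is the list of rounded lengths met by one vertical
  -- line.
  allLists : ℕ → List ℕ → List (List ℕ)
  allLists zero Λ = [] ∷ []
  allLists (suc q) Λ = [] ∷ concatMap (λ c → map (c ∷_) (allLists q Λ)) Λ

  #lists : ℕ → ℕ → ℕ
  #lists zero M = 1
  #lists (suc q) M = 1 + M * #lists q M

  allLists-length : ∀ q Λ M → length Λ ≤ M → length (allLists q Λ) ≤ #lists q M
  allLists-length zero Λ M h = ≤-refl
  allLists-length (suc q) Λ M h = s≤s (≤-trans (≤-reflexive (len Λ)) (*-mono-≤ h (allLists-length q Λ M h)))
    where
    len : ∀ Λ′ → length (concatMap (λ c → map (c ∷_) (allLists q Λ)) Λ′) ≡ length Λ′ * length (allLists q Λ)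
    len [] = refl
    len (c ∷ Λ′) = trans (length-++ (map (c ∷_) (allLists q Λ))) (cong₂ _+_ (length-map (c ∷_) (allLists q Λ)) (len Λ′))

  allLists-complete : ∀ q Λ c → All (_∈ Λ) c → length c ≤ q → c ∈ allLists q Λ
  allLists-complete zero Λ [] h le = here refl
  allLists-complete (suc q) Λ [] h le = here refl
  allLists-complete (suc q) Λ (x ∷ c) (h ∷ hs) (s≤s le) = there (find h)
    where
    find : ∀ {Λ′} → x ∈ Λ′ → (x ∷ c) ∈ concatMap (λ c → map (c ∷_) (allLists q Λ)) Λ′
    find (here refl) = ∈-++⁺ˡ (∈-map⁺ (x ∷_) (allLists-complete q Λ c hs le))
    find (there {x = y} m) = ∈-++⁺ʳ (map (y ∷_) (allLists q Λ)) (find m)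

  record Blocks (κ B : ℕ) (cfgs : List (List ℕ)) (#E q : ℕ) : Set where
    field
      {bdims} : List (ℕ × ℕ)
      blay : Lay (length cfgs) B bdims
      slots : List (ℕ × ℕ)
      frees : List (ℕ × ℕ)
      bperm : bdims ↭ map (λ s → proj₁ s , κ * proj₂ s) slots ++ frees
      slots# : length slots ≤ #E * q
      frees# : length frees ≤ #E
      weight : ∀ φ → Σ′ (λ s → proj₁ s * φ (proj₂ s)) slots ≡ Σ′ (Σ′ φ) cfgs

  stack : ∀ κ m B (e : List ℕ) → κ * Σ′ (λ l → l) e ≤ B →
          Σ (List (ℕ × ℕ)) λ R → Lay m B R × R ↭ map (λ l → m , κ * l) e ++ (m , B ∸ κ * Σ′ (λ l → l) e) ∷ []
  stack κ m B [] h = _ , cell , ↭-reflexive (cong (λ z → (m , B ∸ z) ∷ []) (sym (*-zeroʳ κ)))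
  stack κ m B (l ∷ e) h with stack κ m (B ∸ κ * l) e (le h)
    where
    le : κ * (l + Σ′ (λ l → l) e) ≤ B → κ * Σ′ (λ l → l) e ≤ B ∸ κ * l
    le h = ≤-trans (≤-reflexive (trans (sym (m+n∸m≡n (κ * l) _)) (cong (_∸ κ * l) (sym (*-distribˡ-+ κ l _))))) (∸-monoˡ-≤ (κ * l) h)
  ... | R , lay , p = _ , hor (κ * l) (B ∸ κ * l) (m+[n∸m]≡n (≤-trans (*-monoʳ-≤ κ (m≤m+n l _)) h)) cell lay ,
      prep _ (↭-trans p (↭-reflexive (cong (λ z → map (λ l → m , κ * l) e ++ (m , z) ∷ []) (trans (∸-+-assoc B (κ * l) _) (cong (B ∸_) (sym (*-distribˡ-+ κ l _)))))))

  -- Unit columns with equal configurations are brought together into one block, in which every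
  -- entry of the configuration becomes a slot. The number of slots then depends on the number of
  -- configurations, not on the width.
  blocks : ∀ κ B q (E cfgs : List (List ℕ)) → All (_∈ E) cfgs → All (λ c → κ * Σ′ (λ l → l) c ≤ B) cfgs → All (λ c → length c ≤ q) cfgs →
           Blocks κ B cfgs (length E) q
  blocks κ B q [] [] _ _ _ = record { blay = wvoid refl ; slots = [] ; frees = [] ; bperm = ↭-refl ; slots# = z≤n ; frees# = z≤n ; weight = λ φ → refl }
  blocks κ B q [] (c ∷ cs) (() ∷ _) _ _
  blocks κ B q (e ∷ E) cfgs mem sum≤ len≤ = build eqs refl
    where
    is-e : List ℕ → Bool
    is-e c = ⌊ ≡-dec _≟_ c e ⌋
    eqs rest : List (List ℕ)
    eqs = filterᵇ is-e cfgs
    rest = filterᵇ (not ∘ is-e) cfgs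
    part : cfgs ↭ eqs ++ rest
    part = partition↭ is-e cfgs
    restMem : ∀ {cs} → All (_∈ e ∷ E) cs → All (_∈ E) (filterᵇ (not ∘ is-e) cs)
    restMem [] = []
    restMem (_∷_ {x = c} h hs) with ≡-dec _≟_ c e
    ... | yes _ = restMem hs
    restMem (here c≡e ∷ hs) | no c≢e = contradiction c≡e c≢e
    restMem (there m ∷ hs) | no c≢e = m ∷ restMem hs
    eqs≡ : ∀ cs → All (_≡ e) (filterᵇ is-e cs)
    eqs≡ [] = []
    eqs≡ (c ∷ cs) with ≡-dec _≟_ c e
    ... | yes p = p ∷ eqs≡ cs
    ... | no _ = eqs≡ cs
    ih : Blocks κ B rest (length E) q
    ih = blocks κ B q E rest (restMem mem) (filter-All _ sum≤) (filter-All _ len≤)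
    open Blocks ih
    count : length eqs + length rest ≡ length cfgs
    count = trans (sym (length-++ eqs)) (sym (length-↭ part))
    build : ∀ es → es ≡ eqs → Blocks κ B cfgs (suc (length E)) q
    build [] eq = record
      { blay = subst (λ z → Lay z B bdims) (trans (cong (λ z → length z + length rest) eq) count) blay
      ; slots = slots ; frees = frees ; bperm = bperm
      ; slots# = ≤-trans slots# (m≤n+m _ q) ; frees# = m≤n⇒m≤1+n frees#
      ; weight = λ φ → trans (weight φ) (trans (cong (λ z → Σ′ (Σ′ φ) (z ++ rest)) eq) (sym (Σ-↭ (Σ′ φ) part))) }
    build (c ∷ es) eq = record
      { blay = ver m (length rest) count (proj₁ (proj₂ st)) blay
      ; slots = map (λ l → m , l) e ++ slots
      ; frees = (m , B ∸ κ * Σ′ (λ l → l) e) ∷ frees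
      ; bperm = ↭-trans (↭P.++⁺ (proj₂ (proj₂ st)) bperm)
          (↭-trans (bag 4 (λ a b c d → (a :++ b) :++ (c :++ d) :↭ (a :++ c) :++ (b :++ d)) refl (map (λ l → m , κ * l) e) ((m , B ∸ κ * Σ′ (λ l → l) e) ∷ []) _ frees)
            (↭-reflexive (cong (_++ (m , B ∸ κ * Σ′ (λ l → l) e) ∷ frees) (dimsEq e))))
      ; slots# = ≤-trans (≤-reflexive (trans (length-++ (map (λ l → m , l) e)) (cong (_+ length slots) (length-map _ e)))) (+-mono-≤ e-len slots#)
      ; frees# = s≤s frees#
      ; weight = λ φ → trans (Σ-++ _ (map (λ l → m , l) e) slots) (trans (cong₂ _+_ (own φ) (weight φ))
          (sym (trans (Σ-↭ (Σ′ φ) part) (Σ-++ (Σ′ φ) eqs rest)))) }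
      where
      m = length eqs
      alls : ∀ {P : List ℕ → Set} → All P cfgs → P e
      alls {P} h = subst P (All.head (subst (All (_≡ e)) (sym eq) (eqs≡ cfgs)))
        (All.head (subst (All P) (sym eq) (filter-All is-e h)))
      e-len : length e ≤ q
      e-len = alls len≤
      st = stack κ m B e (alls sum≤)
      dimsEq : ∀ e′ → map (λ l → m , κ * l) e′ ++ map (λ s → proj₁ s , κ * proj₂ s) slots ≡ map (λ s → proj₁ s , κ * proj₂ s) (map (λ l → m , l) e′ ++ slots)
      dimsEq [] = refl
      dimsEq (_ ∷ e′) = cong (_ ∷_) (dimsEq e′)
      own : ∀ φ → Σ′ (λ s → proj₁ s * φ (proj₂ s)) (map (λ l → m , l) e) ≡ Σ′ (Σ′ φ) eqs
      own φ = trans (trans (Σ-map _ _ e) (Σ-* m φ e)) (sym (trans (Σ-cong {ψ = λ _ → Σ′ φ e} (All.map (cong (Σ′ φ)) (eqs≡ cfgs)))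
        (trans (Σ-const (Σ′ φ e) eqs) (*-comm (Σ′ φ e) m))))

  -- Slots, free remainders of the blocks, and one overflowing item for each slot.
  #cfg : ℕ → ℕ → ℕ
  #cfg q M = #lists q M * q + #lists q M + #lists q M * q

  -- Group the levels of a slice by their rounded configurations and refill the resulting slots.
  configure : ∀ {A : Set} {f g : A → ℕ} {a b L} (h r : A → ℕ) κ Λ M δ q xs → Slice f g a b L →
              All (λ x → r x ≤ g x) L → All (λ x → r x ∈ Λ) L → length Λ ≤ M →
              1 ≤ δ → All (λ x → δ ≤ g x) L → b ≤ q * δ →
              All (λ x → 1 ≤ f x) xs → All (λ x → h x ≤ κ * g x) xs →
              (∀ ℓ → above f g ℓ xs ≤ above f r ℓ L) →
              Pack f h a (κ * b) xs (κ * Σ′ (λ x → f x * r x) L) (#cfg q M)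
  configure {A} {f} {g} {a} {b} {L} h r κ Λ M δ q xs s r≤ r∈ ΛM 1≤δ δ≤ b≤ pos len≤ hall = record
    { lay = subst (λ z → Lay z (κ * b) bdims) (trans (length-map (map r) (levels s)) (levels-length s)) blay
    ; cells = fcells ++ map freeCell frees
    ; dims↭ = ↭-trans bperm (↭-trans (↭P.++⁺ʳ frees (↭-trans (↭P.map⁺ slotDim (↭-sym (sortBy↭ len slots))) (↭-reflexive (sym fdims))))
        (↭-reflexive (trans (cong (map dim fcells ++_) (sym (freeDims frees))) (sym (map-++ dim fcells _)))))
    ; ok = ++⁺ fok (freeOK frees)
    ; lost = flost
    ; perm = ↭-trans (↭-sym (sortBy↭ g xs)) (↭-trans fperm (↭-reflexive (cong (_++ flost)
        (sym (trans (items-++ fcells (map freeCell frees)) (trans (cong (items fcells ++_) (freeItems frees)) (++-identityʳ _)))))))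
    ; used≤ = ≤-reflexive (trans (Σ-++ used fcells _) (trans (cong₂ _+_ fused (freeUsed frees)) (trans (+-identityʳ _) usedEq)))
    ; size≤ = ≤-trans (≤-reflexive (cong (_+ length flost) (trans (length-++ fcells) (cong₂ _+_ cells# (length-map freeCell frees)))))
        (+-mono-≤ (+-mono-≤ s# (≤-trans frees# E#)) (≤-trans fcount (≤-trans (≤-reflexive (length-↭ (sortBy↭ len slots))) s#))) }
    where
    open Fill f g h κ
    cfgs : List (List ℕ)
    cfgs = map (map r) (levels s)
    mapAll : ∀ {P : List A → Set} {Q : List ℕ → Set} → (∀ {l} → P l → Q (map r l)) → ∀ {ls} → All P ls → All Q (map (map r) ls)
    mapAll k [] = []
    mapAll k (p ∷ ps) = k p ∷ mapAll k ps
    -- A line of length `b ≤ q * δ` meets at most `q` items of length at least `δ`.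
    levelLen : All (λ l → length l ≤ q) (levels s)
    levelLen = All.zipWith (λ {l} → λ { (p , d) → *-cancelˡ-≤ δ ⦃ >-nonZero 1≤δ ⦄ (≤-trans (Σ-lower δ g d) (≤-trans p (≤-trans b≤ (≤-reflexive (*-comm q δ))))) })
      (levels-≤ s , levels-All s δ≤)
    cfgLen : All (λ c → length c ≤ q) cfgs
    cfgLen = mapAll (λ {l} p → ≤-trans (≤-reflexive (length-map r l)) p) levelLen
    cfgSum : All (λ c → κ * Σ′ (λ l → l) c ≤ κ * b) cfgs
    cfgSum = mapAll (λ {l} → λ { (p , d) → *-monoʳ-≤ κ (≤-trans (≤-reflexive (Σ-map r _ l)) (≤-trans (Σ-mono d) p)) }) (All.zip (levels-≤ s , levels-All s r≤))
    cfgMem : All (_∈ allLists q Λ) cfgs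
    cfgMem = mapAll (λ {l} → λ { (p , d) → allLists-complete q Λ (map r l) (mem d) (≤-trans (≤-reflexive (length-map r l)) p) }) (All.zip (levelLen , levels-All s r∈))
      where mem : ∀ {l} → All (λ x → r x ∈ Λ) l → All (_∈ Λ) (map r l)
            mem [] = []
            mem (m ∷ ms) = m ∷ mem ms
    open Blocks (blocks κ (κ * b) q (allLists q Λ) cfgs cfgMem cfgSum cfgLen)
    E# : length (allLists q Λ) ≤ #lists q M
    E# = allLists-length q Λ M ΛM
    s# : length slots ≤ #lists q M * q
    s# = ≤-trans slots# (*-monoˡ-≤ q E#)
    weight′ : ∀ φ → Σ′ (λ s → cap s * φ (len s)) slots ≡ Σ′ (λ x → f x * φ (r x)) L
    weight′ φ = trans (weight φ) (trans (Σ-map (map r) (Σ′ φ) (levels s))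
      (trans (Σ-cong {xs = levels s} (All.universal (λ l → Σ-map r φ l) (levels s))) (fubini s (φ ∘ r))))
    comm : ∀ {B : Set} (wt key : B → ℕ) ℓ (ys : List B) → above wt key ℓ ys ≡ Σ′ (λ y → wt y * 𝟙 (ℓ ≤ᵇ key y)) ys
    comm wt key ℓ ys = Σ-cong {xs = ys} (All.universal (λ y → *-comm _ (wt y)) ys)
    -- By double counting, the slots of length at least `ℓ` have as much capacity as the items of
    -- `L` rounded to at least `ℓ` have thickness.
    hall′ : ∀ ℓ → above f g ℓ (sortBy g xs) ≤ above cap len ℓ (sortBy len slots)
    hall′ ℓ = ≤-trans (≤-reflexive (Σ-↭ _ (sortBy↭ g xs))) (≤-trans (hall ℓ)
      (≤-reflexive (trans (comm f r ℓ L) (trans (sym (weight′ (λ v → 𝟙 (ℓ ≤ᵇ v)))) (trans (sym (comm cap len ℓ slots)) (sym (Σ-↭ _ (sortBy↭ len slots))))))))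
    total : Σ′ f (sortBy g xs) ≤ Σ′ cap (sortBy len slots)
    total = ≤-trans (≤-reflexive (sym (above-all f g 0 {sortBy g xs} (All.universal (λ _ → z≤n) _)))) (≤-trans (hall′ 0) (≤-reflexive (above-all cap len 0 {sortBy len slots} (All.universal (λ _ → z≤n) _))))
    posS : All (λ x → 1 ≤ f x) (sortBy g xs)
    posS = All-↭ (↭-sym (sortBy↭ g xs)) pos
    open Filled (fill (sortBy len slots) (sortBy g xs)
      (hall⇒Dom _ _ (sortBy-decr len slots) (sortBy-decr g xs) posS hall′) total posS (All-↭ (↭-sym (sortBy↭ g xs)) len≤))
    freeCell : ℕ × ℕ → Cell A
    freeCell (w , t) = mkCell free w t []
    freeDims : ∀ ds → map dim (map freeCell ds) ≡ ds
    freeDims [] = refl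
    freeDims (d ∷ ds) = cong (d ∷_) (freeDims ds)
    freeOK : ∀ ds → All (OK f h) (map freeCell ds)
    freeOK [] = []
    freeOK (d ∷ ds) = refl ∷ freeOK ds
    freeItems : ∀ ds → items (map freeCell ds) ≡ []
    freeItems [] = refl
    freeItems (d ∷ ds) = freeItems ds
    freeUsed : ∀ ds → Σ′ used (map freeCell ds) ≡ 0
    freeUsed [] = refl
    freeUsed (d ∷ ds) = freeUsed ds
    cells# : length fcells ≡ length slots
    cells# = trans (sym (length-map dim fcells)) (trans (cong length fdims) (trans (length-map slotDim (sortBy len slots)) (length-↭ (sortBy↭ len slots))))
    usedEq : Σ′ (λ s → cap s * (κ * len s)) (sortBy len slots) ≡ κ * Σ′ (λ x → f x * r x) L
    usedEq = trans (Σ-↭ _ (sortBy↭ len slots)) (trans (weight′ (κ *_)) (trans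
      (Σ-cong {xs = L} (All.universal (λ x → lia 3 (λ f k r → ⟨ f :* (k :* r) :≡ k :* (f :* r) ⟩) refl (f x) κ (r x)) L)) (Σ-* κ _ L)))

  -- Linear grouping

  packUsed : ∀ {A : Set} {f g : A → ℕ} {a b L U k} → Pack f g a b L U k → Pack f g a b L (a * b) k
  packUsed p = record { lay = lay p ; cells = cells p ; dims↭ = dims↭ p ; ok = ok p ; lost = lost p ; perm = perm p ; size≤ = size≤ p
    ; used≤ = ≤-trans (Σ-mono {xs = cells p} (All.universal used≤area (cells p)))
        (≤-reflexive (trans (sym (Σ-map dim area₂ (cells p))) (trans (sym (Σ-↭ area₂ (dims↭ p))) (lay-area (lay p))))) }
    where
    used≤area : ∀ c → used c ≤ area₂ (dim c)
    used≤area (mkCell free w h _) = z≤n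
    used≤area (mkCell (vert _) w h _) = ≤-refl
    used≤area (mkCell (hori _) w h _) = ≤-refl

  roundDown : List ℕ → ℕ → ℕ
  roundDown [] v = 0
  roundDown (l ∷ Λ) v with l ≤? v
  ... | yes _ = l ⊔ roundDown Λ v
  ... | no _ = roundDown Λ v

  roundDown-≤ : ∀ Λ v → roundDown Λ v ≤ v
  roundDown-≤ [] v = z≤n
  roundDown-≤ (l ∷ Λ) v with l ≤? v
  ... | yes p = ⊔-lub p (roundDown-≤ Λ v)
  ... | no _ = roundDown-≤ Λ v

  roundDown-∈ : ∀ Λ v → roundDown Λ v ∈ 0 ∷ Λ
  roundDown-∈ [] v = here refl
  roundDown-∈ (l ∷ Λ) v with l ≤? v | roundDown-∈ Λ v
  ... | no _ | here e = here e
  ... | no _ | there m = there (there m)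
  ... | yes _ | m with ⊔-sel l (roundDown Λ v)
  ... | inj₁ e = there (here e)
  ... | inj₂ e with m
  ... | here e′ = here (trans e e′)
  ... | there m′ = there (there (subst (_∈ Λ) (sym e) m′))

  roundDown-≥ : ∀ {Λ l v} → l ∈ Λ → l ≤ v → l ≤ roundDown Λ v
  roundDown-≥ {l ∷ Λ} {.l} {v} (here refl) h with l ≤? v
  ... | yes _ = m≤m⊔n l _
  ... | no ¬h = contradiction h ¬h
  roundDown-≥ {l′ ∷ Λ} {l} {v} (there m) h with l′ ≤? v
  ... | yes _ = ≤-trans (roundDown-≥ m h) (m≤n⊔m l′ _)
  ... | no _ = roundDown-≥ m h

  module _ {A : Set} (f g : A → ℕ) (s : ℕ) where

    -- Scanning a list in order of decreasing length, a threshold is set whenever more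
    -- than s thickness has accumulated since the last one.
    thresholds : ℕ → List A → List ℕ
    thresholds acc [] = []
    thresholds acc (x ∷ xs) with acc + f x ≤? s
    ... | yes _ = thresholds (acc + f x) xs
    ... | no _ = g x ∷ thresholds 0 xs

    thresholds-≤ : ∀ acc {xs c} → All (λ x → g x ≤ c) xs → All (_≤ c) (thresholds acc xs)
    thresholds-≤ acc [] = []
    thresholds-≤ acc (_∷_ {x = x} h hs) with acc + f x ≤? s
    ... | yes _ = thresholds-≤ (acc + f x) hs
    ... | no _ = h ∷ thresholds-≤ 0 hs

    thresholds-# : ∀ acc xs → s * length (thresholds acc xs) ≤ acc + Σ′ f xs
    thresholds-# acc [] = ≤-trans (≤-reflexive (*-zeroʳ s)) z≤n
    thresholds-# acc (x ∷ xs) with acc + f x ≤? s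
    ... | yes _ = ≤-trans (thresholds-# (acc + f x) xs) (≤-reflexive (+-assoc acc (f x) _))
    ... | no ¬h = lia 5 (λ s t a x y → (s :* t :≤ y) ⇒ (s :< a :+ x) ⇒ ⟨ s :* (con 1 :+ t) :≤ a :+ (x :+ y) ⟩) refl
        s (length (thresholds 0 xs)) acc (f x) (Σ′ f xs) (thresholds-# 0 xs) (≰⇒> ¬h)

    -- At most `s` of thickness accumulates between successive thresholds, so passing from `ℓ` to
    -- the next threshold above it loses at most `s`. In the first case no threshold reaches `ℓ`.
    thresholds-gap : ∀ ℓ acc xs → Decreasing g xs → acc ≤ s →
      (acc + above f g ℓ xs ≤ s) ⊎ (Σ ℕ λ l → l ∈ thresholds acc xs × ℓ ≤ l × above f g ℓ xs ≤ s + above f g l xs)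
    thresholds-gap ℓ acc [] d h = inj₁ (≤-trans (≤-reflexive (+-identityʳ acc)) h)
    thresholds-gap ℓ acc (x ∷ xs) (dx ∷ d) h with ℓ ≤? g x
    ... | no ¬p = inj₁ (≤-trans (≤-reflexive (trans (cong (acc +_) (above-none f g ℓ {x ∷ xs} (≰⇒> ¬p ∷ All.map (λ z → ≤-<-trans z (≰⇒> ¬p)) dx))) (+-identityʳ acc))) h)
    ... | yes p with acc + f x ≤? s
    ... | yes q with thresholds-gap ℓ (acc + f x) xs d q
    ... | inj₁ r = inj₁ (≤-trans (≤-reflexive (trans (cong (λ c → acc + (𝟙 c * f x + above f g ℓ xs)) (≤ᵇ-true p))
            (lia 3 (λ a x y → ⟨ a :+ (con 1 :* x :+ y) :≡ a :+ x :+ y ⟩) refl acc (f x) (above f g ℓ xs)))) r)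
    ... | inj₂ (l , m , le , r) = inj₂ (l , m , le , lifted)
      where
      lifted : above f g ℓ (x ∷ xs) ≤ s + above f g l (x ∷ xs)
      lifted rewrite ≤ᵇ-true p | ≤ᵇ-true (All.lookup (thresholds-≤ (acc + f x) dx) m) =
        lia 4 (λ s x y z → (y :≤ s :+ z) ⇒ ⟨ con 1 :* x :+ y :≤ s :+ (con 1 :* x :+ z) ⟩) refl s (f x) (above f g ℓ xs) (above f g l xs) r
    thresholds-gap ℓ acc (x ∷ xs) (dx ∷ d) h | yes p | no q with thresholds-gap ℓ 0 xs d z≤n
    ... | inj₁ r = inj₂ (g x , here refl , p , lifted)
      where
      lifted : above f g ℓ (x ∷ xs) ≤ s + above f g (g x) (x ∷ xs)
      lifted rewrite ≤ᵇ-true p | ≤ᵇ-true (≤-refl {g x}) =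
        lia 4 (λ s x y z → (y :≤ s) ⇒ ⟨ con 1 :* x :+ y :≤ s :+ (con 1 :* x :+ z) ⟩) refl s (f x) (above f g ℓ xs) (above f g (g x) xs) r
    ... | inj₂ (l , m , le , r) = inj₂ (l , there m , le , lifted)
      where
      lifted : above f g ℓ (x ∷ xs) ≤ s + above f g l (x ∷ xs)
      lifted rewrite ≤ᵇ-true p | ≤ᵇ-true (All.lookup (thresholds-≤ 0 dx) m) =
        lia 4 (λ s x y z → (y :≤ s :+ z) ⇒ ⟨ con 1 :* x :+ y :≤ s :+ (con 1 :* x :+ z) ⟩) refl s (f x) (above f g ℓ xs) (above f g l xs) r

  -- At most `c * q` thresholds occur, besides the length 0. The summand 3 has room for the extra
  -- strip, an empty cell and a lost item.
  #col : ℕ → ℕ → ℕ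
  #col c q = #cfg q (1 + c * q) + 3

  module _ {A : Set} {f g : A → ℕ} where

    -- Compare areas: every item is at least `δ` long, and the rectangle is at most `q * δ` high.
    thickness-≤ : ∀ {a b L} δ q → 1 ≤ δ → All (λ x → δ ≤ g x) L → b ≤ q * δ → Slice f g a b L → Σ′ f L ≤ a * q
    thickness-≤ {a} {b} {L} δ q 1≤δ long b≤ t = *-cancelˡ-≤ δ ⦃ >-nonZero 1≤δ ⦄ (begin
      δ * Σ′ f L                ≡⟨ Σ-* δ f L ⟨
      Σ′ (λ x → δ * f x) L      ≤⟨ Σ-mono (All.map (λ {x} h → ≤-trans (≤-reflexive (*-comm δ (f x))) (*-monoʳ-≤ (f x) h)) long) ⟩
      area f g L                ≤⟨ area-≤ t ⟩
      a * b                     ≤⟨ *-monoʳ-≤ a b≤ ⟩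
      a * (q * δ)               ≡⟨ lia 3 (λ a q d → ⟨ a :* (q :* d) :≡ d :* (a :* q) ⟩) refl a q δ ⟩
      δ * (a * q)               ∎)
      where open ≤-Reasoning

    -- Linear grouping: the longest items, of total thickness s, go to the extra strip;
    -- every other item takes the place of items that are at least as long.
    column : ∀ {X b L} s c δ q → 1 ≤ s → X ≤ c * s → 1 ≤ δ → All (λ x → δ ≤ g x) L → b ≤ q * δ → All (λ x → 1 ≤ f x) L →
             Slice f g X b L → Pack f g (X + s) b L (area f g L + s * b) (#col c q)
    column {X} {b} {L} s c δ q 1≤s X≤ 1≤δ long b≤ pos t = go (takeFit s xs)
      where
      open Fill f g g 1
      xs = sortBy g L
      xs↭ = sortBy↭ g L
      dx = sortBy-decr g L
      short : All (λ x → g x ≤ b) xs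
      short = All-↭ (↭-sym xs↭) (All.map proj₂ (fits t))
      posx : All (λ x → 1 ≤ f x) xs
      posx = All-↭ (↭-sym xs↭) pos
      Λ = thresholds f g s 0 xs
      thick : Σ′ f L ≤ X * q
      thick = thickness-≤ δ q 1≤δ long b≤ t
      Λ# : length (0 ∷ Λ) ≤ 1 + c * q
      Λ# = s≤s (*-cancelˡ-≤ s ⦃ >-nonZero 1≤s ⦄ (≤-trans (thresholds-# f g s 0 xs) (≤-trans (≤-reflexive (Σ-↭ f xs↭))
        (≤-trans thick (≤-trans (*-monoˡ-≤ q X≤) (≤-reflexive (lia 3 (λ c s q → ⟨ c :* s :* q :≡ s :* (c :* q) ⟩) refl c s q)))))))
      r : A → ℕ
      r x = roundDown Λ (g x)
      gap₁ : ∀ l ℓ → l ∈ Λ → ℓ ≤ l → above f g l xs ≤ above f r ℓ L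
      gap₁ l ℓ m le = ≤-trans (≤-reflexive (Σ-↭ _ xs↭)) (Σ-mono (All.universal pt L))
        where
        pt : ∀ x → 𝟙 (l ≤ᵇ g x) * f x ≤ 𝟙 (ℓ ≤ᵇ r x) * f x
        pt x with l ≤ᵇ g x in eq
        ... | false = z≤n
        ... | true rewrite ≤ᵇ-true (≤-trans le (roundDown-≥ m (true-≤ {l} eq))) = ≤-refl
      go : (Σ (List A) λ ys → Σ (List A) λ zs → xs ≡ ys ++ zs × Σ′ f ys ≤ s ×
             (zs ≡ [] ⊎ Σ A λ o → Σ (List A) λ ws → zs ≡ o ∷ ws × s < Σ′ f ys + f o)) →
           Pack f g (X + s) b L (area f g L + s * b) (#col c q)
      go (ys , .[] , e , fit , inj₁ refl) =
        packWeaken (m≤n+m (s * b) (area f g L)) (≤-trans (s≤s (s≤s z≤n)) (m≤n+m 3 (#cfg q (1 + c * q))))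
          (packPerm (↭-trans (↭-sym xs↭) (↭-reflexive (trans e (++-identityʳ ys))))
            (packVer (packFree X b) (packCell (vert false) s b ys (fit , ++⁻ˡ ys (subst (All _) e short)))))
      go (ys , .(o ∷ ws) , e , fit , inj₂ (o , ws , refl , over)) =
        packWeaken used′ (≤-trans (≤-reflexive (+-assoc (#cfg q (1 + c * q)) 1 1)) (+-monoʳ-≤ (#cfg q (1 + c * q)) (n≤1+n 2)))
          (packPerm perm′ (packLose (o ∷ []) (packVer main (packCell (vert false) s b ys (fit , ++⁻ˡ ys (subst (All _) e short))))))
        where
        -- The items taken out, `ys` and `o`, are thicker than `s`, which outweighs what is lost by
        -- rounding down.
        hall : ∀ ℓ → above f g ℓ ws ≤ above f r ℓ L
        hall ℓ with ℓ ≤? g o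
        ... | no ¬p = ≤-trans (≤-reflexive (above-none f g ℓ (All.map (λ z → ≤-<-trans z (≰⇒> ¬p)) (proj₂ (decr-split g ys o ws (subst (Decreasing g) e dx)))))) z≤n
        ... | yes p = decide (thresholds-gap f g s ℓ 0 xs dx z≤n)
          where
          whole : above f g ℓ xs ≡ Σ′ f ys + f o + above f g ℓ ws
          whole = trans (cong (above f g ℓ) e) (trans (Σ-++ _ ys (o ∷ ws)) (trans (cong₂ _+_
            (above-all f g ℓ (All.map (≤-trans p) (proj₁ (decr-split g ys o ws (subst (Decreasing g) e dx)))))
            (cong (_+ above f g ℓ ws) (trans (cong (λ c → 𝟙 c * f o) (≤ᵇ-true p)) (+-identityʳ (f o))))) (sym (+-assoc (Σ′ f ys) (f o) _))))
          decide : (0 + above f g ℓ xs ≤ s) ⊎ (Σ ℕ λ l → l ∈ Λ × ℓ ≤ l × above f g ℓ xs ≤ s + above f g l xs) → above f g ℓ ws ≤ above f r ℓ L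
          decide (inj₁ h) = lia 6 (λ y o w a s z → (a :≡ y :+ o :+ w) ⇒ (a :≤ s) ⇒ (s :< y :+ o) ⇒ ⟨ w :≤ z ⟩) refl
            (Σ′ f ys) (f o) (above f g ℓ ws) (above f g ℓ xs) s (above f r ℓ L) whole h over
          decide (inj₂ (l , m , le , h)) = lia 7 (λ y o w a s v z → (a :≡ y :+ o :+ w) ⇒ (a :≤ s :+ v) ⇒ (v :≤ z) ⇒ (s :< y :+ o) ⇒ ⟨ w :≤ z ⟩) refl
            (Σ′ f ys) (f o) (above f g ℓ ws) (above f g ℓ xs) s (above f g l xs) (above f r ℓ L) whole h (gap₁ l ℓ m le) over
        main : Pack f g X b ws (1 * Σ′ (λ x → f x * r x) L) (#cfg q (1 + c * q))
        main = subst (λ z → Pack f g X z ws (1 * Σ′ (λ x → f x * r x) L) (#cfg q (1 + c * q))) (+-identityʳ b)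
          (configure g r 1 (0 ∷ Λ) (1 + c * q) δ q ws t (All.universal (λ x → roundDown-≤ Λ (g x)) L) (All.universal (λ x → roundDown-∈ Λ (g x)) L)
            Λ# 1≤δ long b≤ (All.tail (++⁻ʳ ys (subst (All _) e posx))) (All.universal (λ x → ≤-reflexive (sym (+-identityʳ (g x)))) ws) hall)
        used′ : 1 * Σ′ (λ x → f x * r x) L + s * b ≤ area f g L + s * b
        used′ = +-monoˡ-≤ (s * b) (≤-trans (≤-reflexive (+-identityʳ _)) (Σ-mono (All.universal (λ x → *-monoʳ-≤ (f x) (roundDown-≤ Λ (g x))) L)))
        perm′ : L ↭ (ws ++ ys) ++ o ∷ []
        perm′ = ↭-trans (↭-sym xs↭) (↭-trans (↭-reflexive e) (bag 3 (λ y o w → y :++ (o :++ w) :↭ (w :++ y) :++ o) refl ys (o ∷ []) ws))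

    -- The lengths are integers up to `M`, so each of them can be a slot length: neither rounding
    -- nor an extra strip is called for.
    exactColumn : ∀ {a b L} (h : A → ℕ) κ M → b ≤ M → All (λ x → 1 ≤ g x) L → All (λ x → 1 ≤ f x) L → All (λ x → h x ≤ κ * g x) L →
                  Slice f g a b L → Pack f h a (κ * b) L (κ * area f g L) (#cfg M (suc M))
    exactColumn {a} {b} {L} h κ M b≤ long pos len≤ t = configure h g κ (upTo (suc M)) (suc M) 1 M L t
      (All.universal (λ _ → ≤-refl) L) (All.map (λ { (_ , p) → ∈-upTo⁺ (s≤s (≤-trans p b≤)) }) (fits t))
      (≤-reflexive (length-upTo (suc M))) ≤-refl long (≤-trans b≤ (≤-reflexive (sym (*-identityʳ M)))) pos len≤ (λ ℓ → ≤-refl)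

    -- No width is added here: the extra strip of linear grouping is a window of width `X / q` that
    -- is emptied beforehand. Items too thick for the window argument are few because of their area.
    stripPack : ∀ {X b L} δ d q → 1 ≤ q → 1 ≤ δ → All (λ x → δ ≤ g x) L → b ≤ d * δ → All (λ x → 1 ≤ f x) L → Slice f g X b L →
                Σ (List A) λ kept → Σ (List A) λ gone → L ↭ kept ++ gone × q * length gone ≤ 2 * length L + q * (q * d) ×
                  Pack f g X b kept (X * b) (#col (2 * q) d)
    stripPack {X} {b} {L} δ d q 1≤q 1≤δ long b≤ pos t =
        kept , gone ++ fat , ↭-trans (partition↭ thin? L) (↭-trans (↭P.++⁺ʳ fat (proj₁ spec)) (↭-reflexive (++-assoc kept gone fat))) ,
        count , packed (s ≟ 0)
      where
      instance
        q≢0 : NonZero q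
        q≢0 = >-nonZero 1≤q
      s = X / q
      thin? : A → Bool
      thin? x = f x ≤ᵇ s
      thin fat : List A
      thin = filterᵇ thin? L
      fat = filterᵇ (not ∘ thin?) L
      thin≤ : All (λ x → f x ≤ s) thin
      thin≤ = All.map (λ {x} e → true-≤ {f x} e) (filter-true thin? L)
      sq≤ : q * s ≤ X
      sq≤ = ≤-trans (≤-reflexive (*-comm q s)) (m/n*n≤m X q)
      X< : X < q + s * q
      X< = ≤-trans (s≤s (≤-reflexive (m≡m%n+[m/n]*n X q))) (+-monoˡ-≤ (s * q) (m%n<n X q))
      w = window q s 1≤q sq≤ thin≤ (filterS thin? t)
      kept = proj₁ w
      gone = proj₁ (proj₂ w)
      spec = proj₂ (proj₂ w)
      notb : ∀ {c} → not c ≡ true → c ≡ false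
      notb {false} _ = refl
      -- `suc X` is a positive divisor even for `X = 0`, and a fat item satisfies `suc X ≤ q * f x`.
      fatBound : length fat ≤ q * d
      fatBound = *-cancelˡ-≤ (suc X * δ) ⦃ m*n≢0 (suc X) δ ⦃ _ ⦄ ⦃ >-nonZero 1≤δ ⦄ ⦄ (begin
        suc X * δ * length fat              ≤⟨ Σ-lower (suc X * δ) (λ x → q * (f x * g x)) (All.zipWith (λ {x} → λ { (e , l) → each x e l }) (filter-true (not ∘ thin?) L , filter-All (not ∘ thin?) long)) ⟩
        Σ′ (λ x → q * (f x * g x)) fat      ≡⟨ Σ-* q _ fat ⟩
        q * area f g fat                    ≤⟨ *-monoʳ-≤ q (≤-trans (area-≤ (filterS (not ∘ thin?) t)) (*-mono-≤ (n≤1+n X) b≤)) ⟩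
        q * (suc X * (d * δ))               ≡⟨ lia 4 (λ q x d e → ⟨ q :* (x :* (d :* e)) :≡ x :* e :* (q :* d) ⟩) refl q (suc X) d δ ⟩
        suc X * δ * (q * d)                 ∎)
        where
        open ≤-Reasoning
        each : ∀ x → not (thin? x) ≡ true → δ ≤ g x → suc X * δ ≤ q * (f x * g x)
        each x e l = ≤-trans (*-mono-≤ {suc X} {q * f x} (≤-trans X< (≤-trans (≤-reflexive (lia 2 (λ q s → ⟨ q :+ s :* q :≡ q :* (con 1 :+ s) ⟩) refl q s))
          (*-monoʳ-≤ q (false-> {f x} (notb e))))) l) (≤-reflexive (*-assoc q (f x) (g x)))
      count : q * length (gone ++ fat) ≤ 2 * length L + q * (q * d)
      count = ≤-trans (≤-reflexive (trans (cong (q *_) (length-++ gone)) (*-distribˡ-+ q _ _)))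
        (+-mono-≤ (≤-trans (proj₁ (proj₂ spec)) (*-monoʳ-≤ 2 (≤-trans (m≤m+n (length thin) (length fat)) (≤-reflexive (trans (sym (length-++ thin)) (sym (length-↭ (partition↭ thin? L))))))))
                  (*-monoʳ-≤ q fatBound))
      keptAll : ∀ {P : A → Set} → All P L → All P kept
      keptAll h = ++⁻ˡ kept (All-↭ (proj₁ spec) (filter-All thin? h))
      packed : _ → Pack f g X b kept (X * b) (#col (2 * q) d)
      -- For `X < q` a thin item would have width 0, so nothing is kept.
      packed (yes s≡0) = packUsed (packWeaken ≤-refl (≤-trans (s≤s z≤n) (m≤n+m 3 (#cfg d (1 + 2 * q * d)))) (packPerm (↭-reflexive (empty kept keptThin (keptAll pos))) (packFree X b)))
        where
        keptThin : All (λ x → f x ≤ 0) kept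
        keptThin = ++⁻ˡ kept (All-↭ (proj₁ spec) (subst (λ z → All (λ x → f x ≤ z) thin) s≡0 thin≤))
        empty : ∀ (xs : List A) → All (λ x → f x ≤ 0) xs → All (λ x → 1 ≤ f x) xs → xs ≡ []
        empty [] _ _ = refl
        empty (x ∷ xs) (h ∷ _) (k ∷ _) = contradiction (≤-trans k h) λ ()
      packed (no s≢0) = packUsed (subst (λ z → Pack f g z b kept (area f g kept + s * b) (#col (2 * q) d)) (m∸n+n≡m s≤X)
        (column s (2 * q) δ d 1≤s (≤-trans (m∸n≤m X s) X≤) 1≤δ (keptAll long) b≤ (keptAll pos) (proj₂ (proj₂ spec))))
        where
        1≤s : 1 ≤ s
        1≤s = n≢0⇒n>0 s≢0
        s≤X : s ≤ X
        s≤X = m/n≤m X q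
        X≤ : X ≤ 2 * q * s
        X≤ = ≤-trans (<⇒≤ X<) (lia 2 (λ q s → (con 0 :≤ s) ⇒ (q :≤ q :* s) ⇒ ⟨ q :+ s :* q :≤ con 2 :* q :* s ⟩) refl q s z≤n (m≤m*n q s ⦃ >-nonZero 1≤s ⦄))

  -- Widened packings

  packMap : ∀ {A B : Set} {f g : B → ℕ} (h : A → B) {a b L U k} → Pack (f ∘ h) (g ∘ h) a b L U k → Pack f g a b (map h L) U k
  packMap {A} {B} {f} {g} h p = mkPack (lay p) (map mc (cells p)) (↭-trans (dims↭ p) (↭-reflexive (deq (cells p)))) (oks (ok p)) (map h (lost p))
    (↭-trans (↭P.map⁺ h (perm p)) (↭-reflexive (trans (map-++ h (items (cells p)) (lost p)) (cong (_++ map h (lost p)) (ieq (cells p))))))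
    (≤-trans (≤-reflexive (trans (Σ-map mc used (cells p)) (Σ-cong {xs = cells p} (All.universal ueq (cells p))))) (used≤ p))
    (≤-trans (≤-reflexive (cong₂ _+_ (length-map mc (cells p)) (length-map h (lost p)))) (size≤ p))
    where
    mc : Cell A → Cell B
    mc (mkCell k w t xs) = mkCell k w t (map h xs)
    deq : ∀ cs → map dim cs ≡ map dim (map mc cs)
    deq [] = refl
    deq (c ∷ cs) = cong (_ ∷_) (deq cs)
    ueq : ∀ c → used (mc c) ≡ used c
    ueq (mkCell free w t xs) = refl
    ueq (mkCell (vert _) w t xs) = refl
    ueq (mkCell (hori _) w t xs) = refl
    ieq : ∀ cs → map h (items cs) ≡ items (map mc cs)
    ieq [] = refl
    ieq (c ∷ cs) = trans (map-++ h (its c) (items cs)) (cong (map h (its c) ++_) (ieq cs))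
    allM : ∀ {P : B → Set} {xs : List A} → All (P ∘ h) xs → All P (map h xs)
    allM [] = []
    allM (q ∷ qs) = q ∷ allM qs
    okM : ∀ c → OK (f ∘ h) (g ∘ h) c → OK f g (mc c)
    okM (mkCell free w t xs) o = cong (map h) o
    okM (mkCell (vert false) w t xs) (o , q) = ≤-trans (≤-reflexive (Σ-map h f xs)) o , allM q
    okM (mkCell (vert true) w t xs) (o , q) = ≤-trans (≤-reflexive (Σ-map h g xs)) o , allM q
    okM (mkCell (hori false) w t xs) (o , q) = ≤-trans (≤-reflexive (Σ-map h g xs)) o , allM q
    okM (mkCell (hori true) w t xs) (o , q) = ≤-trans (≤-reflexive (Σ-map h f xs)) o , allM q
    oks : ∀ {cs} → All (OK (f ∘ h) (g ∘ h)) cs → All (OK f g) (map mc cs)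
    oks [] = []
    oks (_∷_ {x = c} o os) = okM c o ∷ oks os

  filter-⊎ : ∀ {A : Set} {p p₁ p₂ : A → Bool} {xs} → All (λ x → 𝟙 (p x) ≡ 𝟙 (p₁ x) + 𝟙 (p₂ x)) xs → filterᵇ p xs ↭ filterᵇ p₁ xs ++ filterᵇ p₂ xs
  filter-⊎ [] = ↭-refl
  filter-⊎ {p = p} {p₁} {p₂} (_∷_ {x = x} {xs} h hs) with p x | p₁ x | p₂ x
  ... | true | true | false = prep x (filter-⊎ hs)
  ... | true | false | true = ↭-trans (prep x (filter-⊎ hs)) (↭-sym (↭P.shift x (filterᵇ p₁ xs) _))
  ... | false | false | false = filter-⊎ hs
  ... | true | true | true with () ← h
  ... | true | false | false with () ← h
  ... | false | true | true with () ← h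
  ... | false | true | false with () ← h
  ... | false | false | true with () ← h

  filter-[] : ∀ {A : Set} {p : A → Bool} {xs} → All (λ x → p x ≡ false) xs → filterᵇ p xs ≡ []
  filter-[] [] = refl
  filter-[] (_∷_ {x = x} h hs) rewrite h = filter-[] hs

  unionBound : ∀ {A : Set} n (c : ℕ → A → Bool) {xs : List A} → All (λ x → Σ ℕ λ z → z < n × c z x ≡ true) xs →
               length xs ≤ upΣ n (λ z → length (filterᵇ (c z) xs))
  unionBound n c [] = z≤n
  unionBound n c (_∷_ {x = x} {xs} (z , z< , e) hs) = ≤-trans (s≤s (unionBound n c hs)) (bump n z<)
    where
    noBump : ∀ n → upΣ n (λ z → length (filterᵇ (c z) xs)) ≤ upΣ n (λ z → length (filterᵇ (c z) (x ∷ xs)))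
    noBump zero = z≤n
    noBump (suc n) with c n x
    ... | true = +-mono-≤ (noBump n) (n≤1+n _)
    ... | false = +-monoˡ-≤ _ (noBump n)
    bump : ∀ n → z < n → suc (upΣ n (λ z → length (filterᵇ (c z) xs))) ≤ upΣ n (λ z → length (filterᵇ (c z) (x ∷ xs)))
    bump (suc n) z<n with z ≟ n
    ... | yes refl rewrite e = ≤-trans (≤-reflexive (sym (+-suc _ _))) (+-monoˡ-≤ _ (noBump n))
    ... | no z≢n with bump n (≤∧≢⇒< (s≤s⁻¹ z<n) z≢n)
    ... | ih with c n x
    ... | true = +-mono-≤ ih (n≤1+n _)
    ... | false = +-monoˡ-≤ _ ih

  upΣ-≤ : ∀ n c B → (∀ z → c z ≤ B) → upΣ n c ≤ n * B
  upΣ-≤ zero c B h = z≤n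
  upΣ-≤ (suc n) c B h = ≤-trans (+-mono-≤ (upΣ-≤ n c B h) (h n)) (≤-reflexive (+-comm (n * B) B))

  -- A vertical cut leaves one column and two blocks with fewer columns. Such a block consists of at
  -- most `q` tall rows, treated recursively, and of low rows that are repacked together into
  -- `#cfg M (suc M)` cells.
  #tall : ℕ → ℕ → ℕ → ℕ → ℕ
  #tall z q M zero = 0
  #tall z q M (suc c) = (q * #tall z q M c + #cfg M (suc M)) + (#col z q + (q * #tall z q M c + #cfg M (suc M)))

  -- `(M + 2) * q` bounds the vertical items that cross a grid line; they are lost.
  #grid : ℕ → ℕ → ℕ → ℕ
  #grid z q M = (q * #tall z q M M + #cfg M (suc M)) + (M + 2) * q + 1

  -- A grid of columns of width κ, which are later widened to κ + γ.  The column containing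
  -- a vertical cut is split off, so that only items confined to it (the vertical ones) need
  -- it; a horizontal item keeps only the columns it crosses completely, and the widening
  -- makes up for the loss.

  module Columns {A : Set} (f g : A → ℕ) (δ κ γ B : ℕ) (1≤κ : 1 ≤ κ) (Bκ≤δ : (B + 2) * κ ≤ δ) (κ≤Bγ : 2 * κ ≤ B * γ) where

    private instance
      κ≢0 : NonZero κ
      κ≢0 = >-nonZero 1≤κ

    P = A × ℕ

    fP gP : P → ℕ
    fP = f ∘ proj₁
    gP = g ∘ proj₁

    isV : P → Bool
    isV x = δ ≤ᵇ gP x

    col cl : P → ℕ
    col (x , p) = p / κ
    cl (x , p) = (p + f x) / κ ∸ suc (p / κ)

    Thin : P → Set
    Thin x = isV x ≡ true ⊎ δ ≤ fP x

    div< : ∀ m → m < κ + m / κ * κ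
    div< m = ≤-trans (s≤s (≤-reflexive (m≡m%n+[m/n]*n m κ))) (+-monoˡ-≤ (m / κ * κ) (m%n<n m κ))

    cl-κ : ∀ x → cl x * κ ≤ fP x
    cl-κ (x , p) with suc (p / κ) ≤? (p + f x) / κ
    ... | no ¬h rewrite m≤n⇒m∸n≡0 (<⇒≤ (≰⇒> ¬h)) = z≤n
    ... | yes h = lia 6 (λ e s c k p f → (con 1 :+ s :+ c :≡ e) ⇒ (e :* k :≤ p :+ f) ⇒ (p :< k :+ s :* k) ⇒ (e :* k :≡ (con 1 :+ s :+ c) :* k) ⇒ ⟨ c :* k :≤ f ⟩) refl
        ((p + f x) / κ) (p / κ) (cl (x , p)) κ p (f x) (m+[n∸m]≡n h) (m/n*n≤m (p + f x) κ) (div< p) (cong (_* κ) (sym (m+[n∸m]≡n h)))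

    private
      cl-lower : ∀ x → fP x < (cl x + 2) * κ
      cl-lower (x , p) = lia 7 (λ e s c k p f q → (p :+ f :< k :+ e :* k) ⇒ (s :* k :≤ p) ⇒ (e :* k :≤ (con 1 :+ s :+ c) :* k) ⇒ ⟨ f :< (c :+ con 2) :* k ⟩) refl
        ((p + f x) / κ) (p / κ) (cl (x , p)) κ p (f x) 0 (div< (p + f x)) (m/n*n≤m p κ) (*-monoˡ-≤ κ (m≤n+m∸n ((p + f x) / κ) (suc (p / κ))))

    cl-big : ∀ x → δ ≤ fP x → B < cl x
    cl-big x h = +-cancelʳ-< 2 B (cl x) (*-cancelʳ-< κ (B + 2) (cl x + 2) (≤-<-trans Bκ≤δ (≤-<-trans h (cl-lower x))))

    -- The item crosses more than `B` columns completely. Widening each of them by `γ` gains at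
    -- least `B * γ ≥ 2 * κ`, which makes up for the two columns crossed in part.
    cl-κ′ : ∀ x → δ ≤ fP x → fP x ≤ (κ + γ) * cl x
    cl-κ′ x h = lia 5 (λ f c k g b → (f :< (c :+ con 2) :* k) ⇒ (con 2 :* k :≤ b :* g) ⇒ (b :* g :≤ c :* g) ⇒ ⟨ f :≤ (k :+ g) :* c ⟩) refl
      (fP x) (cl x) κ γ B (cl-lower x) κ≤Bγ (*-monoˡ-≤ γ (<⇒≤ (cl-big x h)))

    -- Widths are counted in columns, and a horizontal item counts with the columns that it crosses
    -- completely. A vertical cut sets one whole column aside for vertical items, wherever in that
    -- column it lies.
    data G (c b : ℕ) : List P → Set where
      none : G c b []
      one  : ∀ x → isV x ≡ false → cl x ≤ c → gP x ≤ b → G c b (x ∷ [])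
      hor  : ∀ {L₁ L₂} b₁ b₂ → b₁ + b₂ ≡ b → G c b₁ L₁ → G c b₂ L₂ → G c b (L₁ ++ L₂)
      ver  : ∀ {L₁ L L₂} c₁ c₂ → suc (c₁ + c₂) ≡ c → G c₁ b L₁ → Slice fP gP κ b L → All (λ x → δ ≤ gP x) L → G c₂ b L₂ → G c b (L₁ ++ L ++ L₂)

    inCol : P → Bool
    inCol (x , p) = p + f x ≤ᵇ κ + p / κ * κ

    -- Horizontal items always pass. A vertical one has to be confined to a single column with
    -- number at least `lo` and less than `hi`.
    handled : ℕ → ℕ → P → Bool
    handled lo hi x = if isV x then ((lo ≤ᵇ col x) ∧ (suc (col x) ≤ᵇ hi)) ∧ inCol x else true

    mid : ℕ → P → Bool
    mid k x = isV x ∧ ((k ≤ᵇ col x) ∧ (suc (col x) ≤ᵇ suc k)) ∧ inCol x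

    private
      notV : ∀ {X : Set} → false ≡ true ⊎ X → X
      notV (inj₂ h) = h

      and-true : ∀ {a b} → a ∧ b ≡ true → a ≡ true × b ≡ true
      and-true {true} {true} _ = refl , refl

      handled-left : ∀ {lo k hi} x → col x ≤ k → lo ≤ k → suc k ≤ hi → 𝟙 (handled lo hi x) ≡ 𝟙 (handled lo k x) + 𝟙 (mid k x)
      handled-left {lo} {k} {hi} x c≤k lo≤k k<hi with isV x
      ... | false = refl
      ... | true rewrite ≤ᵇ-true (≤-trans (s≤s c≤k) k<hi) | ≤ᵇ-true (s≤s c≤k) with k ≤? col x
      ... | yes k≤c rewrite ≤ᵇ-true k≤c | ≤ᵇ-true (≤-trans lo≤k k≤c) | ≤ᵇ-false (s≤s k≤c) = refl
      ... | no ¬k≤c rewrite ≤ᵇ-false (≰⇒> ¬k≤c) | ≤ᵇ-true (≰⇒> ¬k≤c) = sym (+-identityʳ _)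

      handled-right : ∀ {lo k hi} x → k ≤ col x → lo ≤ k → suc k ≤ hi → 𝟙 (handled lo hi x) ≡ 𝟙 (mid k x) + 𝟙 (handled (suc k) hi x)
      handled-right {lo} {k} {hi} x k≤c lo≤k k<hi with isV x
      ... | false = refl
      ... | true rewrite ≤ᵇ-true (≤-trans lo≤k k≤c) | ≤ᵇ-true k≤c with col x ≤? k
      ... | yes c≤k rewrite ≤ᵇ-true (s≤s c≤k) | ≤ᵇ-true (≤-trans (s≤s c≤k) k<hi) | ≤ᵇ-false (s≤s c≤k) = sym (+-identityʳ _)
      ... | no ¬c≤k rewrite ≤ᵇ-false (s≤s (≰⇒> ¬c≤k)) | ≤ᵇ-true (≰⇒> ¬c≤k) = refl

      -- Being at least `δ` long, the item crosses some column completely; hence a rectangle without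
      -- an inner column holds no horizontal item.
      crosses : ∀ {o a} x → δ ≤ fP x → o ≤ proj₂ x → proj₂ x + fP x ≤ o + a → suc (o / κ) < (o + a) / κ
      crosses {o} {a} (x , p) long h k = lia 5 (λ c e s e′ s′ → (con 1 :≤ c) ⇒ (c :+ (con 1 :+ s) :≤ e) ⇒ (e :≤ e′) ⇒ (s′ :≤ s) ⇒ ⟨ con 1 :+ s′ :< e′ ⟩) refl
        (cl (x , p)) ((p + f x) / κ) (p / κ) ((o + a) / κ) (o / κ) (≤-trans (s≤s z≤n) cl>)
        (m≤n∸o⇒m+o≤n ((p + f x) / κ) (suc (p / κ)) (cl (x , p)) (≤-trans (s≤s z≤n) cl>) ≤-refl) (/-monoˡ-≤ κ k) (/-monoˡ-≤ κ h)
        where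
        cl> = cl-big (x , p) long
        m≤n∸o⇒m+o≤n : ∀ n o m → 1 ≤ m → m ≤ n ∸ o → m + o ≤ n
        m≤n∸o⇒m+o≤n n o m 1≤m h with o ≤? n
        ... | yes o≤n = ≤-trans (+-monoˡ-≤ o h) (≤-reflexive (m∸n+n≡m o≤n))
        ... | no ¬o rewrite m≤n⇒m∸n≡0 (<⇒≤ (≰⇒> ¬o)) = contradiction (≤-trans 1≤m h) λ ()

    Loc : ℕ → ℕ → P → Set
    Loc o a x = o ≤ proj₂ x × proj₂ x + fP x ≤ o + a

    locs : ∀ {o a b L} → PSlice f g o a b L → All (Loc o a) L
    locs s = All.map (λ { (h , k , _) → h , k }) (located s)

    -- Inner columns are those from `suc (o / κ)` up to but not including `(o + a) / κ`; the column
    -- of the left border never counts. The column `k` of a cut is inner to neither part, and its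
    -- vertical items from both parts form one slice, the restriction of the undivided rectangle to
    -- that column.
    toG : ∀ {o a b L} → PSlice f g o a b L → All Thin L →
          Σ (List P) λ L′ → filterᵇ (handled (suc (o / κ)) ((o + a) / κ)) L ↭ L′ × G ((o + a) / κ ∸ suc (o / κ)) b L′
    toG none _ = [] , ↭-refl , none
    toG {o} {a} {b} (one x p h k l) (t ∷ []) with isV (x , p) in eq
    ... | false = _ , ↭-refl , one (x , p) eq (∸-mono (/-monoˡ-≤ κ k) (s≤s (/-monoˡ-≤ κ h))) l
    ... | true with ((suc (o / κ) ≤ᵇ p / κ) ∧ (suc (p / κ) ≤ᵇ (o + a) / κ)) ∧ inCol (x , p) in eq′
    ... | false = [] , ↭-refl , none
    ... | true with and-true {(suc (o / κ) ≤ᵇ p / κ) ∧ (suc (p / κ) ≤ᵇ (o + a) / κ)} eq′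
    ... | e₁ , e₂ with and-true {suc (o / κ) ≤ᵇ p / κ} e₁
    ... | e₃ , e₄ = _ , ↭-refl , ver (p / κ ∸ suc (o / κ)) ((o + a) / κ ∸ suc (p / κ)) split none
        (one (x , p) fits₁ l) (true-≤ {δ} eq ∷ []) none
      where
      lo≤ = true-≤ {suc (o / κ)} e₃
      ≤hi = true-≤ {suc (p / κ)} e₄
      split : suc (p / κ ∸ suc (o / κ) + ((o + a) / κ ∸ suc (p / κ))) ≡ (o + a) / κ ∸ suc (o / κ)
      split = lia 6 (λ s k e x y z → (con 1 :+ s :+ x :≡ k) ⇒ (con 1 :+ k :+ y :≡ e) ⇒ (con 1 :+ s :+ z :≡ e) ⇒ ⟨ con 1 :+ (x :+ y) :≡ z ⟩) refl
        (o / κ) (p / κ) ((o + a) / κ) (p / κ ∸ suc (o / κ)) ((o + a) / κ ∸ suc (p / κ)) ((o + a) / κ ∸ suc (o / κ))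
        (m+[n∸m]≡n lo≤) (m+[n∸m]≡n ≤hi) (m+[n∸m]≡n (≤-trans lo≤ (≤-trans (n≤1+n _) ≤hi)))
      fits₁ : f x ≤ κ
      fits₁ = lia 4 (λ p f k c → (p :+ f :≤ k :+ c) ⇒ (c :≤ p) ⇒ ⟨ f :≤ k ⟩) refl p (f x) κ (p / κ * κ) (true-≤ {p + f x} e₂) (m/n*n≤m p κ)
    toG (hor {L₁} {L₂} b₁ b₂ e s t) th with toG s (++⁻ˡ L₁ th) | toG t (++⁻ʳ L₁ th)
    ... | M₁ , p₁ , g₁ | M₂ , p₂ , g₂ = M₁ ++ M₂ , ↭-trans (↭-reflexive (filter-++ _ L₁ L₂)) (↭P.++⁺ p₁ p₂) , hor b₁ b₂ e g₁ g₂
    toG {o} {.(a₁ + a₂)} {b} (ver {L₁} {L₂} a₁ a₂ refl s t) th = go (suc (o / κ) ≤? k) (suc k ≤? (o + (a₁ + a₂)) / κ)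
      where
      k = (o + a₁) / κ
      lo = suc (o / κ)
      hi = (o + (a₁ + a₂)) / κ
      hi≡ : (o + a₁ + a₂) / κ ≡ hi
      hi≡ = cong (_/ κ) (+-assoc o a₁ a₂)
      col≤ : All (λ x → col x ≤ k) L₁
      col≤ = All.map (λ {x} → λ { (_ , h) → /-monoˡ-≤ κ (≤-trans (m≤m+n (proj₂ x) (fP x)) h) }) (locs s)
      col≥ : All (λ x → k ≤ col x) L₂
      col≥ = All.map (λ { (h , _) → /-monoˡ-≤ κ h }) (locs t)
      IH₁ = toG s (++⁻ˡ L₁ th)
      IH₂ = toG t (++⁻ʳ L₁ th)
      p₁ : filterᵇ (handled lo k) L₁ ↭ proj₁ IH₁
      p₁ = proj₁ (proj₂ IH₁)
      p₂ : filterᵇ (handled (suc k) hi) L₂ ↭ proj₁ IH₂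
      p₂ = subst (λ z → filterᵇ (handled (suc k) z) L₂ ↭ proj₁ IH₂) hi≡ (proj₁ (proj₂ IH₂))
      g₂ : G (hi ∸ suc k) b (proj₁ IH₂)
      g₂ = subst (λ z → G (z ∸ suc k) b (proj₁ IH₂)) hi≡ (proj₂ (proj₂ IH₂))
      k≤hi : k ≤ hi
      k≤hi = ≤-trans (/-monoˡ-≤ κ (m≤m+n (o + a₁) a₂)) (≤-reflexive hi≡)
      o≤k : o / κ ≤ k
      o≤k = /-monoˡ-≤ κ (m≤m+n o a₁)
      mids : List P
      mids = filterᵇ (mid k) L₁ ++ filterᵇ (mid k) L₂
      midTrue : ∀ M → All (λ x → δ ≤ gP x × Inside {f = f} {g = g} (k * κ) (κ + k * κ) x) (filterᵇ (mid k) M)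
      midTrue M = All.map (λ {x} → conv x) (filter-true (mid k) M)
        where
        conv : ∀ x → mid k x ≡ true → δ ≤ gP x × Inside {f = f} {g = g} (k * κ) (κ + k * κ) x
        conv (x , p) e with and-true {isV (x , p)} e
        ... | v , e′ with and-true {(k ≤ᵇ p / κ) ∧ (suc (p / κ) ≤ᵇ suc k)} e′
        ... | e₁ , e₂ with and-true {k ≤ᵇ p / κ} e₁
        ... | e₃ , e₄ = true-≤ {δ} v , ≤-trans (*-monoˡ-≤ κ (true-≤ {k} e₃)) (m/n*n≤m p κ) ,
          ≤-trans (true-≤ {p + f x} e₂) (+-monoʳ-≤ κ (*-monoˡ-≤ κ (s≤s⁻¹ (true-≤ {suc (p / κ)} e₄))))
      midSlice : Slice fP gP κ b mids
      midSlice = subst (Slice fP gP κ b) (filter-++ (mid k) L₁ L₂) (padS (≤-reflexive (m+n∸n≡m κ (k * κ))) ≤-refl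
        (restrict (k * κ) (κ + k * κ) (filterP (mid k) (ver {L₁ = L₁} {L₂} a₁ a₂ refl s t)) (All.map proj₂ (midTrue (L₁ ++ L₂)))))
      go : Dec (lo ≤ k) → Dec (suc k ≤ hi) → Σ (List P) λ L′ → filterᵇ (handled lo hi) (L₁ ++ L₂) ↭ L′ × G (hi ∸ lo) b L′
      go (yes lo≤k) (yes k<hi) = proj₁ IH₁ ++ mids ++ proj₁ IH₂ ,
          ↭-trans (↭-reflexive (filter-++ _ L₁ L₂)) (↭-trans (↭P.++⁺
            (filter-⊎ (All.map (λ {x} h → handled-left x h lo≤k k<hi) col≤)) (filter-⊎ (All.map (λ {x} h → handled-right x h lo≤k k<hi) col≥)))
            (↭-trans (bag 4 (λ a b c d → (a :++ b) :++ (c :++ d) :↭ a :++ (b :++ c) :++ d) refl (filterᵇ (handled lo k) L₁) (filterᵇ (mid k) L₁) (filterᵇ (mid k) L₂) (filterᵇ (handled (suc k) hi) L₂))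
              (↭P.++⁺ p₁ (↭P.++⁺ˡ mids p₂)))) ,
          ver (k ∸ lo) (hi ∸ suc k) split (proj₂ (proj₂ IH₁)) midSlice (++⁺ (All.map proj₁ (midTrue L₁)) (All.map proj₁ (midTrue L₂))) g₂
        where
        split : suc (k ∸ lo + (hi ∸ suc k)) ≡ hi ∸ lo
        split = lia 6 (λ s k e x y z → (s :+ x :≡ k) ⇒ (con 1 :+ k :+ y :≡ e) ⇒ (s :+ z :≡ e) ⇒ ⟨ con 1 :+ (x :+ y) :≡ z ⟩) refl
          lo k hi (k ∸ lo) (hi ∸ suc k) (hi ∸ lo) (m+[n∸m]≡n lo≤k) (m+[n∸m]≡n k<hi) (m+[n∸m]≡n (≤-trans lo≤k k≤hi))
      -- The cut lies in the column of the left border: the left part has no inner column, hence no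
      -- horizontal item, and none of its vertical items is handled. The next clause is the mirror
      -- image.
      go (no ¬lo≤k) _ = proj₁ IH₂ ,
          ↭-trans (↭-reflexive (trans (filter-++ _ L₁ L₂) (cong (_++ filterᵇ (handled lo hi) L₂) (filter-[] (All.zipWith (λ {x} → λ { (c , (d , h)) → off x c d h }) (col≤ , All.zip (++⁻ˡ L₁ th , locs s)))))))
            (subst (λ z → filterᵇ (handled z hi) L₂ ↭ proj₁ IH₂) (cong suc k≡) p₂) ,
          subst (λ z → G (hi ∸ z) b (proj₁ IH₂)) (cong suc k≡) g₂
        where
        k≡ : k ≡ o / κ
        k≡ = ≤-antisym (s≤s⁻¹ (≰⇒> ¬lo≤k)) o≤k
        off : ∀ x → col x ≤ k → Thin x → Loc o a₁ x → handled lo hi x ≡ false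
        off x c d (h , l) with isV x
        ... | false = contradiction (≤-trans (n≤1+n _) (crosses x (notV d) h l)) ¬lo≤k
        ... | true rewrite ≤ᵇ-false (≤-<-trans c (≰⇒> ¬lo≤k)) = refl
      go (yes lo≤k) (no ¬k<hi) = proj₁ IH₁ ,
          ↭-trans (↭-reflexive (trans (filter-++ _ L₁ L₂) (trans (cong (filterᵇ (handled lo hi) L₁ ++_) (filter-[] (All.zipWith (λ {x} → λ { (c , (d , h)) → off x c d h }) (col≥ , All.zip (++⁻ʳ L₁ th , locs t))))) (++-identityʳ _))))
            (subst (λ z → filterᵇ (handled lo z) L₁ ↭ proj₁ IH₁) k≡ p₁) ,
          subst (λ z → G (z ∸ lo) b (proj₁ IH₁)) k≡ (proj₂ (proj₂ IH₁))
        where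
        k≡ : k ≡ hi
        k≡ = ≤-antisym k≤hi (s≤s⁻¹ (≰⇒> ¬k<hi))
        off : ∀ x → k ≤ col x → Thin x → Loc (o + a₁) a₂ x → handled lo hi x ≡ false
        off x c d (h , l) with isV x
        ... | false = contradiction (≤-trans (n≤1+n _) (≤-trans (crosses x (notV d) h l) (≤-reflexive hi≡))) ¬k<hi
        ... | true rewrite ≤ᵇ-false (≤-trans (s≤s (≤-reflexive (sym k≡))) (s≤s c)) | ∧-zeroʳ (lo ≤ᵇ col x) = refl

    -- Items that cross the same vertical line lie above one another.
    crossing-≤ : ∀ {o a b L} z → PSlice f g o a b L → All (λ x → proj₂ x < z × z < proj₂ x + fP x) L → Σ′ gP L ≤ b
    crossing-≤ z none h = z≤n
    crossing-≤ z (one x p _ _ l) h = ≤-trans (≤-reflexive (+-identityʳ (g x))) l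
    crossing-≤ {o} z (ver {L₁} {L₂} a₁ a₂ e s t) h with z ≤? o + a₁
    ... | yes z≤ = ≤-trans (≤-reflexive (trans (Σ-++ gP L₁ L₂) (trans (cong (Σ′ gP L₁ +_) (empty L₂ (locs t) (++⁻ʳ L₁ h))) (+-identityʳ _)))) (crossing-≤ z s (++⁻ˡ L₁ h))
      where
      empty : ∀ M → All (Loc (o + a₁) a₂) M → All (λ x → proj₂ x < z × z < proj₂ x + fP x) M → Σ′ gP M ≡ 0
      empty [] _ _ = refl
      empty (x ∷ M) ((l , _) ∷ _) ((k , _) ∷ _) = contradiction (≤-trans z≤ l) (<⇒≱ k)
    ... | no ¬z≤ = ≤-trans (≤-reflexive (trans (Σ-++ gP L₁ L₂) (cong (_+ Σ′ gP L₂) (empty L₁ (locs s) (++⁻ˡ L₁ h))))) (crossing-≤ z t (++⁻ʳ L₁ h))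
      where
      empty : ∀ M → All (Loc o a₁) M → All (λ x → proj₂ x < z × z < proj₂ x + fP x) M → Σ′ gP M ≡ 0
      empty [] _ _ = refl
      empty (x ∷ M) ((_ , l) ∷ _) ((_ , k) ∷ _) = contradiction (≤-trans (<⇒≤ k) l) ¬z≤
    crossing-≤ z (hor {L₁} {L₂} b₁ b₂ refl s t) h = ≤-trans (≤-reflexive (Σ-++ gP L₁ L₂)) (+-mono-≤ (crossing-≤ z s (++⁻ˡ L₁ h)) (crossing-≤ z t (++⁻ʳ L₁ h)))

    crossing-# : ∀ {o a b L} q → 1 ≤ δ → b ≤ q * δ → ∀ z → PSlice f g o a b L → All (λ x → δ ≤ gP x) L →
                 length (filterᵇ (λ x → (suc (proj₂ x) ≤ᵇ z) ∧ (suc z ≤ᵇ proj₂ x + fP x)) L) ≤ q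
    crossing-# {L = L} q 1≤δ b≤ z s long = *-cancelˡ-≤ δ ⦃ >-nonZero 1≤δ ⦄ (≤-trans (Σ-lower δ gP (filter-All c long))
      (≤-trans (crossing-≤ z (filterP c s) (All.map (λ {x} e → let (u , v) = and-true {suc (proj₂ x) ≤ᵇ z} e in true-≤ {suc (proj₂ x)} u , true-≤ {suc z} v) (filter-true c L)))
        (≤-trans b≤ (≤-reflexive (*-comm q δ)))))
      where c : P → Bool
            c x = (suc (proj₂ x) ≤ᵇ z) ∧ (suc z ≤ᵇ proj₂ x + fP x)

    -- Rows of height less than δ contain horizontal items only; at most b / δ rows are taller.

    module Mixing (z q : ℕ) (1≤δ : 1 ≤ δ) (1≤γ : 1 ≤ γ) (κ≡ : κ ≡ z * γ) (M : ℕ) where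

      κ′ #H #C : ℕ
      κ′ = κ + γ
      #H = #cfg M (suc M)
      #C = #col z q

      #E : ℕ → ℕ
      #E = #tall z q M

      #E-suc : ∀ c → #E c ≤ #E (suc c)
      #E-suc zero = z≤n
      #E-suc (suc c) = +-mono-≤ (+-monoˡ-≤ #H (*-monoʳ-≤ q (#E-suc c))) (+-monoʳ-≤ #C (+-monoˡ-≤ #H (*-monoʳ-≤ q (#E-suc c))))

      #E-+ : ∀ c d → #E c ≤ #E (d + c)
      #E-+ c zero = ≤-refl
      #E-+ c (suc d) = ≤-trans (#E-+ c d) (#E-suc (d + c))

      aP : List P → ℕ
      aP = area fP gP

      Sized : P → Set
      Sized x = 1 ≤ fP x × 1 ≤ gP x × (δ ≤ gP x ⊎ δ ≤ fP x)

      Flat : P → Set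
      Flat x = 1 ≤ gP x × δ ≤ fP x

      -- The height is divided between low rows and tall blocks. The rows hold horizontal items
      -- only, so rows from all over the tree can be joined; in `rows` width and height are
      -- exchanged. The blocks are packed already, each has height at least `δ`, and `c * κ′ * bT`
      -- pays for the extra strips of their columns.
      record Mix (c b : ℕ) (L : List P) : Set where
        field
          hR bT : ℕ
          height : bT + hR ≡ b
          Hs Ts : List P
          split : L ↭ Hs ++ Ts
          rows : Slice gP cl hR c Hs
          flat : All Flat Hs
          tall U : ℕ
          tall≤ : δ * tall ≤ bT
          used≤′ : z * U ≤ suc z * aP Ts + c * κ′ * bT
          boxes : Pack fP gP (c * κ′) bT Ts U (tall * #E c)

      Packed : ℕ → ℕ → List P → ℕ → Set
      Packed a b L k = Σ ℕ λ U → z * U ≤ suc z * aP L + a * b × Pack fP gP a b L U k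

      -- Measured in columns, the items of the low rows have integral lengths up to `M`. This is the
      -- situation of `exactColumn`, which repacks all rows at once.
      finish : ∀ {c b L} → c ≤ M → b ≤ q * δ → Mix c b L → Packed (c * κ′) b L (q * #E c + #H)
      finish {c} {b} {L} c≤M b≤ m = U + κ′ * area gP cl Hs , bound ,
          packWeaken ≤-refl (+-monoˡ-≤ #H (*-monoˡ-≤ (#E c) tall≤q))
            (packPerm (↭-trans split (bag 2 (λ a b → a :++ b :↭ b :++ a) refl Hs Ts))
              (subst (λ t → Pack fP gP (c * κ′) t (Ts ++ Hs) (U + κ′ * area gP cl Hs) (tall * #E c + #H)) height (packHor boxes flatPack)))
        where
        open Mix m
        flatPack : Pack fP gP (c * κ′) hR Hs (κ′ * area gP cl Hs) #H
        flatPack = subst (λ t → Pack fP gP t hR Hs (κ′ * area gP cl Hs) #H) (*-comm κ′ c) (packSwap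
          (exactColumn fP κ′ M c≤M (All.map (λ {x} → λ { (_ , l) → ≤-trans (s≤s z≤n) (cl-big x l) }) flat) (All.map proj₁ flat) (All.map (λ {x} → λ { (_ , l) → cl-κ′ x l }) flat) rows))
        tall≤q : tall ≤ q
        tall≤q = *-cancelˡ-≤ δ ⦃ >-nonZero 1≤δ ⦄ (≤-trans tall≤ (≤-trans (≤-trans (m≤m+n bT hR) (≤-reflexive height)) (≤-trans b≤ (≤-reflexive (*-comm q δ)))))
        -- `z * κ′ = suc z * κ`, because `κ = z * γ`.
        flatArea : z * (κ′ * area gP cl Hs) ≤ suc z * aP Hs
        flatArea = begin
          z * (κ′ * area gP cl Hs)                ≡⟨ lia 4 (λ z k g a → (k :≡ z :* g) ⇒ (k :* a :≡ z :* g :* a) ⇒ ⟨ z :* ((k :+ g) :* a) :≡ (con 1 :+ z) :* (k :* a) ⟩) refl z κ γ (area gP cl Hs) κ≡ (cong (_* area gP cl Hs) κ≡) ⟩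
          suc z * (κ * area gP cl Hs)             ≡⟨ cong (suc z *_) (Σ-* κ _ Hs) ⟨
          suc z * Σ′ (λ x → κ * (gP x * cl x)) Hs ≤⟨ *-monoʳ-≤ (suc z) (Σ-mono (All.universal (λ x → lia 4 (λ k g c f → (g :* (c :* k) :≤ g :* f) ⇒ ⟨ k :* (g :* c) :≤ f :* g ⟩) refl κ (gP x) (cl x) (fP x) (*-monoʳ-≤ (gP x) (cl-κ x))) Hs)) ⟩
          suc z * aP Hs                           ∎
          where open ≤-Reasoning
        bound : z * (U + κ′ * area gP cl Hs) ≤ suc z * aP L + c * κ′ * b
        bound = lia 10 (λ z u v l h t w bt b hr → (z :* u :≤ (con 1 :+ z) :* t :+ w :* bt) ⇒ (z :* v :≤ (con 1 :+ z) :* h) ⇒ ((con 1 :+ z) :* l :≡ (con 1 :+ z) :* (h :+ t)) ⇒ (w :* b :≡ w :* (bt :+ hr)) ⇒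
            ⟨ z :* (u :+ v) :≤ (con 1 :+ z) :* l :+ w :* b ⟩) refl
          z U (κ′ * area gP cl Hs) (aP L) (aP Hs) (aP Ts) (c * κ′) bT b hR used≤′ flatArea
          (cong (suc z *_) (trans (Σ-↭ _ split) (Σ-++ _ Hs Ts))) (cong (c * κ′ *_) (sym height))

      flatten : ∀ {c b L} → b < δ → G c b L → Slice gP cl b c L
      flatten b< none = none
      flatten b< (one x v c g) = one x g c
      flatten b< (hor b₁ b₂ refl s t) = ver b₁ b₂ refl (flatten (≤-<-trans (m≤m+n b₁ b₂) b<) s) (flatten (≤-<-trans (m≤n+m b₂ b₁) b<) t)
      flatten b< (ver {L₁} {L} {L₂} c₁ c₂ e s t l u) with L | l | fits t
      ... | [] | [] | [] = hor c₁ (suc c₂) (trans (+-suc c₁ c₂) e) (flatten b< s) (padS ≤-refl (n≤1+n c₂) (flatten b< u))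
      ... | x ∷ _ | h ∷ _ | (_ , k) ∷ _ = contradiction (≤-trans h k) (<⇒≱ b<)

      flatAll : ∀ {c b L} → b < δ → G c b L → All Sized L → All Flat L
      flatAll {b = b} b< s h = All.zipWith (λ { (p , (_ , g1 , inj₁ l)) → contradiction (≤-trans l p) (<⇒≱ b<) ; (p , (_ , g1 , inj₂ l)) → g1 , l }) (All.map proj₁ (fits (flatten b< s)) , h)

      onlyRows : ∀ {c b L} → Slice gP cl b c L → All Flat L → Mix c b L
      onlyRows {c} {b} {L} s h = record
        { hR = b ; bT = 0 ; height = refl ; Hs = L ; Ts = [] ; split = ↭-reflexive (sym (++-identityʳ L)) ; rows = s ; flat = h
        ; tall = 0 ; U = 0 ; tall≤ = ≤-reflexive (*-zeroʳ δ) ; used≤′ = ≤-trans (≤-reflexive (*-zeroʳ z)) z≤n ; boxes = packVoid (c * κ′) }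

      mix : ∀ {c b L} → c ≤ M → b ≤ q * δ → G c b L → All Sized L → Mix c b L
      mix c≤ b≤ none h = onlyRows none []
      mix c≤ b≤ (one x v c g) ((_ , g1 , long) ∷ []) = onlyRows (one x g c) ((g1 , notVert long) ∷ [])
        where notVert : δ ≤ gP x ⊎ δ ≤ fP x → δ ≤ fP x
              notVert (inj₁ l) with () ← trans (sym (≤ᵇ-true l)) v
              notVert (inj₂ l) = l
      mix {c} {b} c≤ b≤ (hor {L₁} {L₂} b₁ b₂ refl s t) h = record
        { hR = m₁.hR + m₂.hR ; bT = m₁.bT + m₂.bT
        ; height = trans (lia 4 (λ a b c d → ⟨ a :+ b :+ (c :+ d) :≡ a :+ c :+ (b :+ d) ⟩) refl m₁.bT m₂.bT m₁.hR m₂.hR) (cong₂ _+_ m₁.height m₂.height)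
        ; Hs = m₁.Hs ++ m₂.Hs ; Ts = m₁.Ts ++ m₂.Ts
        ; split = ↭-trans (↭P.++⁺ m₁.split m₂.split) (bag 4 (λ a b c d → (a :++ b) :++ (c :++ d) :↭ (a :++ c) :++ (b :++ d)) refl m₁.Hs m₁.Ts m₂.Hs m₂.Ts)
        ; rows = ver m₁.hR m₂.hR refl m₁.rows m₂.rows
        ; flat = ++⁺ m₁.flat m₂.flat
        ; tall = m₁.tall + m₂.tall ; U = m₁.U + m₂.U
        ; tall≤ = ≤-trans (≤-reflexive (*-distribˡ-+ δ m₁.tall m₂.tall)) (+-mono-≤ m₁.tall≤ m₂.tall≤)
        ; used≤′ = lia 9 (λ z u v t₁ t₂ t w x y → (z :* u :≤ (con 1 :+ z) :* t₁ :+ w :* x) ⇒ (z :* v :≤ (con 1 :+ z) :* t₂ :+ w :* y) ⇒ ((con 1 :+ z) :* t :≡ (con 1 :+ z) :* (t₁ :+ t₂)) ⇒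
              ⟨ z :* (u :+ v) :≤ (con 1 :+ z) :* t :+ w :* (x :+ y) ⟩) refl z m₁.U m₂.U (aP m₁.Ts) (aP m₂.Ts) (aP (m₁.Ts ++ m₂.Ts)) (c * κ′) m₁.bT m₂.bT m₁.used≤′ m₂.used≤′
              (cong (suc z *_) (Σ-++ _ m₁.Ts m₂.Ts))
        ; boxes = packWeaken ≤-refl (≤-reflexive (sym (*-distribʳ-+ (#E c) m₁.tall m₂.tall))) (packHor m₁.boxes m₂.boxes) }
        where
        module m₁ = Mix (mix c≤ (≤-trans (m≤m+n b₁ b₂) b≤) s (++⁻ˡ L₁ h))
        module m₂ = Mix (mix c≤ (≤-trans (m≤n+m b₂ b₁) b≤) t (++⁻ʳ L₁ h))
      mix {c} {b} {L} c≤ b≤ s@(ver {L₁} {Lm} {L₂} c₁ c₂ refl s₁ sm long s₂) h with δ ≤? b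
      -- Below height `δ` the column set aside is empty and rows remain; otherwise the whole block
      -- is a single tall row.
      ... | no ¬δ≤b = onlyRows (flatten (≰⇒> ¬δ≤b) s) (flatAll (≰⇒> ¬δ≤b) s h)
      ... | yes δ≤b = record
        { hR = 0 ; bT = b ; height = +-identityʳ b ; Hs = [] ; Ts = L ; split = ↭-refl ; rows = none ; flat = []
        ; tall = 1 ; U = proj₁ F₁ + (Um + proj₁ F₂) ; tall≤ = ≤-trans (≤-reflexive (*-identityʳ δ)) δ≤b
        ; used≤′ = bound
        ; boxes = packWeaken ≤-refl sizes (subst (λ w → Pack fP gP w b L (proj₁ F₁ + (Um + proj₁ F₂)) ((q * #E c₁ + #H) + (#C + (q * #E c₂ + #H)))) widths
            (packVer (proj₂ (proj₂ F₁)) (packVer colPack (proj₂ (proj₂ F₂))))) }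
        where
        h₁ = ++⁻ˡ L₁ h
        hm = ++⁻ˡ Lm (++⁻ʳ L₁ h)
        h₂ = ++⁻ʳ Lm (++⁻ʳ L₁ h)
        c₁≤ : c₁ ≤ M
        c₁≤ = ≤-trans (≤-trans (m≤m+n c₁ c₂) (n≤1+n _)) c≤
        c₂≤ : c₂ ≤ M
        c₂≤ = ≤-trans (≤-trans (m≤n+m c₂ c₁) (n≤1+n _)) c≤
        F₁ = finish c₁≤ b≤ (mix c₁≤ b≤ s₁ h₁)
        F₂ = finish c₂≤ b≤ (mix c₂≤ b≤ s₂ h₂)
        Um = aP Lm + γ * b
        -- The widening by `γ` serves as the extra strip of linear grouping.
        colPack : Pack fP gP κ′ b Lm Um #C
        colPack = column γ z δ q 1≤γ (≤-reflexive κ≡) 1≤δ long b≤ (All.map proj₁ hm) sm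
        widths : c₁ * κ′ + (κ′ + c₂ * κ′) ≡ suc (c₁ + c₂) * κ′
        widths = lia 3 (λ c d k → ⟨ c :* k :+ (k :+ d :* k) :≡ (con 1 :+ (c :+ d)) :* k ⟩) refl c₁ c₂ κ′
        sizes : (q * #E c₁ + #H) + (#C + (q * #E c₂ + #H)) ≤ 1 * #E (suc (c₁ + c₂))
        sizes = ≤-trans (+-mono-≤ (+-monoˡ-≤ #H (*-monoʳ-≤ q (subst (λ w → #E c₁ ≤ #E w) (+-comm c₂ c₁) (#E-+ c₁ c₂))))
          (+-monoʳ-≤ #C (+-monoˡ-≤ #H (*-monoʳ-≤ q (#E-+ c₂ c₁))))) (≤-reflexive (sym (+-identityʳ _)))
        areas : aP L ≡ aP L₁ + (aP Lm + aP L₂)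
        areas = trans (Σ-++ _ L₁ (Lm ++ L₂)) (cong (aP L₁ +_) (Σ-++ _ Lm L₂))
        bound : z * (proj₁ F₁ + (Um + proj₁ F₂)) ≤ suc z * aP L + suc (c₁ + c₂) * κ′ * b
        bound = ≤-trans (lia 12 (λ z u v x y w a k g b c d → (z :* u :≤ (con 1 :+ z) :* x :+ c :* (k :+ g) :* b) ⇒ (z :* v :≤ (con 1 :+ z) :* y :+ d :* (k :+ g) :* b) ⇒ (z :* (g :* b) :≡ k :* b) ⇒
            ⟨ z :* (u :+ ((w :+ g :* b) :+ v)) :≤ (con 1 :+ z) :* (x :+ (w :+ y)) :+ (con 1 :+ (c :+ d)) :* (k :+ g) :* b ⟩) refl
            z (proj₁ F₁) (proj₁ F₂) (aP L₁) (aP L₂) (aP Lm) 0 κ γ b c₁ c₂ (proj₁ (proj₂ F₁)) (proj₁ (proj₂ F₂)) (trans (sym (*-assoc z γ b)) (cong (_* b) (sym κ≡))))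
          (≤-reflexive (cong (λ w → suc z * w + suc (c₁ + c₂) * κ′ * b) (sym areas)))

      widened : ∀ {a b L} a′ → a ≤ M * κ → M * (κ + γ) ≤ a′ → b ≤ q * δ → All (λ x → 1 ≤ f x × 1 ≤ g x × (δ ≤ g x ⊎ δ ≤ f x)) L → Slice f g a b L →
                Σ ℕ λ U → z * U ≤ suc z * area f g L + a′ * b × Pack f g a′ b L U (#grid z q M)
      widened {a} {b} {L} a′ a≤ a′≥ b≤ sized t = proj₁ F , bound ,
          packPadW a′≥ (packPerm (↭-reflexive (sym P≡)) (packMap proj₁ (packWeaken ≤-refl (+-monoʳ-≤ _ unhandled#)
            (packPerm (↭-trans (partition↭ ok? PL) (↭P.++⁺ʳ _ handled↭)) (packLose (filterᵇ (not ∘ ok?) PL) (proj₂ (proj₂ F)))))))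
        where
        pos = position κ (padS a≤ (≤-refl {b}) t)
        PL : List P
        PL = proj₁ pos
        P≡ : map proj₁ PL ≡ L
        P≡ = proj₁ (proj₂ pos)
        -- The empty column in front turns all `M` columns of the packing into inner ones.
        root : PSlice f g 0 (κ + M * κ) b PL
        root = ver κ (M * κ) refl none (proj₂ (proj₂ pos))
        sizedP : All Sized PL
        sizedP = go PL (subst (All _) (sym P≡) sized)
          where go : ∀ xs → All (λ x → 1 ≤ f x × 1 ≤ g x × (δ ≤ g x ⊎ δ ≤ f x)) (map proj₁ xs) → All Sized xs
                go [] [] = []
                go (x ∷ xs) (h ∷ hs) = h ∷ go xs hs
        thinP : All Thin PL
        thinP = All.map (λ { (_ , _ , inj₁ l) → inj₁ (≤ᵇ-true l) ; (_ , _ , inj₂ l) → inj₂ l }) sizedP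
        lo≡ : suc (0 / κ) ≡ 1
        lo≡ = cong suc (0/n≡0 κ)
        hi≡ : (κ + M * κ) / κ ≡ suc M
        hi≡ = m*n/n≡m (suc M) κ
        ok? : P → Bool
        ok? = handled (suc (0 / κ)) ((κ + M * κ) / κ)
        gg = toG root thinP
        handled↭ : filterᵇ ok? PL ↭ proj₁ gg
        handled↭ = proj₁ (proj₂ gg)
        tree : G M b (proj₁ gg)
        tree = subst (λ c → G c b (proj₁ gg)) (trans (cong₂ _∸_ hi≡ lo≡) refl) (proj₂ (proj₂ gg))
        F = finish ≤-refl b≤ (mix ≤-refl b≤ tree (All-↭ handled↭ (filter-All ok? sizedP)))
        c : ℕ → P → Bool
        c n x = (suc (proj₂ x) ≤ᵇ n * κ) ∧ (suc (n * κ) ≤ᵇ proj₂ x + fP x)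
        -- A vertical item that begins in column `p / κ` and is not handled extends beyond the next
        -- grid line.
        unhandledV : ∀ x → Loc κ (M * κ) x → 1 ≤ fP x → not (ok? x) ≡ true → δ ≤ gP x × Σ ℕ λ n → n < M + 2 × c n x ≡ true
        unhandledV (x , p) (l , r) 1≤f e with δ ≤ᵇ g x in v
        ... | true = true-≤ {δ} v , suc (p / κ) , ≤-trans (s≤s p/κ<) (≤-reflexive (+-comm 2 M)) , cross
          where
          p/κ< : p / κ < suc M
          p/κ< = m<n*o⇒m/o<n {p} {suc M} {κ} (≤-trans (≤-trans (≤-reflexive (+-comm 1 p)) (+-monoʳ-≤ p 1≤f)) r)
          1≤p/κ : 1 ≤ p / κ
          1≤p/κ = ≤-trans (≤-reflexive (sym (n/n≡1 κ))) (/-monoˡ-≤ κ l)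
          off : (p + f x ≤ᵇ κ + p / κ * κ) ≡ false
          off = outside (suc (0 / κ) ≤ᵇ p / κ) (suc (p / κ) ≤ᵇ (κ + M * κ) / κ) (p + f x ≤ᵇ κ + p / κ * κ)
            (≤ᵇ-true (≤-trans (≤-reflexive lo≡) 1≤p/κ)) (≤ᵇ-true (≤-trans p/κ< (≤-reflexive (sym hi≡)))) e
            where
            outside : ∀ a b c → a ≡ true → b ≡ true → not ((a ∧ b) ∧ c) ≡ true → c ≡ false
            outside true true false _ _ _ = refl
          cross : c (suc (p / κ)) (x , p) ≡ true
          cross rewrite ≤ᵇ-true (div< p) | ≤ᵇ-true (false-> {p + f x} off) = refl
        un = filterᵇ (not ∘ ok?) PL
        unSpec : All (λ x → δ ≤ gP x × Σ ℕ λ n → n < M + 2 × c n x ≡ true) un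
        unSpec = All.zipWith (λ {x} → λ { ((lc , 1≤f) , e) → unhandledV x lc 1≤f e })
          (filter-All (not ∘ ok?) (All.zipWith (λ { (a , (b , _)) → a , b }) (locs (proj₂ (proj₂ pos)) , sizedP)) , filter-true (not ∘ ok?) PL)
        unhandled# : length un ≤ (M + 2) * q
        unhandled# = ≤-trans (unionBound (M + 2) c (All.map proj₂ unSpec)) (upΣ-≤ (M + 2) _ q
          (λ n → crossing-# q 1≤δ b≤ (n * κ) (filterP (not ∘ ok?) root) (All.map proj₁ unSpec)))
        bound : z * proj₁ F ≤ suc z * area f g L + a′ * b
        bound = ≤-trans (proj₁ (proj₂ F)) (+-mono-≤ (*-monoʳ-≤ (suc z) (≤-trans (≤-reflexive (sym (Σ-↭ _ handled↭)))
          (≤-trans (≤-trans (m≤m+n _ _) (≤-reflexive (trans (sym (Σ-++ _ (filterᵇ ok? PL) un)) (sym (Σ-↭ _ (partition↭ ok? PL)))))) (≤-reflexive (trans (sym (Σ-map proj₁ _ PL)) (cong (area f g) P≡))))))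
          (*-monoˡ-≤ b a′≥))

  slackPack : ∀ {A : Set} {f g : A → ℕ} {a b L} δ κ γ B z q M a′ → 1 ≤ δ → 1 ≤ κ → 1 ≤ γ → κ ≡ z * γ → (B + 2) * κ ≤ δ → 2 * κ ≤ B * γ →
              a ≤ M * κ → M * (κ + γ) ≤ a′ → b ≤ q * δ → All (λ x → 1 ≤ f x × 1 ≤ g x × (δ ≤ g x ⊎ δ ≤ f x)) L → Slice f g a b L →
              Σ ℕ λ U → z * U ≤ suc z * area f g L + a′ * b × Pack f g a′ b L U (#grid z q M)
  slackPack {f = f} {g} δ κ γ B z q M a′ 1≤δ 1≤κ 1≤γ κ≡ Bκ≤δ κ≤Bγ = Columns.Mixing.widened f g δ κ γ B 1≤κ Bκ≤δ κ≤Bγ z q 1≤δ 1≤γ κ≡ M a′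

  -- Frames

  pow2 : ℕ → ℕ
  pow2 zero = 1
  pow2 (suc n) = pow2 n + pow2 n

  1≤pow2 : ∀ n → 1 ≤ pow2 n
  1≤pow2 zero = ≤-refl
  1≤pow2 (suc n) = ≤-trans (1≤pow2 n) (m≤m+n _ _)

  -- A strip of width p, peeled off after strips of total width x, lies in the gap between θ′ and θ.
  inGap : (θ θ′ x p : ℕ) → Bool
  inGap θ θ′ x p = ((x ≤ᵇ θ) ∧ (p ≤ᵇ θ)) ∧ (suc θ′ ≤ᵇ x + p)

  -- A part narrower than `δ` is peeled off, and its items are charged if it falls into the gap. `x`
  -- is the width peeled so far by cuts of the same direction, `y` by those of the other; both start
  -- again from 0 after a balanced cut.
  stepCost : (δ θ θ′ a₁ a₂ l₁ l₂ : ℕ) → (ℕ → ℕ → ℕ) → (ℕ → ℕ → ℕ) → ℕ → ℕ → ℕ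
  stepCost δ θ θ′ a₁ a₂ l₁ l₂ c₁ c₂ x y with δ ≤? a₁ | δ ≤? a₂
  ... | yes _ | yes _ = c₁ 0 0 + c₂ 0 0
  ... | yes _ | no _ = 𝟙 (inGap θ θ′ x a₂) * l₂ + c₁ (x + a₂) y
  ... | no _ | _ = 𝟙 (inGap θ θ′ x a₁) * l₁ + c₂ (x + a₁) y

  module _ {A : Set} {f g : A → ℕ} where

    gapCost : (δ θ θ′ : ℕ) → ∀ {a b L} → Slice f g a b L → ℕ → ℕ → ℕ
    gapCost δ θ θ′ none x y = 0
    gapCost δ θ θ′ (one _ _ _) x y = 0
    gapCost δ θ θ′ (ver {L₁} {L₂} a₁ a₂ e s t) x y = stepCost δ θ θ′ a₁ a₂ (length L₁) (length L₂) (gapCost δ θ θ′ s) (gapCost δ θ θ′ t) x y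
    gapCost δ θ θ′ (hor {L₁} {L₂} b₁ b₂ e s t) x y =
      stepCost δ θ θ′ b₁ b₂ (length L₁) (length L₂) (λ v u → gapCost δ θ θ′ s u v) (λ v u → gapCost δ θ θ′ t u v) y x

    module _ (δ : ℕ) (θ θ′ : ℕ → ℕ) (J : ℕ) (sep : ∀ x p → upΣ J (λ j → 𝟙 (inGap (θ j) (θ′ j) x p)) ≤ 1) where

      private
        upΣ-+ : ∀ n c d → upΣ n (λ j → c j + d j) ≡ upΣ n c + upΣ n d
        upΣ-+ zero c d = refl
        upΣ-+ (suc n) c d rewrite upΣ-+ n c d = lia 4 (λ a b c d → ⟨ a :+ b :+ (c :+ d) :≡ a :+ c :+ (b :+ d) ⟩) refl (upΣ n c) (upΣ n d) (c n) (d n)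

        upΣ-* : ∀ n c k → upΣ n (λ j → c j * k) ≡ upΣ n c * k
        upΣ-* zero c k = refl
        upΣ-* (suc n) c k rewrite upΣ-* n c k = sym (*-distribʳ-+ k (upΣ n c) (c n))

        step : ∀ a₁ a₂ l₁ l₂ (c₁ c₂ : ℕ → ℕ → ℕ → ℕ) → (∀ x y → upΣ J (λ j → c₁ j x y) ≤ l₁) → (∀ x y → upΣ J (λ j → c₂ j x y) ≤ l₂) →
               ∀ x y → upΣ J (λ j → stepCost δ (θ j) (θ′ j) a₁ a₂ l₁ l₂ (c₁ j) (c₂ j) x y) ≤ l₁ + l₂
        step a₁ a₂ l₁ l₂ c₁ c₂ h₁ h₂ x y with δ ≤? a₁ | δ ≤? a₂
        ... | yes _ | yes _ = ≤-trans (≤-reflexive (upΣ-+ J (λ j → c₁ j 0 0) (λ j → c₂ j 0 0))) (+-mono-≤ (h₁ 0 0) (h₂ 0 0))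
        ... | yes _ | no _ = ≤-trans (≤-reflexive (upΣ-+ J (λ j → 𝟙 (inGap (θ j) (θ′ j) x a₂) * l₂) (λ j → c₁ j (x + a₂) y)))
            (≤-trans (+-mono-≤ (≤-trans (≤-reflexive (upΣ-* J (λ j → 𝟙 (inGap (θ j) (θ′ j) x a₂)) l₂)) (*-monoˡ-≤ l₂ (sep x a₂))) (h₁ (x + a₂) y))
              (≤-reflexive (lia 2 (λ a b → ⟨ con 1 :* a :+ b :≡ b :+ a ⟩) refl l₂ l₁)))
        ... | no _ | _ = ≤-trans (≤-reflexive (upΣ-+ J (λ j → 𝟙 (inGap (θ j) (θ′ j) x a₁) * l₁) (λ j → c₂ j (x + a₁) y)))
            (≤-trans (+-mono-≤ (≤-trans (≤-reflexive (upΣ-* J (λ j → 𝟙 (inGap (θ j) (θ′ j) x a₁)) l₁)) (*-monoˡ-≤ l₁ (sep x a₁))) (h₂ (x + a₁) y))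
              (≤-reflexive (cong (_+ l₂) (*-identityˡ l₁))))

        upΣ-0 : ∀ n → upΣ n (λ _ → 0) ≤ 0
        upΣ-0 zero = z≤n
        upΣ-0 (suc n) = ≤-trans (≤-reflexive (+-identityʳ _)) (upΣ-0 n)

      -- The peeled strips are disjoint, and by `sep` each of them is charged for at most one index
      -- `j`.
      gapCost-total : ∀ {a b L} (t : Slice f g a b L) x y → upΣ J (λ j → gapCost δ (θ j) (θ′ j) t x y) ≤ length L
      gapCost-total none x y = upΣ-0 J
      gapCost-total (one _ _ _) x y = ≤-trans (upΣ-0 J) z≤n
      gapCost-total (ver {L₁} {L₂} a₁ a₂ e s t) x y = ≤-trans (step a₁ a₂ (length L₁) (length L₂) _ _ (gapCost-total s) (gapCost-total t) x y) (≤-reflexive (sym (length-++ L₁)))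
      gapCost-total (hor {L₁} {L₂} a₁ a₂ e s t) x y = ≤-trans
        (step a₁ a₂ (length L₁) (length L₂) (λ j v u → gapCost δ (θ j) (θ′ j) s u v) (λ j v u → gapCost δ (θ j) (θ′ j) t u v) (λ v u → gapCost-total s u v) (λ v u → gapCost-total t u v) y x)
        (≤-reflexive (sym (length-++ L₁)))

  -- By `qΘ≤θ` a strip wider than `θ` has a cheap window of width `Θ`. By `θ′Θ≤θ`, peeled strips
  -- that outgrow `θ` leave `Θ` free beside an arm of width at most `θ′`.
  record FrameSizes : Set where
    field
      δ μ q θ θ′ Θ : ℕ
      1≤δ : 1 ≤ δ
      1≤q : 1 ≤ q
      μ≤Θ : μ ≤ Θ
      qΘ≤θ : q * Θ ≤ θ
      θ′Θ≤θ : θ′ + Θ ≤ θ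

  module FrameTheory {A : Set} (sizes : FrameSizes) where
    open FrameSizes sizes

    Item : (f g : A → ℕ) → A → Set
    Item f g x = 1 ≤ f x × 1 ≤ g x × ((δ ≤ g x × f x ≤ μ) ⊎ (δ ≤ f x × g x ≤ μ))

    swapItem : ∀ {f g x} → Item f g x → Item g f x
    swapItem (p , q , inj₁ h) = q , p , inj₂ h
    swapItem (p , q , inj₂ h) = q , p , inj₁ h

    mutual
      -- Vertical items Vs in an arm of width X, horizontal items Hs in an arm of height Y, discarded
      -- items Ds, and a core: it ends with a free strip of width Θ (exit) or at a balanced cut (bal).
      data Fr (f g : A → ℕ) (n a b : ℕ) (L : List A) : Set where
        frame : ∀ X Y ac bc (Vs Hs Ds Cs : List A) → X + ac ≡ a → Y + bc ≡ b → X ≤ θ′ → Y ≤ θ′ →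
                Slice f g X b Vs → Slice f g a Y Hs → All (λ x → δ ≤ g x) Vs → All (λ x → δ ≤ f x) Hs →
                Core f g n ac bc Cs → L ↭ Vs ++ Hs ++ Ds ++ Cs → Fr f g n a b L

      data Core (f g : A → ℕ) : ℕ → ℕ → ℕ → List A → Set where
        empty : ∀ {n a b} → Core f g n a b []
        exitX : ∀ {n a b C} a′ b′ → a′ + Θ ≤ a → b′ ≤ b → Slice f g a′ b′ C → Core f g n a b C
        exitY : ∀ {n a b C} a′ b′ → a′ ≤ a → b′ + Θ ≤ b → Slice f g a′ b′ C → Core f g n a b C
        balX  : ∀ {n a b C₁ C₂} a₁ a₂ b′ → δ ≤ a₁ → δ ≤ a₂ → a₁ + a₂ ≤ a → b′ ≤ b →
                Fr f g n a₁ b′ C₁ → Fr f g n a₂ b′ C₂ → Core f g (suc n) a b (C₁ ++ C₂)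
        balY  : ∀ {n a b C₁ C₂} b₁ b₂ a′ → δ ≤ b₁ → δ ≤ b₂ → a′ ≤ a → b₁ + b₂ ≤ b →
                Fr f g n a′ b₁ C₁ → Fr f g n a′ b₂ C₂ → Core f g (suc n) a b (C₁ ++ C₂)

    mutual
      drops : ∀ {f g n a b L} → Fr f g n a b L → ℕ
      drops (frame _ _ _ _ _ _ Ds _ _ _ _ _ _ _ _ _ c _) = length Ds + dropsC c

      dropsC : ∀ {f g n a b L} → Core f g n a b L → ℕ
      dropsC empty = 0
      dropsC (exitX _ _ _ _ _) = 0
      dropsC (exitY _ _ _ _ _) = 0
      dropsC (balX _ _ _ _ _ _ _ F₁ F₂) = drops F₁ + drops F₂
      dropsC (balY _ _ _ _ _ _ _ F₁ F₂) = drops F₁ + drops F₂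

    mutual
      swapFr : ∀ {f g n a b L} → Fr f g n a b L → Fr g f n b a L
      swapFr (frame X Y ac bc Vs Hs Ds Cs p q r s vs hs lv lh c pm) =
        frame Y X bc ac Hs Vs Ds Cs q p s r (swapS hs) (swapS vs) lh lv (swapCore c)
          (↭-trans pm (bag 3 (λ v h r → v :++ (h :++ r) :↭ h :++ (v :++ r)) refl Vs Hs (Ds ++ Cs)))

      swapCore : ∀ {f g n a b L} → Core f g n a b L → Core g f n b a L
      swapCore empty = empty
      swapCore (exitX a′ b′ p q s) = exitY b′ a′ q p (swapS s)
      swapCore (exitY a′ b′ p q s) = exitX b′ a′ q p (swapS s)
      swapCore (balX a₁ a₂ b′ p q r s F₁ F₂) = balY a₁ a₂ b′ p q s r (swapFr F₁) (swapFr F₂)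
      swapCore (balY a₁ a₂ b′ p q r s F₁ F₂) = balX a₁ a₂ b′ p q s r (swapFr F₁) (swapFr F₂)

    mutual
      drops-swap : ∀ {f g n a b L} (F : Fr f g n a b L) → drops (swapFr F) ≡ drops F
      drops-swap (frame _ _ _ _ _ _ Ds _ _ _ _ _ _ _ _ _ c _) = cong (length Ds +_) (dropsC-swap c)

      dropsC-swap : ∀ {f g n a b L} (c : Core f g n a b L) → dropsC (swapCore c) ≡ dropsC c
      dropsC-swap empty = refl
      dropsC-swap (exitX _ _ _ _ _) = refl
      dropsC-swap (exitY _ _ _ _ _) = refl
      dropsC-swap (balX _ _ _ _ _ _ _ F₁ F₂) = cong₂ _+_ (drops-swap F₁) (drops-swap F₂)
      dropsC-swap (balY _ _ _ _ _ _ _ F₁ F₂) = cong₂ _+_ (drops-swap F₁) (drops-swap F₂)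

    permFr : ∀ {f g n a b L L′} → L′ ↭ L → Fr f g n a b L → Fr f g n a b L′
    permFr p (frame X Y ac bc Vs Hs Ds Cs e₁ e₂ r s vs hs lv lh c pm) = frame X Y ac bc Vs Hs Ds Cs e₁ e₂ r s vs hs lv lh c (↭-trans p pm)

    drops-perm : ∀ {f g n a b L L′} (p : L′ ↭ L) (F : Fr f g n a b L) → drops (permFr p F) ≡ drops F
    drops-perm p (frame _ _ _ _ _ _ _ _ _ _ _ _ _ _ _ _ _ _) = refl

    -- Continuing to peel the remaining a′ × b′ rectangle, holding the items L, of a frame
    -- whose arms so far have widths X and Y, strips of widths e and e′ having been discarded.
    Chain : (f g : A → ℕ) (a′ b′ : ℕ) (L : List A) (c : ℕ → ℕ → ℕ) → Set
    Chain f g a′ b′ L c = ∀ n a b X e Y e′ Vs Hs Ds → X + (e + a′) ≡ a → Y + (e′ + b′) ≡ b →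
      X + e ≤ θ → Y + e′ ≤ θ → X ≤ θ′ → Y ≤ θ′ → a + b ≤ n * δ →
      Slice f g X b Vs → Slice f g a Y Hs → All (λ x → δ ≤ g x) Vs → All (λ x → δ ≤ f x) Hs →
      Σ (Fr f g n a b (Vs ++ Hs ++ Ds ++ L)) λ F → q * drops F ≤ q * length Ds + q * c (X + e) (Y + e′) + 2 * length L + q * pow2 n

    swapChain : ∀ {f g a′ b′ L c} → Chain f g a′ b′ L c → Chain g f b′ a′ L (λ y x → c x y)
    swapChain {L = L} ch n a b X e Y e′ Vs Hs Ds p p′ r s t u v vs hs lv lh
      with ch n b a Y e′ X e Hs Vs Ds p′ p s r u t (≤-trans (≤-reflexive (+-comm b a)) v) (swapS hs) (swapS vs) lh lv
    ... | F , le = permFr pm (swapFr F) , ≤-trans (≤-reflexive (cong (q *_) (trans (drops-perm pm (swapFr F)) (drops-swap F)))) le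
      where pm = bag 3 (λ v h r → v :++ (h :++ r) :↭ h :++ (v :++ r)) refl Vs Hs (Ds ++ L)

    private
      finishD : ∀ {q d D w c L p} → q * w ≤ 2 * L → d ≡ D + w → q * d ≤ q * D + q * c + 2 * L + q * p
      finishD {q} {d} {D} {w} {c} {L} {p} h refl = lia 6 (λ q D w c L p → (q :* w :≤ con 2 :* L) ⇒ ⟨ q :* (D :+ w) :≤ q :* D :+ q :* c :+ con 2 :* L :+ q :* p ⟩) refl q D w c L p h

    -- A strip wider than `θ` is cleared along a window and ends the frame. Otherwise it joins the
    -- arm as long as the total width stays within `θ′`. Beyond that it falls into the gap and its
    -- items are discarded at the expense of `gapCost`; then either peeling goes on, or the
    -- discarded strips amount to a free strip of width `Θ`.
    strip : ∀ {f g b′ S R c} p r → p < δ → All (Item f g) S → Slice f g p b′ S → Slice f g r b′ R → Chain f g r b′ R c →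
            Chain f g (p + r) b′ (S ++ R) (λ x y → 𝟙 (inGap θ θ′ x p) * length S + c (x + p) y)
    strip {f} {g} {b′} {S} {R} {c} p r p<δ items ss rs ch n a b X e Y e′ Vs Hs Ds refl refl xe ye X≤ Y≤ ab vs hs lv lh = go (p ≤? θ)
      where
      vertical : All (λ x → δ ≤ g x × f x ≤ μ) S
      vertical = All.zipWith (λ { ((fx , _) , (_ , _ , inj₁ h)) → h ; ((fx , _) , (_ , _ , inj₂ (h , _))) → contradiction (≤-trans h fx) (<⇒≱ p<δ) }) (fits ss , items)
      cst = 𝟙 (inGap θ θ′ (X + e) p) * length S + c (X + e + p) (Y + e′)
      Goal = Σ (Fr f g n (X + (e + (p + r))) (Y + (e′ + b′)) (Vs ++ Hs ++ Ds ++ S ++ R)) λ F → q * drops F ≤ q * length Ds + q * cst + 2 * length (S ++ R) + q * pow2 n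
      recurse : ∀ X₁ e₁ Vs₁ Ds₁ → X₁ + (e₁ + r) ≡ X + (e + (p + r)) → X₁ + e₁ ≡ X + e + p → X₁ + e₁ ≤ θ → X₁ ≤ θ′ →
                Slice f g X₁ (Y + (e′ + b′)) Vs₁ → All (λ x → δ ≤ g x) Vs₁ → Vs ++ Hs ++ Ds ++ S ++ R ↭ Vs₁ ++ Hs ++ Ds₁ ++ R →
                length Ds₁ ≤ length Ds + 𝟙 (inGap θ θ′ (X + e) p) * length S → Goal
      recurse X₁ e₁ Vs₁ Ds₁ eq x≡ x≤ X₁≤ vs₁ lv₁ pm d≤ with ch n _ _ X₁ e₁ Y e′ Vs₁ Hs Ds₁ eq refl x≤ ye X₁≤ Y≤ ab vs₁ hs lv₁ lh
      ... | F , le = permFr pm F , ≤-trans (≤-reflexive (cong (q *_) (drops-perm pm F))) (≤-trans le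
          (≤-trans (≤-reflexive (cong (λ x → q * length Ds₁ + q * c x (Y + e′) + 2 * length R + q * pow2 n) x≡))
            (lia 8 (λ q d₁ d w c l s p → (q :* d₁ :≤ q :* (d :+ w)) ⇒ ⟨ q :* d₁ :+ q :* c :+ con 2 :* l :+ q :* p :≤ q :* d :+ q :* (w :+ c) :+ con 2 :* (s :+ l) :+ q :* p ⟩) refl
              q (length Ds₁) (length Ds) (𝟙 (inGap θ θ′ (X + e) p) * length S) (c (X + e + p) (Y + e′)) (length R) (length S) (pow2 n) (*-monoʳ-≤ q d≤)
            |> λ h → ≤-trans h (≤-reflexive (cong (λ l → q * length Ds + q * cst + 2 * l + q * pow2 n) (sym (length-++ S)))))))
      go : Dec (p ≤ θ) → Goal
      go (no ¬p≤θ) = wide (window q Θ 1≤q (≤-trans qΘ≤θ (<⇒≤ (≰⇒> ¬p≤θ))) (All.map (λ { (_ , h) → ≤-trans h μ≤Θ }) vertical) ss)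
        where
        Θ≤p : Θ ≤ p
        Θ≤p = ≤-trans (≤-trans (m≤n+m Θ θ′) θ′Θ≤θ) (<⇒≤ (≰⇒> ¬p≤θ))
        wide : (Σ (List A) λ kept → Σ (List A) λ lost → S ↭ kept ++ lost × q * length lost ≤ 2 * length S × Slice f g (p ∸ Θ) b′ kept) → Goal
        wide (kept , lost , pm , le , ks) =
          frame X Y (e + (p + r)) (e′ + b′) Vs Hs (Ds ++ lost) (kept ++ R) refl refl X≤ Y≤ vs hs lv lh
            (exitX ((p ∸ Θ) + r) b′ (lia 5 (λ d t p r e → (d :+ t :≡ p) ⇒ ⟨ d :+ r :+ t :≤ e :+ (p :+ r) ⟩) refl (p ∸ Θ) Θ p r e (m∸n+n≡m Θ≤p)) (m≤n+m b′ e′) (ver (p ∸ Θ) r refl ks rs))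
            (↭P.++⁺ˡ Vs (↭P.++⁺ˡ Hs (↭-trans (↭P.++⁺ˡ Ds (↭P.++⁺ʳ R pm)) (bag 4 (λ d k l r → d :++ ((k :++ l) :++ r) :↭ (d :++ l) :++ (k :++ r)) refl Ds kept lost R)))) ,
          finishD {q} {c = cst} {L = length (S ++ R)} (≤-trans le (*-monoʳ-≤ 2 {length S} (≤-trans (m≤m+n (length S) (length R)) (≤-reflexive (sym (length-++ S {R})))))) (trans (+-identityʳ _) (length-++ Ds))
      go (yes p≤θ) with X + e + p ≤? θ′
      ... | yes small = recurse (X + p) e (Vs ++ S) Ds (lia 4 (λ x e p r → ⟨ x :+ p :+ (e :+ r) :≡ x :+ (e :+ (p :+ r)) ⟩) refl X e p r) x≡
          (≤-trans (≤-reflexive x≡) (≤-trans small (≤-trans (m≤m+n θ′ Θ) θ′Θ≤θ))) (≤-trans (m≤m+n (X + p) e) (≤-trans (≤-reflexive x≡) small))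
          (ver X p refl vs (padS ≤-refl (≤-trans (m≤n+m b′ e′) (m≤n+m _ Y)) ss)) (++⁺ lv (All.map proj₁ vertical))
          (bag 5 (λ v h d s r → v :++ (h :++ (d :++ (s :++ r))) :↭ (v :++ s) :++ (h :++ (d :++ r))) refl Vs Hs Ds S R) (m≤m+n _ _)
        where
        x≡ : X + p + e ≡ X + e + p
        x≡ = lia 3 (λ x p e → ⟨ x :+ p :+ e :≡ x :+ e :+ p ⟩) refl X p e
      ... | no ¬small = gap (X + e + p ≤? θ)
        where
        bad : inGap θ θ′ (X + e) p ≡ true
        bad rewrite ≤ᵇ-true xe | ≤ᵇ-true p≤θ | ≤ᵇ-true (≰⇒> ¬small) = refl
        one′ : 𝟙 (inGap θ θ′ (X + e) p) * length S ≡ length S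
        one′ = trans (cong (λ z → 𝟙 z * length S) bad) (+-identityʳ _)
        gap : Dec (X + e + p ≤ θ) → Goal
        gap (yes ok) = recurse X (e + p) Vs (Ds ++ S) (lia 4 (λ x e p r → ⟨ x :+ (e :+ p :+ r) :≡ x :+ (e :+ (p :+ r)) ⟩) refl X e p r) (sym (+-assoc X e p))
          (≤-trans (≤-reflexive (sym (+-assoc X e p))) ok) X≤ vs lv (bag 5 (λ v h d s r → v :++ (h :++ (d :++ (s :++ r))) :↭ v :++ (h :++ ((d :++ s) :++ r))) refl Vs Hs Ds S R)
          (≤-reflexive (trans (length-++ Ds) (cong (length Ds +_) (sym one′))))
        gap (no ¬ok) = frame X Y (e + (p + r)) (e′ + b′) Vs Hs (Ds ++ S) R refl refl X≤ Y≤ vs hs lv lh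
            (exitX r b′ (lia 7 (λ r t e p x θ θ′ → (θ :< x :+ e :+ p) ⇒ (x :≤ θ′) ⇒ (θ′ :+ t :≤ θ) ⇒ ⟨ r :+ t :≤ e :+ (p :+ r) ⟩) refl r Θ e p X θ θ′ (≰⇒> ¬ok) X≤ θ′Θ≤θ) (m≤n+m b′ e′) rs)
            (bag 5 (λ v h d s r → v :++ (h :++ (d :++ (s :++ r))) :↭ v :++ (h :++ ((d :++ s) :++ r))) refl Vs Hs Ds S R) ,
          ≤-trans (≤-reflexive (cong (q *_) (trans (+-identityʳ _) (trans (length-++ Ds) (cong (length Ds +_) (sym one′))))))
            (lia 6 (λ q d w c l p → ⟨ q :* (d :+ w) :≤ q :* d :+ q :* (w :+ c) :+ con 2 :* l :+ q :* p ⟩) refl q (length Ds) (𝟙 (inGap θ θ′ (X + e) p) * length S) (c (X + e + p) (Y + e′)) (length (S ++ R)) (pow2 n))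

    -- The cut takes at least `δ` away from each part, so the bound on `a + b` drops from `suc n` to
    -- `n` times `δ`: at most `n` balanced cuts are nested. The terms `pow2 n` of both parts add up
    -- to `pow2 (suc n)`.
    balanced : ∀ {f g b′ L₁ L₂ c₁ c₂} a₁ a₂ → δ ≤ a₁ → δ ≤ a₂ → Chain f g a₁ b′ L₁ c₁ → Chain f g a₂ b′ L₂ c₂ →
               Chain f g (a₁ + a₂) b′ (L₁ ++ L₂) (λ _ _ → c₁ 0 0 + c₂ 0 0)
    balanced a₁ a₂ δ₁ δ₂ ch₁ ch₂ zero a b X e Y e′ Vs Hs Ds refl eb xe ye X≤ Y≤ ab =
      contradiction (≤-trans 1≤δ (≤-trans (≤-trans (≤-trans (≤-trans δ₁ (m≤m+n a₁ a₂)) (m≤n+m _ e)) (≤-trans (m≤n+m _ X) (m≤m+n _ b))) ab)) λ ()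
    balanced {b′ = b′} {L₁} {L₂} {c₁} {c₂} a₁ a₂ δ₁ δ₂ ch₁ ch₂ (suc n) a b X e Y e′ Vs Hs Ds ea eb xe ye X≤ Y≤ ab vs hs lv lh
      with ch₁ n a₁ b′ 0 0 0 0 [] [] [] refl refl z≤n z≤n z≤n z≤n (lia 9 (λ a b d a₁ a₂ b′ x y n → (a :+ b :≤ d :+ n) ⇒ (d :≤ a₂) ⇒ (x :+ (a₁ :+ a₂) :≡ a) ⇒ (y :+ b′ :≡ b) ⇒ ⟨ a₁ :+ b′ :≤ n ⟩) refl a b δ a₁ a₂ b′ (X + e) (Y + e′) (n * δ) ab δ₂ (trans (+-assoc X e _) ea) (trans (+-assoc Y e′ _) eb)) none none [] []
         | ch₂ n a₂ b′ 0 0 0 0 [] [] [] refl refl z≤n z≤n z≤n z≤n (lia 9 (λ a b d a₁ a₂ b′ x y n → (a :+ b :≤ d :+ n) ⇒ (d :≤ a₁) ⇒ (x :+ (a₁ :+ a₂) :≡ a) ⇒ (y :+ b′ :≡ b) ⇒ ⟨ a₂ :+ b′ :≤ n ⟩) refl a b δ a₁ a₂ b′ (X + e) (Y + e′) (n * δ) ab δ₁ (trans (+-assoc X e _) ea) (trans (+-assoc Y e′ _) eb)) none none [] []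
    ... | F₁ , le₁ | F₂ , le₂ = frame X Y (e + (a₁ + a₂)) (e′ + b′) Vs Hs Ds (L₁ ++ L₂) ea eb X≤ Y≤ vs hs lv lh
          (balX a₁ a₂ b′ δ₁ δ₂ (m≤n+m _ e) (m≤n+m b′ e′) F₁ F₂) ↭-refl ,
        ≤-trans (lia 9 (λ q d d₁ d₂ c₁ c₂ l₁ l₂ p → (q :* d₁ :≤ q :* con 0 :+ q :* c₁ :+ con 2 :* l₁ :+ q :* p) ⇒ (q :* d₂ :≤ q :* con 0 :+ q :* c₂ :+ con 2 :* l₂ :+ q :* p) ⇒
            ⟨ q :* (d :+ (d₁ :+ d₂)) :≤ q :* d :+ q :* (c₁ :+ c₂) :+ con 2 :* (l₁ :+ l₂) :+ q :* (p :+ p) ⟩) refl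
            q (length Ds) (drops F₁) (drops F₂) (c₁ 0 0) (c₂ 0 0) (length L₁) (length L₂) (pow2 n) le₁ le₂)
          (≤-reflexive (cong (λ l → q * length Ds + q * (c₁ 0 0 + c₂ 0 0) + 2 * l + q * (pow2 n + pow2 n)) (sym (length-++ L₁))))

    permChain : ∀ {f g a b L L′ c} → L′ ↭ L → Chain f g a b L c → Chain f g a b L′ c
    permChain {L = L} {L′} p ch n a b X e Y e′ Vs Hs Ds ea eb xe ye X≤ Y≤ ab vs hs lv lh with ch n a b X e Y e′ Vs Hs Ds ea eb xe ye X≤ Y≤ ab vs hs lv lh
    ... | F , le = permFr pm F , ≤-trans (≤-reflexive (cong (q *_) (drops-perm pm F)))
        (≤-trans le (≤-reflexive (cong (λ l → q * length Ds + _ + 2 * l + _) (sym (length-↭ p)))))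
      where pm = ↭P.++⁺ˡ Vs (↭P.++⁺ˡ Hs (↭P.++⁺ˡ Ds p))

    stepV : ∀ {f g b′ L₁ L₂ c₁ c₂} a₁ a₂ → All (Item f g) L₁ → All (Item f g) L₂ → Slice f g a₁ b′ L₁ → Slice f g a₂ b′ L₂ →
            Chain f g a₁ b′ L₁ c₁ → Chain f g a₂ b′ L₂ c₂ → Chain f g (a₁ + a₂) b′ (L₁ ++ L₂) (stepCost δ θ θ′ a₁ a₂ (length L₁) (length L₂) c₁ c₂)
    stepV {f} {g} {b′} {L₁} {L₂} {c₁} {c₂} a₁ a₂ i₁ i₂ s₁ s₂ ch₁ ch₂ n a b X e Y e′ Vs Hs Ds with δ ≤? a₁ | δ ≤? a₂
    ... | yes h₁ | yes h₂ = balanced {c₁ = c₁} {c₂} a₁ a₂ h₁ h₂ ch₁ ch₂ n a b X e Y e′ Vs Hs Ds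
    ... | no h₁ | _ = strip {c = c₂} a₁ a₂ (≰⇒> h₁) i₁ s₁ s₂ ch₂ n a b X e Y e′ Vs Hs Ds
    ... | yes h₁ | no h₂ = λ ea → permChain {c = λ x y → 𝟙 (inGap θ θ′ x a₂) * length L₂ + c₁ (x + a₂) y} (↭P.++-comm L₁ L₂) (strip {c = c₁} a₂ a₁ (≰⇒> h₂) i₂ s₂ s₁ ch₁) n a b X e Y e′ Vs Hs Ds (trans (cong (λ z → X + (e + z)) (+-comm a₂ a₁)) ea)

    chain : ∀ {f g a b L} (t : Slice f g a b L) → All (Item f g) L → Chain f g a b L (gapCost δ θ θ′ t)
    chain none i n a b X e Y e′ Vs Hs Ds ea eb xe ye X≤ Y≤ ab vs hs lv lh =
      frame X Y _ _ Vs Hs Ds [] ea eb X≤ Y≤ vs hs lv lh empty ↭-refl ,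
      finishD {q} {w = 0} {c = 0} {L = 0} (≤-reflexive (*-zeroʳ q)) refl
    -- A single remaining item is discarded, and `1 ≤ pow2 n` pays for it.
    chain (one x h k) i n a b X e Y e′ Vs Hs Ds ea eb xe ye X≤ Y≤ ab vs hs lv lh =
      frame X Y _ _ Vs Hs (Ds ++ x ∷ []) [] ea eb X≤ Y≤ vs hs lv lh empty (↭-reflexive (cong (λ z → Vs ++ Hs ++ z) (sym (++-identityʳ _)))) ,
      ≤-trans (≤-reflexive (cong (q *_) (trans (+-identityʳ _) (length-++ Ds)))) (lia 4 (λ q d p r → (q :* con 1 :≤ q :* p) ⇒ ⟨ q :* (d :+ con 1) :≤ q :* d :+ q :* con 0 :+ con 2 :* con 1 :+ q :* p ⟩) refl
        q (length Ds) (pow2 n) 0 (*-monoʳ-≤ q (1≤pow2 n)))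
    chain (ver {L₁} a₁ a₂ refl s t) i = stepV a₁ a₂ (++⁻ˡ L₁ i) (++⁻ʳ L₁ i) s t (chain s (++⁻ˡ L₁ i)) (chain t (++⁻ʳ L₁ i))
    chain {f} {g} (hor {L₁} {L₂} b₁ b₂ refl s t) i =
      swapChain {c = stepCost δ θ θ′ b₁ b₂ (length L₁) (length L₂) (λ v u → gapCost δ θ θ′ s u v) (λ v u → gapCost δ θ θ′ t u v)}
        (stepV {c₁ = λ v u → gapCost δ θ θ′ s u v} {λ v u → gapCost δ θ θ′ t u v} b₁ b₂
          (All.map (λ {x} → swapItem {f} {g} {x}) (++⁻ˡ L₁ i)) (All.map (λ {x} → swapItem {f} {g} {x}) (++⁻ʳ L₁ i)) (swapS s) (swapS t)
          (swapChain {c = gapCost δ θ θ′ s} (chain s (++⁻ˡ L₁ i))) (swapChain {c = gapCost δ θ θ′ t} (chain t (++⁻ʳ L₁ i))))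

  -- Two ways to repack a framed slicing tree

  upΣ-∋ : ∀ n (c : ℕ → ℕ) k → k < n → c k ≤ upΣ n c
  upΣ-∋ (suc n) c k k< with k ≟ n
  ... | yes refl = m≤n+m (c k) (upΣ k c)
  ... | no k≢n = ≤-trans (upΣ-∋ n c k (≤∧≢⇒< (s≤s⁻¹ k<) k≢n)) (m≤m+n _ _)

  -- Balanced cuts are nested to depth at most `n`, and each of them starts two further frames.
  #frames #coreFrames : ℕ → ℕ
  #frames n = suc (#coreFrames n)
  #coreFrames zero = 0
  #coreFrames (suc n) = #frames n + #frames n

  -- The number of grid columns varies with the rectangle but is at most `suc M₀`; summing over all
  -- possibilities gives a uniform bound.
  #slack : ℕ → ℕ → ℕ → ℕ
  #slack z d M₀ = upΣ (2 + M₀) (#grid z d) + 1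

  #optA : (q z d M₀ n : ℕ) → ℕ
  #coreA : (q z d M₀ n : ℕ) → ℕ
  #optA q z d M₀ n = #coreA q z d M₀ n + 1 + #col (2 * q) d
  #coreA q z d M₀ zero = #slack z d M₀ + 1
  #coreA q z d M₀ (suc n) = #optA q z d M₀ n + #optA q z d M₀ n + 1 + 1 + (#slack z d M₀ + 1)

  -- The free strip `Θ` consists of `s`, the slack spent on the grid, and of two strips of width `w`
  -- for the items of the vertical and of the horizontal arms. In `fine`, `κ` pays for rounding up
  -- to whole columns and `suc M₀ * γ` for widening them.
  record OptionSizes : Set where
    field
      frameSizes : FrameSizes
    open FrameSizes frameSizes public
    field
      d N κ γ B z M₀ s w n₀ : ℕ
      μ<δ : μ < δ
      θ≤δ : θ ≤ δ
      N≤ : N ≤ d * δ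
      δ≤N : δ ≤ N
      1≤κ : 1 ≤ κ
      1≤γ : 1 ≤ γ
      κ≡ : κ ≡ z * γ
      Bκ≤δ : (B + 2) * κ ≤ δ
      κ≤Bγ : 2 * κ ≤ B * γ
      N≤Mκ : N ≤ M₀ * κ
      fine : κ + suc M₀ * γ ≤ s
      Θ≡ : Θ ≡ s + 2 * w
      w≥ : #frames n₀ * (θ′ * d) ≤ w

  module OptionTheory {A : Set} (sizes : OptionSizes) where
    open OptionSizes sizes
    open FrameTheory {A} frameSizes public

    private
      instance
        κ≢0 : NonZero κ
        κ≢0 = >-nonZero 1≤κ

      #X #S : ℕ
      #X = #slack z d M₀
      #S = #col (2 * q) d

    Θ≤N : Θ ≤ N
    Θ≤N = ≤-trans (≤-trans (m≤n+m Θ θ′) θ′Θ≤θ) (≤-trans θ≤δ δ≤N)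

    weakItem : ∀ {f g x} → Item f g x → 1 ≤ f x × 1 ≤ g x × (δ ≤ g x ⊎ δ ≤ f x)
    weakItem (p , q , inj₁ (h , _)) = p , q , inj₁ h
    weakItem (p , q , inj₂ (h , _)) = p , q , inj₂ h

    -- The used area is the area of the items, up to a `1 / z` fraction of it and of the rectangle.
    -- `extra` stands for strips of arm items, which are counted in full.
    Bounded : (f g : A → ℕ) (a b : ℕ) (L : List A) (extra k : ℕ) → Set
    Bounded f g a b L extra k = Σ ℕ λ U → z * U ≤ suc z * area f g L + a * b + z * extra × Pack f g a b L U k

    swapBounded : ∀ {f g a b L x k} → Bounded f g a b L x k → Bounded g f b a L x k
    swapBounded {f} {g} {a} {b} {L} {x} (U , h , p) = U , ≤-trans h (≤-reflexive (cong₂ (λ u v → suc z * u + v + z * x) (area-swap f g L) (*-comm a b))) , packSwap p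

    useSlack : ∀ {f g : A → ℕ} {a b C} a′ b′ → a ≤ N → b ≤ N → a′ + s ≤ a → b′ ≤ b → All (Item f g) C → Slice f g a′ b′ C → Bounded f g a b C 0 (#X + 1)
    useSlack {f} {g} {a} {b} {C} a′ b′ a≤N b≤N h k items t =
        proj₁ P , ≤-trans (proj₁ (proj₂ P)) (≤-trans (+-monoʳ-≤ (suc z * area f g C) (*-monoʳ-≤ a k)) (m≤m+n _ (z * 0))) ,
        packWeaken ≤-refl (≤-trans (+-monoˡ-≤ 1 (upΣ-∋ (2 + M₀) (#grid z d) M (s≤s (s≤s a′/κ≤)))) (m≤m+n _ 1)) (packPadH k (proj₂ (proj₂ P)))
      where
      -- The width `a′` rounded up to whole columns, which costs at most `κ`.
      M = suc (a′ / κ)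
      a′/κ≤ : a′ / κ ≤ M₀
      a′/κ≤ = ≤-trans (/-monoˡ-≤ κ (≤-trans (≤-trans (m≤m+n a′ s) h) (≤-trans a≤N N≤Mκ))) (≤-reflexive (m*n/n≡m M₀ κ))
      a′≤ : a′ ≤ M * κ
      a′≤ = <⇒≤ (≤-trans (s≤s (≤-reflexive (m≡m%n+[m/n]*n a′ κ))) (+-monoˡ-≤ (a′ / κ * κ) (m%n<n a′ κ)))
      a≥ : M * (κ + γ) ≤ a
      a≥ = lia 8 (λ x k g a′ s a m v → (x :* k :≤ a′) ⇒ (k :+ (con 1 :+ m) :* g :≤ s) ⇒ (a′ :+ s :≤ a) ⇒ (x :* g :≤ m :* g) ⇒ ⟨ (con 1 :+ x) :* (k :+ g) :≤ a ⟩) refl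
        (a′ / κ) κ γ a′ s a M₀ 0 (m/n*n≤m a′ κ) fine h (*-monoˡ-≤ γ a′/κ≤)
      P = slackPack δ κ γ B z d M a 1≤δ 1≤κ 1≤γ κ≡ Bκ≤δ κ≤Bγ a′≤ a≥ (≤-trans k (≤-trans b≤N N≤)) (All.map (λ {x} → weakItem {f} {g} {x}) items) t

    s≤Θ : s ≤ Θ
    s≤Θ = ≤-trans (m≤m+n s _) (≤-reflexive (sym Θ≡))

    mutual
      arms : ∀ {f g n a b L} → Fr f g n a b L → ℕ
      arms (frame _ _ _ _ Vs Hs _ _ _ _ _ _ _ _ _ _ c _) = length Vs + length Hs + armsC c

      armsC : ∀ {f g n a b L} → Core f g n a b L → ℕ
      armsC empty = 0
      armsC (exitX _ _ _ _ _) = 0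
      armsC (exitY _ _ _ _ _) = 0
      armsC (balX _ _ _ _ _ _ _ F₁ F₂) = arms F₁ + arms F₂
      armsC (balY _ _ _ _ _ _ _ F₁ F₂) = arms F₁ + arms F₂

    -- Half of the `tt` arm items and all of the `dd` discarded ones are given up. The term
    -- `4 * length L` comes from the windows in the arms, the last one from at most `q * d` fat
    -- items in each of `ff` frames.
    record OptA (f g : A → ℕ) (a b : ℕ) (L : List A) (tt dd ff k : ℕ) : Set where
      constructor optA-mk
      field
        kept gone : List A
        permA : L ↭ kept ++ gone
        countA : 2 * q * length gone ≤ q * tt + 2 * q * dd + 4 * length L + 2 * q * (q * d) * ff
        packA : Bounded f g a b kept (ff * (θ′ * N)) k

    private
      swapOptA : ∀ {f g a b L t e h k} → OptA f g a b L t e h k → OptA g f b a L t e h k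
      swapOptA (optA-mk K G p c P) = optA-mk K G p c (swapBounded P)

      besides : ∀ {f g a₁ a₂ a b′ b L₁ L₂ t₁ t₂ e₁ e₂ h₁ h₂ k₁ k₂} → a₁ + a₂ ≤ a → b′ ≤ b →
                OptA f g a₁ b′ L₁ t₁ e₁ h₁ k₁ → OptA f g a₂ b′ L₂ t₂ e₂ h₂ k₂ →
                OptA f g a b (L₁ ++ L₂) (t₁ + t₂) (e₁ + e₂) (h₁ + h₂) (k₁ + k₂ + 1 + 1)
      besides {f} {g} {a₁} {a₂} {a} {b′} {b} {L₁} {L₂} {t₁} {t₂} {e₁} {e₂} {h₁} {h₂} le₁ le₂ (optA-mk K₁ G₁ p₁ c₁ (U₁ , u₁ , P₁)) (optA-mk K₂ G₂ p₂ c₂ (U₂ , u₂ , P₂)) =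
        optA-mk (K₁ ++ K₂) (G₁ ++ G₂)
          (↭-trans (↭P.++⁺ p₁ p₂) (bag 4 (λ a b c d → (a :++ b) :++ (c :++ d) :↭ (a :++ c) :++ (b :++ d)) refl K₁ G₁ K₂ G₂))
          (≤-trans (≤-reflexive (trans (cong (2 * q *_) (length-++ G₁)) (*-distribˡ-+ (2 * q) (length G₁) (length G₂)))) (≤-trans (+-mono-≤ c₁ c₂)
            (≤-trans (≤-reflexive (lia 10 (λ q t₁ t₂ e₁ e₂ l₁ l₂ h₁ h₂ d → ⟨ (q :* t₁ :+ con 2 :* q :* e₁ :+ con 4 :* l₁ :+ con 2 :* q :* (q :* d) :* h₁) :+ (q :* t₂ :+ con 2 :* q :* e₂ :+ con 4 :* l₂ :+ con 2 :* q :* (q :* d) :* h₂)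
               :≡ q :* (t₁ :+ t₂) :+ con 2 :* q :* (e₁ :+ e₂) :+ con 4 :* (l₁ :+ l₂) :+ con 2 :* q :* (q :* d) :* (h₁ :+ h₂) ⟩) refl q t₁ t₂ e₁ e₂ (length L₁) (length L₂) h₁ h₂ d))
              (≤-reflexive (cong (λ l → q * (t₁ + t₂) + 2 * q * (e₁ + e₂) + 4 * l + 2 * q * (q * d) * (h₁ + h₂)) (sym (length-++ L₁)))))))
          (U₁ + U₂ , ≤-trans (lia 13 (λ z U₁ U₂ A₁ A₂ a₁ a₂ b′ h₁ h₂ y R r → (z :* U₁ :≤ (con 1 :+ z) :* A₁ :+ a₁ :* b′ :+ z :* (h₁ :* y)) ⇒ (z :* U₂ :≤ (con 1 :+ z) :* A₂ :+ a₂ :* b′ :+ z :* (h₂ :* y)) ⇒ ((a₁ :+ a₂) :* b′ :≤ R) ⇒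
                ⟨ z :* (U₁ :+ U₂) :≤ (con 1 :+ z) :* (A₁ :+ A₂) :+ R :+ z :* ((h₁ :+ h₂) :* y) ⟩) refl z U₁ U₂ (area f g K₁) (area f g K₂) a₁ a₂ b′ h₁ h₂ (θ′ * N) (a * b) 0 u₁ u₂ (*-mono-≤ le₁ le₂))
              (≤-reflexive (cong (λ v → suc z * v + a * b + z * ((h₁ + h₂) * (θ′ * N))) (sym (Σ-++ _ K₁ K₂)))) ,
           packPadH le₂ (packPadW le₁ (packVer P₁ P₂)))

      weakenA : ∀ {f g a b L t e h h′ k k′} → h ≤ h′ → k ≤ k′ → OptA f g a b L t e h k → OptA f g a b L t e h′ k′
      weakenA {f} {g} {a} {b} {L} {t} {e} h≤ k≤ (optA-mk K G p c (U , u , P)) = optA-mk K G p (≤-trans c (+-monoʳ-≤ (q * t + 2 * q * e + 4 * length L) (*-monoʳ-≤ (2 * q * (q * d)) h≤)))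
        (U , ≤-trans u (+-monoʳ-≤ (suc z * area f g K + a * b) (*-monoʳ-≤ z (*-monoˡ-≤ (θ′ * N) h≤))) , packWeaken ≤-refl k≤ P)

      exitA : ∀ {f g a b C k} n → Bounded f g a b C 0 k → k ≤ #coreA q z d M₀ n → OptA f g a b C 0 0 (#coreFrames n) (#coreA q z d M₀ n)
      exitA {C = C} n P k≤ = weakenA z≤n k≤ (optA-mk C [] (↭-reflexive (sym (++-identityʳ C))) (≤-trans (≤-reflexive (*-zeroʳ (2 * q))) z≤n) P)

      #coreA-≥ : ∀ n → #X + 1 ≤ #coreA q z d M₀ n
      #coreA-≥ zero = ≤-refl
      #coreA-≥ (suc n) = m≤n+m (#X + 1) (#optA q z d M₀ n + #optA q z d M₀ n + 1 + 1)

      -- One arm is packed next to the core and the other one is discarded.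
      arm : ∀ {f g X ac a bc b Vs Cs O t e h k} → X + ac ≡ a → bc ≤ b → b ≤ N → X ≤ θ′ → length O ≤ length Vs → All (Item f g) Vs → All (λ x → δ ≤ g x) Vs →
            Slice f g X b Vs → OptA f g ac bc Cs t e h k → ∀ Ds L → L ↭ Vs ++ O ++ Ds ++ Cs →
            OptA f g a b L (length Vs + length O + t) (length Ds + e) (suc h) (k + 1 + #S)
      arm {f} {g} {X} {ac} {a} {bc} {b} {Vs} {Cs} {O} {t} {e} {h} {k} refl bc≤ b≤N X≤ O≤ items long vs (optA-mk K G p c (U , u , P)) Ds L pm = packed (stripPack δ d q 1≤q 1≤δ long (≤-trans b≤N N≤) (All.map proj₁ items) vs)
        where
        packed : (Σ (List A) λ kept → Σ (List A) λ gone → Vs ↭ kept ++ gone × q * length gone ≤ 2 * length Vs + q * (q * d) × Pack f g X b kept (X * b) #S) → _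
        packed (kept , gone , pv , cv , pk) = optA-mk (K ++ kept) (G ++ gone ++ O ++ Ds)
          (↭-trans pm (↭-trans (↭P.++⁺ pv (↭P.++⁺ˡ O (↭P.++⁺ˡ Ds p))) (bag 6 (λ v g o d k h → (v :++ g) :++ (o :++ (d :++ (k :++ h))) :↭ (k :++ v) :++ (h :++ (g :++ (o :++ d)))) refl kept gone O Ds K G)))
          (≤-trans (≤-reflexive (cong (2 * q *_) (trans (length-++ G) (cong (length G +_) (trans (length-++ gone) (cong (length gone +_) (length-++ O)))))))
            (≤-trans (lia 12 (λ q G g O D V C t e d h r → (con 2 :* q :* G :≤ q :* t :+ con 2 :* q :* e :+ con 4 :* C :+ con 2 :* q :* (q :* d) :* h) ⇒ (q :* g :≤ con 2 :* V :+ q :* (q :* d)) ⇒ (q :* O :≤ q :* V) ⇒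
                 ⟨ con 2 :* q :* (G :+ (g :+ (O :+ D))) :≤ q :* (V :+ O :+ t) :+ con 2 :* q :* (D :+ e) :+ con 4 :* (V :+ (O :+ (D :+ C))) :+ con 2 :* q :* (q :* d) :* (con 1 :+ h) ⟩) refl
                 q (length G) (length gone) (length O) (length Ds) (length Vs) (length Cs) t e d h 0 c cv (*-monoʳ-≤ q O≤))
              (≤-reflexive (cong (λ l → q * (length Vs + length O + t) + 2 * q * (length Ds + e) + 4 * l + 2 * q * (q * d) * suc h)
                (sym (trans (length-↭ pm) (trans (length-++ Vs) (cong (length Vs +_) (trans (length-++ O) (cong (length O +_) (length-++ Ds)))))))))))
          (U + X * b , ≤-trans (lia 12 (λ z U X b A A′ ac bc h y r e → (z :* U :≤ (con 1 :+ z) :* A :+ ac :* bc :+ z :* (h :* y)) ⇒ (z :* (X :* b) :≤ z :* y) ⇒ (ac :* bc :≤ ac :* b) ⇒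
                ⟨ z :* (U :+ X :* b) :≤ (con 1 :+ z) :* (A :+ A′) :+ (X :+ ac) :* b :+ z :* ((con 1 :+ h) :* y) ⟩) refl
                z U X b (area f g K) (area f g kept) ac bc h (θ′ * N) 0 0 u (*-monoʳ-≤ z (*-mono-≤ X≤ b≤N)) (*-monoʳ-≤ ac bc≤))
              (≤-reflexive (cong (λ v → suc z * v + (X + ac) * b + z * (suc h * (θ′ * N))) (sym (Σ-++ _ K kept)))) ,
           subst (λ v → Pack f g v b (K ++ kept) (U + X * b) (k + 1 + #S)) (+-comm ac X) (packVer (packPadH bc≤ P) pk))

    mutual
      optA : ∀ {f g n a b L} (F : Fr f g n a b L) → a ≤ N → b ≤ N → All (Item f g) L → OptA f g a b L (arms F) (drops F) (#frames n) (#optA q z d M₀ n)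
      optA {f} {g} {n} {a} {b} {L} (frame X Y ac bc Vs Hs Ds Cs ea eb X≤ Y≤ vs hs lv lh c pm) a≤N b≤N items with length Hs ≤? length Vs
      ... | yes h≤v = arm {O = Hs} ea (≤-trans (m≤n+m bc Y) (≤-reflexive eb)) b≤N X≤ h≤v (++⁻ˡ Vs itemsP) lv vs core Ds L pm
        where
        itemsP = All-↭ pm items
        core = optCore c (≤-trans (≤-trans (m≤n+m ac X) (≤-reflexive ea)) a≤N) (≤-trans (≤-trans (m≤n+m bc Y) (≤-reflexive eb)) b≤N) (++⁻ʳ Ds (++⁻ʳ Hs (++⁻ʳ Vs itemsP)))
      ... | no v<h = subst (λ v → OptA f g a b L (v + armsC c) (length Ds + dropsC c) (#frames n) (#optA q z d M₀ n)) (+-comm (length Hs) (length Vs))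
          (swapOptA (arm {O = Vs} eb (≤-trans (m≤n+m ac X) (≤-reflexive ea)) a≤N Y≤ (<⇒≤ (≰⇒> v<h)) (All.map (λ {x} → swapItem {f} {g} {x}) (++⁻ˡ Hs (++⁻ʳ Vs itemsP))) lh (swapS hs) (swapOptA core) Ds L
            (↭-trans pm (bag 3 (λ v h r → v :++ (h :++ r) :↭ h :++ (v :++ r)) refl Vs Hs (Ds ++ Cs)))))
        where
        itemsP = All-↭ pm items
        core = optCore c (≤-trans (≤-trans (m≤n+m ac X) (≤-reflexive ea)) a≤N) (≤-trans (≤-trans (m≤n+m bc Y) (≤-reflexive eb)) b≤N) (++⁻ʳ Ds (++⁻ʳ Hs (++⁻ʳ Vs itemsP)))

      optCore : ∀ {f g n a b L} (c : Core f g n a b L) → a ≤ N → b ≤ N → All (Item f g) L → OptA f g a b L (armsC c) (dropsC c) (#coreFrames n) (#coreA q z d M₀ n)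
      optCore {n = n} {a} {b} empty a≤N b≤N items = exitA n (0 , ≤-trans (≤-reflexive (*-zeroʳ z)) z≤n , packFree a b) (≤-trans (m≤n+m 1 #X) (#coreA-≥ n))
      optCore {n = n} (exitX a′ b′ p r t) a≤N b≤N items = exitA n (useSlack a′ b′ a≤N b≤N (≤-trans (+-monoʳ-≤ a′ s≤Θ) p) r items t) (#coreA-≥ n)
      optCore {f} {g} {n = n} (exitY a′ b′ p r t) a≤N b≤N items = exitA n (swapBounded (useSlack b′ a′ b≤N a≤N (≤-trans (+-monoʳ-≤ b′ s≤Θ) r) p (All.map (λ {x} → swapItem {f} {g} {x}) items) (swapS t))) (#coreA-≥ n)
      optCore (balX {n} {C₁ = C₁} a₁ a₂ b′ _ _ r t F₁ F₂) a≤N b≤N items = weakenA ≤-refl (m≤m+n _ (#X + 1))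
        (besides r t (optA F₁ (≤-trans (≤-trans (m≤m+n a₁ a₂) r) a≤N) (≤-trans t b≤N) (++⁻ˡ C₁ items)) (optA F₂ (≤-trans (≤-trans (m≤n+m a₂ a₁) r) a≤N) (≤-trans t b≤N) (++⁻ʳ C₁ items)))
      optCore (balY {n} {C₁ = C₁} b₁ b₂ a′ _ _ r t F₁ F₂) a≤N b≤N items = weakenA ≤-refl (m≤m+n _ (#X + 1))
        (swapOptA (besides t r (swapOptA (optA F₁ (≤-trans r a≤N) (≤-trans (≤-trans (m≤m+n b₁ b₂) t) b≤N) (++⁻ˡ C₁ items))) (swapOptA (optA F₂ (≤-trans r a≤N) (≤-trans (≤-trans (m≤n+m b₂ b₁) t) b≤N) (++⁻ʳ C₁ items)))))

    mutual
      -- Collected over all nested frames: the items of the vertical arms, those of the horizontal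
      -- arms, the discarded ones, and the rest, which lies in the innermost cores.
      vts hts dts rts : ∀ {f g n a b L} → Fr f g n a b L → List A
      vts (frame _ _ _ _ Vs Hs Ds Cs _ _ _ _ _ _ _ _ c _) = Vs ++ vtsC c
      hts (frame _ _ _ _ Vs Hs Ds Cs _ _ _ _ _ _ _ _ c _) = Hs ++ htsC c
      dts (frame _ _ _ _ Vs Hs Ds Cs _ _ _ _ _ _ _ _ c _) = Ds ++ dtsC c
      rts (frame _ _ _ _ Vs Hs Ds Cs _ _ _ _ _ _ _ _ c _) = rtsC c

      vtsC htsC dtsC rtsC : ∀ {f g n a b L} → Core f g n a b L → List A
      vtsC (balX _ _ _ _ _ _ _ F₁ F₂) = vts F₁ ++ vts F₂
      vtsC (balY _ _ _ _ _ _ _ F₁ F₂) = vts F₁ ++ vts F₂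
      vtsC _ = []
      htsC (balX _ _ _ _ _ _ _ F₁ F₂) = hts F₁ ++ hts F₂
      htsC (balY _ _ _ _ _ _ _ F₁ F₂) = hts F₁ ++ hts F₂
      htsC _ = []
      dtsC (balX _ _ _ _ _ _ _ F₁ F₂) = dts F₁ ++ dts F₂
      dtsC (balY _ _ _ _ _ _ _ F₁ F₂) = dts F₁ ++ dts F₂
      dtsC _ = []
      rtsC empty = []
      rtsC (exitX {C = C} _ _ _ _ _) = C
      rtsC (exitY {C = C} _ _ _ _ _) = C
      rtsC (balX _ _ _ _ _ _ _ F₁ F₂) = rts F₁ ++ rts F₂
      rtsC (balY _ _ _ _ _ _ _ F₁ F₂) = rts F₁ ++ rts F₂

    private
      4way : ∀ {V₁ H₁ D₁ R₁ V₂ H₂ D₂ R₂ L₁ L₂ : List A} → L₁ ↭ V₁ ++ H₁ ++ D₁ ++ R₁ → L₂ ↭ V₂ ++ H₂ ++ D₂ ++ R₂ →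
             L₁ ++ L₂ ↭ (V₁ ++ V₂) ++ (H₁ ++ H₂) ++ (D₁ ++ D₂) ++ (R₁ ++ R₂)
      4way {V₁} {H₁} {D₁} {R₁} {V₂} {H₂} {D₂} {R₂} p r = ↭-trans (↭P.++⁺ p r)
        (bag 8 (λ a b c d e f g h → (a :++ (b :++ (c :++ d))) :++ (e :++ (f :++ (g :++ h))) :↭ (a :++ e) :++ ((b :++ f) :++ ((c :++ g) :++ (d :++ h)))) refl V₁ H₁ D₁ R₁ V₂ H₂ D₂ R₂)

    mutual
      parts : ∀ {f g n a b L} (F : Fr f g n a b L) → L ↭ vts F ++ hts F ++ dts F ++ rts F
      parts (frame _ _ _ _ Vs Hs Ds Cs _ _ _ _ _ _ _ _ c pm) = ↭-trans pm (↭-trans (↭P.++⁺ˡ Vs (↭P.++⁺ˡ Hs (↭P.++⁺ˡ Ds (partsC c))))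
        (bag 7 (λ v h d a b c r → v :++ (h :++ (d :++ (a :++ (b :++ (c :++ r))))) :↭ (v :++ a) :++ ((h :++ b) :++ ((d :++ c) :++ r))) refl Vs Hs Ds (vtsC c) (htsC c) (dtsC c) (rtsC c)))

      partsC : ∀ {f g n a b L} (c : Core f g n a b L) → L ↭ vtsC c ++ htsC c ++ dtsC c ++ rtsC c
      partsC empty = ↭-refl
      partsC (exitX _ _ _ _ _) = ↭-refl
      partsC (exitY _ _ _ _ _) = ↭-refl
      partsC (balX _ _ _ _ _ _ _ F₁ F₂) = 4way {vts F₁} {hts F₁} {dts F₁} {rts F₁} {vts F₂} {hts F₂} {dts F₂} {rts F₂} (parts F₁) (parts F₂)
      partsC (balY _ _ _ _ _ _ _ F₁ F₂) = 4way {vts F₁} {hts F₁} {dts F₁} {rts F₁} {vts F₂} {hts F₂} {dts F₂} {rts F₂} (parts F₁) (parts F₂)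

    private
      +-swap4 : ∀ a b c d → (a + b) + (c + d) ≡ (a + c) + (b + d)
      +-swap4 = lia 4 (λ a b c d → ⟨ a :+ b :+ (c :+ d) :≡ a :+ c :+ (b :+ d) ⟩) refl

    mutual
      arms≡ : ∀ {f g n a b L} (F : Fr f g n a b L) → length (vts F) + length (hts F) ≡ arms F
      arms≡ (frame _ _ _ _ Vs Hs _ _ _ _ _ _ _ _ _ _ c _) = trans (cong₂ _+_ (length-++ Vs) (length-++ Hs)) (trans (+-swap4 (length Vs) (length (vtsC c)) (length Hs) (length (htsC c))) (cong (length Vs + length Hs +_) (armsC≡ c)))

      armsC≡ : ∀ {f g n a b L} (c : Core f g n a b L) → length (vtsC c) + length (htsC c) ≡ armsC c
      armsC≡ empty = refl
      armsC≡ (exitX _ _ _ _ _) = refl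
      armsC≡ (exitY _ _ _ _ _) = refl
      armsC≡ (balX _ _ _ _ _ _ _ F₁ F₂) = trans (cong₂ _+_ (length-++ (vts F₁)) (length-++ (hts F₁))) (trans (+-swap4 (length (vts F₁)) _ _ _) (cong₂ _+_ (arms≡ F₁) (arms≡ F₂)))
      armsC≡ (balY _ _ _ _ _ _ _ F₁ F₂) = trans (cong₂ _+_ (length-++ (vts F₁)) (length-++ (hts F₁))) (trans (+-swap4 (length (vts F₁)) _ _ _) (cong₂ _+_ (arms≡ F₁) (arms≡ F₂)))

    mutual
      drops≡ : ∀ {f g n a b L} (F : Fr f g n a b L) → length (dts F) ≡ drops F
      drops≡ (frame _ _ _ _ _ _ Ds _ _ _ _ _ _ _ _ _ c _) = trans (length-++ Ds) (cong (length Ds +_) (dropsC≡ c))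

      dropsC≡ : ∀ {f g n a b L} (c : Core f g n a b L) → length (dtsC c) ≡ dropsC c
      dropsC≡ empty = refl
      dropsC≡ (exitX _ _ _ _ _) = refl
      dropsC≡ (exitY _ _ _ _ _) = refl
      dropsC≡ (balX _ _ _ _ _ _ _ F₁ F₂) = trans (length-++ (dts F₁)) (cong₂ _+_ (drops≡ F₁) (drops≡ F₂))
      dropsC≡ (balY _ _ _ _ _ _ _ F₁ F₂) = trans (length-++ (dts F₁)) (cong₂ _+_ (drops≡ F₁) (drops≡ F₂))

    mutual
      -- The cores stay where they are; the space of the arms becomes padding.
      restS : ∀ {f g n a b L} (F : Fr f g n a b L) → Slice f g a b (rts F)
      restS (frame X Y _ _ _ _ _ _ refl refl _ _ _ _ _ _ c _) = padS (m≤n+m _ X) (m≤n+m _ Y) (restC c)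

      restC : ∀ {f g n a b L} (c : Core f g n a b L) → Slice f g a b (rtsC c)
      restC empty = none
      restC (exitX a′ b′ p r t) = padS (≤-trans (m≤m+n a′ Θ) p) r t
      restC (exitY a′ b′ p r t) = padS p (≤-trans (m≤m+n b′ Θ) r) t
      restC (balX a₁ a₂ b′ _ _ r t F₁ F₂) = padS r t (ver a₁ a₂ refl (restS F₁) (restS F₂))
      restC (balY b₁ b₂ a′ _ _ r t F₁ F₂) = padS r t (hor b₁ b₂ refl (restS F₁) (restS F₂))

    private
      2thin : ∀ (φ : A → ℕ) xs ys {h₁ h₂ y} → Σ′ φ xs ≤ h₁ * y → Σ′ φ ys ≤ h₂ * y → Σ′ φ (xs ++ ys) ≤ (h₁ + h₂) * y
      2thin φ xs ys {h₁} {h₂} {y} p r = ≤-trans (≤-reflexive (Σ-++ φ xs ys)) (≤-trans (+-mono-≤ p r) (≤-reflexive (sym (*-distribʳ-+ y h₁ h₂))))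

    mutual
      -- The items of one arm have thickness at most `θ′ * d`, being at least `δ` long in a
      -- rectangle of width at most `θ′` and height at most `d * δ`. This is where `w` comes from.
      thinV : ∀ {f g n a b L} (F : Fr f g n a b L) → b ≤ N → Σ′ f (vts F) ≤ #frames n * (θ′ * d)
      thinV {f} {g} {n} (frame X Y ac bc Vs Hs Ds Cs _ eb X≤ _ vs _ lv _ c _) b≤N = ≤-trans (≤-reflexive (Σ-++ f Vs (vtsC c)))
        (+-mono-≤ (≤-trans (thickness-≤ δ d 1≤δ lv (≤-trans b≤N N≤) vs) (*-monoˡ-≤ d X≤)) (thinVC c (≤-trans (≤-trans (m≤n+m bc Y) (≤-reflexive eb)) b≤N)))

      thinVC : ∀ {f g n a b L} (c : Core f g n a b L) → b ≤ N → Σ′ f (vtsC c) ≤ #coreFrames n * (θ′ * d)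
      thinVC empty b≤N = z≤n
      thinVC (exitX _ _ _ _ _) b≤N = z≤n
      thinVC (exitY _ _ _ _ _) b≤N = z≤n
      thinVC (balX {n} a₁ a₂ b′ _ _ _ t F₁ F₂) b≤N = 2thin _ (vts F₁) (vts F₂) {#frames n} (thinV F₁ (≤-trans t b≤N)) (thinV F₂ (≤-trans t b≤N))
      thinVC (balY {n} b₁ b₂ a′ _ _ _ t F₁ F₂) b≤N = 2thin _ (vts F₁) (vts F₂) {#frames n} (thinV F₁ (≤-trans (≤-trans (m≤m+n b₁ b₂) t) b≤N)) (thinV F₂ (≤-trans (≤-trans (m≤n+m b₂ b₁) t) b≤N))

    mutual
      thinH : ∀ {f g n a b L} (F : Fr f g n a b L) → a ≤ N → Σ′ g (hts F) ≤ #frames n * (θ′ * d)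
      thinH {f} {g} {n} (frame X Y ac bc Vs Hs Ds Cs ea _ _ Y≤ _ hs _ lh c _) a≤N = ≤-trans (≤-reflexive (Σ-++ g Hs (htsC c)))
        (+-mono-≤ (≤-trans (thickness-≤ δ d 1≤δ lh (≤-trans a≤N N≤) (swapS hs)) (*-monoˡ-≤ d Y≤)) (thinHC c (≤-trans (≤-trans (m≤n+m ac X) (≤-reflexive ea)) a≤N)))

      thinHC : ∀ {f g n a b L} (c : Core f g n a b L) → a ≤ N → Σ′ g (htsC c) ≤ #coreFrames n * (θ′ * d)
      thinHC empty a≤N = z≤n
      thinHC (exitX _ _ _ _ _) a≤N = z≤n
      thinHC (exitY _ _ _ _ _) a≤N = z≤n
      thinHC (balX {n} a₁ a₂ b′ _ _ r _ F₁ F₂) a≤N = 2thin _ (hts F₁) (hts F₂) {#frames n} (thinH F₁ (≤-trans (≤-trans (m≤m+n a₁ a₂) r) a≤N)) (thinH F₂ (≤-trans (≤-trans (m≤n+m a₂ a₁) r) a≤N))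
      thinHC (balY {n} b₁ b₂ a′ _ _ r _ F₁ F₂) a≤N = 2thin _ (hts F₁) (hts F₂) {#frames n} (thinH F₁ (≤-trans r a≤N)) (thinH F₂ (≤-trans r a≤N))

    record Choice (f g : A → ℕ) (R : List A) : Set where
      constructor choose
      field
        K G : List A
        permC : R ↭ K ++ G
        countC : 3 * q * length G ≤ q * length R + 6 * length R
        room : Σ ℕ λ a′ → Σ ℕ λ b′ → ((a′ + Θ ≤ N × b′ ≤ N) ⊎ (a′ ≤ N × b′ + Θ ≤ N)) × Slice f g a′ b′ K

    swapChoice : ∀ {f g R} → Choice f g R → Choice g f R
    swapChoice (choose K G p c (a′ , b′ , inj₁ (h , k) , t)) = choose K G p c (b′ , a′ , inj₂ (k , h) , swapS t)
    swapChoice (choose K G p c (a′ , b′ , inj₂ (h , k) , t)) = choose K G p c (b′ , a′ , inj₁ (k , h) , swapS t)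

    private
      vertical? : (A → ℕ) → A → Bool
      vertical? g x = δ ≤ᵇ g x

      verticals-thin : ∀ {f g} R → All (Item f g) R → All (λ x → f x ≤ Θ) (filterᵇ (vertical? g) R)
      verticals-thin {f} {g} R i = All.zipWith (λ {x} → λ { (e , (_ , _ , inj₁ (_ , h))) → ≤-trans h μ≤Θ ; (e , (_ , _ , inj₂ (_ , h))) → contradiction (≤-trans (true-≤ {δ} e) h) (<⇒≱ μ<δ) })
        (filter-true (vertical? g) R , filter-All (vertical? g) i)

      notb : ∀ {c} → not c ≡ true → c ≡ false
      notb {false} _ = refl

      horizontals-thin : ∀ {f g} R → All (Item f g) R → All (λ x → g x ≤ Θ) (filterᵇ (not ∘ vertical? g) R)
      horizontals-thin {f} {g} R i = All.zipWith (λ {x} → λ { (e , (_ , _ , inj₁ (h , _))) → contradiction h (<⇒≱ (false-> {δ} (notb e))) ; (e , (_ , _ , inj₂ (_ , h))) → ≤-trans h μ≤Θ })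
        (filter-true (not ∘ vertical? g) R , filter-All (not ∘ vertical? g) i)

      Θ≤δ : Θ ≤ δ
      Θ≤δ = ≤-trans (≤-trans (m≤n+m Θ θ′) θ′Θ≤θ) θ≤δ

      part-length : ∀ (p : A → Bool) R → length R ≡ length (filterᵇ p R) + length (filterᵇ (not ∘ p) R)
      part-length p R = trans (length-↭ (partition↭ p R)) (length-++ (filterᵇ p R))

      -- Without its horizontal items the first part has a window that is cheap to empty.
      clear : ∀ {f g a₁ a₂ b′ R₁ R₂} R → R ↭ R₁ ++ R₂ → δ ≤ a₁ → a₁ + a₂ ≤ N → b′ ≤ N → All (Item f g) R₁ → Slice f g a₁ b′ R₁ → Slice f g a₂ b′ R₂ →
              3 * length (filterᵇ (not ∘ vertical? g) R₁) ≤ length R → Choice f g R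
      clear {f} {g} {a₁} {a₂} {b′} {R₁} {R₂} R pR δ≤ a≤ b≤ i₁ t₁ t₂ few =
        go (window q Θ 1≤q (≤-trans qΘ≤θ (≤-trans θ≤δ δ≤)) (verticals-thin R₁ i₁) (filterS (vertical? g) t₁))
        where
        V₁ H₁ : List A
        V₁ = filterᵇ (vertical? g) R₁
        H₁ = filterᵇ (not ∘ vertical? g) R₁
        V₁≤ : length V₁ ≤ length R
        V₁≤ = ≤-trans (≤-trans (m≤m+n _ (length H₁)) (≤-reflexive (sym (part-length (vertical? g) R₁)))) (≤-trans (m≤m+n _ (length R₂)) (≤-reflexive (sym (trans (length-↭ pR) (length-++ R₁)))))
        go : (Σ (List A) λ kept → Σ (List A) λ lost → V₁ ↭ kept ++ lost × q * length lost ≤ 2 * length V₁ × Slice f g (a₁ ∸ Θ) b′ kept) → Choice f g R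
        go (kept , lost , p , c , t) = choose (kept ++ R₂) (H₁ ++ lost)
          (↭-trans pR (↭-trans (↭P.++⁺ʳ R₂ (↭-trans (partition↭ (vertical? g) R₁) (↭P.++⁺ʳ H₁ p))) (bag 4 (λ k l h r → ((k :++ l) :++ h) :++ r :↭ (k :++ r) :++ (h :++ l)) refl kept lost H₁ R₂)))
          (≤-trans (≤-reflexive (cong (3 * q *_) (length-++ H₁)))
            (lia 5 (λ q h l v r → (con 3 :* h :* q :≤ r :* q) ⇒ (q :* l :≤ con 2 :* v) ⇒ (v :≤ r) ⇒ ⟨ con 3 :* q :* (h :+ l) :≤ q :* r :+ con 6 :* r ⟩) refl
              q (length H₁) (length lost) (length V₁) (length R) (*-monoˡ-≤ q few) c V₁≤))
          ((a₁ ∸ Θ) + a₂ , b′ , inj₁ (≤-trans (≤-reflexive (lia 4 (λ d t a b → (d :+ t :≡ a) ⇒ ⟨ d :+ b :+ t :≡ a :+ b ⟩) refl (a₁ ∸ Θ) Θ a₁ a₂ (m∸n+n≡m (≤-trans Θ≤δ δ≤)))) a≤ , b≤) ,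
           ver (a₁ ∸ Θ) a₂ refl t t₂)

      -- The horizontal items of the first part, those of the second part, and all vertical items
      -- are three disjoint sets, so one of them holds at most a third of the items. Without one of
      -- the first two a vertical window can be emptied in that part; without the third a horizontal
      -- one can be emptied across the square.
      bal : ∀ {f g a₁ a₂ b′ R₁ R₂} → δ ≤ a₁ → δ ≤ a₂ → a₁ + a₂ ≤ N → b′ ≤ N → All (Item f g) R₁ → All (Item f g) R₂ →
            Slice f g a₁ b′ R₁ → Slice f g a₂ b′ R₂ → Choice f g (R₁ ++ R₂)
      bal {f} {g} {a₁} {a₂} {b′} {R₁} {R₂} δ₁ δ₂ a≤ b≤ i₁ i₂ t₁ t₂ with 3 * length (filterᵇ (not ∘ vertical? g) R₁) ≤? length (R₁ ++ R₂) | 3 * length (filterᵇ (not ∘ vertical? g) R₂) ≤? length (R₁ ++ R₂)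
      ... | yes few | _ = clear (R₁ ++ R₂) ↭-refl δ₁ a≤ b≤ i₁ t₁ t₂ few
      ... | no _ | yes few = clear (R₁ ++ R₂) (↭P.++-comm R₁ R₂) δ₂ (≤-trans (≤-reflexive (+-comm a₂ a₁)) a≤) b≤ i₂ t₂ t₁ few
      ... | no many₁ | no many₂ = go (window q Θ 1≤q (≤-trans qΘ≤θ (≤-trans θ≤δ δ≤N)) (horizontals-thin R (++⁺ i₁ i₂)) (filterS (not ∘ vertical? g) (swapS (padS a≤ b≤ (ver a₁ a₂ refl t₁ t₂)))))
        where
        R = R₁ ++ R₂
        V H : List A
        V = filterᵇ (vertical? g) R
        H = filterᵇ (not ∘ vertical? g) R
        few : 3 * length V ≤ length R
        few = lia 5 (λ v h r h₁ h₂ → (r :≡ v :+ h) ⇒ (h :≡ h₁ :+ h₂) ⇒ (r :< con 3 :* h₁) ⇒ (r :< con 3 :* h₂) ⇒ ⟨ con 3 :* v :≤ r ⟩) refl (length V) (length H) (length R)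
          (length (filterᵇ (not ∘ vertical? g) R₁)) (length (filterᵇ (not ∘ vertical? g) R₂)) (part-length (vertical? g) R) (trans (cong length (filter-++ _ R₁ R₂)) (length-++ (filterᵇ (not ∘ vertical? g) R₁))) (≰⇒> many₁) (≰⇒> many₂)
        go : (Σ (List A) λ kept → Σ (List A) λ lost → H ↭ kept ++ lost × q * length lost ≤ 2 * length H × Slice g f (N ∸ Θ) N kept) → Choice f g R
        go (kept , lost , p , c , t) = choose kept (V ++ lost)
          (↭-trans (partition↭ (vertical? g) R) (↭-trans (↭P.++⁺ˡ V p) (bag 3 (λ v k l → v :++ (k :++ l) :↭ k :++ (v :++ l)) refl V kept lost)))
          (≤-trans (≤-reflexive (cong (3 * q *_) (length-++ V)))
            (lia 5 (λ q v l h r → (con 3 :* v :* q :≤ r :* q) ⇒ (q :* l :≤ con 2 :* h) ⇒ (h :≤ r) ⇒ ⟨ con 3 :* q :* (v :+ l) :≤ q :* r :+ con 6 :* r ⟩) refl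
              q (length V) (length lost) (length H) (length R) (*-monoˡ-≤ q few) c (≤-trans (m≤n+m (length H) (length V)) (≤-reflexive (sym (part-length (vertical? g) R))))))
          (N , N ∸ Θ , inj₂ (≤-refl , ≤-reflexive (m∸n+n≡m Θ≤N)) , swapS t)

      none-lost : ∀ {f g R} a′ b′ → ((a′ + Θ ≤ N × b′ ≤ N) ⊎ (a′ ≤ N × b′ + Θ ≤ N)) → Slice f g a′ b′ R → Choice f g R
      none-lost {R = R} a′ b′ h t = choose R [] (↭-reflexive (sym (++-identityʳ R))) (≤-trans (≤-reflexive (*-zeroʳ (3 * q))) z≤n) (a′ , b′ , h , t)

    choice : ∀ {f g n a b L} (c : Core f g n a b L) → a ≤ N → b ≤ N → All (Item f g) (rtsC c) → Choice f g (rtsC c)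
    choice empty a≤ b≤ i = none-lost 0 0 (inj₁ (Θ≤N , z≤n)) none
    choice (exitX a′ b′ p r t) a≤ b≤ i = none-lost a′ b′ (inj₁ (≤-trans p a≤ , ≤-trans r b≤)) t
    choice (exitY a′ b′ p r t) a≤ b≤ i = none-lost a′ b′ (inj₂ (≤-trans p a≤ , ≤-trans r b≤)) t
    choice (balX a₁ a₂ b′ δ₁ δ₂ r t F₁ F₂) a≤ b≤ i = bal δ₁ δ₂ (≤-trans r a≤) (≤-trans t b≤) (++⁻ˡ (rts F₁) i) (++⁻ʳ (rts F₁) i) (restS F₁) (restS F₂)
    choice {f} {g} (balY b₁ b₂ a′ δ₁ δ₂ r t F₁ F₂) a≤ b≤ i = swapChoice (bal δ₁ δ₂ (≤-trans t b≤) (≤-trans r a≤)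
      (All.map (λ {x} → swapItem {f} {g} {x}) (++⁻ˡ (rts F₁) i)) (All.map (λ {x} → swapItem {f} {g} {x}) (++⁻ʳ (rts F₁) i)) (swapS (restS F₁)) (swapS (restS F₂)))

    -- Both kinds of arm items end up upright in two strips of width `w`, the horizontal ones being
    -- rotated; the slack `s` that is left of `Θ` is used for the rest.
    sidePack : ∀ {f g : A → ℕ} vs hs {R} a′ b′ → Σ′ f vs ≤ w → All (λ x → g x ≤ N) vs → Σ′ g hs ≤ w → All (λ x → f x ≤ N) hs →
               a′ + Θ ≤ N → b′ ≤ N → All (Item f g) R → Slice f g a′ b′ R → Bounded f g N N (vs ++ hs ++ R) (2 * w * N) (#X + 3)
    sidePack {f} {g} vs hs {R} a′ b′ v≤ vN h≤ hN a≤ b≤ i t = pack (useSlack a′ b′ (m∸n≤m N (2 * w)) ≤-refl inner b≤ i t)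
      where
      2w≤N : 2 * w ≤ N
      2w≤N = ≤-trans (≤-trans (m≤n+m (2 * w) s) (≤-reflexive (sym Θ≡))) Θ≤N
      inner : a′ + s ≤ N ∸ 2 * w
      inner = +-cancelʳ-≤ (2 * w) (a′ + s) (N ∸ 2 * w) (≤-trans (≤-reflexive (trans (+-assoc a′ s (2 * w)) (cong (a′ +_) (sym Θ≡)))) (≤-trans a≤ (≤-reflexive (sym (m∸n+n≡m 2w≤N)))))
      pack : Bounded f g (N ∸ 2 * w) N R 0 (#X + 1) → Bounded f g N N (vs ++ hs ++ R) (2 * w * N) (#X + 3)
      pack (U , u , P) = w * N + (w * N + U) ,
        ≤-trans (lia 9 (λ z w n U A r V H o → (z :* U :≤ (con 1 :+ z) :* A :+ r :* n :+ z :* con 0) ⇒ (r :* n :≤ n :* n) ⇒ ⟨ z :* (w :* n :+ (w :* n :+ U)) :≤ (con 1 :+ z) :* (V :+ (H :+ A)) :+ n :* n :+ z :* (con 2 :* w :* n) ⟩) refl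
            z w N U (area f g R) (N ∸ 2 * w) (area f g vs) (area f g hs) 0 u (*-monoˡ-≤ N (m∸n≤m N (2 * w))))
          (≤-reflexive (cong (λ v → suc z * v + N * N + z * (2 * w * N)) (sym (trans (Σ-++ _ vs (hs ++ R)) (cong (area f g vs +_) (Σ-++ _ hs R)))))) ,
        packWeaken ≤-refl (≤-reflexive (lia 1 (λ x → ⟨ con 1 :+ (con 1 :+ (x :+ con 1)) :≡ x :+ con 3 ⟩) refl #X))
          (subst (λ v → Pack f g v N (vs ++ hs ++ R) (w * N + (w * N + U)) (1 + (1 + (#X + 1)))) widths
            (packVer (packCell (vert false) w N vs (v≤ , vN)) (packVer (packCell (vert true) w N hs (h≤ , hN)) P)))
        where
        widths : w + (w + (N ∸ 2 * w)) ≡ N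
        widths = lia 3 (λ w r n → (con 2 :* w :+ r :≡ n) ⇒ ⟨ w :+ (w :+ r) :≡ n ⟩) refl w (N ∸ 2 * w) N (m+[n∸m]≡n 2w≤N)

    record OptB (f g : A → ℕ) (L : List A) (rr dd : ℕ) : Set where
      constructor optB-mk
      field
        kept gone : List A
        permB : L ↭ kept ++ gone
        countB : 3 * q * length gone ≤ q * rr + 3 * q * dd + 6 * length L
        packB : Bounded f g N N kept (2 * w * N) (#X + 3)

    optB : ∀ {f g L} (F : Fr f g n₀ N N L) → All (Item f g) L → All (λ x → f x ≤ N × g x ≤ N) L → OptB f g L (length (rts F)) (drops F)
    optB {f} {g} {L} F@(frame X Y ac bc _ _ _ _ ea eb _ _ _ _ _ _ c _) items fit = finish (choice c (≤-trans (m≤n+m ac X) (≤-reflexive ea)) (≤-trans (m≤n+m bc Y) (≤-reflexive eb)) iR)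
      where
      pm = parts F
      itemsP = All-↭ pm items
      fitP = All-↭ pm fit
      iR : All (Item f g) (rts F)
      iR = ++⁻ʳ (dts F) (++⁻ʳ (hts F) (++⁻ʳ (vts F) itemsP))
      vN : All (λ x → g x ≤ N) (vts F)
      vN = All.map proj₂ (++⁻ˡ (vts F) fitP)
      hN : All (λ x → f x ≤ N) (hts F)
      hN = All.map proj₁ (++⁻ˡ (hts F) (++⁻ʳ (vts F) fitP))
      v≤ : Σ′ f (vts F) ≤ w
      v≤ = ≤-trans (thinV F ≤-refl) w≥
      h≤ : Σ′ g (hts F) ≤ w
      h≤ = ≤-trans (thinH F ≤-refl) w≥
      finish : Choice f g (rts F) → OptB f g L (length (rts F)) (drops F)
      finish (choose K G p cnt (a′ , b′ , r , t)) = optB-mk (vts F ++ hts F ++ K) (G ++ dts F)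
        (↭-trans pm (↭-trans (↭P.++⁺ˡ (vts F) (↭P.++⁺ˡ (hts F) (↭P.++⁺ˡ (dts F) p))) (bag 5 (λ v h d k g → v :++ (h :++ (d :++ (k :++ g))) :↭ (v :++ (h :++ k)) :++ (g :++ d)) refl (vts F) (hts F) (dts F) K G)))
        (≤-trans (≤-reflexive (cong (3 * q *_) (trans (length-++ G) (cong (length G +_) (drops≡ F)))))
          (lia 5 (λ q g d r l → (con 3 :* q :* g :≤ q :* r :+ con 6 :* r) ⇒ (r :≤ l) ⇒ ⟨ con 3 :* q :* (g :+ d) :≤ q :* r :+ con 3 :* q :* d :+ con 6 :* l ⟩) refl q (length G) (drops F) (length (rts F)) (length L) cnt R≤L))
        (packed r)
        where
        R≤L : length (rts F) ≤ length L
        R≤L = ≤-trans (≤-trans (m≤n+m _ (length (dts F))) (≤-reflexive (sym (length-++ (dts F))))) (≤-trans (≤-trans (m≤n+m _ (length (hts F))) (≤-reflexive (sym (length-++ (hts F))))) (≤-trans (≤-trans (m≤n+m _ (length (vts F))) (≤-reflexive (sym (length-++ (vts F))))) (≤-reflexive (sym (length-↭ pm)))))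
        iK : All (Item f g) K
        iK = ++⁻ˡ K (All-↭ p iR)
        packed : ((a′ + Θ ≤ N × b′ ≤ N) ⊎ (a′ ≤ N × b′ + Θ ≤ N)) → Bounded f g N N (vts F ++ hts F ++ K) (2 * w * N) (#X + 3)
        packed (inj₁ (h , k)) = sidePack (vts F) (hts F) a′ b′ v≤ vN h≤ hN h k iK t
        packed (inj₂ (h , k)) = permBounded (bag 3 (λ v h k → v :++ (h :++ k) :↭ h :++ (v :++ k)) refl (vts F) (hts F) K)
          (swapBounded (sidePack (hts F) (vts F) b′ a′ h≤ hN v≤ vN k h (All.map (λ {x} → swapItem {f} {g} {x}) iK) (swapS t)))
          where
          permBounded : ∀ {L₁ L₂ x k} → L₁ ↭ L₂ → Bounded f g N N L₂ x k → Bounded f g N N L₁ x k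
          permBounded {x = x} p (U , u , P) = U , ≤-trans u (≤-reflexive (cong (λ v → suc z * v + N * N + z * x) (sym (Σ-↭ _ p)))) , packPerm p P

    record Outcome (f g : A → ℕ) (L : List A) (cost : ℕ) : Set where
      constructor outcome
      field
        kept gone : List A
        permO : L ↭ kept ++ gone
        countO : 5 * q * length gone ≤ q * length L + 20 * length L + 5 * q * cost + 5 * q * pow2 n₀ + 5 * q * (q * d) * #frames n₀
        packO : Bounded f g N N kept (#frames n₀ * (θ′ * N) + 2 * w * N) (#optA q z d M₀ n₀ + (#X + 3))

    outcomeOf : ∀ {f g L} (t : Slice f g N N L) → N + N ≤ n₀ * δ → All (Item f g) L → Outcome f g L (gapCost δ θ θ′ t 0 0)
    outcomeOf {f} {g} {L} t NN items with chain t items n₀ N N 0 0 0 0 [] [] [] refl refl z≤n z≤n z≤n z≤n NN none none [] []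
    ... | F , le = select (3 * arms F ≤? 2 * length (rts F))
      where
      cst = gapCost δ θ θ′ t 0 0
      split : length L ≡ arms F + (drops F + length (rts F))
      split = trans (length-↭ (parts F)) (trans (length-++ (vts F)) (trans (cong (length (vts F) +_) (trans (length-++ (hts F)) (cong (length (hts F) +_) (trans (length-++ (dts F)) (cong (_+ length (rts F)) (drops≡ F))))))
        (trans (sym (+-assoc (length (vts F)) _ _)) (cong (_+ (drops F + length (rts F))) (arms≡ F)))))
      weaken : ∀ {K x x′ k k′} → x ≤ x′ → k ≤ k′ → Bounded f g N N K x k → Bounded f g N N K x′ k′
      weaken {K} x≤ k≤ (U , u , P) = U , ≤-trans u (+-monoʳ-≤ (suc z * area f g K + N * N) (*-monoʳ-≤ z x≤)) , packWeaken ≤-refl k≤ P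
      -- The switch is at `t / 2 = r / 3`. In both cases the windows, inside and outside of the
      -- frames' construction, add up to `20 * length L`.
      select : Dec (3 * arms F ≤ 2 * length (rts F)) → Outcome f g L cst
      select (yes few) = let optA-mk K G p c P = optA F ≤-refl ≤-refl items in
        outcome K G p
          (*-cancelˡ-≤ 2 (lia 11 (λ q G a r D l c p d h o → (con 2 :* q :* G :≤ q :* a :+ con 2 :* q :* D :+ con 4 :* l :+ con 2 :* q :* (q :* d) :* h) ⇒ (con 3 :* a :* q :≤ con 2 :* r :* q) ⇒ (l :≡ a :+ (D :+ r)) ⇒ (l :* q :≡ (a :+ (D :+ r)) :* q) ⇒
              (q :* D :≤ q :* con 0 :+ q :* c :+ con 2 :* l :+ q :* p) ⇒
              ⟨ con 2 :* (con 5 :* q :* G) :≤ con 2 :* (q :* l :+ con 20 :* l :+ con 5 :* q :* c :+ con 5 :* q :* p :+ con 5 :* q :* (q :* d) :* h) ⟩) refl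
              q (length G) (arms F) (length (rts F)) (drops F) (length L) cst (pow2 n₀) d (#frames n₀) 0 c (*-monoˡ-≤ q few) split (cong (_* q) split) le))
          (weaken (m≤m+n _ _) (m≤m+n _ _) P)
      select (no many) = let optB-mk K G p c P = optB F items (fits t) in
        outcome K G p
          (*-cancelˡ-≤ 3 (lia 11 (λ q G a r D l c p d h o → (con 3 :* q :* G :≤ q :* r :+ con 3 :* q :* D :+ con 6 :* l) ⇒ (con 2 :* r :* q :≤ con 3 :* a :* q) ⇒ (l :≡ a :+ (D :+ r)) ⇒ (l :* q :≡ (a :+ (D :+ r)) :* q) ⇒
              (q :* D :≤ q :* con 0 :+ q :* c :+ con 2 :* l :+ q :* p) ⇒
              ⟨ con 3 :* (con 5 :* q :* G) :≤ con 3 :* (q :* l :+ con 20 :* l :+ con 5 :* q :* c :+ con 5 :* q :* p :+ con 5 :* q :* (q :* d) :* h) ⟩) refl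
              q (length G) (arms F) (length (rts F)) (drops F) (length L) cst (pow2 n₀) d (#frames n₀) 0 c (*-monoˡ-≤ q (<⇒≤ (≰⇒> many))) split (cong (_* q) split) le))
          (weaken (m≤n+m _ (#frames n₀ * (θ′ * N))) (m≤n+m _ (#optA q z d M₀ n₀)) P)

  -- Shelves of small items

  lay-≤ : ∀ {a b R} → Lay a b R → All (λ r → proj₁ r ≤ a × proj₂ r ≤ b) R
  lay-≤ (void _) = []
  lay-≤ (wvoid _) = []
  lay-≤ cell = (≤-refl , ≤-refl) ∷ []
  lay-≤ (ver a₁ a₂ refl s t) = ++⁺ (All.map (λ { (p , q) → ≤-trans p (m≤m+n a₁ a₂) , q }) (lay-≤ s)) (All.map (λ { (p , q) → ≤-trans p (m≤n+m a₂ a₁) , q }) (lay-≤ t))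
  lay-≤ (hor b₁ b₂ refl s t) = ++⁺ (All.map (λ { (p , q) → p , ≤-trans q (m≤m+n b₁ b₂) }) (lay-≤ s)) (All.map (λ { (p , q) → p , ≤-trans q (m≤n+m b₂ b₁) }) (lay-≤ t))

  freeArea : {A : Set} → Cell A → ℕ
  freeArea (mkCell free w h _) = w * h
  freeArea _ = 0

  -- The area containers: small items assigned to the free cells.
  SmallOK : {A : Set} (f g : A → ℕ) → ℕ → Cell A × List A → Set
  SmallOK f g q (mkCell free w h _ , ss) = Slice f g w h ss × All (λ x → q * f x ≤ w × q * g x ≤ h) ss
  SmallOK f g q (_ , ss) = ss ≡ []

  module Shelves {A : Set} (f g : A → ℕ) (μ : ℕ) where

    Small : A → Set
    Small x = f x ≤ μ × g x ≤ μ

    row : ∀ p h ys → Σ′ f ys ≤ p → All (λ y → g y ≤ h) ys → Slice f g p h ys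
    row p h [] _ _ = none
    row p h (y ∷ ys) le (k ∷ ks) = ver (f y) (p ∸ f y) (m+[n∸m]≡n (≤-trans (m≤m+n (f y) _) le)) (one y ≤-refl k)
      (row (p ∸ f y) h ys (≤-trans (≤-reflexive (sym (m+n∸m≡n (f y) _))) (∸-monoˡ-≤ (f y) le)) ks)

    decr-suffix : ∀ ys {zs} → Decreasing g (ys ++ zs) → Decreasing g zs
    decr-suffix [] d = d
    decr-suffix (y ∷ ys) (_ ∷ d) = decr-suffix ys d

    record Shelved (p h : ℕ) (xs : List A) (top : ℕ) : Set where
      constructor shelved
      field
        done left : List A
        split : xs ≡ done ++ left
        sl : Slice f g p h done
        full : left ≡ [] ⊎ (p ∸ μ) * (h ∸ top) ≤ area f g done

    -- Next-fit decreasing height: a closed shelf is filled up to μ, and all its items are at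
    -- least as high as the next shelf.
    nfdh : ∀ n p h x xs → length (x ∷ xs) ≤ n → μ ≤ p → Decreasing g (x ∷ xs) → All Small (x ∷ xs) → Shelved p h (x ∷ xs) (g x)
    nfdh (suc n) p h x xs (s≤s len≤) μ≤p d small with g x ≤? h
    ... | no ¬fit = shelved [] (x ∷ xs) refl none (inj₂ (≤-reflexive (trans (cong ((p ∸ μ) *_) (m≤n⇒m∸n≡0 (<⇒≤ (≰⇒> ¬fit)))) (*-zeroʳ (p ∸ μ)))))
    ... | yes fit = go (Fill.takeFit f g g 1 p (x ∷ xs))
      where
      low : All (λ y → g y ≤ g x) (x ∷ xs)
      low = ≤-refl ∷ proj₂ (decr-split g [] x xs d)
      go : (Σ (List A) λ ys → Σ (List A) λ zs → x ∷ xs ≡ ys ++ zs × Σ′ f ys ≤ p × (zs ≡ [] ⊎ Σ A λ o → Σ (List A) λ ws → zs ≡ o ∷ ws × p < Σ′ f ys + f o)) → Shelved p h (x ∷ xs) (g x)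
      go (ys , .[] , e , le , inj₁ refl) = shelved ys [] e (padS ≤-refl fit (row p (g x) ys le (++⁻ˡ ys (subst (All _) e low)))) (inj₁ refl)
      go ([] , _ , refl , le , inj₂ (o , ws , refl , over)) = contradiction (≤-trans (proj₁ (All.head small)) μ≤p) (<⇒≱ over)
      go (y ∷ ys , _ , refl , le , inj₂ (o , ws , refl , over)) = next (nfdh n p (h ∸ g y) o ws len′ μ≤p (decr-suffix (y ∷ ys) d) (++⁻ʳ (y ∷ ys) small))
        where
        len′ : length (o ∷ ws) ≤ n
        len′ = ≤-trans (≤-trans (m≤n+m _ (length ys)) (≤-reflexive (sym (length-++ ys)))) len≤
        shelfArea : (p ∸ μ) * g o ≤ area f g (y ∷ ys)
        shelfArea = ≤-trans (*-monoˡ-≤ (g o) (≤-trans (∸-monoˡ-≤ μ (≤-trans (<⇒≤ over) (+-monoʳ-≤ _ (proj₁ (All.head (++⁻ʳ (y ∷ ys) small)))))) (≤-reflexive (m+n∸n≡m (Σ′ f (y ∷ ys)) μ))))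
          (≤-trans (≤-reflexive (trans (*-comm (Σ′ f (y ∷ ys)) (g o)) (sym (Σ-* (g o) f (y ∷ ys)))))
            (Σ-mono (All.map (λ {v} k → ≤-trans (≤-reflexive (*-comm (g o) (f v))) (*-monoʳ-≤ (f v) k)) (proj₁ (decr-split g (y ∷ ys) o ws d)))))
        next : Shelved p (h ∸ g y) (o ∷ ws) (g o) → Shelved p h (y ∷ ys ++ o ∷ ws) (g y)
        next (shelved done left e sl full) = shelved (y ∷ ys ++ done) left (trans (cong ((y ∷ ys) ++_) e) (sym (++-assoc (y ∷ ys) done left)))
          (hor (g y) (h ∸ g y) (m+[n∸m]≡n fit) (row p (g y) (y ∷ ys) le (++⁻ˡ (y ∷ ys) low)) sl) (bound full)
          where
          bound : (left ≡ [] ⊎ (p ∸ μ) * (h ∸ g y ∸ g o) ≤ area f g done) → left ≡ [] ⊎ (p ∸ μ) * (h ∸ g y) ≤ area f g (y ∷ ys ++ done)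
          bound (inj₁ l) = inj₁ l
          bound (inj₂ l) = inj₂ (≤-trans (*-monoʳ-≤ (p ∸ μ) (m≤n+m∸n (h ∸ g y) (g o))) (≤-trans (≤-reflexive (*-distribˡ-+ (p ∸ μ) (g o) _))
            (≤-trans (+-mono-≤ shelfArea l) (≤-reflexive (sym (Σ-++ _ (y ∷ ys) done))))))

    record FilledFree (q N : ℕ) (cs : List (Cell A)) (xs : List A) : Set where
      constructor filledFree
      field
        out : List (Cell A × List A)
        left : List A
        cells≡ : map proj₁ out ≡ cs
        perm′ : xs ≡ concat (map proj₂ out) ++ left
        allOK : All (SmallOK f g q) out
        enough : left ≡ [] ⊎ Σ′ freeArea cs ≤ area f g (concat (map proj₂ out)) + length cs * (2 * (q * μ) * N)

    -- A cell with a side below `q * μ` is skipped; its area is at most `q * μ * N`. In any other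
    -- cell all small items satisfy the size condition of an area container, and the shelves waste
    -- at most a width `μ` and a height `μ`. If an item is left over, every cell has been used up to
    -- this waste.
    fillFree : ∀ q N cs xs → 1 ≤ q → All (λ c → cw c ≤ N × ch c ≤ N) cs → Decreasing g xs → All Small xs → FilledFree q N cs xs
    fillFree q N [] xs 1≤q _ d sm = filledFree [] xs refl refl [] (inj₂ z≤n)
    fillFree q N (c@(mkCell (vert _) w h _) ∷ cs) xs 1≤q (_ ∷ ns) d sm with fillFree q N cs xs 1≤q ns d sm
    ... | filledFree out left e p o en = filledFree ((c , []) ∷ out) left (cong (c ∷_) e) p (refl ∷ o) (more en)
      where more : (left ≡ [] ⊎ Σ′ freeArea cs ≤ area f g (concat (map proj₂ out)) + length cs * (2 * (q * μ) * N)) → (left ≡ [] ⊎ Σ′ freeArea (c ∷ cs) ≤ area f g (concat (map proj₂ out)) + suc (length cs) * (2 * (q * μ) * N))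
            more (inj₁ l) = inj₁ l
            more (inj₂ l) = inj₂ (≤-trans l (+-monoʳ-≤ (area f g (concat (map proj₂ out))) (m≤n+m (length cs * (2 * (q * μ) * N)) (2 * (q * μ) * N))))
    fillFree q N (c@(mkCell (hori _) w h _) ∷ cs) xs 1≤q (_ ∷ ns) d sm with fillFree q N cs xs 1≤q ns d sm
    ... | filledFree out left e p o en = filledFree ((c , []) ∷ out) left (cong (c ∷_) e) p (refl ∷ o) (more en)
      where more : (left ≡ [] ⊎ Σ′ freeArea cs ≤ area f g (concat (map proj₂ out)) + length cs * (2 * (q * μ) * N)) → (left ≡ [] ⊎ Σ′ freeArea (c ∷ cs) ≤ area f g (concat (map proj₂ out)) + suc (length cs) * (2 * (q * μ) * N))
            more (inj₁ l) = inj₁ l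
            more (inj₂ l) = inj₂ (≤-trans l (+-monoʳ-≤ (area f g (concat (map proj₂ out))) (m≤n+m (length cs * (2 * (q * μ) * N)) (2 * (q * μ) * N))))
    fillFree q N (c@(mkCell free w h zs) ∷ cs) xs 1≤q ((w≤ , h≤) ∷ ns) d sm = go xs refl (q * μ ≤? w) (q * μ ≤? h)
      where
      loss = 2 * (q * μ) * N
      skip : w * h ≤ loss → FilledFree q N (c ∷ cs) xs
      skip small with fillFree q N cs xs 1≤q ns d sm
      ... | filledFree out left e p o en = filledFree ((c , []) ∷ out) left (cong (c ∷_) e) p ((none , []) ∷ o) (more en)
        where more : (left ≡ [] ⊎ Σ′ freeArea cs ≤ area f g (concat (map proj₂ out)) + length cs * loss) → (left ≡ [] ⊎ w * h + Σ′ freeArea cs ≤ area f g (concat (map proj₂ out)) + suc (length cs) * loss)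
              more (inj₁ l) = inj₁ l
              more (inj₂ l) = inj₂ (lia 5 (λ wh s a n o → (wh :≤ o) ⇒ (s :≤ a :+ n) ⇒ ⟨ wh :+ s :≤ a :+ (o :+ n) ⟩) refl (w * h) (Σ′ freeArea cs) (area f g (concat (map proj₂ out))) (length cs * loss) loss small l)
      qμ≤ : q * μ * N ≤ loss
      qμ≤ = *-monoˡ-≤ N (m≤m+n (q * μ) _)
      go : ∀ ys → xs ≡ ys → Dec (q * μ ≤ w) → Dec (q * μ ≤ h) → FilledFree q N (c ∷ cs) xs
      go _ _ (no ¬w) _ = skip (≤-trans (*-mono-≤ (<⇒≤ (≰⇒> ¬w)) h≤) qμ≤)
      go _ _ (yes _) (no ¬h) = skip (≤-trans (*-mono-≤ w≤ (<⇒≤ (≰⇒> ¬h))) (≤-trans (≤-reflexive (*-comm N (q * μ))) qμ≤))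
      go [] e (yes _) (yes _) with fillFree q N cs xs 1≤q ns d sm
      ... | filledFree out left e′ p o en = filledFree ((c , []) ∷ out) left (cong (c ∷_) e′) p ((none , []) ∷ o) (inj₁ (no-left (concat (map proj₂ out)) (trans (sym p) e)))
        where no-left : ∀ (us : List A) {vs} → us ++ vs ≡ [] → vs ≡ []
              no-left [] r = r
      go (x ∷ ys) refl (yes qμ≤w) (yes qμ≤h) = fillIt (nfdh (length (x ∷ ys)) w h x ys ≤-refl (≤-trans (≤-trans (≤-reflexive (sym (*-identityˡ μ))) (*-monoˡ-≤ μ 1≤q)) qμ≤w) d sm)
        where
        fillIt : Shelved w h (x ∷ ys) (g x) → FilledFree q N (c ∷ cs) (x ∷ ys)
        fillIt (shelved done rest e sl full) with fillFree q N cs rest 1≤q ns (decr-suffix done (subst (Decreasing g) e d)) (++⁻ʳ done (subst (All Small) e sm))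
        ... | filledFree out left e′ p o en = filledFree ((c , done) ∷ out) left (cong (c ∷_) e′) (trans e (trans (cong (done ++_) p) (sym (++-assoc done _ left))))
            ((sl , All.map (λ { (a , b) → ≤-trans (*-monoʳ-≤ q a) qμ≤w , ≤-trans (*-monoʳ-≤ q b) qμ≤h }) (++⁻ˡ done (subst (All Small) e sm))) ∷ o) (more full en)
          where
          cellLoss : w * h ≤ (w ∸ μ) * (h ∸ g x) + loss
          cellLoss = ≤-trans (lia 7 (λ w h w′ h′ m gx n → (w :≤ m :+ w′) ⇒ (h :≤ gx :+ h′) ⇒ (w :* h :≤ (m :+ w′) :* h) ⇒ (w′ :* h :≤ w′ :* (gx :+ h′)) ⇒ (m :* h :≤ m :* n) ⇒ (w′ :* gx :≤ n :* m) ⇒ ⟨ w :* h :≤ w′ :* h′ :+ con 2 :* m :* n ⟩) refl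
              w h (w ∸ μ) (h ∸ g x) μ (g x) N (m≤n+m∸n w μ) (m≤n+m∸n h (g x)) (*-monoˡ-≤ h (m≤n+m∸n w μ)) (*-monoʳ-≤ (w ∸ μ) (m≤n+m∸n h (g x))) (*-monoʳ-≤ μ h≤) (*-mono-≤ (≤-trans (m∸n≤m w μ) w≤) (proj₂ (All.head sm))))
            (+-monoʳ-≤ ((w ∸ μ) * (h ∸ g x)) (*-monoˡ-≤ N (*-monoʳ-≤ 2 (≤-trans (≤-reflexive (sym (*-identityˡ μ))) (*-monoˡ-≤ μ 1≤q)))))
          more : (rest ≡ [] ⊎ (w ∸ μ) * (h ∸ g x) ≤ area f g done) → (left ≡ [] ⊎ Σ′ freeArea cs ≤ area f g (concat (map proj₂ out)) + length cs * loss) →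
                 (left ≡ [] ⊎ w * h + Σ′ freeArea cs ≤ area f g (done ++ concat (map proj₂ out)) + suc (length cs) * loss)
          more _ (inj₁ l) = inj₁ l
          more (inj₁ r) (inj₂ _) = inj₁ (no-left (concat (map proj₂ out)) (trans (sym p) r))
            where no-left : ∀ (us : List A) {vs} → us ++ vs ≡ [] → vs ≡ []
                  no-left [] r = r
          more (inj₂ r) (inj₂ l) = inj₂ (≤-trans (lia 7 (λ wh s a b n o v → (wh :≤ v :+ o) ⇒ (v :≤ b) ⇒ (s :≤ a :+ n) ⇒ ⟨ wh :+ s :≤ b :+ a :+ (o :+ n) ⟩) refl
              (w * h) (Σ′ freeArea cs) (area f g (concat (map proj₂ out))) (area f g done) (length cs * loss) loss ((w ∸ μ) * (h ∸ g x)) cellLoss r l)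
            (≤-reflexive (cong (_+ suc (length cs) * loss) (sym (Σ-++ _ done (concat (map proj₂ out)))))))

  -- Choice of scales

  prod : ℕ → (ℕ → ℕ) → ℕ
  prod zero φ = 1
  prod (suc n) φ = prod n φ * φ n

  prod-≥1 : ∀ n φ → (∀ j → 1 ≤ φ j) → 1 ≤ prod n φ
  prod-≥1 zero φ h = ≤-refl
  prod-≥1 (suc n) φ h = *-mono-≤ (prod-≥1 n φ h) (h n)

  prod-∣ : ∀ n φ j → j < n → Σ ℕ λ r → prod n φ ≡ φ j * r
  prod-∣ (suc n) φ j j<n with j ≟ n
  ... | yes refl = prod j φ , *-comm (prod j φ) (φ j)
  ... | no j≢n with prod-∣ n φ j (≤∧≢⇒< (s≤s⁻¹ j<n) j≢n)
  ... | r , e = r * φ n , trans (cong (_* φ n) e) (*-assoc (φ j) r (φ n))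

  pow-≥1 : ∀ c n → 1 ≤ c → 1 ≤ c ^ n
  pow-≥1 c zero h = ≤-refl
  pow-≥1 c (suc n) h = *-mono-≤ h (pow-≥1 c n h)

  contents : ∀ {A : Set} → Cell A × List A → List A
  contents (c , ss) = its c ++ ss

  record Packing {A : Set} (f g : A → ℕ) (q N Kt #lost : ℕ) (T S : List A) : Set where
    constructor mkPacking
    field
      {dims} : List (ℕ × ℕ)
      lay : Lay N N dims
      fs : List (Cell A × List A)
      dims≡ : dims ≡ map (dim ∘ proj₁) fs
      ok : All (OK f g ∘ proj₁) fs
      smallOK : All (SmallOK f g q) fs
      size : length fs ≤ Kt
      gone : List A
      perm : T ++ S ↭ concat (map contents fs) ++ gone
      count : 5 * q * length gone ≤ q * length T + 25 * length T + 5 * q * #lost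

  module Level (q d : ℕ) (1≤q : 1 ≤ q) (8≤d : 8 ≤ d) where

    abstract
      -- `n₀` is `2 * N / δ`, the initial budget for nested balanced cuts. `c` is the ratio of
      -- successive widths `θ`, chosen to make `θ j = 8 * q * w j`.
      n₀ F c : ℕ
      n₀ = 2 * d
      F = #frames n₀
      c = 16 * q * F * d

      n₀≡ : n₀ ≡ 2 * d
      n₀≡ = refl

      F≡ : F ≡ #frames n₀
      F≡ = refl

      c≡ : c ≡ 16 * q * F * d
      c≡ = refl

      1≤F : 1 ≤ F
      1≤F = s≤s z≤n

    1≤d : 1 ≤ d
    1≤d = ≤-trans (s≤s z≤n) 8≤d

    1≤c : 1 ≤ c
    1≤c = ≤-trans (*-mono-≤ (*-mono-≤ (*-mono-≤ {1} {16} (s≤s z≤n) 1≤q) 1≤F) 1≤d) (≤-reflexive (sym c≡))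

    abstract
      -- For level `j`: `e j` is `N / s`, `1 / z j` is the relative error of rounding, and `M j` is
      -- the number of columns, so that `δ` is `2 * z j + 2` columns wide and `N` is `d` times that.
      -- `K j` counts cells and lost items.
      e z M K : ℕ → ℕ
      e j = 4 * q * d * c ^ j
      z j = 4 * e j
      M j = d * (2 * z j + 2)
      K j = #optA q (z j) d (M j) n₀ + (#slack (z j) d (M j) + 3)

      e≡ : ∀ j → e j ≡ 4 * q * d * c ^ j
      e≡ j = refl

      z≡ : ∀ j → z j ≡ 4 * e j
      z≡ j = refl

      M≡ : ∀ j → M j ≡ d * (2 * z j + 2)
      M≡ j = refl

      K≡ : ∀ j → #optA q (z j) d (M j) n₀ + (#slack (z j) d (M j) + 3) ≡ K j
      K≡ j = refl

      1≤e : ∀ j → 1 ≤ e j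
      1≤e j = *-mono-≤ (*-mono-≤ (*-mono-≤ {1} {4} (s≤s z≤n) 1≤q) 1≤d) (pow-≥1 c j 1≤c)

      1≤z : ∀ j → 1 ≤ z j
      1≤z j = *-mono-≤ {1} {4} (s≤s z≤n) (1≤e j)

      1≤M : ∀ j → 1 ≤ M j
      1≤M j = *-mono-≤ 1≤d (≤-trans (s≤s z≤n) (m≤n+m 2 (2 * z j)))

      -- `Pr` makes the scaled side divisible by every `M j * z j`, so that `κ` and `γ` are integers
      -- at all levels. `m` makes small items so small that the shelves in up to `Kt` cells waste at
      -- most a fraction `1 / (8 q)` of the area, whichever level is selected.
      Pr Kt m e₀ : ℕ
      Pr = prod q (λ j → M j * z j)
      Kt = upΣ q K
      m = 16 * q * q * suc Kt * (d * c ^ q)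
      e₀ = pred (d * c ^ q * Pr * m)

      Pr-∣ : ∀ j → j < q → Σ ℕ λ r → Pr ≡ M j * z j * r
      Pr-∣ = prod-∣ q (λ j → M j * z j)

      K≤Kt : ∀ j → j < q → K j ≤ Kt
      K≤Kt = upΣ-∋ q K

      m≡ : m ≡ 16 * q * q * suc Kt * (d * c ^ q)
      m≡ = refl

      1≤m : 1 ≤ m
      1≤m = *-mono-≤ (*-mono-≤ (*-mono-≤ (*-mono-≤ {1} {16} (s≤s z≤n) 1≤q) 1≤q) (s≤s (z≤n {Kt}))) (*-mono-≤ 1≤d (pow-≥1 c q 1≤c))

      1≤Pr : 1 ≤ Pr
      1≤Pr = prod-≥1 q _ (λ j → *-mono-≤ (1≤M j) (1≤z j))

      E≡ : suc e₀ ≡ d * c ^ q * Pr * m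
      E≡ = suc-pred (d * c ^ q * Pr * m) ⦃ >-nonZero (*-mono-≤ (*-mono-≤ (*-mono-≤ 1≤d (pow-≥1 c q 1≤c)) 1≤Pr) 1≤m) ⦄

      d<m : d < m
      d<m = lia 3 (λ d m k → (con 8 :≤ d) ⇒ (con 16 :* d :≤ m) ⇒ ⟨ d :< m ⟩) refl d m 0 8≤d
        (*-mono-≤ {16} (≤-trans (≤-reflexive refl) (*-mono-≤ (*-mono-≤ (*-monoʳ-≤ 16 1≤q) 1≤q) (s≤s (z≤n {Kt})))) (≤-trans (≤-reflexive (sym (*-identityʳ d))) (*-monoʳ-≤ d (pow-≥1 c q 1≤c))))

      #lost : ℕ
      #lost = pow2 n₀ + q * d * F + Kt

      #lost≡ : #lost ≡ pow2 n₀ + q * d * F + Kt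
      #lost≡ = refl

    E : ℕ
    E = suc e₀

    module Scaled {A : Set} (f g : A → ℕ) (N₀ : ℕ) (1≤N₀ : 1 ≤ N₀) where

      x N δ μ : ℕ
      x = N₀ * Pr * m
      N = E * N₀
      δ = x * c ^ q
      μ = d * c ^ q * N₀ * Pr

      θ θ′ w : ℕ → ℕ
      θ j = x * c ^ (q ∸ j)
      θ′ j = 2 * θ (suc j)
      w j = F * (θ′ j * d)

      1≤x : 1 ≤ x
      1≤x = *-mono-≤ (*-mono-≤ 1≤N₀ 1≤Pr) 1≤m

      N≡dδ : N ≡ d * δ
      N≡dδ = trans (cong (_* N₀) E≡) (lia 5 (λ d c P m n → ⟨ d :* c :* P :* m :* n :≡ d :* (n :* P :* m :* c) ⟩) refl d (c ^ q) Pr m N₀)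

      N≡mμ : N ≡ m * μ
      N≡mμ = trans (cong (_* N₀) E≡) (lia 5 (λ d c P m n → ⟨ d :* c :* P :* m :* n :≡ m :* (d :* c :* n :* P) ⟩) refl d (c ^ q) Pr m N₀)

      θ-suc : ∀ {j} → j < q → θ j ≡ c * θ (suc j)
      θ-suc {j} j<q = trans (cong (λ k → x * c ^ k) (+-∸-assoc 1 j<q)) (lia 3 (λ x c y → ⟨ x :* (c :* y) :≡ c :* (x :* y) ⟩) refl x c (c ^ (q ∸ suc j)))

      θ≡8qw : ∀ {j} → j < q → θ j ≡ 8 * q * w j
      θ≡8qw {j} j<q = trans (θ-suc j<q) (trans (cong (_* θ (suc j)) c≡) (lia 4 (λ q F d t → ⟨ con 16 :* q :* F :* d :* t :≡ con 8 :* q :* (F :* (con 2 :* t :* d)) ⟩) refl q F d (θ (suc j))))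

      δ≡ : ∀ {j} → j ≤ q → δ ≡ c ^ j * θ j
      δ≡ {j} j≤q = trans (cong (λ k → x * c ^ k) (sym (m+[n∸m]≡n j≤q))) (trans (cong (x *_) (^-distribˡ-+-* c j (q ∸ j))) (lia 3 (λ x a b → ⟨ x :* (a :* b) :≡ a :* (x :* b) ⟩) refl x (c ^ j) (c ^ (q ∸ j))))

      θ-decr : ∀ j → θ (suc j) ≤ θ j
      θ-decr j = *-monoʳ-≤ x (^-monoʳ-≤ c ⦃ >-nonZero 1≤c ⦄ (∸-monoʳ-≤ q (n≤1+n j)))

      -- A strip in the gap of level `j` has `2 * θ (suc j) < u + p ≤ 2 * θ j`, and these intervals
      -- are disjoint. Hence the factor 2 in `θ′`.
      sep : ∀ u p → upΣ q (λ j → 𝟙 (inGap (θ j) (θ′ j) u p)) ≤ 1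
      sep u p = ≤-trans (go q) (≤1 (suc (2 * θ q) ≤ᵇ u + p))
        where
        ≤1 : ∀ b → 𝟙 b ≤ 1
        ≤1 true = ≤-refl
        ≤1 false = z≤n
        go : ∀ k → upΣ k (λ j → 𝟙 (inGap (θ j) (θ′ j) u p)) ≤ 𝟙 (suc (2 * θ k) ≤ᵇ u + p)
        go zero = z≤n
        go (suc k) with inGap (θ k) (θ′ k) u p in eq
        ... | false = ≤-trans (≤-reflexive (+-identityʳ _)) (≤-trans (go k) (mono (suc (2 * θ k) ≤ᵇ u + p) refl))
          where
          mono : ∀ b → (suc (2 * θ k) ≤ᵇ u + p) ≡ b → 𝟙 b ≤ 𝟙 (suc (2 * θ (suc k)) ≤ᵇ u + p)
          mono false _ = z≤n
          mono true e = ≤-reflexive (sym (cong 𝟙 (≤ᵇ-true {suc (2 * θ (suc k))} {u + p} (≤-trans (s≤s (*-monoʳ-≤ 2 (θ-decr k))) (true-≤ {suc (2 * θ k)} {u + p} e)))))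
        ... | true = ≤-trans (+-monoˡ-≤ 1 (≤-trans (go k) (≤-reflexive (cong 𝟙 (≤ᵇ-false below))))) (≤-reflexive (sym (cong 𝟙 above′)))
          where
          split : ∀ a b c → (a ∧ b) ∧ c ≡ true → a ≡ true × b ≡ true × c ≡ true
          split true true true _ = refl , refl , refl
          parts′ = split (u ≤ᵇ θ k) (p ≤ᵇ θ k) (suc (θ′ k) ≤ᵇ u + p) eq
          below : u + p < suc (2 * θ k)
          below = s≤s (lia 3 (λ u p t → (u :≤ t) ⇒ (p :≤ t) ⇒ ⟨ u :+ p :≤ con 2 :* t ⟩) refl u p (θ k) (true-≤ {u} (proj₁ parts′)) (true-≤ {p} (proj₁ (proj₂ parts′))))
          above′ : (suc (2 * θ (suc k)) ≤ᵇ u + p) ≡ true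
          above′ = proj₂ (proj₂ parts′)

      1≤δ : 1 ≤ δ
      1≤δ = *-mono-≤ 1≤x (pow-≥1 c q 1≤c)

      μ<δ : μ < δ
      μ<δ = *-cancelˡ-< m μ δ (≤-trans (s≤s (≤-reflexive (sym N≡mμ))) (≤-trans (s≤s (≤-reflexive N≡dδ)) (*-monoˡ-< δ ⦃ >-nonZero 1≤δ ⦄ d<m)))

      δ≤N : δ ≤ N
      δ≤N = ≤-trans (≤-trans (≤-reflexive (sym (*-identityˡ δ))) (*-monoˡ-≤ δ 1≤d)) (≤-reflexive (sym N≡dδ))

      1≤N : 1 ≤ N
      1≤N = ≤-trans 1≤δ δ≤N

      module AtLevel (j : ℕ) (j<q : j < q) where

        r γ κ s Θ : ℕ
        r = proj₁ (Pr-∣ j j<q)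
        γ = d * c ^ q * N₀ * r * m
        κ = z j * γ
        s = 2 * w j
        Θ = s + 2 * w j

        N≡Mκ : N ≡ M j * κ
        N≡Mκ = trans (cong (_* N₀) E≡) (trans (cong (λ v → d * c ^ q * v * m * N₀) (proj₂ (Pr-∣ j j<q)))
          (lia 7 (λ d c M z r m n → ⟨ d :* c :* (M :* z :* r) :* m :* n :≡ M :* (z :* (d :* c :* n :* r :* m)) ⟩) refl d (c ^ q) (M j) (z j) r m N₀))

        1≤γ : 1 ≤ γ
        1≤γ = n≢0⇒n>0 (λ γ≡0 → <⇒≢ 1≤N (sym (trans N≡Mκ (trans (cong (λ v → M j * (z j * v)) γ≡0) (trans (cong (M j *_) (*-zeroʳ (z j))) (*-zeroʳ (M j)))))))

        1≤κ : 1 ≤ κ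
        1≤κ = *-mono-≤ (1≤z j) 1≤γ

        N≡es : N ≡ e j * s
        N≡es = trans N≡dδ (trans (cong (d *_) (trans (δ≡ (<⇒≤ j<q)) (cong (c ^ j *_) (θ≡8qw j<q))))
          (trans (lia 4 (λ d p q w → ⟨ d :* (p :* (con 8 :* q :* w)) :≡ con 4 :* q :* d :* p :* (con 2 :* w) ⟩) refl d (c ^ j) q (w j)) (cong (_* s) (sym (e≡ j)))))

        -- `κ` and `γ` are at most `s / 8` each, and `M j * γ` is exactly `s / 4`.
        fine : κ + suc (M j) * γ ≤ s
        fine = lia 4 (λ k mg g s → (con 8 :* k :≤ s) ⇒ (g :≤ k) ⇒ (con 4 :* mg :≡ s) ⇒ ⟨ k :+ (g :+ mg) :≤ s ⟩) refl κ (M j * γ) γ s 8κ≤s (≤-trans (≤-reflexive (sym (*-identityˡ γ))) (*-monoˡ-≤ γ (1≤z j))) 4Mγ≡s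
          where
          4Mγ≡s : 4 * (M j * γ) ≡ s
          4Mγ≡s = *-cancelˡ-≡ (4 * (M j * γ)) s (e j) ⦃ >-nonZero (1≤e j) ⦄ (trans (lia 3 (λ e M g → ⟨ e :* (con 4 :* (M :* g)) :≡ M :* (con 4 :* e :* g) ⟩) refl (e j) (M j) γ) (trans (cong (λ v → M j * (v * γ)) (sym (z≡ j))) (trans (sym N≡Mκ) N≡es)))
          8κ≤s : 8 * κ ≤ s
          8κ≤s = *-cancelˡ-≤ (e j) ⦃ >-nonZero (1≤e j) ⦄ (≤-trans (≤-reflexive (trans (lia 2 (λ e k → ⟨ e :* (con 8 :* k) :≡ con 2 :* (con 4 :* e) :* k ⟩) refl (e j) κ) (cong (λ v → 2 * v * κ) (sym (z≡ j)))))
            (≤-trans (*-monoˡ-≤ κ (≤-trans (≤-trans (≤-trans (m≤m+n (2 * z j) 2) (≤-reflexive (sym (*-identityˡ _)))) (*-monoˡ-≤ (2 * z j + 2) 1≤d)) (≤-reflexive (sym (M≡ j))))) (≤-trans (≤-reflexive (sym N≡Mκ)) (≤-reflexive N≡es))))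

        Bκ≡δ : (2 * z j + 2) * κ ≡ δ
        Bκ≡δ = *-cancelˡ-≡ _ δ d ⦃ >-nonZero 1≤d ⦄ (trans (sym (*-assoc d _ κ)) (trans (cong (_* κ) (sym (M≡ j))) (trans (sym N≡Mκ) N≡dδ)))

        qΘ≤θ : q * Θ ≤ θ j
        qΘ≤θ = ≤-trans (lia 2 (λ q w → ⟨ q :* (con 2 :* w :+ con 2 :* w) :≤ con 8 :* q :* w ⟩) refl q (w j)) (≤-reflexive (sym (θ≡8qw j<q)))

        θ′≤w : θ′ j ≤ w j
        θ′≤w = ≤-trans (≤-trans (≤-reflexive (sym (*-identityʳ (θ′ j)))) (*-monoʳ-≤ (θ′ j) 1≤d)) (≤-trans (≤-reflexive (sym (*-identityˡ _))) (*-monoˡ-≤ (θ′ j * d) 1≤F))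

        θ′Θ≤θ : θ′ j + Θ ≤ θ j
        θ′Θ≤θ = ≤-trans (lia 3 (λ t w q → (t :≤ w) ⇒ (con 1 :* w :≤ q :* w) ⇒ ⟨ t :+ (con 2 :* w :+ con 2 :* w) :≤ con 8 :* q :* w ⟩) refl (θ′ j) (w j) q θ′≤w (*-monoˡ-≤ (w j) 1≤q)) (≤-reflexive (sym (θ≡8qw j<q)))

        θ≤δ : θ j ≤ δ
        θ≤δ = ≤-trans (≤-trans (≤-reflexive (sym (*-identityˡ (θ j)))) (*-monoˡ-≤ (θ j) (pow-≥1 c j 1≤c))) (≤-reflexive (sym (δ≡ (<⇒≤ j<q))))

        μ≤Θ : μ ≤ Θ
        μ≤Θ = *-cancelˡ-≤ m ⦃ >-nonZero 1≤m ⦄ (≤-trans (≤-reflexive (trans (sym N≡mμ) N≡es)) (*-mono-≤ e≤m (m≤m+n s _)))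
          where
          e≤m : e j ≤ m
          e≤m = ≤-trans (≤-reflexive (trans (e≡ j) (*-assoc (4 * q) d (c ^ j)))) (≤-trans (*-mono-≤ 4q≤ (*-monoʳ-≤ d (^-monoʳ-≤ c ⦃ >-nonZero 1≤c ⦄ (<⇒≤ j<q)))) (≤-reflexive (sym m≡)))
            where
            4q≤ : 4 * q ≤ 16 * q * q * suc Kt
            4q≤ = ≤-trans (≤-trans (*-monoˡ-≤ q {4} {16} (s≤s (s≤s (s≤s (s≤s z≤n))))) (≤-trans (≤-reflexive (sym (*-identityʳ (16 * q)))) (*-monoʳ-≤ (16 * q) 1≤q)))
              (≤-trans (≤-reflexive (sym (*-identityʳ (16 * q * q)))) (*-monoʳ-≤ (16 * q * q) (s≤s (z≤n {Kt}))))

        sizes : OptionSizes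
        sizes = record
          { frameSizes = record { δ = δ ; μ = μ ; q = q ; θ = θ j ; θ′ = θ′ j ; Θ = Θ ; 1≤δ = 1≤δ ; 1≤q = 1≤q ; μ≤Θ = μ≤Θ ; qΘ≤θ = qΘ≤θ ; θ′Θ≤θ = θ′Θ≤θ }
          ; d = d ; N = N ; κ = κ ; γ = γ ; B = 2 * z j ; z = z j ; M₀ = M j ; s = s ; w = w j ; n₀ = n₀ ; μ<δ = μ<δ ; θ≤δ = θ≤δ ; N≤ = ≤-reflexive N≡dδ ; δ≤N = δ≤N
          ; 1≤κ = 1≤κ ; 1≤γ = 1≤γ ; κ≡ = refl ; Bκ≤δ = ≤-reflexive Bκ≡δ ; κ≤Bγ = ≤-reflexive (sym (*-assoc 2 (z j) γ)) ; N≤Mκ = ≤-reflexive N≡Mκ ; fine = fine ; Θ≡ = refl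
          ; w≥ = ≤-reflexive (cong (_* (θ′ j * d)) (sym F≡)) }

        NN : N + N ≤ n₀ * δ
        NN = ≤-reflexive (trans (cong₂ _+_ N≡dδ N≡dδ) (trans (lia 2 (λ d e → ⟨ d :* e :+ d :* e :≡ con 2 :* d :* e ⟩) refl d δ) (cong (_* δ) (sym n₀≡))))

        -- All the area lost to rounding is below (1 / 8 q) N².
        used-bound : ∀ {U T} → T ≤ N * N → z j * U ≤ suc (z j) * T + N * N + z j * (F * (θ′ j * N) + 2 * w j * N) → 16 * q * U ≤ 16 * q * T + 2 * (N * N)
        used-bound {U} {T} T≤ h = *-cancelˡ-≤ (z j) ⦃ >-nonZero (1≤z j) ⦄ (lia 8 (λ z q U T Q W y v → (z :* U :≤ T :+ z :* T :+ Q :+ z :* W) ⇒ (q :* (z :* U) :≤ q :* (T :+ z :* T :+ Q :+ z :* W)) ⇒ (q :* T :≤ q :* Q) ⇒ (con 32 :* q :* Q :≤ z :* Q) ⇒ (con 16 :* q :* W :* z :≤ Q :* z) ⇒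
            ⟨ z :* (con 16 :* q :* U) :≤ z :* (con 16 :* q :* T :+ con 2 :* Q) ⟩) refl (z j) q U T (N * N) (F * (θ′ j * N) + 2 * w j * N) 0 0 h (*-monoʳ-≤ q h) (*-monoʳ-≤ q T≤) (*-monoˡ-≤ (N * N) 32q≤z) (*-monoˡ-≤ (z j) 16qW))
          where
          32q≤z : 32 * q ≤ z j
          32q≤z = ≤-trans (lia 2 (λ q d → (con 8 :* q :≤ d :* q) ⇒ ⟨ con 32 :* q :≤ con 4 :* (con 4 :* q :* d :* con 1) ⟩) refl q d (*-monoˡ-≤ q 8≤d)) (≤-trans (*-monoʳ-≤ 4 (≤-trans (*-monoʳ-≤ (4 * q * d) (pow-≥1 c j 1≤c)) (≤-reflexive (sym (e≡ j))))) (≤-reflexive (sym (z≡ j))))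
          Fθ′≤w : F * θ′ j ≤ w j
          Fθ′≤w = *-monoʳ-≤ F (≤-trans (≤-reflexive (sym (*-identityʳ (θ′ j)))) (*-monoʳ-≤ (θ′ j) 1≤d))
          16qW : 16 * q * (F * (θ′ j * N) + 2 * w j * N) ≤ N * N
          16qW = begin
            16 * q * (F * (θ′ j * N) + 2 * w j * N)  ≡⟨ lia 5 (λ q F t n w → ⟨ con 16 :* q :* (F :* (t :* n) :+ con 2 :* w :* n) :≡ con 16 :* q :* (F :* t :+ con 2 :* w) :* n ⟩) refl q F (θ′ j) N (w j) ⟩
            16 * q * (F * θ′ j + 2 * w j) * N        ≤⟨ *-monoˡ-≤ N (*-monoʳ-≤ (16 * q) (+-monoˡ-≤ (2 * w j) Fθ′≤w)) ⟩
            16 * q * (w j + 2 * w j) * N             ≡⟨ cong (_* N) (lia 2 (λ q w → ⟨ con 16 :* q :* (w :+ con 2 :* w) :≡ con 6 :* (con 8 :* q :* w) ⟩) refl q (w j)) ⟩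
            6 * (8 * q * w j) * N                    ≡⟨ cong (λ v → 6 * v * N) (sym (θ≡8qw j<q)) ⟩
            6 * θ j * N                              ≤⟨ *-monoˡ-≤ N (*-mono-≤ (≤-trans (s≤s (s≤s (s≤s (s≤s (s≤s (s≤s z≤n)))))) 8≤d) θ≤δ) ⟩
            d * δ * N                                ≡⟨ cong (_* N) N≡dδ ⟨
            N * N                                    ∎
            where open ≤-Reasoning

      Thin : A → Set
      Thin y = 1 ≤ f y × 1 ≤ g y × ((δ ≤ g y × f y ≤ μ) ⊎ (δ ≤ f y × g y ≤ μ))

      private
        interleave : ∀ (fs : List (Cell A × List A)) → concat (map contents fs) ↭ items (map proj₁ fs) ++ concat (map proj₂ fs)
        interleave [] = ↭-refl
        interleave ((c , ss) ∷ fs) = ↭-trans (↭P.++⁺ˡ (its c ++ ss) (interleave fs)) (bag 4 (λ a b c d → (a :++ b) :++ (c :++ d) :↭ (a :++ c) :++ (b :++ d)) refl (its c) ss (items (map proj₁ fs)) (concat (map proj₂ fs)))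

        concat-↭ : ∀ {B : Set} (φ : B → List A) {xs ys} → xs ↭ ys → concat (map φ xs) ↭ concat (map φ ys)
        concat-↭ φ ↭.refl = ↭-refl
        concat-↭ φ (prep b p) = ↭P.++⁺ˡ (φ b) (concat-↭ φ p)
        concat-↭ φ (swap {ys = ys} a b p) = ↭-trans (↭P.++⁺ˡ (φ a) (↭P.++⁺ˡ (φ b) (concat-↭ φ p))) (↭P.shifts (φ a) (φ b))
        concat-↭ φ (↭.trans p r) = ↭-trans (concat-↭ φ p) (concat-↭ φ r)

        free+used : ∀ (cs : List (Cell A)) → Σ′ freeArea cs + Σ′ used cs ≡ Σ′ area₂ (map dim cs)
        free+used [] = refl
        free+used (mkCell free u v _ ∷ cs) = trans (+-assoc (u * v) _ _) (cong (u * v +_) (free+used cs))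
        free+used (mkCell (vert _) u v _ ∷ cs) = trans (lia 3 (λ a b c → ⟨ a :+ (b :+ c) :≡ b :+ (a :+ c) ⟩) refl (Σ′ freeArea cs) (u * v) (Σ′ used cs)) (cong (u * v +_) (free+used cs))
        free+used (mkCell (hori _) u v _ ∷ cs) = trans (lia 3 (λ a b c → ⟨ a :+ (b :+ c) :≡ b :+ (a :+ c) ⟩) refl (Σ′ freeArea cs) (u * v) (Σ′ used cs)) (cong (u * v +_) (free+used cs))

      core : ∀ T S → Slice f g N N T → All Thin T → All (λ y → f y ≤ μ × g y ≤ μ) S → q * (area f g T + area f g S) + N * N ≤ q * (N * N) → Packing f g q N Kt #lost T S
      core T S t thin small areas = go (pigeon q (λ j → gapCost δ (θ j) (θ′ j) t 0 0) (length T) 1≤q (gapCost-total δ θ θ′ q sep t 0 0))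
        where
        go : (Σ ℕ λ j → j < q × q * gapCost δ (θ j) (θ′ j) t 0 0 ≤ length T) → Packing f g q N Kt #lost T S
        go (j , j<q , cost≤) = assemble (OptionTheory.outcomeOf sizes t (AtLevel.NN j j<q) thin)
          where
          sizes = AtLevel.sizes j j<q
          cost = gapCost δ (θ j) (θ′ j) t 0 0
          assemble : OptionTheory.Outcome sizes f g T cost → Packing f g q N Kt #lost T S
          assemble (OptionTheory.outcome kept gone permO countO (U , U≤ , P)) = withSmall (fillFree q N (cells P) (sortBy g S) 1≤q cells≤N (sortBy-decr g S) (All-↭ (↭-sym (sortBy↭ g S)) small))
            where
            open Shelves f g μ
            cells≤N : All (λ b → cw b ≤ N × ch b ≤ N) (cells P)
            cells≤N = back (cells P) (All-↭ (dims↭ P) (lay-≤ (lay P)))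
              where back : ∀ (cs : List (Cell A)) → All (λ r → proj₁ r ≤ N × proj₂ r ≤ N) (map dim cs) → All (λ b → cw b ≤ N × ch b ≤ N) cs
                    back [] [] = []
                    back (b ∷ cs) (h ∷ hs) = h ∷ back cs hs
            Kj≤ : length (cells P) + length (lost P) ≤ Kt
            Kj≤ = ≤-trans (size≤ P) (≤-trans (≤-reflexive (K≡ j)) (K≤Kt j j<q))
            keptT : area f g kept ≤ area f g T
            keptT = ≤-trans (m≤m+n _ (area f g gone)) (≤-reflexive (sym (trans (Σ-↭ _ permO) (Σ-++ _ kept gone))))
            usedQ : 16 * q * Σ′ used (cells P) ≤ 16 * q * area f g T + 2 * (N * N)
            usedQ = ≤-trans (*-monoʳ-≤ (16 * q) (used≤ P)) (≤-trans (AtLevel.used-bound j j<q {U} {area f g kept} (≤-trans keptT (area-≤ t)) (subst (λ v → z j * U ≤ suc (z j) * area f g kept + N * N + z j * (v * (θ′ j * N) + 2 * w j * N)) (sym F≡) U≤)) (+-monoˡ-≤ (2 * (N * N)) (*-monoʳ-≤ (16 * q) keptT)))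
            totalQ : Σ′ freeArea (cells P) + Σ′ used (cells P) ≡ N * N
            totalQ = trans (free+used (cells P)) (trans (sym (Σ-↭ area₂ (dims↭ P))) (lay-area (lay P)))
            lossQ : 8 * q * (length (cells P) * (2 * (q * μ) * N)) ≤ N * N
            lossQ = begin
              8 * q * (length (cells P) * (2 * (q * μ) * N))  ≤⟨ *-monoʳ-≤ (8 * q) (*-monoˡ-≤ (2 * (q * μ) * N) (≤-trans (m≤m+n (length (cells P)) (length (lost P))) (≤-trans Kj≤ (n≤1+n Kt)))) ⟩
              8 * q * (suc Kt * (2 * (q * μ) * N))            ≡⟨ lia 4 (λ q k m n → ⟨ con 8 :* q :* (k :* (con 2 :* (q :* m) :* n)) :≡ con 16 :* q :* q :* k :* con 1 :* m :* n ⟩) refl q (suc Kt) μ N ⟩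
              16 * q * q * suc Kt * 1 * μ * N                 ≤⟨ *-monoˡ-≤ N (*-monoˡ-≤ μ (*-monoʳ-≤ (16 * q * q * suc Kt) (*-mono-≤ 1≤d (pow-≥1 c q 1≤c)))) ⟩
              16 * q * q * suc Kt * (d * c ^ q) * μ * N       ≡⟨ cong (λ v → v * μ * N) m≡ ⟨
              m * μ * N                                       ≡⟨ cong (_* N) N≡mμ ⟨
              N * N                                           ∎
              where open ≤-Reasoning
            withSmall : FilledFree q N (cells P) (sortBy g S) → Packing f g q N Kt #lost T S
            withSmall (filledFree out left cells≡ perm′ allOK enough) = mkPacking (lay P) fs′ dimsEq (All-↭ out↭ okOut) (All-↭ out↭ allOK)
                (≤-trans (≤-reflexive (sym (length-↭ out↭))) (≤-trans (≤-reflexive (trans (sym (length-map proj₁ out)) (cong length cells≡))) (≤-trans (m≤m+n _ _) Kj≤)))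
                (gone ++ lost P) permAll countAll
              where
              left≡[] : left ≡ []
              left≡[] = decide enough
                where
                packedS : area f g (concat (map proj₂ out)) ≤ area f g S
                packedS = ≤-trans (m≤m+n _ (area f g left)) (≤-reflexive (sym (trans (sym (Σ-↭ _ (sortBy↭ g S))) (trans (cong (area f g) perm′) (Σ-++ _ (concat (map proj₂ out)) left)))))
                -- The items leave a fraction `1 / q` of the area free, while rounding and shelves
                -- waste at most `1 / (8 q)` each. So the free cells cannot be used up.
                tooBig : Σ′ freeArea (cells P) ≤ area f g (concat (map proj₂ out)) + length (cells P) * (2 * (q * μ) * N) → N * N ≤ 0
                tooBig h = lia 8 (λ q fr us T S pS Q L → (fr :≤ pS :+ L) ⇒ (q :* fr :≤ q :* (pS :+ L)) ⇒ (q :* pS :≤ q :* S) ⇒ (con 16 :* q :* us :≤ con 16 :* q :* T :+ con 2 :* Q) ⇒ (q :* (fr :+ us) :≡ q :* Q) ⇒ (con 8 :* q :* L :≤ Q) ⇒ (q :* (T :+ S) :+ Q :≤ q :* Q) ⇒ ⟨ Q :≤ con 0 ⟩) refl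
                  q (Σ′ freeArea (cells P)) (Σ′ used (cells P)) (area f g T) (area f g S) (area f g (concat (map proj₂ out))) (N * N) (length (cells P) * (2 * (q * μ) * N))
                  h (*-monoʳ-≤ q h) (*-monoʳ-≤ q packedS) usedQ (cong (q *_) totalQ) lossQ areas
                decide : (left ≡ [] ⊎ Σ′ freeArea (cells P) ≤ area f g (concat (map proj₂ out)) + length (cells P) * (2 * (q * μ) * N)) → left ≡ []
                decide (inj₁ l) = l
                decide (inj₂ h) = contradiction (tooBig h) (<⇒≱ (*-mono-≤ 1≤N 1≤N))
              inv = ↭P.↭-map-inv (dim ∘ proj₁) {out} (↭-trans (↭-reflexive (trans (map-∘′ out) (cong (map dim) cells≡))) (↭-sym (dims↭ P)))
                where map-∘′ : ∀ (os : List (Cell A × List A)) → map (dim ∘ proj₁) os ≡ map dim (map proj₁ os)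
                      map-∘′ [] = refl
                      map-∘′ (o ∷ os) = cong (_ ∷_) (map-∘′ os)
              fs′ : List (Cell A × List A)
              fs′ = proj₁ inv
              dimsEq = proj₁ (proj₂ inv)
              out↭ : out ↭ fs′
              out↭ = proj₂ (proj₂ inv)
              okOut : All (OK f g ∘ proj₁) out
              okOut = back out (subst (All (OK f g)) (sym cells≡) (ok P))
                where back : ∀ (os : List (Cell A × List A)) → All (OK f g) (map proj₁ os) → All (OK f g ∘ proj₁) os
                      back [] [] = []
                      back (o ∷ os) (h ∷ hs) = h ∷ back os hs
              permAll : T ++ S ↭ concat (map contents fs′) ++ gone ++ lost P
              permAll = ↭-trans (↭P.++⁺ (↭-trans permO (↭P.++⁺ʳ gone (perm P))) (↭-trans (↭-sym (sortBy↭ g S)) (↭-reflexive (trans perm′ (trans (cong (concat (map proj₂ out) ++_) left≡[]) (++-identityʳ _))))))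
                (↭-trans (bag 4 (λ i l g o → ((i :++ l) :++ g) :++ o :↭ (i :++ o) :++ (g :++ l)) refl (items (cells P)) (lost P) gone (concat (map proj₂ out)))
                  (↭P.++⁺ʳ (gone ++ lost P) (↭-trans (↭-reflexive (cong (λ v → items v ++ concat (map proj₂ out)) (sym cells≡))) (↭-trans (↭-sym (interleave out)) (concat-↭ _ out↭)))))
              -- The gap of the selected level costs at most `length T / q` items, which turns the
              -- coefficient 20 into 25.
              countAll : 5 * q * length (gone ++ lost P) ≤ q * length T + 25 * length T + 5 * q * #lost
              countAll = ≤-trans (≤-reflexive (cong (5 * q *_) (length-++ gone)))
                (lia 9 (λ q G l T cst p dd ff K → (con 5 :* q :* G :≤ q :* T :+ con 20 :* T :+ con 5 :* q :* cst :+ con 5 :* q :* p :+ con 5 :* q :* (q :* dd) :* ff) ⇒ (q :* cst :≤ T) ⇒ (q :* l :≤ q :* K) ⇒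
                  ⟨ con 5 :* q :* (G :+ l) :≤ q :* T :+ con 25 :* T :+ con 5 :* q :* (p :+ q :* dd :* ff :+ K) ⟩) refl q (length gone) (length (lost P)) (length T) cost (pow2 n₀) d F Kt
                  (subst (λ v → 5 * q * length gone ≤ q * length T + 20 * length T + 5 * q * cost + 5 * q * pow2 n₀ + 5 * q * (q * d) * v) (sym F≡) countO) cost≤ (*-monoʳ-≤ q (≤-trans (m≤n+m _ _) Kj≤))
                  |> λ h → ≤-trans h (≤-reflexive (cong (λ v → q * length T + 25 * length T + 5 * q * v) (sym #lost≡))))

    scaledPack : ∀ {A : Set} (u v : A → ℕ) N₀ → 1 ≤ N₀ → ∀ T S → Slice u v N₀ N₀ T →
      All (λ x → 1 ≤ u x × 1 ≤ v x × ((N₀ ≤ d * v x × m * u x ≤ N₀) ⊎ (N₀ ≤ d * u x × m * v x ≤ N₀))) T →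
      All (λ x → m * u x ≤ N₀ × m * v x ≤ N₀) S → q * (area u v T + area u v S) + N₀ * N₀ ≤ q * (N₀ * N₀) →
      Packing (λ x → suc e₀ * u x) (λ x → suc e₀ * v x) q (suc e₀ * N₀) Kt #lost T S
    scaledPack {A} u v N₀ 1≤N₀ T S t thin small areas = Scaled.core f g N₀ 1≤N₀ T S (scaleS E t) (All.map thin′ thin) (All.map (λ { (h , k) → toSmall _ h , toSmall _ k }) small) areas′
      where
      f g : A → ℕ
      f x = E * u x
      g x = E * v x
      toSmall : ∀ s → m * s ≤ N₀ → E * s ≤ Scaled.μ f g N₀ 1≤N₀
      toSmall s h = *-cancelˡ-≤ m ⦃ >-nonZero 1≤m ⦄ (≤-trans (≤-reflexive (lia 3 (λ m E s → ⟨ m :* (E :* s) :≡ E :* (m :* s) ⟩) refl m E s)) (≤-trans (*-monoʳ-≤ E h) (≤-reflexive (Scaled.N≡mμ f g N₀ 1≤N₀))))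
      toLong : ∀ s → N₀ ≤ d * s → Scaled.δ f g N₀ 1≤N₀ ≤ E * s
      toLong s h = *-cancelˡ-≤ d ⦃ >-nonZero 1≤d ⦄ (≤-trans (≤-reflexive (sym (Scaled.N≡dδ f g N₀ 1≤N₀))) (≤-trans (*-monoʳ-≤ E h) (≤-reflexive (lia 3 (λ d E s → ⟨ E :* (d :* s) :≡ d :* (E :* s) ⟩) refl d E s))))
      1≤E* : ∀ s → 1 ≤ s → 1 ≤ E * s
      1≤E* s h = *-mono-≤ (s≤s (z≤n {e₀})) h
      thin′ : ∀ {x} → 1 ≤ u x × 1 ≤ v x × ((N₀ ≤ d * v x × m * u x ≤ N₀) ⊎ (N₀ ≤ d * u x × m * v x ≤ N₀)) → Scaled.Thin f g N₀ 1≤N₀ x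
      thin′ {x} (a , b , inj₁ (h , k)) = 1≤E* (u x) a , 1≤E* (v x) b , inj₁ (toLong (v x) h , toSmall (u x) k)
      thin′ {x} (a , b , inj₂ (h , k)) = 1≤E* (u x) a , 1≤E* (v x) b , inj₂ (toLong (u x) h , toSmall (v x) k)
      scaledArea : ∀ xs → area f g xs ≡ E * E * area u v xs
      scaledArea xs = trans (Σ-cong {xs = xs} (All.universal (λ x → lia 3 (λ E a b → ⟨ E :* a :* (E :* b) :≡ E :* E :* (a :* b) ⟩) refl E (u x) (v x)) xs)) (Σ-* (E * E) _ xs)
      areas′ : q * (area f g T + area f g S) + (E * N₀) * (E * N₀) ≤ q * ((E * N₀) * (E * N₀))
      areas′ = begin
        q * (area f g T + area f g S) + (E * N₀) * (E * N₀)                          ≡⟨ cong (λ z → q * z + (E * N₀) * (E * N₀)) (cong₂ _+_ (scaledArea T) (scaledArea S)) ⟩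
        q * (E * E * area u v T + E * E * area u v S) + (E * N₀) * (E * N₀)          ≡⟨ lia 5 (λ q E a b n → ⟨ q :* (E :* E :* a :+ E :* E :* b) :+ (E :* n) :* (E :* n) :≡ E :* E :* (q :* (a :+ b) :+ n :* n) ⟩) refl q E (area u v T) (area u v S) N₀ ⟩
        E * E * (q * (area u v T + area u v S) + N₀ * N₀)                            ≤⟨ *-monoʳ-≤ (E * E) areas ⟩
        E * E * (q * (N₀ * N₀))                                                      ≡⟨ lia 3 (λ q E n → ⟨ E :* E :* (q :* (n :* n)) :≡ q :* ((E :* n) :* (E :* n)) ⟩) refl q E N₀ ⟩
        q * ((E * N₀) * (E * N₀))                                                    ∎
        where open ≤-Reasoning

  -- Sides strictly between `N₀ / m` and `N₀ / d` are excluded. `K` bounds the number of cells, and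
  -- `ℓ` the items lost in addition to those proportional to `T`.
  record Scale (q d : ℕ) : Set₁ where
    field
      m e₀ K ℓ : ℕ
      d<m : d < m
      pack : ∀ {A : Set} (u v : A → ℕ) N₀ → 1 ≤ N₀ → ∀ T S → Slice u v N₀ N₀ T →
        All (λ x → 1 ≤ u x × 1 ≤ v x × ((N₀ ≤ d * v x × m * u x ≤ N₀) ⊎ (N₀ ≤ d * u x × m * v x ≤ N₀))) T →
        All (λ x → m * u x ≤ N₀ × m * v x ≤ N₀) S → q * (area u v T + area u v S) + N₀ * N₀ ≤ q * (N₀ * N₀) →
        Packing (λ x → suc e₀ * u x) (λ x → suc e₀ * v x) q (suc e₀ * N₀) K ℓ T S

  abstract
    scaleAt : ∀ q d → 1 ≤ q → 8 ≤ d → Scale q d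
    scaleAt q d 1≤q 8≤d = record { m = Level.m q d 1≤q 8≤d ; e₀ = Level.e₀ q d 1≤q 8≤d ; K = Level.Kt q d 1≤q 8≤d ; ℓ = Level.#lost q d 1≤q 8≤d ; d<m = Level.d<m q d 1≤q 8≤d ; pack = Level.scaledPack q d 1≤q 8≤d }

-- Lattice points among the rational numbers

module Lattice where

  open import Data.Nat as ℕ using (ℕ; suc)
  import Data.Nat.Properties as ℕP
  open import Data.Integer as ℤ using (ℤ; +_)
  import Data.Integer.Properties as ℤP
  open import Data.Integer.Tactic.RingSolver using (solve-∀)
  open import Data.Rational
  open import Data.Rational.Properties
  open import Data.Rational.Solver using (module +-*-Solver)
  open import Data.Rational.Unnormalised as ℚᵘ using (mkℚᵘ; *≡*; *≤*; *<*)
  import Data.Rational.Unnormalised.Properties as ℚᵘP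
  open import Relation.Binary.PropositionalEquality

  -- Lattice points: the coordinate c of a grid with E = suc e lines per unit.
  abstract
    ι : ℕ → ℕ → ℚ
    ι e c = + c / suc e

    ι-def : ∀ e c → ι e c ≡ + c / suc e
    ι-def e c = refl

  module _ (e : ℕ) where

    private
      u : ℕ → ℚᵘ.ℚᵘ
      u c = mkℚᵘ (+ c) e

      abstract
        ι≃ : ∀ c → toℚᵘ (ι e c) ℚᵘ.≃ u c
        ι≃ c = toℚᵘ-fromℚᵘ (u c)

    ι-+ : ∀ a b → ι e (a ℕ.+ b) ≡ ι e a + ι e b
    ι-+ a b = toℚᵘ-injective (ℚᵘP.≃-trans (ι≃ (a ℕ.+ b)) (ℚᵘP.≃-trans sumᵘ (ℚᵘP.≃-sym (ℚᵘP.≃-trans (toℚᵘ-homo-+ (ι e a) (ι e b)) (ℚᵘP.+-cong (ι≃ a) (ι≃ b))))))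
      where
      sumᵘ : u (a ℕ.+ b) ℚᵘ.≃ u a ℚᵘ.+ u b
      sumᵘ = *≡* (trans (cong (ℤ._* (+ (suc e ℕ.* suc e))) (ℤP.pos-+ a b)) (trans (cong ((+ a ℤ.+ + b) ℤ.*_) (ℤP.pos-* (suc e) (suc e))) (lem (+ a) (+ b) (+ suc e))))
        where
        lem : ∀ a b e → (a ℤ.+ b) ℤ.* (e ℤ.* e) ≡ (a ℤ.* e ℤ.+ b ℤ.* e) ℤ.* e
        lem = solve-∀

    ι-mono : ∀ {a b} → a ℕ.≤ b → ι e a ≤ ι e b
    ι-mono {a} {b} h = toℚᵘ-cancel-≤ (ℚᵘP.≤-trans (ℚᵘP.≤-reflexive (ι≃ a)) (ℚᵘP.≤-trans (*≤* (ℤP.*-monoʳ-≤-nonNeg (+ suc e) (ℤ.+≤+ h))) (ℚᵘP.≤-reflexive (ℚᵘP.≃-sym (ι≃ b)))))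

    ι-mono-< : ∀ {a b} → a ℕ.< b → ι e a < ι e b
    ι-mono-< {a} {b} h = toℚᵘ-cancel-< (ℚᵘP.<-respˡ-≃ (ℚᵘP.≃-sym (ι≃ a)) (ℚᵘP.<-respʳ-≃ (ℚᵘP.≃-sym (ι≃ b)) (*<* (ℤP.*-monoʳ-<-pos (+ suc e) (ℤ.+<+ h)))))

    ι-scale : ∀ k → ι e (suc e ℕ.* k) ≡ + k / 1
    ι-scale k = toℚᵘ-injective (ℚᵘP.≃-trans (ι≃ (suc e ℕ.* k)) (ℚᵘP.≃-trans (*≡* (trans (ℤP.*-identityʳ _) (trans (ℤP.pos-* (suc e) k) (ℤP.*-comm (+ suc e) (+ k))))) (ℚᵘP.≃-sym (toℚᵘ-fromℚᵘ (mkℚᵘ (+ k) 0)))))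

    ι-0 : ι e 0 ≡ 0ℚ
    ι-0 = trans (cong (ι e) (sym (ℕP.*-zeroʳ (suc e)))) (ι-scale 0)

  abstract
    ι-* : ∀ a b → ι 0 (a ℕ.* b) ≡ ι 0 a * ι 0 b
    ι-* a b = toℚᵘ-injective (ℚᵘP.≃-trans (toℚᵘ-fromℚᵘ (mkℚᵘ (+ (a ℕ.* b)) 0)) (ℚᵘP.≃-trans (*≡* (cong (ℤ._* + 1) (ℤP.pos-* a b)))
      (ℚᵘP.≃-sym (ℚᵘP.≃-trans (toℚᵘ-homo-* (ι 0 a) (ι 0 b)) (ℚᵘP.*-cong (toℚᵘ-fromℚᵘ (mkℚᵘ (+ a) 0)) (toℚᵘ-fromℚᵘ (mkℚᵘ (+ b) 0)))))))

  ι-cancel : ∀ e {a b} → ι e a ≤ ι e b → a ℕ.≤ b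
  ι-cancel e {a} {b} h = ℕP.≮⇒≥ (λ lt → <-irrefl refl (<-≤-trans (ι-mono-< e lt) h))

  times-5q : ∀ e Q n → ((+ 5 / 1) * Q) * (((+ 4 / 5) - (+ 9 / 1) * e) * n) ≡ (+ 4 / 1) * Q * n - (+ 45 / 1) * (e * Q * n)
  times-5q = solve 3 (λ e Q n → (con (+ 5 / 1) :* Q) :* ((con (+ 4 / 5) :- con (+ 9 / 1) :* e) :* n) := con (+ 4 / 1) :* Q :* n :- con (+ 45 / 1) :* (e :* Q :* n)) refl
    where open +-*-Solver

-- Translation between guillotine packings and slicing trees

module Geometry where

  open import Defs
  open import Data.Nat as ℕ using (ℕ; suc; zero; z≤n; s≤s)
  import Data.Nat.Properties as ℕP
  open import Data.Rational using (ℚ; _+_; _*_; _-_; _≤_; _<_; 0ℚ; 1ℚ; nonNegative)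
  open import Data.Rational.Properties
  open import Data.Rational.Solver using (module +-*-Solver)
  open import Data.Bool using (Bool; true; false; not)
  open import Data.Fin using (Fin)
  open import Data.Product using (Σ; _×_; _,_; proj₁; proj₂)
  open import Data.Sum using (inj₁; inj₂)
  open import Data.List using (List; []; _∷_; map; length; _++_; concat)
  open import Data.List.Properties using (map-++; ++-identityʳ; length-++; length-map; map-∘; concat-++; ∷-injectiveˡ; ∷-injectiveʳ)
  open import Data.List.Relation.Unary.All as All using (All; []; _∷_)
  open import Data.List.Relation.Unary.All.Properties using (++⁺; ++⁻ˡ; ++⁻ʳ)
  open import Data.List.Relation.Unary.AllPairs using (AllPairs; []; _∷_)
  import Data.List.Relation.Unary.AllPairs.Properties as AP
  open import Data.List.Relation.Unary.Unique.Propositional using (Unique)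
  open import Data.List.Relation.Binary.Permutation.Propositional using (_↭_; ↭-refl; ↭-sym; ↭-trans; ↭-reflexive; prep; swap)
  import Data.List.Relation.Binary.Permutation.Propositional as ↭
  import Data.List.Relation.Binary.Permutation.Propositional.Properties as ↭P
  open import Function using (_∘_)
  open import Relation.Nullary using (contradiction)
  open import Relation.Binary.PropositionalEquality
  open SlicingPackings hiding (area)
  open Lattice

  -- From guillotine packings to slicing trees

  Oriented : Instance → Set
  Oriented I = Fin (n I) × Bool

  width height : (I : Instance) → Oriented I → ℕ
  width I (i , false) = wd I i
  width I (i , true) = ht I i
  height I (i , false) = ht I i
  height I (i , true) = wd I i

  orient : ∀ {I} → Placement I → Oriented I
  orient p = item p , rotated p

  placed-w : ∀ {I} (p : Placement I) → w (placedRect p) ≡ ι 0 (width I (orient p))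
  placed-w (place _ _ _ false) = sym (ι-def 0 _)
  placed-w (place _ _ _ true) = sym (ι-def 0 _)

  placed-h : ∀ {I} (p : Placement I) → h (placedRect p) ≡ ι 0 (height I (orient p))
  placed-h (place _ _ _ false) = sym (ι-def 0 _)
  placed-h (place _ _ _ true) = sym (ι-def 0 _)

  minus : ∀ a b → a + (b - a) ≡ b
  minus = solve 2 (λ a b → a :+ (b :- a) := b) refl
    where open +-*-Solver

  0≤- : ∀ {a b} → a ≤ b → 0ℚ ≤ b - a
  0≤- {a} {b} le = ≤-trans (≤-reflexive (sym (+-inverseʳ a))) (+-monoˡ-≤ (Data.Rational.- a) le)

  cancel : ∀ {a b c} → a + b ≤ a + c → b ≤ c
  cancel {a} {b} {c} le = ≤-trans (≤-reflexive (sym (neg a b))) (≤-trans (+-monoʳ-≤ (Data.Rational.- a) le) (≤-reflexive (neg a c)))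
    where
    neg : ∀ a b → (Data.Rational.- a) + (a + b) ≡ b
    neg = solve 2 (λ a b → :- a :+ (a :+ b) := b) refl
      where open +-*-Solver

  map-split : ∀ {A B : Set} (f : A → B) L₁ {L₂} P → L₁ ++ L₂ ≡ map f P → Σ (List A) λ P₁ → Σ (List A) λ P₂ → P ≡ P₁ ++ P₂ × L₁ ≡ map f P₁ × L₂ ≡ map f P₂
  map-split f [] P e = [] , P , refl , refl , e
  map-split f (_ ∷ L₁) (p ∷ P) e with map-split f L₁ P (∷-injectiveʳ e)
  ... | P₁ , P₂ , e₁ , e₂ , e₃ = p ∷ P₁ , P₂ , cong (p ∷_) e₁ , cong₂ _∷_ (∷-injectiveˡ e) e₂ , e₃

  module _ {I : Instance} where

    -- Cuts may have any rational coordinates, but the items have integral sides: from the leaves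
    -- upwards every part needs only an integral size, and this fits into its rational rectangle.
    -- The order of `M` is that of the cuts, hence the permutation.
    Sliced : Rect → List (Placement I) → Set
    Sliced R P = Σ ℕ λ a → Σ ℕ λ b → Σ (List (Oriented I)) λ M → Slice (width I) (height I) a b M × ι 0 a ≤ w R × ι 0 b ≤ h R × M ↭ map orient P

    ι-⊔ : ∀ a b {r} → ι 0 a ≤ r → ι 0 b ≤ r → ι 0 (a ℕ.⊔ b) ≤ r
    ι-⊔ a b p q with ℕP.⊔-sel a b
    ... | inj₁ e = subst (λ z → ι 0 z ≤ _) (sym e) p
    ... | inj₂ e = subst (λ z → ι 0 z ≤ _) (sym e) q

    sliced : ∀ R L P → L ≡ map placedRect P → 0ℚ ≤ w R → 0ℚ ≤ h R → All (_⊆R R) L → Guillotine R L → Sliced R P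
    sliced R L [] e w≥ h≥ inR (trivial _) = 0 , 0 , [] , none , ≤-trans (≤-reflexive (ι-0 0)) w≥ , ≤-trans (≤-reflexive (ι-0 0)) h≥ , ↭-refl
    sliced R .(map placedRect (p ∷ [])) (p ∷ []) refl w≥ h≥ ((a , b , c , d) ∷ []) (trivial _) =
      width I (orient p) , height I (orient p) , orient p ∷ [] , one (orient p) ℕP.≤-refl ℕP.≤-refl ,
      ≤-trans (≤-reflexive (sym (placed-w p))) (cancel {x R} (≤-trans (+-monoˡ-≤ _ a) b)) ,
      ≤-trans (≤-reflexive (sym (placed-h p))) (cancel {y R} (≤-trans (+-monoˡ-≤ _ c) d)) , ↭-refl
    sliced R .(map placedRect (p ∷ p′ ∷ P)) (p ∷ p′ ∷ P) refl w≥ h≥ inR (trivial (s≤s ()))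
    sliced R L P refl w≥ h≥ inR (vcut c L₁ L₂ x<c c<x pm l r G₁ G₂) with ↭P.↭-map-inv placedRect pm
    ... | P′ , e , pP with map-split placedRect L₁ P′ e
    ... | P₁ , P₂ , refl , e₁ , e₂ with sliced (leftPart R c) L₁ P₁ e₁ (0≤- (<⇒≤ x<c)) h≥ in₁ G₁ | sliced (rightPart R c) L₂ P₂ e₂ (0≤- (<⇒≤ c<x)) h≥ in₂ G₂
      where
      inP = All-↭ pm inR
      in₁ : All (_⊆R leftPart R c) L₁
      in₁ = All.zipWith (λ { ((a , _ , b , d) , k) → a , ≤-trans k (≤-reflexive (sym (minus (x R) c))) , b , d }) (++⁻ˡ L₁ inP , l)
      in₂ : All (_⊆R rightPart R c) L₂
      in₂ = All.zipWith (λ { ((_ , a , b , d) , k) → k , ≤-trans a (≤-reflexive (sym (minus c (x R + w R)))) , b , d }) (++⁻ʳ L₁ inP , r)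
    ... | a₁ , b₁ , M₁ , s₁ , wa₁ , hb₁ , p₁ | a₂ , b₂ , M₂ , s₂ , wa₂ , hb₂ , p₂ =
      a₁ ℕ.+ a₂ , b₁ ℕ.⊔ b₂ , M₁ ++ M₂ , ver a₁ a₂ refl (padS ℕP.≤-refl (ℕP.m≤m⊔n b₁ b₂) s₁) (padS ℕP.≤-refl (ℕP.m≤n⊔m b₁ b₂) s₂) ,
      ≤-trans (≤-reflexive (ι-+ 0 a₁ a₂)) (≤-trans (+-mono-≤ wa₁ wa₂) (≤-reflexive (sums (x R) (w R) c))) , ι-⊔ b₁ b₂ hb₁ hb₂ ,
      ↭-trans (↭P.++⁺ p₁ p₂) (↭-trans (↭-reflexive (sym (map-++ orient P₁ P₂))) (↭P.map⁺ orient (↭-sym pP)))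
      where
      sums : ∀ x w c → (c - x) + (x + w - c) ≡ w
      sums = solve 3 (λ x w c → (c :- x) :+ (x :+ w :- c) := w) refl
        where open +-*-Solver
    sliced R L P refl w≥ h≥ inR (hcut c L₁ L₂ y<c c<y pm l r G₁ G₂) with ↭P.↭-map-inv placedRect pm
    ... | P′ , e , pP with map-split placedRect L₁ P′ e
    ... | P₁ , P₂ , refl , e₁ , e₂ with sliced (bottomPart R c) L₁ P₁ e₁ w≥ (0≤- (<⇒≤ y<c)) in₁ G₁ | sliced (topPart R c) L₂ P₂ e₂ w≥ (0≤- (<⇒≤ c<y)) in₂ G₂
      where
      inP = All-↭ pm inR
      in₁ : All (_⊆R bottomPart R c) L₁
      in₁ = All.zipWith (λ { ((b , d , a , _) , k) → b , d , a , ≤-trans k (≤-reflexive (sym (minus (y R) c))) }) (++⁻ˡ L₁ inP , l)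
      in₂ : All (_⊆R topPart R c) L₂
      in₂ = All.zipWith (λ { ((b , d , _ , a) , k) → b , d , k , ≤-trans a (≤-reflexive (sym (minus c (y R + h R)))) }) (++⁻ʳ L₁ inP , r)
    ... | a₁ , b₁ , M₁ , s₁ , wa₁ , hb₁ , p₁ | a₂ , b₂ , M₂ , s₂ , wa₂ , hb₂ , p₂ =
      a₁ ℕ.⊔ a₂ , b₁ ℕ.+ b₂ , M₁ ++ M₂ , hor b₁ b₂ refl (padS (ℕP.m≤m⊔n a₁ a₂) ℕP.≤-refl s₁) (padS (ℕP.m≤n⊔m a₁ a₂) ℕP.≤-refl s₂) ,
      ι-⊔ a₁ a₂ wa₁ wa₂ , ≤-trans (≤-reflexive (ι-+ 0 b₁ b₂)) (≤-trans (+-mono-≤ hb₁ hb₂) (≤-reflexive (sums (y R) (h R) c))) ,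
      ↭-trans (↭P.++⁺ p₁ p₂) (↭-trans (↭-reflexive (sym (map-++ orient P₁ P₂))) (↭P.map⁺ orient (↭-sym pP)))
      where
      sums : ∀ x w c → (c - x) + (x + w - c) ≡ w
      sums = solve 3 (λ x w c → (c :- x) :+ (x :+ w :- c) := w) refl
        where open +-*-Solver

    feasible⇒Slice : ∀ {P : List (Placement I)} → Feasible I P → Σ (List (Oriented I)) λ M → M ↭ map orient P × Slice (width I) (height I) (N I) (N I) M
    feasible⇒Slice {P} (_ , inR , _ , G) with sliced (Square (N I)) (map placedRect P) P refl N≥0 N≥0 inR G
      where
      N≥0 : 0ℚ ≤ ℕ→ℚ (N I)
      N≥0 = ≤-trans (≤-reflexive (sym (ι-0 0))) (≤-trans (ι-mono 0 z≤n) (≤-reflexive (ι-def 0 (N I))))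
    ... | a , b , M , s , wa , hb , p = M , p , padS (ι-cancel 0 (≤-trans wa (≤-reflexive (sym (ι-def 0 (N I)))))) (ι-cancel 0 (≤-trans hb (≤-reflexive (sym (ι-def 0 (N I)))))) s

  -- From cells to containers

  Unique-↭ : ∀ {A : Set} {xs ys : List A} → xs ↭ ys → Unique xs → Unique ys
  Unique-↭ ↭.refl u = u
  Unique-↭ (prep x p) (h ∷ u) = All-↭ p h ∷ Unique-↭ p u
  Unique-↭ (swap x y p) ((h ∷ hx) ∷ hy ∷ u) = (h ∘ sym ∷ All-↭ p hy) ∷ All-↭ p hx ∷ Unique-↭ p u
  Unique-↭ (↭.trans p q) u = Unique-↭ q (Unique-↭ p u)

  module Realise (e : ℕ) where

    nr : ℕ → ℕ → ℕ → ℕ → Rect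
    nr X Y a b = rect (ι e X) (ι e Y) (ι e a) (ι e b)

    Positive : Rect → Set
    Positive r = (0ℚ < w r) × (0ℚ < h r)

    -- Cuts must be strictly inside the rectangle, so a part of width or height 0 has to be shown
    -- empty: this is what positivity is for.
    NG : ℕ → ℕ → ℕ → ℕ → List Rect → Set
    NG X Y a b L = All Positive L × All (_⊆R nr X Y a b) L × AllPairs Disj L × Guillotine (nr X Y a b) L

    private
      ι+ : ∀ X a → ι e (X ℕ.+ a) ≡ ι e X + ι e a
      ι+ = ι-+ e

      -ι : ∀ X a → ι e (X ℕ.+ a) - ι e X ≡ ι e a
      -ι X a = trans (cong (_- ι e X) (trans (ι+ X a) (+-comm (ι e X) (ι e a)))) (trans (+-assoc (ι e a) (ι e X) _) (trans (cong (ι e a +_) (+-inverseʳ (ι e X))) (+-identityʳ (ι e a))))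

      -ι₂ : ∀ X a₁ a₂ → ι e X + ι e (a₁ ℕ.+ a₂) - ι e (X ℕ.+ a₁) ≡ ι e a₂
      -ι₂ X a₁ a₂ = trans (cong (_- ι e (X ℕ.+ a₁)) (trans (sym (ι+ X (a₁ ℕ.+ a₂))) (cong (ι e) (sym (ℕP.+-assoc X a₁ a₂))))) (-ι (X ℕ.+ a₁) a₂)

      flat-x : ∀ {X Y b L} → NG X Y 0 b L → L ≡ []
      flat-x {L = []} _ = refl
      flat-x {X} {L = r ∷ L} ((p , _) ∷ _ , (a , b , _) ∷ _ , _) =
        contradiction (<-≤-trans p (cancel {x r} (≤-trans b (≤-trans (≤-reflexive (trans (cong (λ z → ι e X + z) (ι-0 e)) (+-identityʳ _))) (≤-trans a (≤-reflexive (sym (+-identityʳ (x r)))))))))  (<-irrefl refl)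

      flat-y : ∀ {X Y a L} → NG X Y a 0 L → L ≡ []
      flat-y {L = []} _ = refl
      flat-y {X} {Y} {L = r ∷ L} ((_ , p) ∷ _ , (_ , _ , a , b) ∷ _ , _) =
        contradiction (<-≤-trans p (cancel {y r} (≤-trans b (≤-trans (≤-reflexive (trans (cong (λ z → ι e Y + z) (ι-0 e)) (+-identityʳ _))) (≤-trans a (≤-reflexive (sym (+-identityʳ (y r)))))))))  (<-irrefl refl)

    ng-none : ∀ {X Y a b} → NG X Y a b []
    ng-none = [] , [] , [] , trivial z≤n

    ng-one : ∀ {X Y a b a′ b′} → 1 ℕ.≤ a′ → 1 ℕ.≤ b′ → a′ ℕ.≤ a → b′ ℕ.≤ b → NG X Y a b (nr X Y a′ b′ ∷ [])
    ng-one {X} {Y} p q ha hb = (pos p , pos q) ∷ [] , (≤-refl , +-monoʳ-≤ (ι e X) (ι-mono e ha) , ≤-refl , +-monoʳ-≤ (ι e Y) (ι-mono e hb)) ∷ [] , [] ∷ [] , trivial ℕP.≤-refl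
      where pos : ∀ {a} → 1 ℕ.≤ a → 0ℚ < ι e a
            pos {a} h = subst (_< ι e a) (ι-0 e) (ι-mono-< e h)

    ng-ver : ∀ {X Y a₁ a₂ b L₁ L₂} → NG X Y a₁ b L₁ → NG (X ℕ.+ a₁) Y a₂ b L₂ → NG X Y (a₁ ℕ.+ a₂) b (L₁ ++ L₂)
    ng-ver {X} {Y} {zero} {a₂} {b} {L₁} {L₂} n₁ n₂ rewrite flat-x n₁ = subst (λ z → NG z Y a₂ b L₂) (ℕP.+-identityʳ X) n₂
    ng-ver {X} {Y} {suc a₁} {zero} {b} {L₁} {L₂} n₁ n₂ rewrite flat-x n₂ | ++-identityʳ L₁ = subst (λ z → NG X Y z b L₁) (sym (ℕP.+-identityʳ (suc a₁))) n₁
    ng-ver {X} {Y} {suc a₁} {suc a₂} {b} {L₁} {L₂} (p₁ , s₁ , d₁ , g₁) (p₂ , s₂ , d₂ , g₂) =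
      ++⁺ p₁ p₂ , ++⁺ (All.map (λ { (h , k , l , m) → h , ≤-trans k (+-monoʳ-≤ (ι e X) (ι-mono e (ℕP.m≤m+n A₁ A₂))) , l , m }) s₁)
        (All.map (λ { (h , k , l , m) → ≤-trans (ι-mono e (ℕP.m≤m+n X A₁)) h , ≤-trans k (≤-reflexive whole) , l , m }) s₂) ,
      AP.++⁺ d₁ d₂ (All.map (λ { k → All.map (λ { h → inj₁ (inj₁ (≤-trans k h)) }) right }) left) ,
      vcut c L₁ L₂ (ι-mono-< e (ℕP.m<m+n X (s≤s z≤n))) (subst (c <_) (trans (cong (ι e) (ℕP.+-assoc X A₁ A₂)) (ι+ X (A₁ ℕ.+ A₂))) (ι-mono-< e (ℕP.m<m+n (X ℕ.+ A₁) (s≤s z≤n)))) ↭-refl left right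
        (subst (λ z → Guillotine (rect (ι e X) (ι e Y) z (ι e b)) L₁) (sym (-ι X A₁)) g₁)
        (subst (λ z → Guillotine (rect c (ι e Y) z (ι e b)) L₂) (sym (-ι₂ X A₁ A₂)) g₂)
      where
      A₁ = suc a₁
      A₂ = suc a₂
      c = ι e (X ℕ.+ A₁)
      whole : ι e (X ℕ.+ A₁) + ι e A₂ ≡ ι e X + ι e (A₁ ℕ.+ A₂)
      whole = trans (sym (ι+ (X ℕ.+ A₁) A₂)) (trans (cong (ι e) (ℕP.+-assoc X A₁ A₂)) (ι+ X (A₁ ℕ.+ A₂)))
      left : All (λ r → x r + w r ≤ c) L₁
      left = All.map (λ { (_ , k , _) → ≤-trans k (≤-reflexive (sym (ι+ X A₁))) }) s₁
      right : All (λ r → c ≤ x r) L₂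
      right = All.map proj₁ s₂

    ng-hor : ∀ {X Y a b₁ b₂ L₁ L₂} → NG X Y a b₁ L₁ → NG X (Y ℕ.+ b₁) a b₂ L₂ → NG X Y a (b₁ ℕ.+ b₂) (L₁ ++ L₂)
    ng-hor {X} {Y} {a} {zero} {b₂} {L₁} {L₂} n₁ n₂ rewrite flat-y n₁ = subst (λ z → NG X z a b₂ L₂) (ℕP.+-identityʳ Y) n₂
    ng-hor {X} {Y} {a} {suc b₁} {zero} {L₁} {L₂} n₁ n₂ rewrite flat-y n₂ | ++-identityʳ L₁ = subst (λ z → NG X Y a z L₁) (sym (ℕP.+-identityʳ (suc b₁))) n₁
    ng-hor {X} {Y} {a} {suc b₁} {suc b₂} {L₁} {L₂} (p₁ , s₁ , d₁ , g₁) (p₂ , s₂ , d₂ , g₂) =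
      ++⁺ p₁ p₂ , ++⁺ (All.map (λ { (l , m , h , k) → l , m , h , ≤-trans k (+-monoʳ-≤ (ι e Y) (ι-mono e (ℕP.m≤m+n B₁ B₂))) }) s₁)
        (All.map (λ { (l , m , h , k) → l , m , ≤-trans (ι-mono e (ℕP.m≤m+n Y B₁)) h , ≤-trans k (≤-reflexive whole) }) s₂) ,
      AP.++⁺ d₁ d₂ (All.map (λ { k → All.map (λ { h → inj₂ (inj₁ (≤-trans k h)) }) top }) bottom) ,
      hcut c L₁ L₂ (ι-mono-< e (ℕP.m<m+n Y (s≤s z≤n))) (subst (c <_) (trans (cong (ι e) (ℕP.+-assoc Y B₁ B₂)) (ι+ Y (B₁ ℕ.+ B₂))) (ι-mono-< e (ℕP.m<m+n (Y ℕ.+ B₁) (s≤s z≤n)))) ↭-refl bottom top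
        (subst (λ z → Guillotine (rect (ι e X) (ι e Y) (ι e a) z) L₁) (sym (-ι Y B₁)) g₁)
        (subst (λ z → Guillotine (rect (ι e X) c (ι e a) z) L₂) (sym (-ι₂ Y B₁ B₂)) g₂)
      where
      B₁ = suc b₁
      B₂ = suc b₂
      c = ι e (Y ℕ.+ B₁)
      whole : ι e (Y ℕ.+ B₁) + ι e B₂ ≡ ι e Y + ι e (B₁ ℕ.+ B₂)
      whole = trans (sym (ι+ (Y ℕ.+ B₁) B₂)) (trans (cong (ι e) (ℕP.+-assoc Y B₁ B₂)) (ι+ Y (B₁ ℕ.+ B₂)))
      bottom : All (λ r → y r + h r ≤ c) L₁
      bottom = All.map (λ { (_ , _ , _ , k) → ≤-trans k (≤-reflexive (sym (ι+ Y B₁))) }) s₁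
      top : All (λ r → c ≤ y r) L₂
      top = All.map (λ { (_ , _ , k , _) → k }) s₂

    module _ (I : Instance) where

      f g : Oriented I → ℕ
      f x = suc e ℕ.* width I x
      g x = suc e ℕ.* height I x

      rot : Oriented I → Oriented I
      rot (i , b) = i , not b

      f-rot : ∀ x → f (rot x) ≡ g x
      f-rot (i , false) = refl
      f-rot (i , true) = refl

      g-rot : ∀ x → g (rot x) ≡ f x
      g-rot (i , false) = refl
      g-rot (i , true) = refl

      1≤f : ∀ x → 1 ℕ.≤ f x
      1≤f (i , false) = ℕP.*-mono-≤ (s≤s (z≤n {e})) (wd-pos I i)
      1≤f (i , true) = ℕP.*-mono-≤ (s≤s (z≤n {e})) (ht-pos I i)

      1≤g : ∀ x → 1 ℕ.≤ g x
      1≤g (i , false) = ℕP.*-mono-≤ (s≤s (z≤n {e})) (ht-pos I i)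
      1≤g (i , true) = ℕP.*-mono-≤ (s≤s (z≤n {e})) (wd-pos I i)

      pl : Oriented I → ℕ → ℕ → Placement I
      pl (i , b) X Y = place i (ι e X) (ι e Y) b

      pl-rect : ∀ x X Y → placedRect (pl x X Y) ≡ nr X Y (f x) (g x)
      pl-rect (i , false) X Y = cong₂ (rect (ι e X) (ι e Y)) (sym (ι-scale e (wd I i))) (sym (ι-scale e (ht I i)))
      pl-rect (i , true) X Y = cong₂ (rect (ι e X) (ι e Y)) (sym (ι-scale e (ht I i))) (sym (ι-scale e (wd I i)))

      single : ∀ {X Y a b} x → f x ℕ.≤ a → g x ℕ.≤ b → NG X Y a b (map placedRect (pl x X Y ∷ []))
      single {X} {Y} {a} {b} x p q = subst (λ r → NG X Y a b (r ∷ [])) (sym (pl-rect x X Y)) (ng-one (1≤f x) (1≤g x) p q)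

      Sized : Oriented I → Rect → Set
      Sized x r = w r ≡ ι e (f x) × h r ≡ ι e (g x)

      record Realised (X Y a b : ℕ) (L : List (Oriented I)) : Set where
        constructor realised
        field
          P : List (Placement I)
          orient≡ : map orient P ≡ L
          ng : NG X Y a b (map placedRect P)

      realSlice : ∀ {a b L} X Y → Slice f g a b L → Realised X Y a b L
      realSlice X Y none = realised [] refl ng-none
      realSlice X Y (one x p q) = realised (pl x X Y ∷ []) refl (single x p q)
      realSlice X Y (ver a₁ a₂ refl s t) with realSlice X Y s | realSlice (X ℕ.+ a₁) Y t
      ... | realised P₁ e₁ n₁ | realised P₂ e₂ n₂ = realised (P₁ ++ P₂) (trans (map-++ orient P₁ P₂) (cong₂ _++_ e₁ e₂)) (subst (NG X Y _ _) (sym (map-++ placedRect P₁ P₂)) (ng-ver n₁ n₂))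
      realSlice X Y (hor b₁ b₂ refl s t) with realSlice X Y s | realSlice X (Y ℕ.+ b₁) t
      ... | realised P₁ e₁ n₁ | realised P₂ e₂ n₂ = realised (P₁ ++ P₂) (trans (map-++ orient P₁ P₂) (cong₂ _++_ e₁ e₂)) (subst (NG X Y _ _) (sym (map-++ placedRect P₁ P₂)) (ng-hor n₁ n₂))

      realV : ∀ {a b} X Y xs → Σ′ f xs ℕ.≤ a → All (λ x → g x ℕ.≤ b) xs → Σ (Realised X Y a b xs) λ r → AllPairs XDisj (map placedRect (Realised.P r))
      realV X Y [] le k = realised [] refl ng-none , []
      realV {a} {b} X Y (z ∷ xs) le (k ∷ ks) with realV {a ℕ.∸ f z} (X ℕ.+ f z) Y xs (ℕP.≤-trans (ℕP.≤-reflexive (sym (ℕP.m+n∸m≡n (f z) _))) (ℕP.∸-monoˡ-≤ (f z) le)) ks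
      ... | realised P eq n , dj = realised (pl z X Y ∷ P) (cong (z ∷_) eq) (subst (λ v → NG X Y v b (map placedRect (pl z X Y ∷ P))) (ℕP.m+[n∸m]≡n (ℕP.≤-trans (ℕP.m≤m+n (f z) _) le)) (ng-ver (single z ℕP.≤-refl k) n)) ,
        subst (λ r → All (XDisj r) (map placedRect P)) (sym (pl-rect z X Y)) (All.map (λ { (h , _) → inj₁ (≤-trans (≤-reflexive (sym (ι-+ e X (f z)))) h) }) (proj₁ (proj₂ n))) ∷ dj

      realH : ∀ {a b} X Y xs → Σ′ g xs ℕ.≤ b → All (λ x → f x ℕ.≤ a) xs → Σ (Realised X Y a b xs) λ r → AllPairs YDisj (map placedRect (Realised.P r))
      realH X Y [] le k = realised [] refl ng-none , []
      realH {a} {b} X Y (z ∷ xs) le (k ∷ ks) with realH {b = b ℕ.∸ g z} X (Y ℕ.+ g z) xs (ℕP.≤-trans (ℕP.≤-reflexive (sym (ℕP.m+n∸m≡n (g z) _))) (ℕP.∸-monoˡ-≤ (g z) le)) ks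
      ... | realised P eq n , dj = realised (pl z X Y ∷ P) (cong (z ∷_) eq) (subst (λ v → NG X Y a v (map placedRect (pl z X Y ∷ P))) (ℕP.m+[n∸m]≡n (ℕP.≤-trans (ℕP.m≤m+n (g z) _) le)) (ng-hor (single z k ℕP.≤-refl) n)) ,
        subst (λ r → All (YDisj r) (map placedRect P)) (sym (pl-rect z X Y)) (All.map (λ { (_ , _ , h , _) → inj₁ (≤-trans (≤-reflexive (sym (ι-+ e Y (g z)))) h) }) (proj₁ (proj₂ n))) ∷ dj

      module _ (ε : ℚ) (q : ℕ) (0≤ε : 0ℚ ≤ ε) (1≤εq : 1ℚ ≤ ε * ι 0 q) where

        ι-q : ∀ c → ι e (q ℕ.* c) ≡ ι 0 q * ι e c
        ι-q c = go q
          where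
          go : ∀ q → ι e (q ℕ.* c) ≡ ι 0 q * ι e c
          go zero = trans (ι-0 e) (trans (sym (*-zeroˡ (ι e c))) (cong (_* ι e c) (sym (ι-0 0))))
          go (suc q) = trans (ι-+ e c (q ℕ.* c)) (trans (cong₂ _+_ (sym (*-identityˡ (ι e c))) (go q)) (trans (sym (*-distribʳ-+ (ι e c) 1ℚ (ι 0 q)))
            (cong (_* ι e c) (trans (cong (_+ ι 0 q) (sym (trans (ι-def 0 1) refl))) (sym (ι-+ 0 1 q))))))

        -- `1 ≤ ε * q` turns the integral size condition into the one demanded of area containers.
        small : ∀ {c d} → q ℕ.* c ℕ.≤ d → ι e c ≤ ε * ι e d
        small {c} {d} le = ≤-trans (≤-reflexive (sym (*-identityˡ (ι e c)))) (≤-trans (*-monoʳ-≤-nonNeg (ι e c) ⦃ nonNegative (≤-trans (≤-reflexive (sym (ι-0 e))) (ι-mono e z≤n)) ⦄ 1≤εq)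
          (≤-trans (≤-reflexive (trans (*-assoc ε (ι 0 q) (ι e c)) (cong (ε *_) (sym (ι-q c))))) (*-monoˡ-≤-nonNeg ε ⦃ nonNegative 0≤ε ⦄ (ι-mono e le))))

        FCell = Cell (Oriented I) × List (Oriented I)

        ids : FCell → List (Fin (n I))
        ids (c , ss) = map proj₁ (its c ++ ss)

        allIds : List FCell → List (Fin (n I))
        allIds fs = concat (map ids fs)

        record RealCell (X Y a b : ℕ) (is : List (Fin (n I))) : Set where
          constructor realCell
          field
            lab : Label
            P : List (Placement I)
            item≡ : map item P ≡ is
            ng : NG X Y a b (map placedRect P)
            lok : LabelOK ε lab (nr X Y a b) (map placedRect P)

        private
          itemIds : ∀ P → map item P ≡ map proj₁ (map (orient {I}) P)
          itemIds P = map-∘ P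

          itemsR : ∀ (xs : List (Oriented I)) → map proj₁ (map rot xs) ≡ map proj₁ xs
          itemsR [] = refl
          itemsR (z ∷ xs) = cong (_ ∷_) (itemsR xs)

          Σ-rot : ∀ {φ ψ : Oriented I → ℕ} → (∀ z → φ (rot z) ≡ ψ z) → ∀ xs → Σ′ φ (map rot xs) ≡ Σ′ ψ xs
          Σ-rot eq [] = refl
          Σ-rot eq (z ∷ xs) = cong₂ ℕ._+_ (eq z) (Σ-rot eq xs)

          All-rot : ∀ {φ ψ : Oriented I → ℕ} {v} → (∀ z → φ (rot z) ≡ ψ z) → ∀ {xs} → All (λ z → ψ z ℕ.≤ v) xs → All (λ z → φ z ℕ.≤ v) (map rot xs)
          All-rot eq [] = []
          All-rot eq (_∷_ {x = z} k ks) = ℕP.≤-trans (ℕP.≤-reflexive (eq z)) k ∷ All-rot eq ks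

          nilʳ : ∀ (xs : List (Oriented I)) → map proj₁ xs ≡ map proj₁ (xs ++ [])
          nilʳ xs = cong (map proj₁) (sym (++-identityʳ xs))

          sizes : ∀ P {L} → map (orient {I}) P ≡ L → ∀ {a b} → All (λ z → q ℕ.* f z ℕ.≤ a × q ℕ.* g z ℕ.≤ b) L → All (λ r → (w r ≤ ε * ι e a) × (h r ≤ ε * ι e b)) (map placedRect P)
          sizes [] refl [] = []
          sizes (p ∷ P) refl ((k , l) ∷ ks) = (≤-trans (≤-reflexive (trans (placed-w p) (trans (ι-def 0 _) (sym (ι-scale e (width I (orient p))))))) (small k) ,
            ≤-trans (≤-reflexive (trans (placed-h p) (trans (ι-def 0 _) (sym (ι-scale e (height I (orient p))))))) (small l)) ∷ sizes P refl ks

        realiseCell : ∀ X Y (fc : FCell) → OK f g (proj₁ fc) → SmallOK f g q fc → RealCell X Y (cw (proj₁ fc)) (ch (proj₁ fc)) (ids fc)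
        realiseCell X Y (mkCell free a b xs , ss) refl (sl , k) with realSlice X Y sl
        ... | realised P eq n = realCell area P (trans (itemIds P) (cong (map proj₁) eq)) n (sizes P eq k)
        realiseCell X Y (mkCell (vert false) a b xs , .[]) (s , k) refl with realV X Y xs s k
        ... | realised P eq n , dj = realCell vertical P (trans (itemIds P) (trans (cong (map proj₁) eq) (nilʳ xs))) n dj
        realiseCell X Y (mkCell (vert true) a b xs , .[]) (s , k) refl with realV X Y (map rot xs) (ℕP.≤-trans (ℕP.≤-reflexive (Σ-rot f-rot xs)) s) (All-rot g-rot k)
        ... | realised P eq n , dj = realCell vertical P (trans (itemIds P) (trans (cong (map proj₁) eq) (trans (itemsR xs) (nilʳ xs)))) n dj
        realiseCell X Y (mkCell (hori false) a b xs , .[]) (s , k) refl with realH X Y xs s k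
        ... | realised P eq n , dj = realCell horizontal P (trans (itemIds P) (trans (cong (map proj₁) eq) (nilʳ xs))) n dj
        realiseCell X Y (mkCell (hori true) a b xs , .[]) (s , k) refl with realH X Y (map rot xs) (ℕP.≤-trans (ℕP.≤-reflexive (Σ-rot g-rot xs)) s) (All-rot f-rot k)
        ... | realised P eq n , dj = realCell horizontal P (trans (itemIds P) (trans (cong (map proj₁) eq) (trans (itemsR xs) (nilʳ xs)))) n dj

        CP = List (Container × List (Placement I))

        -- Containers and items are assembled in parallel, since the packing of the boxes and that
        -- of the items both have to be guillotine separable.
        record RealLay (X Y a b : ℕ) (fs : List FCell) : Set where
          constructor realLay
          field
            cps : CP
            count : length cps ℕ.≤ length fs
            item≡ : map item (concat (map proj₂ cps)) ≡ allIds fs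
            boxes : NG X Y a b (map (λ cp → box (proj₁ cp)) cps)
            inner : NG X Y a b (map placedRect (concat (map proj₂ cps)))
            valid : All (λ cp → ValidContainer ε (proj₁ cp) (map placedRect (proj₂ cp))) cps

        private
          join : ∀ {X Y a b X₁ Y₁ a₁ b₁ X₂ Y₂ a₂ b₂} fs₁ fs₂ →
                 (∀ {L₁ L₂} → NG X₁ Y₁ a₁ b₁ L₁ → NG X₂ Y₂ a₂ b₂ L₂ → NG X Y a b (L₁ ++ L₂)) →
                 RealLay X₁ Y₁ a₁ b₁ fs₁ → RealLay X₂ Y₂ a₂ b₂ fs₂ → RealLay X Y a b (fs₁ ++ fs₂)
          join {X} {Y} {a} {b} fs₁ fs₂ glue (realLay c₁ n₁ i₁ b₁ r₁ v₁) (realLay c₂ n₂ i₂ b₂ r₂ v₂) = realLay (c₁ ++ c₂)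
            (ℕP.≤-trans (ℕP.≤-reflexive (length-++ c₁)) (ℕP.≤-trans (ℕP.+-mono-≤ n₁ n₂) (ℕP.≤-reflexive (sym (length-++ fs₁)))))
            (trans (cong (map item) cat) (trans (map-++ item (concat (map proj₂ c₁)) _) (trans (cong₂ _++_ i₁ i₂) (trans (concat-++ (map ids fs₁) (map ids fs₂)) (cong concat (sym (map-++ ids fs₁ fs₂)))))))
            (subst (NG X Y a b) (sym (map-++ _ c₁ c₂)) (glue b₁ b₂))
            (subst (NG X Y a b) (sym (trans (cong (map placedRect) cat) (map-++ placedRect (concat (map proj₂ c₁)) _))) (glue r₁ r₂))
            (++⁺ v₁ v₂)
            where
            cat : concat (map proj₂ (c₁ ++ c₂)) ≡ concat (map proj₂ c₁) ++ concat (map proj₂ c₂)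
            cat = trans (cong concat (map-++ proj₂ c₁ c₂)) (sym (concat-++ (map proj₂ c₁) (map proj₂ c₂)))

          map-[] : ∀ {A B : Set} {φ : A → B} {xs} → map φ xs ≡ [] → xs ≡ []
          map-[] {xs = []} _ = refl

          -- A cell with a side 0 contains no item and yields no container, because boxes in `NG`
          -- have positive sides.
          oneCell : ∀ {X Y a b} fc → RealCell X Y a b (ids fc) → RealLay X Y a b (fc ∷ [])
          oneCell {X} {Y} {zero} {b} fc (realCell lab P i n l) = realLay [] z≤n (trans (trans (cong (map item) (sym (map-[] (flat-x n)))) i) (sym (++-identityʳ (ids fc)))) ng-none ng-none []
          oneCell {X} {Y} {suc a} {zero} fc (realCell lab P i n l) = realLay [] z≤n (trans (trans (cong (map item) (sym (map-[] (flat-y n)))) i) (sym (++-identityʳ (ids fc)))) ng-none ng-none []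
          oneCell {X} {Y} {suc a} {suc b} fc (realCell lab P i n l) = realLay ((container (nr X Y (suc a) (suc b)) lab , P) ∷ []) ℕP.≤-refl
            (trans (cong (map item) (++-identityʳ P)) (trans i (sym (++-identityʳ (ids fc))))) (ng-one (s≤s z≤n) (s≤s z≤n) ℕP.≤-refl ℕP.≤-refl)
            (subst (λ z → NG X Y (suc a) (suc b) (map placedRect z)) (sym (++-identityʳ P)) n) ((nn (suc a) , nn (suc b) , proj₁ (proj₂ n) , l) ∷ [])
            where nn : ∀ c → 0ℚ ≤ ι e c
                  nn c = ≤-trans (≤-reflexive (sym (ι-0 e))) (ι-mono e z≤n)

        private
          noCells : ∀ {X Y a b} fs → [] ≡ map (dim ∘ proj₁) fs → RealLay X Y a b fs
          noCells [] _ = realLay [] z≤n refl ng-none ng-none []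

        realiseLay : ∀ {a b R} X Y fs → R ≡ map (dim ∘ proj₁) fs → Lay a b R → All (OK f g ∘ proj₁) fs → All (SmallOK f g q) fs → RealLay X Y a b fs
        realiseLay X Y fs eq (void _) _ _ = noCells fs eq
        realiseLay X Y fs eq (wvoid _) _ _ = noCells fs eq
        realiseLay X Y fs eq cell o k = theCell fs eq o k
          where
          theCell : ∀ {a b} fs → (a , b) ∷ [] ≡ map (dim ∘ proj₁) fs → All (OK f g ∘ proj₁) fs → All (SmallOK f g q) fs → RealLay X Y a b fs
          theCell (fc ∷ []) refl (o ∷ []) (s ∷ []) = oneCell fc (realiseCell X Y fc o s)
        realiseLay X Y fs eq (ver {R₁} a₁ a₂ refl s t) o k with map-split (dim ∘ proj₁) R₁ fs eq
        ... | fs₁ , fs₂ , refl , e₁ , e₂ = join fs₁ fs₂ ng-ver (realiseLay X Y fs₁ e₁ s (++⁻ˡ fs₁ o) (++⁻ˡ fs₁ k)) (realiseLay (X ℕ.+ a₁) Y fs₂ e₂ t (++⁻ʳ fs₁ o) (++⁻ʳ fs₁ k))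
        realiseLay X Y fs eq (hor {R₁} b₁ b₂ refl s t) o k with map-split (dim ∘ proj₁) R₁ fs eq
        ... | fs₁ , fs₂ , refl , e₁ , e₂ = join fs₁ fs₂ ng-hor (realiseLay X Y fs₁ e₁ s (++⁻ˡ fs₁ o) (++⁻ˡ fs₁ k)) (realiseLay X (Y ℕ.+ b₁) fs₂ e₂ t (++⁻ʳ fs₁ o) (++⁻ʳ fs₁ k))

        toSolution : ∀ {R} K fs → R ≡ map (dim ∘ proj₁) fs → Lay (suc e ℕ.* N I) (suc e ℕ.* N I) R → All (OK f g ∘ proj₁) fs → All (SmallOK f g q) fs →
                     Unique (allIds fs) → length fs ℕ.≤ K → Σ (List (Placement I)) λ P → ContainerSolution I ε K P × length P ≡ length (allIds fs)
        toSolution K fs eq lay o k uniq len with realiseLay 0 0 fs eq lay o k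
        ... | realLay cps cnt i bx inn v = concat (map proj₂ cps) , ((subst Unique (sym i) uniq , square inn) , (cps , ℕP.≤-trans cnt len , ↭-refl , v , square bx)) ,
            trans (sym (length-map item (concat (map proj₂ cps)))) (cong length i)
          where
          square : ∀ {L} → NG 0 0 (suc e ℕ.* N I) (suc e ℕ.* N I) L → GuillotinePacking (N I) L
          square {L} (_ , s , d , G) = subst (λ R → All (_⊆R R) L × AllPairs Disj L × Guillotine R L) sq (s , d , G)
            where sq : nr 0 0 (suc e ℕ.* N I) (suc e ℕ.* N I) ≡ Square (N I)
                  sq = trans (cong₂ (λ u v → rect u u v v) (ι-0 e) (ι-scale e (N I))) refl

-- Reduction to slim and small items, and the approximation ratio

module Reductions where

  open import Data.Nat
  open import Data.Nat.Properties
  open import Data.Nat.DivMod using (_/_; m%n<n; m≡m%n+[m/n]*n; m/n*n≤m)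
  open import Data.Bool using (Bool; true; false; _∧_; _∨_; not)
  open import Data.List using (List; []; _∷_; _++_; map; filterᵇ; length; concat; take; drop)
  open import Data.List.Properties using (++-assoc; ++-identityʳ; length-++; map-++; length-map; ++-conicalˡ; ∷-injectiveˡ; ∷-injectiveʳ; map-∘; take++drop≡id; length-take)
  open import Data.List.Relation.Unary.All as All using (All; []; _∷_)
  open import Data.List.Relation.Unary.All.Properties using (++⁺; ++⁻ˡ)
  open import Data.List.Relation.Unary.Any using (here)
  open import Data.List.Relation.Unary.AllPairs using (AllPairs; []; _∷_)
  import Data.List.Relation.Unary.AllPairs as AllPairs
  open import Data.List.Relation.Unary.Unique.Propositional using (Unique)
  open import Data.List.Membership.Propositional.Properties using (∈-++⁻; ∈-∃++)
  open import Data.List.Relation.Binary.Permutation.Propositional using (_↭_; ↭-refl; ↭-sym; ↭-trans; ↭-reflexive; prep)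
  import Data.List.Relation.Binary.Permutation.Propositional.Properties as ↭P
  open import Data.Product using (Σ; _×_; _,_; proj₁; proj₂)
  open import Data.Sum using (_⊎_; inj₁; inj₂)
  import Data.Integer as ℤ
  import Data.Rational as ℚ
  import Data.Rational.Properties as ℚP
  open import Data.Rational using (ℚ; mkℚ; 0ℚ; 1ℚ)
  import Data.Rational.Unnormalised as ℚᵘ
  import Data.Rational.Unnormalised.Properties as ℚᵘP
  open import Function using (_∘_)
  open import Relation.Nullary using (Dec; yes; no; contradiction)
  open import Relation.Binary.PropositionalEquality
  open import Defs hiding (area; horizontal; vertical)
  open LinearArithmetic using (con; _:+_; _:*_; _:≤_; _:<_; _:≡_; ⟨_⟩; _⇒_; lia)
  open BagSolver using (_:++_; _:↭_; bag)
  open SlicingPackings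
  open Lattice
  open Geometry

  module _ {A : Set} where

    heavyChunk : ∀ q c (φ : A → ℕ) xs → length xs ≤ suc q * c →
      Σ (List A) λ B → Σ (List A) λ D → Σ (List A) λ C → xs ≡ B ++ D ++ C × length D ≤ c × Σ′ φ xs ≤ suc q * Σ′ φ D
    heavyChunk zero c φ xs le = [] , xs , [] , sym (++-identityʳ xs) , ≤-trans le (≤-reflexive (+-identityʳ c)) , ≤-reflexive (sym (+-identityʳ _))
    heavyChunk (suc q) c φ xs le with heavyChunk q c φ (drop c xs) dropped
      where
      dropped : length (drop c xs) ≤ suc q * c
      dropped = go c xs le
        where
        go : ∀ k (ys : List A) {r} → length ys ≤ k + r → length (drop k ys) ≤ r
        go zero ys h = h
        go (suc k) [] h = z≤n
        go (suc k) (y ∷ ys) h = go k ys (s≤s⁻¹ h)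
    ... | B , D , C , e , D≤ , w with Σ′ φ D ≤? Σ′ φ (take c xs)
    ... | yes heavy = [] , take c xs , drop c xs , sym (take++drop≡id c xs) , ≤-trans (≤-reflexive (length-take c xs)) (m⊓n≤m c (length xs)) ,
        ≤-trans (≤-reflexive (trans (cong (Σ′ φ) (sym (take++drop≡id c xs))) (Σ-++ φ (take c xs) (drop c xs)))) (+-monoʳ-≤ (Σ′ φ (take c xs)) (≤-trans w (*-monoʳ-≤ (suc q) heavy)))
    ... | no light = take c xs ++ B , D , C , trans (sym (take++drop≡id c xs)) (trans (cong (take c xs ++_) e) (sym (++-assoc (take c xs) B _))) , D≤ ,
        ≤-trans (≤-reflexive (trans (cong (Σ′ φ) (sym (take++drop≡id c xs))) (Σ-++ φ (take c xs) (drop c xs)))) (+-mono-≤ (<⇒≤ (≰⇒> light)) w)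

    split↭ : ∀ L₁ {L₂ K D : List A} → L₁ ++ L₂ ↭ K ++ D →
      Σ (List A) λ K₁ → Σ (List A) λ D₁ → Σ (List A) λ K₂ → Σ (List A) λ D₂ → L₁ ↭ K₁ ++ D₁ × L₂ ↭ K₂ ++ D₂ × K₁ ++ K₂ ↭ K
    split↭ [] {K = K} {D} p = [] , [] , K , D , ↭-refl , p , ↭-refl
    split↭ (x ∷ L₁) {L₂} {K} {D} p with ∈-++⁻ K (↭P.∈-resp-↭ p (here refl))
    ... | inj₁ x∈K with ∈-∃++ x∈K
    ... | B , C , refl with split↭ L₁ {L₂} {B ++ C} {D} (↭P.drop-∷ (↭-trans p (bag 4 (λ b x c d → (b :++ (x :++ c)) :++ d :↭ x :++ ((b :++ c) :++ d)) refl B (x ∷ []) C D)))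
    ... | K₁ , D₁ , K₂ , D₂ , p₁ , p₂ , r = x ∷ K₁ , D₁ , K₂ , D₂ , prep x p₁ , p₂ , ↭-trans (prep x r) (↭-sym (↭P.shift x B C))
    split↭ (x ∷ L₁) {L₂} {K} {D} p | inj₂ x∈D with ∈-∃++ x∈D
    ... | B , C , refl with split↭ L₁ {L₂} {K} {B ++ C} (↭P.drop-∷ (↭-trans p (bag 4 (λ k b x c → k :++ (b :++ (x :++ c)) :↭ x :++ (k :++ (b :++ c))) refl K B (x ∷ []) C)))
    ... | K₁ , D₁ , K₂ , D₂ , p₁ , p₂ , r = K₁ , x ∷ D₁ , K₂ , D₂ , ↭-trans (prep x p₁) (↭-sym (↭P.shift x K₁ D₁)) , p₂ , r

    -- `filterS` removes items by a predicate, whereas a chunk is known only by its place in the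
    -- list. The permutation is therefore distributed over the tree with `split↭`.
    subS : ∀ {f g : A → ℕ} {a b L} K {D} → Slice f g a b L → L ↭ K ++ D → Σ (List A) λ K′ → K′ ↭ K × Slice f g a b K′
    subS K none p = [] , ↭-reflexive (sym (++-conicalˡ K _ (↭P.↭-empty-inv (↭-sym p)))) , none
    subS [] (one x h k) p = [] , ↭-refl , none
    subS (y ∷ K) {D} (one x h k) p = x ∷ [] , ↭-reflexive (cong₂ _∷_ (sym (∷-injectiveˡ e)) (sym (++-conicalˡ K D (∷-injectiveʳ e)))) , one x h k
      where e = ↭P.↭-singleton-inv (↭-sym p)
    subS K (ver {L₁} a₁ a₂ e s t) p with split↭ L₁ p
    ... | K₁ , D₁ , K₂ , D₂ , p₁ , p₂ , r with subS K₁ s p₁ | subS K₂ t p₂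
    ... | K₁′ , r₁ , s′ | K₂′ , r₂ , t′ = K₁′ ++ K₂′ , ↭-trans (↭P.++⁺ r₁ r₂) r , ver a₁ a₂ e s′ t′
    subS K (hor {L₁} b₁ b₂ e s t) p with split↭ L₁ p
    ... | K₁ , D₁ , K₂ , D₂ , p₁ , p₂ , r with subS K₁ s p₁ | subS K₂ t p₂
    ... | K₁′ , r₁ , s′ | K₂′ , r₂ , t′ = K₁′ ++ K₂′ , ↭-trans (↭P.++⁺ r₁ r₂) r , hor b₁ b₂ e s′ t′

    consLength : ∀ (p : A → Bool) x xs → length (filterᵇ p (x ∷ xs)) ≡ 𝟙 (p x) + length (filterᵇ p xs)
    consLength p x xs with p x
    ... | true = refl
    ... | false = refl

    upΣ-filter : ∀ n (b : ℕ → A → Bool) C → (∀ x → upΣ n (λ i → 𝟙 (b i x)) ≤ C) → ∀ xs → upΣ n (λ i → length (filterᵇ (b i) xs)) ≤ C * length xs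
    upΣ-filter n b C h [] = ≤-trans (≤-reflexive (zeros n)) z≤n
      where zeros : ∀ n → upΣ n (λ i → 0) ≡ 0
            zeros zero = refl
            zeros (suc n) = trans (+-identityʳ _) (zeros n)
    upΣ-filter n b C h (x ∷ xs) = ≤-trans (≤-reflexive (split n)) (≤-trans (+-mono-≤ (h x) (upΣ-filter n b C h xs)) (≤-reflexive (sym (*-suc C (length xs)))))
      where
      split : ∀ n → upΣ n (λ i → length (filterᵇ (b i) (x ∷ xs))) ≡ upΣ n (λ i → 𝟙 (b i x)) + upΣ n (λ i → length (filterᵇ (b i) xs))
      split zero = refl
      split (suc n) rewrite split n | consLength (b n) x xs =
        lia 4 (λ a b c d → ⟨ a :+ b :+ (c :+ d) :≡ a :+ c :+ (b :+ d) ⟩) refl (upΣ n (λ i → 𝟙 (b i x))) (upΣ n (λ i → length (filterᵇ (b i) xs))) (𝟙 (b n x)) (length (filterᵇ (b n) xs))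

  medium : (N d m s : ℕ) → Bool
  medium N d m s = (suc N ≤ᵇ m * s) ∧ (suc (d * s) ≤ᵇ N)

  or-≤ : ∀ a b → 𝟙 (a ∨ b) ≤ 𝟙 a + 𝟙 b
  or-≤ true b = m≤m+n 1 (𝟙 b)
  or-≤ false b = ≤-refl

  upΣ-or : ∀ n (a b : ℕ → Bool) → upΣ n (λ i → 𝟙 (a i ∨ b i)) ≤ upΣ n (λ i → 𝟙 (a i)) + upΣ n (λ i → 𝟙 (b i))
  upΣ-or zero a b = z≤n
  upΣ-or (suc n) a b = ≤-trans (+-mono-≤ (upΣ-or n a b) (or-≤ (a n) (b n)))
    (≤-reflexive (lia 4 (λ a b c d → ⟨ a :+ b :+ (c :+ d) :≡ a :+ c :+ (b :+ d) ⟩) refl (upΣ n (λ i → 𝟙 (a i))) (upΣ n (λ i → 𝟙 (b i))) (𝟙 (a n)) (𝟙 (b n))))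

  or-false : ∀ {a b} → not (a ∨ b) ≡ true → a ≡ false × b ≡ false
  or-false {false} {false} _ = refl , refl

  or-true : ∀ {a b} → a ∨ b ≡ true → a ≡ true ⊎ b ≡ true
  or-true {true} _ = inj₁ refl
  or-true {false} e = inj₂ e

  and-false : ∀ {a b} → a ∧ b ≡ false → a ≡ false ⊎ b ≡ false
  and-false {false} _ = inj₁ refl
  and-false {true} e = inj₂ e

  and-true : ∀ {a b} → a ∧ b ≡ true → a ≡ true × b ≡ true
  and-true {true} {true} _ = refl , refl

  not-medium : ∀ {N d m s} → medium N d m s ≡ false → m * s ≤ N ⊎ N ≤ d * s
  not-medium {N} {d} {m} {s} e with and-false {suc N ≤ᵇ m * s} e
  ... | inj₁ h = inj₁ (s≤s⁻¹ (false-> {suc N} {m * s} h))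
  ... | inj₂ h = inj₂ (s≤s⁻¹ (false-> {suc (d * s)} {N} h))

  Unique-prefix : ∀ {X : Set} (xs : List X) {ys} → Unique (xs ++ ys) → Unique xs
  Unique-prefix [] _ = AllPairs.[]
  Unique-prefix (x ∷ xs) (h AllPairs.∷ u) = ++⁻ˡ xs h AllPairs.∷ Unique-prefix xs u

  module _ {A : Set} (u v : A → ℕ) (N : ℕ) where

    record Thinned (q : ℕ) (M : List A) : Set where
      constructor thinned
      field
        kept heavy : List A
        perm : M ↭ kept ++ heavy
        heavy# : q * length heavy ≤ length M + q
        room : q * area u v kept + N * N ≤ q * (N * N)
        slice : Slice u v N N kept

    -- The heaviest of `q` chunks holds at least `1 / q` of the item area, so the kept items leave
    -- at least `N * N / q` of the square free.
    thin : ∀ q {M} → 1 ≤ q → Slice u v N N M → Thinned q M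
    thin (suc p) {M} _ t with heavyChunk p (suc (length M / suc p)) (λ x → u x * v x) M chunks
      where
      chunks : length M ≤ suc p * suc (length M / suc p)
      chunks = ≤-trans (<⇒≤ (≤-trans (s≤s (≤-reflexive (m≡m%n+[m/n]*n (length M) (suc p)))) (+-monoˡ-≤ (length M / suc p * suc p) (m%n<n (length M) (suc p)))))
        (≤-reflexive (lia 2 (λ q r → ⟨ q :+ r :* q :≡ q :* (con 1 :+ r) ⟩) refl (suc p) (length M / suc p)))
    ... | B , D , C , e , D≤ , w with subS (B ++ C) {D} t (↭-trans (↭-reflexive e) (bag 3 (λ b d c → b :++ (d :++ c) :↭ (b :++ c) :++ d) refl B D C))
    ... | Kp , K↭ , tK = thinned Kp D pm
        (≤-trans (*-monoʳ-≤ (suc p) D≤) (lia 3 (λ q r n → (r :* q :≤ n) ⇒ ⟨ q :* (con 1 :+ r) :≤ n :+ q ⟩) refl (suc p) (length M / suc p) (length M) (m/n*n≤m (length M) (suc p))))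
        (lia 5 (λ p k d m Q → (m :≡ k :+ d) ⇒ (m :≤ (con 1 :+ p) :* d) ⇒ (p :* m :≤ p :* Q) ⇒ (p :* m :≡ p :* (k :+ d)) ⇒ ⟨ (con 1 :+ p) :* k :+ Q :≤ (con 1 :+ p) :* Q ⟩) refl
          p (area u v Kp) (area u v D) (area u v M) (N * N) areas w (*-monoʳ-≤ p (area-≤ t)) (cong (p *_) areas))
        tK
      where
      pm : M ↭ Kp ++ D
      pm = ↭-trans (↭-reflexive e) (↭-trans (bag 3 (λ b d c → b :++ (d :++ c) :↭ (b :++ c) :++ d) refl B D C) (↭P.++⁺ʳ D (↭-sym K↭)))
      areas : area u v M ≡ area u v Kp + area u v D
      areas = trans (Σ-↭ _ pm) (Σ-++ _ Kp D)

    bad : (d m : ℕ) → A → Bool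
    bad d m x = medium N d m (u x) ∨ medium N d m (v x)

    Extreme : (d m s : ℕ) → Set
    Extreme d m s = m * s ≤ N ⊎ N ≤ d * s

    Slim Small : (d m : ℕ) → A → Set
    Slim d m x = 1 ≤ u x × 1 ≤ v x × ((N ≤ d * v x × m * u x ≤ N) ⊎ (N ≤ d * u x × m * v x ≤ N))
    Small d m x = m * u x ≤ N × m * v x ≤ N

    record Classified (d m : ℕ) (L : List A) : Set where
      constructor classified
      field
        big slim small : List A
        perm : L ↭ filterᵇ (bad d m) L ++ big ++ slim ++ small
        big# : length big ≤ d * d
        slice : Slice u v N N slim
        slims : All (Slim d m) slim
        smalls : All (Small d m) small

    classify : ∀ d m {L} → 1 ≤ N → (∀ x → 1 ≤ u x) → (∀ x → 1 ≤ v x) → Slice u v N N L → Classified d m L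
    classify d m {L} 1≤N 1≤u 1≤v t = classified Bg T S
        (↭-trans (partition↭ (bad d m) L) (↭P.++⁺ˡ _ (↭-trans (partition↭ big G) (↭P.++⁺ˡ Bg (partition↭ long R)))))
        Bg# (filterS long (filterS (not ∘ big) tG))
        (All.zipWith (λ {x} (e , nb , du , dv) → 1≤u x , 1≤v x , slim x e nb du dv) (filter-true long R , filter-All long specR))
        (All.zipWith (λ {x} (e , _ , du , dv) → pick (proj₁ (or-false {N ≤ᵇ d * u x} e)) du , pick (proj₂ (or-false {N ≤ᵇ d * u x} e)) dv) (filter-true (not ∘ long) R , filter-All (not ∘ long) specR))
      where
      big long : A → Bool
      big x = (N ≤ᵇ d * u x) ∧ (N ≤ᵇ d * v x)
      long x = (N ≤ᵇ d * u x) ∨ (N ≤ᵇ d * v x)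
      G Bg R T S : List A
      G = filterᵇ (not ∘ bad d m) L
      Bg = filterᵇ big G
      R = filterᵇ (not ∘ big) G
      T = filterᵇ long R
      S = filterᵇ (not ∘ long) R
      tG : Slice u v N N G
      tG = filterS (not ∘ bad d m) t
      extremes : ∀ x → not (bad d m x) ≡ true → Extreme d m (u x) × Extreme d m (v x)
      extremes x e with or-false {medium N d m (u x)} {medium N d m (v x)} e
      ... | eu , ev = not-medium {N} {d} {m} {u x} eu , not-medium {N} {d} {m} {v x} ev
      specR : All (λ x → not (big x) ≡ true × Extreme d m (u x) × Extreme d m (v x)) R
      specR = All.zip (filter-true (not ∘ big) G , filter-All (not ∘ big) (All.map (λ {x} → extremes x) (filter-true (not ∘ bad d m) L)))
      slim : ∀ x → long x ≡ true → not (big x) ≡ true → Extreme d m (u x) → Extreme d m (v x) → (N ≤ d * v x × m * u x ≤ N) ⊎ (N ≤ d * u x × m * v x ≤ N)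
      slim x e nb (inj₁ su) (inj₂ lv) = inj₁ (lv , su)
      slim x e nb (inj₂ lu) (inj₁ sv) = inj₂ (lu , sv)
      slim x e nb (inj₂ lu) (inj₂ lv) with () ← trans (sym nb) (cong₂ (λ a b → not (a ∧ b)) (≤ᵇ-true lu) (≤ᵇ-true lv))
      slim x e nb (inj₁ su) (inj₁ sv) with or-true {N ≤ᵇ d * u x} e
      ... | inj₁ lu = inj₂ (true-≤ {N} {d * u x} lu , sv)
      ... | inj₂ lv = inj₁ (true-≤ {N} {d * v x} lv , su)
      pick : ∀ {s} → (N ≤ᵇ d * s) ≡ false → Extreme d m s → m * s ≤ N
      pick {s} e (inj₁ h) = h
      pick {s} e (inj₂ h) = contradiction h (<⇒≱ (false-> {N} {d * s} e))
      -- Two sides of length at least `N / d` give an area of at least `1 / (d * d)` of the square.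
      Bg# : length Bg ≤ d * d
      Bg# = *-cancelˡ-≤ (N * N) ⦃ >-nonZero (*-mono-≤ 1≤N 1≤N) ⦄ (begin
        N * N * length Bg                     ≤⟨ Σ-lower (N * N) (λ x → d * d * (u x * v x)) (All.map (λ {x} e → each x (and-true {N ≤ᵇ d * u x} e)) (filter-true big G)) ⟩
        Σ′ (λ x → d * d * (u x * v x)) Bg     ≡⟨ Σ-* (d * d) _ Bg ⟩
        d * d * area u v Bg                   ≤⟨ *-monoʳ-≤ (d * d) (area-≤ (filterS big tG)) ⟩
        d * d * (N * N)                       ≡⟨ *-comm (d * d) (N * N) ⟩
        N * N * (d * d)                       ∎)
        where
        open ≤-Reasoning
        each : ∀ x → (N ≤ᵇ d * u x) ≡ true × (N ≤ᵇ d * v x) ≡ true → N * N ≤ d * d * (u x * v x)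
        each x (a , b) = ≤-trans (*-mono-≤ (true-≤ {N} {d * u x} a) (true-≤ {N} {d * v x} b)) (≤-reflexive (lia 3 (λ d a b → ⟨ d :* a :* (d :* b) :≡ d :* d :* (a :* b) ⟩) refl d (u x) (v x)))

    record Packed (q K : ℕ) (M : List A) : Set where
      constructor packed
      field
        e₀ : ℕ
        {dims} : List (ℕ × ℕ)
        fs : List (Cell A × List A)
        rest : List A
        lay : Lay (suc e₀ * N) (suc e₀ * N) dims
        dims≡ : dims ≡ map (dim ∘ proj₁) fs
        ok : All (OK (λ x → suc e₀ * u x) (λ x → suc e₀ * v x) ∘ proj₁) fs
        smallOK : All (SmallOK (λ x → suc e₀ * u x) (λ x → suc e₀ * v x) q) fs
        size : length fs ≤ K
        perm : M ↭ concat (map contents fs) ++ rest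
        count : 4 * q * length M ≤ 5 * q * length (concat (map contents fs)) + 45 * length M

  -- The coefficient 45 is 25 for repacking the slim items, 10 for those with a side in the excluded
  -- range, 5 for the heavy chunk and 5 for all constants, which `q * (1 + dd + k) ≤ n` makes
  -- negligible.
  keptMost : ∀ q n o G B b D T k dd Kp → n ≡ o + (G + (B + (b + D))) → 5 * q * G ≤ q * T + 25 * T + 5 * q * k → B ≤ dd → q * b ≤ 2 * Kp →
             q * D ≤ n + q → T ≤ n → Kp ≤ n → q * (1 + dd + k) ≤ n → 4 * q * n ≤ 5 * q * o + 45 * n
  keptMost q n o G B b D T k dd Kp n≡ G≤ B≤ b≤ D≤ T≤ Kp≤ const≤ =
    lia 11 (λ q n o G B b D T k dd Kp → (n :≡ o :+ (G :+ (B :+ (b :+ D)))) ⇒ (q :* n :≡ q :* (o :+ (G :+ (B :+ (b :+ D))))) ⇒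
        (con 5 :* q :* G :≤ q :* T :+ con 25 :* T :+ con 5 :* q :* k) ⇒ (q :* B :≤ q :* dd) ⇒ (q :* b :≤ con 2 :* Kp) ⇒ (q :* D :≤ n :+ q) ⇒
        (T :≤ n) ⇒ (q :* T :≤ q :* n) ⇒ (Kp :≤ n) ⇒ (q :* (con 1 :+ dd :+ k) :≤ n) ⇒ ⟨ con 4 :* q :* n :≤ con 5 :* q :* o :+ con 45 :* n ⟩) refl
      q n o G B b D T k dd Kp n≡ (cong (q *_) n≡) G≤ (*-monoʳ-≤ q B≤) b≤ D≤ T≤ (*-monoʳ-≤ q T≤) Kp≤ const≤

  module AtScale {q d : ℕ} (scale : Scale q d) {A : Set} (u v : A → ℕ) (N : ℕ) (1≤N : 1 ≤ N) where
    open Scale scale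

    Bad : List A → List A
    Bad = filterᵇ (bad u v N d m)

    finish : ∀ {M kept heavy big slim small} → M ↭ kept ++ heavy → kept ↭ Bad kept ++ big ++ slim ++ small →
      q * length (Bad kept) ≤ 2 * length kept → q * length heavy ≤ length M + q → length big ≤ d * d → q * (1 + d * d + ℓ) ≤ length M →
      Packing (λ x → suc e₀ * u x) (λ x → suc e₀ * v x) q (suc e₀ * N) K ℓ slim small → Packed u v N q K M
    finish {M} {kept} {heavy} {big} {slim} {small} permK permC bad# heavy# big# const≤ (mkPacking lay fs dims≡ ok smallOK size gone perm count) =
      packed e₀ fs (gone ++ big ++ Bad kept ++ heavy) lay dims≡ ok smallOK size permM
        (keptMost q (length M) (length out) (length gone) (length big) (length (Bad kept)) (length heavy) (length slim) ℓ (d * d) (length kept)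
          (trans (length-↭ permM) (trans (length-++ out) (cong (length out +_) (trans (length-++ gone) (cong (length gone +_) (trans (length-++ big) (cong (length big +_) (length-++ (Bad kept)))))))))
          count big# bad# heavy# (≤-trans slim≤ kept≤) kept≤ const≤)
      where
      out : List A
      out = concat (map contents fs)
      permM : M ↭ out ++ gone ++ big ++ Bad kept ++ heavy
      permM = ↭-trans permK (↭-trans (↭P.++⁺ʳ heavy (↭-trans permC (↭P.++⁺ˡ (Bad kept) (↭P.++⁺ˡ big perm))))
        (bag 5 (λ b g o n d → (b :++ (g :++ (o :++ n))) :++ d :↭ o :++ (n :++ (g :++ (b :++ d)))) refl (Bad kept) big out gone heavy))
      kept≤ : length kept ≤ length M
      kept≤ = ≤-trans (m≤m+n _ (length heavy)) (≤-reflexive (sym (trans (length-↭ permK) (length-++ kept))))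
      slim≤ : length slim ≤ length kept
      slim≤ = ≤-trans (≤-trans (≤-trans (m≤m+n _ (length small)) (≤-reflexive (sym (length-++ slim)))) (≤-trans (m≤n+m _ (length big)) (≤-reflexive (sym (length-++ big)))))
        (≤-trans (m≤n+m _ (length (Bad kept))) (≤-reflexive (sym (trans (length-↭ permC) (length-++ (Bad kept))))))

    packAt : ∀ {M} → (∀ x → 1 ≤ u x) → (∀ x → 1 ≤ v x) → (th : Thinned u v N q M) → q * length (Bad (Thinned.kept th)) ≤ 2 * length (Thinned.kept th) →
      q * (1 + d * d + ℓ) ≤ length M → Packed u v N q K M
    packAt 1≤u 1≤v (thinned kept heavy permK heavy# areaK tK) bad# const≤ = go (classify u v N d m 1≤N 1≤u 1≤v tK)
      where
      go : Classified u v N d m kept → Packed u v N q K _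
      go (classified big slim small permC big# tT slims smalls) = finish {kept = kept} {heavy} {big} {slim} {small} permK permC bad# heavy# big# const≤
          (pack u v N 1≤N slim small tT slims smalls (≤-trans (+-monoˡ-≤ (N * N) (*-monoʳ-≤ q sub)) areaK))
        where
        sub : area u v slim + area u v small ≤ area u v kept
        sub = ≤-trans (≤-trans (≤-reflexive (sym (Σ-++ _ slim small))) (≤-trans (m≤n+m _ (area u v big)) (≤-reflexive (sym (Σ-++ _ big (slim ++ small))))))
          (≤-trans (m≤n+m _ (area u v (Bad kept))) (≤-reflexive (trans (sym (Σ-++ _ (Bad kept) _)) (sym (Σ-↭ _ permC)))))

  enlarge : ∀ {A : Set} {u v : A → ℕ} {N q K K′ M} → K ≤ K′ → Packed u v N q K M → Packed u v N q K′ M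
  enlarge le (packed e₀ fs rest lay dims≡ ok smallOK size perm count) = packed e₀ fs rest lay dims≡ ok smallOK (≤-trans size le) perm count

  module Reduction (q : ℕ) (1≤q : 1 ≤ q) where

    -- Every range of sides ends where the next one begins: `d (suc i)` is the `m` of scale `i`. The
    -- start 8 is what the estimates of a scale require of `d`.
    chosen : ℕ → Σ ℕ λ d → 8 ≤ d
    level : ∀ i → Scale q (proj₁ (chosen i))

    chosen zero = 8 , ≤-refl
    chosen (suc i) = Scale.m (level i) , ≤-trans (proj₂ (chosen i)) (<⇒≤ (Scale.d<m (level i)))
    level i = scaleAt q (proj₁ (chosen i)) 1≤q (proj₂ (chosen i))

    d K ℓ : ℕ → ℕ
    d i = proj₁ (chosen i)
    K i = Scale.K (level i)
    ℓ i = Scale.ℓ (level i)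

    const : ℕ → ℕ
    const i = 1 + d i * d i + ℓ i

    -- From `threshold` items on, the constants of every scale are at most a fraction `1 / q`; the
    -- successor makes the packing nonempty, which forces `1 ≤ N`. Adding `threshold` to `bound`
    -- allows smaller packings one container for each item.
    threshold bound : ℕ
    threshold = suc (q * upΣ q const)
    bound = upΣ q K + threshold

    -- Range `i` asks for `d i * s < N < d (suc i) * s`, and `d` is increasing.
    medium-sep : ∀ N s → upΣ q (λ i → 𝟙 (medium N (d i) (d (suc i)) s)) ≤ 1
    medium-sep N s = ≤-trans (go q) (≤1 (suc N ≤ᵇ d q * s))
      where
      ≤1 : ∀ b → 𝟙 b ≤ 1
      ≤1 true = ≤-refl
      ≤1 false = z≤n
      go : ∀ k → upΣ k (λ i → 𝟙 (medium N (d i) (d (suc i)) s)) ≤ 𝟙 (suc N ≤ᵇ d k * s)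
      go zero = z≤n
      go (suc k) with medium N (d k) (d (suc k)) s in eq
      ... | false = ≤-trans (≤-reflexive (+-identityʳ _)) (≤-trans (go k) (mono (suc N ≤ᵇ d k * s) refl))
        where
        mono : ∀ b → (suc N ≤ᵇ d k * s) ≡ b → 𝟙 b ≤ 𝟙 (suc N ≤ᵇ d (suc k) * s)
        mono false _ = z≤n
        mono true e = ≤-reflexive (sym (cong 𝟙 (≤ᵇ-true {suc N} {d (suc k) * s} (≤-trans (true-≤ {suc N} {d k * s} e) (*-monoˡ-≤ s (<⇒≤ (Scale.d<m (level k))))))))
      ... | true = ≤-trans (+-monoˡ-≤ 1 (≤-trans (go k) (≤-reflexive (cong 𝟙 (≤ᵇ-false {suc N} {d k * s} (≤-trans (true-≤ {suc (d k * s)} {N} (proj₂ parts)) (n≤1+n N))))))) (≤-reflexive (sym (cong 𝟙 (proj₁ parts))))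
        where
        split : ∀ a b → a ∧ b ≡ true → a ≡ true × b ≡ true
        split true true _ = refl , refl
        parts = split (suc N ≤ᵇ d (suc k) * s) (suc (d k * s) ≤ᵇ N) eq

    packMost : ∀ {A : Set} (u v : A → ℕ) N {M} → (∀ x → 1 ≤ u x) → (∀ x → 1 ≤ v x) → Slice u v N N M → threshold ≤ length M → Packed u v N q bound M
    packMost {A} u v N {M} 1≤u 1≤v t many = choose (pigeon q (λ i → length (filterᵇ (bads i) kept)) (2 * length kept) 1≤q (upΣ-filter q bads 2 bads≤2 kept))
      where
      th : Thinned u v N q M
      th = thin u v N q 1≤q t
      kept : List A
      kept = Thinned.kept th
      bads : ℕ → A → Bool
      bads i = bad u v N (d i) (d (suc i))
      -- Each of the two sides lies in at most one range.
      bads≤2 : ∀ x → upΣ q (λ i → 𝟙 (bads i x)) ≤ 2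
      bads≤2 x = ≤-trans (upΣ-or q (λ i → medium N (d i) (d (suc i)) (u x)) (λ i → medium N (d i) (d (suc i)) (v x))) (+-mono-≤ (medium-sep N (u x)) (medium-sep N (v x)))
      1≤N : 1 ≤ N
      1≤N = go M (fits t) (≤-trans (s≤s z≤n) many)
        where go : ∀ xs → All (λ x → u x ≤ N × v x ≤ N) xs → 1 ≤ length xs → 1 ≤ N
              go (x ∷ xs) ((h , _) ∷ _) _ = ≤-trans (1≤u x) h
      choose : (Σ ℕ λ i → i < q × q * length (filterᵇ (bads i) kept) ≤ 2 * length kept) → Packed u v N q bound M
      choose (i , i<q , bad#) = enlarge (≤-trans (upΣ-∋ q K i i<q) (m≤m+n (upΣ q K) threshold))
        (AtScale.packAt (level i) u v N 1≤N 1≤u 1≤v th bad# (≤-trans (*-monoʳ-≤ q (upΣ-∋ q const i i<q)) (≤-trans (n≤1+n _) many)))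

    Solution : ∀ I → List (Placement I) → ℚ → Set
    Solution I OPT ε = Σ (List (Placement I)) λ P → ContainerSolution I ε bound P × 4 * q * length OPT ≤ 5 * q * length P + 45 * length OPT

    solution : ∀ I OPT → Feasible I OPT → threshold ≤ length OPT → ∀ ε → 0ℚ ℚ.≤ ε → 1ℚ ℚ.≤ ε ℚ.* ι 0 q → Solution I OPT ε
    solution I OPT feas many ε 0≤ε 1≤εq = fromSlice (feasible⇒Slice feas)
      where
      fromSlice : (Σ (List (Oriented I)) λ M → M ↭ map orient OPT × Slice (width I) (height I) (Defs.N I) (Defs.N I) M) → Solution I OPT ε
      fromSlice (M , M↭ , t) = realise (packMost (width I) (height I) (Defs.N I) 1≤width 1≤height t (≤-trans many (≤-reflexive (sym M#))))
        where
        M# : length M ≡ length OPT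
        M# = trans (length-↭ M↭) (length-map orient OPT)
        1≤width : ∀ x → 1 ≤ width I x
        1≤width (i , false) = wd-pos I i
        1≤width (i , true) = ht-pos I i
        1≤height : ∀ x → 1 ≤ height I x
        1≤height (i , false) = ht-pos I i
        1≤height (i , true) = wd-pos I i
        realise : Packed (width I) (height I) (Defs.N I) q bound M → Solution I OPT ε
        realise (packed e₀ fs rest lay dims≡ ok smallOK size perm count) = conclude (Realise.toSolution e₀ I ε q 0≤ε 1≤εq bound fs dims≡ lay ok smallOK uniq size)
          where
          out = concat (map contents fs)
          idsEq : ∀ gs → Realise.allIds e₀ I ε q 0≤ε 1≤εq gs ≡ map proj₁ (concat (map contents gs))
          idsEq [] = refl
          idsEq ((c , ss) ∷ gs) = trans (cong (map proj₁ (its c ++ ss) ++_) (idsEq gs)) (sym (map-++ proj₁ (its c ++ ss) _))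
          uniq : Unique (Realise.allIds e₀ I ε q 0≤ε 1≤εq fs)
          uniq = subst Unique (sym (idsEq fs)) (Unique-prefix (map proj₁ out) (subst Unique (map-++ proj₁ out _) (Unique-↭ (↭P.map⁺ proj₁ perm)
            (Unique-↭ (↭-trans (↭-reflexive (map-∘ OPT)) (↭P.map⁺ proj₁ (↭-sym M↭))) (proj₁ feas)))))
          conclude : (Σ (List (Placement I)) λ P → ContainerSolution I ε bound P × length P ≡ length (Realise.allIds e₀ I ε q 0≤ε 1≤εq fs)) → Solution I OPT ε
          conclude (P , sol , len) = P , sol ,
            subst₂ (λ n o → 4 * q * n ≤ 5 * q * o + 45 * n) M# (trans (sym (length-map proj₁ out)) (trans (cong length (sym (idsEq fs))) (sym len))) count

  singletons : ∀ (I : Instance) ε K (P : List (Placement I)) → Feasible I P → length P ≤ K → ContainerSolution I ε K P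
  singletons I ε K P feas@(_ , packing) len = feas , map own P , ≤-trans (≤-reflexive (length-map own P)) len , ↭-reflexive (flat P) , valid P , subst (GuillotinePacking (Defs.N I)) (map-∘ P) packing
    where
    own : Placement I → Container × List (Placement I)
    own p = container (placedRect p) large , p ∷ []
    flat : ∀ P → P ≡ concat (map proj₂ (map own P))
    flat [] = refl
    flat (p ∷ P) = cong (p ∷_) (flat P)
    nonneg : ∀ {k} → 0ℚ ℚ.≤ ι 0 k
    nonneg = ℚP.≤-trans (ℚP.≤-reflexive (sym (ι-0 0))) (ι-mono 0 z≤n)
    valid : ∀ P → All (λ cp → ValidContainer ε (proj₁ cp) (map placedRect (proj₂ cp))) (map own P)
    valid [] = []
    valid (p ∷ P) = (ℚP.≤-trans nonneg (ℚP.≤-reflexive (sym (placed-w p))) , ℚP.≤-trans nonneg (ℚP.≤-reflexive (sym (placed-h p))) , (ℚP.≤-refl , ℚP.≤-refl , ℚP.≤-refl , ℚP.≤-refl) ∷ [] , refl) ∷ valid P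

  -- A positive `ε` has numerator at least 1, so its denominator can serve as `q`.
  recip : ∀ ε → 0ℚ ℚ.< ε → 1ℚ ℚ.≤ ε ℚ.* ι 0 (ℚ.↧ₙ ε)
  recip ε@(mkℚ (ℤ.+ suc k) d-1 _) _ = subst (λ z → 1ℚ ℚ.≤ ε ℚ.* z) (sym (ι-def 0 (suc d-1)))
    (ℚP.toℚᵘ-cancel-≤ (ℚᵘP.≤-trans step (ℚᵘP.≤-reflexive (ℚᵘP.≃-sym (ℚᵘP.≃-trans (ℚP.toℚᵘ-homo-* ε (ℤ.+ suc d-1 ℚ./ 1)) (ℚᵘP.*-congˡ {ℚ.toℚᵘ ε} (ℚP.toℚᵘ-fromℚᵘ (ℚᵘ.mkℚᵘ (ℤ.+ suc d-1) 0))))))))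
    where
    step : ℚᵘ.1ℚᵘ ℚᵘ.≤ ℚᵘ.mkℚᵘ (ℤ.+ suc k) d-1 ℚᵘ.* ℚᵘ.mkℚᵘ (ℤ.+ suc d-1) 0
    step = ℚᵘ.*≤* (ℤ.+≤+ (lia 2 (λ k d → ⟨ con 1 :* ((con 1 :+ d) :* con 1) :≤ (con 1 :+ k) :* (con 1 :+ d) :* con 1 ⟩) refl k d-1))
  recip (mkℚ (ℤ.+ zero) _ _) (ℚ.*<* (ℤ.+<+ ()))
  recip (mkℚ ℤ.-[1+ _ ] _ _) (ℚ.*<* ())

  -- After multiplication by `5 * q` the error `45 * n` is absorbed by `n ≤ ε * q * n`; this gives
  -- the constant `9 = 45 / 5`.
  ratio : ∀ ε q n m → 1 ≤ q → 1ℚ ℚ.≤ ε ℚ.* ι 0 q → 4 * q * n ≤ 5 * q * m + 45 * n →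
          ((ℤ.+ 4 ℚ./ 5) ℚ.- (ℤ.+ 9 ℚ./ 1) ℚ.* ε) ℚ.* ℕ→ℚ n ℚ.≤ ℕ→ℚ m
  ratio ε q n m 1≤q 1≤εq h = subst₂ (λ a b → ((ℤ.+ 4 ℚ./ 5) ℚ.- (ℤ.+ 9 ℚ./ 1) ℚ.* ε) ℚ.* a ℚ.≤ b) (ι-def 0 n) (ι-def 0 m)
    (ℚP.*-cancelˡ-≤-pos (five ℚ.* ι 0 q) ⦃ ℚP.pos*pos⇒pos five (ι 0 q) ⦃ ℚ.positive (subst (ℚ._< ι 0 q) (ι-0 0) (ι-mono-< 0 1≤q)) ⦄ ⦄ scaled)
    where
    five four many : ℚ
    five = ℤ.+ 5 ℚ./ 1
    four = ℤ.+ 4 ℚ./ 1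
    many = ℤ.+ 45 ℚ./ 1
    n≥0 : ℚ.NonNegative (ι 0 n)
    n≥0 = ℚ.nonNegative (ℚP.≤-trans (ℚP.≤-reflexive (sym (ι-0 0))) (ι-mono 0 z≤n))
    move : ∀ {a b c} → a ℚ.≤ b ℚ.+ c → a ℚ.- c ℚ.≤ b
    move {a} {b} {c} le = ℚP.≤-trans (ℚP.+-monoˡ-≤ (ℚ.- c) le) (ℚP.≤-reflexive (trans (ℚP.+-assoc b c (ℚ.- c)) (trans (cong (b ℚ.+_) (ℚP.+-inverseʳ c)) (ℚP.+-identityʳ b))))
    hℚ : four ℚ.* ι 0 q ℚ.* ι 0 n ℚ.≤ five ℚ.* ι 0 q ℚ.* ι 0 m ℚ.+ many ℚ.* ι 0 n
    hℚ = subst₂ ℚ._≤_ (expand 4 n) (trans (ι-+ 0 (5 * q * m) (45 * n)) (cong₂ ℚ._+_ (expand 5 m) (trans (ι-* 45 n) (cong (ℚ._* ι 0 n) (ι-def 0 45))))) (ι-mono 0 h)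
      where
      expand : ∀ k r → ι 0 (k * q * r) ≡ (ℤ.+ k ℚ./ 1) ℚ.* ι 0 q ℚ.* ι 0 r
      expand k r = trans (ι-* (k * q) r) (cong (ℚ._* ι 0 r) (trans (ι-* k q) (cong (ℚ._* ι 0 q) (ι-def 0 k))))
    scaled : (five ℚ.* ι 0 q) ℚ.* (((ℤ.+ 4 ℚ./ 5) ℚ.- (ℤ.+ 9 ℚ./ 1) ℚ.* ε) ℚ.* ι 0 n) ℚ.≤ (five ℚ.* ι 0 q) ℚ.* ι 0 m
    scaled = ℚP.≤-trans (ℚP.≤-reflexive (times-5q ε (ι 0 q) (ι 0 n))) (ℚP.≤-trans (ℚP.+-monoʳ-≤ (four ℚ.* ι 0 q ℚ.* ι 0 n) (ℚP.neg-antimono-≤ (ℚP.*-monoˡ-≤-nonNeg many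
        (ℚP.≤-trans (ℚP.≤-reflexive (sym (ℚP.*-identityˡ (ι 0 n)))) (ℚP.*-monoʳ-≤-nonNeg (ι 0 n) ⦃ n≥0 ⦄ 1≤εq))))) (move hℚ))

  optimum-≤ : ∀ ε (0<ε : 0ℚ ℚ.< ε) (I : Instance) (OPT APX : List (Placement I)) → Feasible I OPT →
    (∀ S → ContainerSolution I ε (Reduction.bound (ℚ.↧ₙ ε) (s≤s z≤n)) S → profit S ≤ profit APX) →
    4 * ℚ.↧ₙ ε * length OPT ≤ 5 * ℚ.↧ₙ ε * length APX + 45 * length OPT
  optimum-≤ ε 0<ε I OPT APX feas best = decide (Reduction.threshold (ℚ.↧ₙ ε) (s≤s z≤n) ≤? length OPT)
    where
    decide : Dec (Reduction.threshold (ℚ.↧ₙ ε) (s≤s z≤n) ≤ length OPT) → 4 * ℚ.↧ₙ ε * length OPT ≤ 5 * ℚ.↧ₙ ε * length APX + 45 * length OPT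
    decide (yes many) = conclude (Reduction.solution (ℚ.↧ₙ ε) (s≤s z≤n) I OPT feas many ε (ℚP.<⇒≤ 0<ε) (recip ε 0<ε))
      where
      conclude : Reduction.Solution (ℚ.↧ₙ ε) (s≤s z≤n) I OPT ε → 4 * ℚ.↧ₙ ε * length OPT ≤ 5 * ℚ.↧ₙ ε * length APX + 45 * length OPT
      conclude (P , sol , le) = ≤-trans le (+-monoˡ-≤ (45 * length OPT) (*-monoʳ-≤ (5 * ℚ.↧ₙ ε) (best P sol)))
    -- Below the threshold `OPT` itself, with one container for each item, is a competitor of `APX`.
    decide (no few) = ≤-trans (*-mono-≤ (*-monoˡ-≤ (ℚ.↧ₙ ε) (n≤1+n 4)) (best OPT (singletons I ε _ OPT feas (≤-trans (<⇒≤ (≰⇒> few)) (m≤n+m _ _))))) (m≤m+n _ _)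

open import Defs
open import Data.Nat using (ℕ; s≤s; z≤n)
open import Data.Rational using (ℚ; _+_; _*_; _-_; _≤_; _<_; _/_; 0ℚ; ↧ₙ_)
open import Data.Integer using (+_)
open import Data.Product using (Σ; _×_; _,_)
open import Data.List using (List)
open Reductions

mainTheorem9 : Σ ℚ λ c → (ε : ℚ) → 0ℚ < ε → Σ ℕ λ K →
    (I : Instance) (OPT APX : List (Placement I)) →
    Feasible I OPT → (∀ S → Feasible I S → profit S Data.Nat.≤ profit OPT) →
    ContainerSolution I ε K APX →
    (∀ S → ContainerSolution I ε K S → profit S Data.Nat.≤ profit APX) →
    ((+ 4 / 5) - c * ε) * ℕ→ℚ (profit OPT) ≤ ℕ→ℚ (profit APX)
mainTheorem9 = + 9 / 1 , λ ε 0<ε → Reduction.bound (↧ₙ ε) (s≤s z≤n) , λ I OPT APX feas _ _ best →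
  ratio ε (↧ₙ ε) (profit OPT) (profit APX) (s≤s z≤n) (recip ε 0<ε) (optimum-≤ ε 0<ε I OPT APX feas best)
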